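{- The parameterized counting problems #$k$-Min $(s,t)$-Cut, #$k$-Odd Cycle Transversal, #$\ell$-Vertex Cover and #$m$-Vertex Cover do not admit polynomial compressions, unless the SUM-conjecture is false. (That is, if the SUM-conjecture holds, then none of these four problems admits a polynomial compression.)
   Context: Graphs are finite, simple and undirected. Problems: - #$k$-Min $(s,t)$-Cut: given a graph $G$ and two distinct vertices $s,t\in V(G)$, output the number of minimum $(s,t)$-cuts in $G$, where an $(s,t)$-cut is a set $S\subseteq E(G)$ such that $s$ and $t$ lie in different connected components of $G-S$, and it is minimum if none of smaller size exists. The parameter $k$ is the size of a minimum $(s,t)$-cut in $G$. - #$k$-Odd Cycle Transversal: given a graph $G$ and a non-negative integer $k$, output the number of sets $S\subseteq V(G)$ of size at most $k$ such that $G-S$ contains no odd cycle. The parameter is $k$. - #$\ell$-Vertex Cover and #$m$-Vertex Cover: given a graph $G$ and a non-negative integer $k$, output the number of vertex covers of $G$ of size at most $k$. The parameters are, respectively, $\ell=k-\mathsf{LP_{VC}}(G)$ and $m=k-\mu(G)$, where $\mathsf{LP_{VC}}(G)$ is the optimum of the standard linear program for Vertex Cover (minimize $\sum_{v\in V(G)}x_v$ subject to $x_u+x_v\ge 1$ for every edge $\{u,v\}$ and $x_v\ge 0$ for every vertex $v$), and $\mu(G)$ is the maximum size of a matching in $G$. Let $\Sigma=\{0,1\}$ and $\mathbb{N}_0=\{0,1,2,\ldots\}$. A counting problem is a mapping $\Sigma^\star\to\mathbb{N}_0$; a parameterized counting problem is a mapping $\Sigma^\star\times\mathbb{N}_0\to\mathbb{N}_0$,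 the second coordinate of an instance being the parameter. Numbers of solutions are encoded in binary. Well-behaved: a parameterized counting problem $Q$ is well-behaved if there is a polynomial-time algorithm that, given $n\in\mathbb{N}$ in unary, outputs $N\in\mathbb{N}$ in binary such that $Q(x,k)\le N$ for every $(x,k)$ of size at most $n$. Compression: a compression of a parameterized counting problem $P$ into a parameterized counting problem $Q$ is a pair $(\mathsf{reduce},\mathsf{lift})$ of polynomial-time procedures such that: (1) given an instance $(x,k)$ of $P$, $\mathsf{reduce}$ outputs an instance $(x',k')$ of $Q$ with $|x'|,k'\le f(k)$ for some computable function $f$; (2) given $(x,k)$, the output $(x',k')$ of $\mathsf{reduce}$ on $(x,k)$, and $s'=Q(x',k')$, $\mathsf{lift}$ outputs $s=P(x,k)$. It is polynomial if $f$ is a polynomial function. "A compression of $P$" means a compression of $P$ into some $Q$. Standing convention: the target $Q$ is always assumed well-behaved. Polynomial equivalence relation: an equivalence relation $R$ on $\Sigma^\star$ such that (i) there is an algorithm that, given $x,y\in\Sigma^\star$, resolves whether $x\equiv_R y$ in time polynomial in $|x|+|y|$, and (ii) $R$ restricted to $\Sigma^{\le n}$ has at most $p(n)$ equivalence classes, for some polynomial $p$. SUM-cross-composition: a counting problem $P$ SUM-cross-composes into a parameterized counting problem $Q$ if there exist a polynomial equivalence relation $R$ and an algorithm $A$ that takes as input strings $x_1,\ldots,x_t\in\Sigma^\star$ that are equivalent with respect to $R$, runs in time polynomial in $\sum_{i=1}^t|x_i|$, and outputs one instance $(y,k)\in\Sigma^\star\times\mathbb{N}_0$ such that $k\le p(\max_{i=1}^t|x_i|+\log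 t)$ for some polynomial function $p$, and $Q(y,k)=\sum_{i=1}^tP(x_i)$. SUM-conjecture: if a #P-hard counting problem $P$ SUM-cross-composes into a well-behaved parameterized counting problem $Q$, then $Q$ does not admit a polynomial compression. -}

module Defs where

open import Data.Bool.Base using (Bool; true; false; T; if_then_else_)
open import Data.Bool.Properties as Bool using (T?)
open import Data.Empty using (⊥)
open import Data.Fin.Base as Fin using (Fin; zero; suc; toℕ; fromℕ; fromℕ<; inject₁; combine)
open import Data.Fin.Properties as Fin using (all?; any?; injective⇒≤; toℕ<n; toℕ-fromℕ<)
open import Data.Fin.Subset using (Subset; _∈_; _∉_; ∣_∣)
open import Data.Fin.Subset.Properties using (_∈?_)
open import Data.Integer.Base as ℤ using (+_; 0ℤ)
import Data.Integer.Properties as ℤ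
open import Data.List.Base as List
  using (List; []; _∷_; _++_; length; filter; allFin; cartesianProduct; cartesianProductWith)
open import Data.List.Extrema.Nat using (argmin; argmin-all; f[argmin]≤f[xs])
open import Data.List.Membership.Propositional as List using (find; lose)
open import Data.List.Membership.Propositional.Properties
  using (∈-cartesianProductWith⁺; ∈-allFin; ∈-filter⁺)
open import Data.List.NonEmpty.Base as List⁺ using (List⁺)
open import Data.List.Relation.Unary.All as All using (All)
open import Data.List.Relation.Unary.All.Properties using (all-filter)
open import Data.List.Relation.Unary.AllPairs using (AllPairs)
open import Data.List.Relation.Unary.Any as Any using (Any; here; there)
open import Data.Maybe.Base using (Maybe; just; nothing; maybe′; _>>=_)
open import Data.Nat.Base as ℕ
  using (ℕ; zero; suc; _+_; _*_; _∸_; _⊔_; _⊓_; _≤_; _<_; z≤n; s≤s; NonZero)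
open import Data.Nat.Divisibility using (_∣_; _∣?_)
open import Data.Nat.Logarithm using (⌈log₂_⌉)
open import Data.Nat.ListAction using (sum)
import Data.Nat.Properties as ℕ
open import Data.Nat.Tactic.RingSolver using (solve-∀)
open import Data.Product.Base using (Σ; Σ-syntax; ∃; ∃₂; _×_; _,_; proj₁; proj₂; map₁)
open import Data.Rational.Base as ℚ using (ℚ; mkℚ; 0ℚ; 1ℚ; ½; ceiling)
open import Data.Rational.Literals using (fromℤ)
import Data.Rational.Properties as ℚ
import Data.Rational.Unnormalised.Base as ℚᵘ
import Data.Rational.Unnormalised.Properties as ℚᵘ
open import Data.Sum.Base using (_⊎_; inj₁; inj₂)
open import Data.Unit.Base using (⊤)
open import Data.Vec.Base as Vec using (Vec; []; _∷_; lookup; tabulate)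
open import Data.Vec.Properties using (lookup∘tabulate)
open import Function.Base using (_∘_)
open import Function.Definitions using (Injective)
open import Level using (0ℓ)
open import Relation.Binary.Construct.Closure.ReflexiveTransitive using (Star; ε; _◅_; _◅◅_)
open import Relation.Binary.Core using (Rel)
open import Relation.Binary.PropositionalEquality
  using (_≡_; _≢_; refl; sym; trans; cong; cong₂; subst; subst₂; module ≡-Reasoning)
open import Relation.Binary.Structures using (IsEquivalence)
open import Relation.Nullary.Decidable
  using (Dec; yes; no; does; map′; ¬?; _×-dec_; _⊎-dec_; _→-dec_)
open import Relation.Nullary.Negation using (¬_; contradiction)
open import Relation.Unary using (Pred; Decidable)
open import Algebra.Bundles using (CommutativeRing)
import Algebra.Properties.Semiring.Sum as Sum

module Σℕ = Sum ℕ.+-*-semiring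
module Σℚ = Sum (CommutativeRing.semiring ℚ.+-*-commutativeRing)

------------------------------------------------------------------------
-- Exhaustive enumeration of vectors

vectors : ∀ {A : Set} → List A → ∀ n → List (Vec A n)
vectors as zero    = [] ∷ []
vectors as (suc n) = cartesianProductWith _∷_ as (vectors as n)

module Enumeration {A : Set} (as : List A) (complete : ∀ a → a List.∈ as) where

  vectors-complete : ∀ {n} (v : Vec A n) → v List.∈ vectors as n
  vectors-complete []      = here refl
  vectors-complete (a ∷ v) = ∈-cartesianProductWith⁺ _∷_ (complete a) (vectors-complete v)

  ∃? : ∀ {n} {P : Pred (Vec A n) 0ℓ} → Decidable P → Dec (∃ P)
  ∃? {n} P? = map′ (λ p → let v , _ , Pv = find p in v , Pv)
                   (λ (v , Pv) → lose (vectors-complete v) Pv)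
                   (Any.any? P? (vectors as n))

  ∀? : ∀ {n} {P : Pred (Vec A n) 0ℓ} → Decidable P → Dec (∀ v → P v)
  ∀? {n} P? = map′ (λ ps v → All.lookup ps (vectors-complete v))
                   (λ ps → All.universal ps _)
                   (All.all? P? (vectors as n))

bools : List Bool
bools = false ∷ true ∷ []

bools-complete : ∀ b → b List.∈ bools
bools-complete false = here refl
bools-complete true  = there (here refl)

open Enumeration bools bools-complete
  renaming (∃? to ∃Subset?; ∀? to ∀Subset?) using ()

count : ∀ {n} {P : Pred (Vec Bool n) 0ℓ} → Decidable P → ℕ
count {n} P? = length (filter P? (vectors bools n))

------------------------------------------------------------------------
-- Strings and counting problems

Word : Set
Word = List Bool

-- Binary numerals, least significant bit first.
increment : Word → Word
increment []          = true ∷ []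
increment (false ∷ w) = true ∷ w
increment (true  ∷ w) = false ∷ increment w

binary : ℕ → Word
binary zero    = []
binary (suc n) = increment (binary n)

unary : ℕ → Word
unary n = List.replicate n true

-- A self-delimiting code for lists of strings: every bit is preceded by
-- the flag true, and every string is terminated by the flag false.
delimit : Word → Word
delimit []      = false ∷ []
delimit (b ∷ w) = true ∷ b ∷ delimit w

encodeList : List Word → Word
encodeList = List.concatMap delimit

CountingProblem : Set
CountingProblem = Word → ℕ

Instance : Set
Instance = Word × ℕ

ParameterizedCountingProblem : Set
ParameterizedCountingProblem = Instance → ℕ

-- The parameter is written in unary, so that the size of (x , k) is ∣x∣ + k.
encode : Instance → Vec Word 2
encode (x , k) = x ∷ unary k ∷ []

instanceSize : Instance → ℕ
instanceSize (x , k) = length x + k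

Polynomial : Set
Polynomial = List ℕ

-- c₀ ∷ c₁ ∷ c₂ ∷ … denotes c₀ + c₁ n + c₂ n² + ….  Polynomials only serve as
-- upper bounds, so nonnegative coefficients lose no generality.
⟦_⟧ : Polynomial → ℕ → ℕ
⟦ p ⟧ n = List.foldr (λ c r → c + n * r) 0 p

------------------------------------------------------------------------
-- Machines
--
-- A program controls finitely many stacks of bits at unit cost per
-- elementary operation.  Since two stacks make a tape, these are multitape
-- Turing machines up to a constant factor in the running time.  Queries to
-- oracles drawn from the index set Q are charged for the length of the
-- question and of the answer; a program with Q = ⊥ is an ordinary machine.

Register : Set
Register = ℕ

data Program (Q : Set) : Set where
  skip   : Program Q
  push   : Bool → Register → Program Q
  pop    : Register → Program Q
  _⨾_    : Program Q → Program Q → Program Q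
  branch : Register → (ifEmpty ifFalse ifTrue : Program Q) → Program Q
  while  : Register → Program Q → Program Q
  query  : Q → (question answer : Register) → Program Q

Store : Set
Store = Register → Word

_[_≔_] : Store → Register → Word → Store
(σ [ r ≔ w ]) s = if does (s ℕ.≟ r) then w else σ s

Oracle : Set → Set
Oracle Q = Q → Word → Word

infix 4 _⊢⟨_,_⟩⇓⟨_,_⟩

-- O ⊢⟨ p , σ ⟩⇓⟨ τ , t ⟩: started in store σ, program p halts after t steps
-- in store τ.
data _⊢⟨_,_⟩⇓⟨_,_⟩ {Q : Set} (O : Oracle Q) :
       Program Q → Store → Store → ℕ → Set where

  ⇓skip : ∀ {σ} → O ⊢⟨ skip , σ ⟩⇓⟨ σ , 1 ⟩

  ⇓push : ∀ {σ b r} → O ⊢⟨ push b r , σ ⟩⇓⟨ σ [ r ≔ b ∷ σ r ] , 1 ⟩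

  ⇓pop : ∀ {σ r} → O ⊢⟨ pop r , σ ⟩⇓⟨ σ [ r ≔ List.drop 1 (σ r) ] , 1 ⟩

  ⇓seq : ∀ {p q σ τ υ s t} →
         O ⊢⟨ p , σ ⟩⇓⟨ τ , s ⟩ → O ⊢⟨ q , τ ⟩⇓⟨ υ , t ⟩ →
         O ⊢⟨ p ⨾ q , σ ⟩⇓⟨ υ , s + t ⟩

  ⇓empty : ∀ {r p₀ p₁ p₂ σ τ t} → σ r ≡ [] →
           O ⊢⟨ p₀ , σ ⟩⇓⟨ τ , t ⟩ →
           O ⊢⟨ branch r p₀ p₁ p₂ , σ ⟩⇓⟨ τ , 1 + t ⟩

  ⇓false : ∀ {r p₀ p₁ p₂ σ τ t w} → σ r ≡ false ∷ w →
           O ⊢⟨ p₁ , σ ⟩⇓⟨ τ , t ⟩ →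
           O ⊢⟨ branch r p₀ p₁ p₂ , σ ⟩⇓⟨ τ , 1 + t ⟩

  ⇓true : ∀ {r p₀ p₁ p₂ σ τ t w} → σ r ≡ true ∷ w →
          O ⊢⟨ p₂ , σ ⟩⇓⟨ τ , t ⟩ →
          O ⊢⟨ branch r p₀ p₁ p₂ , σ ⟩⇓⟨ τ , 1 + t ⟩

  ⇓done : ∀ {r p σ} → σ r ≡ [] →
          O ⊢⟨ while r p , σ ⟩⇓⟨ σ , 1 ⟩

  ⇓loop : ∀ {r p σ τ υ s t b w} → σ r ≡ b ∷ w →
          O ⊢⟨ p , σ ⟩⇓⟨ τ , s ⟩ → O ⊢⟨ while r p , τ ⟩⇓⟨ υ , t ⟩ →
          O ⊢⟨ while r p , σ ⟩⇓⟨ υ , 1 + s + t ⟩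

  ⇓query : ∀ {i q a σ} →
           O ⊢⟨ query i q a , σ ⟩⇓⟨ σ [ a ≔ O i (σ q) ]
                                  , 1 + length (σ q) + length (O i (σ q)) ⟩

load : ∀ {a} → Vec Word a → Store
load []       _       = []
load (w ∷ ws) zero    = w
load (w ∷ ws) (suc r) = load ws r

unload : ∀ b → Store → Vec Word b
unload b σ = tabulate (λ (i : Fin b) → σ (toℕ i))

-- For every i : I, the program started on the strings input i in its first
-- registers halts within time polynomial in size i with the strings
-- output i in its first registers.
record PolyTime {Q : Set} (O : Oracle Q) {I : Set} (size : I → ℕ) {a b : ℕ}
                (input : I → Vec Word a) (output : I → Vec Word b) : Set where
  field
    program : Program Q
    bound   : Polynomial
    correct : ∀ i → ∃₂ λ τ t →
              O ⊢⟨ program , load (input i) ⟩⇓⟨ τ , t ⟩ ×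
              t ≤ ⟦ bound ⟧ (size i) ×
              unload b τ ≡ output i

totalLength : ∀ {a} → Vec Word a → ℕ
totalLength = Vec.sum ∘ Vec.map length

noOracle : Oracle ⊥
noOracle ()

FP : ∀ {I : Set} {a b} (input : I → Vec Word a) (output : I → Vec Word b) → Set
FP input output = PolyTime noOracle (totalLength ∘ input) input output

------------------------------------------------------------------------
-- #P-hardness

record _∈#P (F : CountingProblem) : Set where
  field
    witnessLength : Polynomial
    verify        : Word → Word → Bool
    verify-FP     : FP {Word × Word} (λ (x , y) → x ∷ y ∷ [])
                       (λ (x , y) → (verify x y ∷ []) ∷ [])
    counts        : ∀ x → F x ≡ count {⟦ witnessLength ⟧ (length x)}
                                      (λ y → T? (verify x (Vec.toList y)))

-- Hardness is under polynomial-time Turing reductions.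
#P-hard : CountingProblem → Set
#P-hard P = ∀ F → F ∈#P →
  PolyTime {Q = ⊤} (λ _ → binary ∘ P) length (λ x → x ∷ []) (λ x → binary (F x) ∷ [])

------------------------------------------------------------------------
-- Compressions

record WellBehaved (Q : ParameterizedCountingProblem) : Set where
  field
    N       : ℕ → ℕ
    N-FP    : FP (λ n → unary n ∷ []) (λ n → binary (N n) ∷ [])
    bounded : ∀ n i → instanceSize i ≤ n → Q i ≤ N n

-- Compressions with size bound f.  Below f is always a polynomial, hence
-- computable.
record Compression (f : ℕ → ℕ) (P Q : ParameterizedCountingProblem) : Set where
  field
    reduce    : Instance → Instance
    reduce-FP : FP encode (encode ∘ reduce)
    lift      : Instance → Instance → ℕ → ℕ
    lift-FP   : FP {Instance × Instance × ℕ}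
                     (λ (i , i′ , s′) → encode i Vec.++ encode i′ Vec.++ binary s′ ∷ [])
                     (λ (i , i′ , s′) → binary (lift i i′ s′) ∷ [])
    small     : ∀ x k → let x′ , k′ = reduce (x , k) in length x′ ≤ f k × k′ ≤ f k
    lifts     : ∀ i → lift i (reduce i) (Q (reduce i)) ≡ P i

PolynomialCompression : ParameterizedCountingProblem → Set
PolynomialCompression P =
  ∃ λ Q → WellBehaved Q × ∃ λ (p : Polynomial) → Compression ⟦ p ⟧ P Q

------------------------------------------------------------------------
-- SUM-cross-composition

record PolynomialEquivalence : Set₁ where
  field
    _∼_           : Rel Word 0ℓ
    isEquivalence : IsEquivalence _∼_
    _∼?_          : ∀ x y → Dec (x ∼ y)
    ∼?-FP         : FP {Word × Word} (λ (x , y) → x ∷ y ∷ [])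
                                         (λ (x , y) → (does (x ∼? y) ∷ []) ∷ [])
    classes       : Polynomial
    -- Every class of ∼ on the strings of length at most n is met by
    -- representatives n.
    representatives : ℕ → List Word
    few             : ∀ n → length (representatives n) ≤ ⟦ classes ⟧ n
    exhaustive      : ∀ n x → length x ≤ n → Any (x ∼_) (representatives n)

maximum : List ℕ → ℕ
maximum = List.foldr _⊔_ 0

record SUMCrossComposition (P : CountingProblem) (Q : ParameterizedCountingProblem) : Set₁ where
  field
    equivalence : PolynomialEquivalence

  open PolynomialEquivalence equivalence public

  Input : Set
  Input = Σ[ xs ∈ List⁺ Word ] AllPairs _∼_ (List⁺.toList xs)

  strings : Input → List Word
  strings (xs , _) = List⁺.toList xs

  field
    compose        : Input → Instance
    compose-FP     : PolyTime noOracle (λ xs → sum (List.map length (strings xs)))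
                              (λ xs → encodeList (strings xs) ∷ []) (encode ∘ compose)
    parameterBound : Polynomial
    smallParameter : ∀ xs → proj₂ (compose xs) ≤
                     ⟦ parameterBound ⟧ (maximum (List.map length (strings xs))
                                         + ⌈log₂ length (strings xs) ⌉)
    sums           : ∀ xs → Q (compose xs) ≡ sum (List.map P (strings xs))

SUMConjecture : Set₁
SUMConjecture = ∀ P Q → #P-hard P → SUMCrossComposition P Q → WellBehaved Q →
                ¬ PolynomialCompression Q

------------------------------------------------------------------------
-- Graphs

record Graph : Set where
  field
    order  : ℕ
    adj    : Fin order → Fin order → Bool
    symm   : ∀ u v → adj u v ≡ adj v u
    irrefl : ∀ v → adj v v ≡ false

  Vertex : Set
  Vertex = Fin order

  Adj : Vertex → Vertex → Set
  Adj u v = T (adj u v)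

  Adj? : ∀ u v → Dec (Adj u v)
  Adj? u v = T? (adj u v)

  -- Each edge is listed once, smaller endpoint first.
  edges : List (Vertex × Vertex)
  edges = filter (λ (u , v) → (u Fin.<? v) ×-dec Adj? u v)
                 (cartesianProduct (allFin order) (allFin order))

  Edge : Set
  Edge = Fin (length edges)

  Joins : Edge → Vertex → Vertex → Set
  Joins e u v = List.lookup edges e ≡ (u , v) ⊎ List.lookup edges e ≡ (v , u)

  Incident : Edge → Vertex → Set
  Incident e v = proj₁ (List.lookup edges e) ≡ v ⊎ proj₂ (List.lookup edges e) ≡ v

  VertexSet EdgeSet : Set
  VertexSet = Subset order
  EdgeSet   = Subset (length edges)

  Joins? : ∀ e u v → Dec (Joins e u v)
  Joins? e u v = (List.lookup edges e ≟ (u , v)) ⊎-dec (List.lookup edges e ≟ (v , u))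
    where
    _≟_ : (p q : Vertex × Vertex) → Dec (p ≡ q)
    (a , b) ≟ (c , d) = map′ (λ (p , q) → cong₂ _,_ p q)
                             (λ p → cong proj₁ p , cong proj₂ p)
                             ((a Fin.≟ c) ×-dec (b Fin.≟ d))

  Incident? : ∀ e v → Dec (Incident e v)
  Incident? e v = (_ Fin.≟ v) ⊎-dec (_ Fin.≟ v)

------------------------------------------------------------------------
-- Minimum cuts

-- Reachability over Fin n is decided by Warshall's algorithm.
module Reachability {n} {_⟶_ : Rel (Fin n) 0ℓ} (_⟶?_ : ∀ u v → Dec (u ⟶ v)) where

  Via : List (Fin n) → Rel (Fin n) 0ℓ
  Via []       u v = u ≡ v ⊎ u ⟶ v
  Via (w ∷ ws) u v = Via ws u v ⊎ (Via ws u w × Via ws w v)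

  Via? : ∀ ws u v → Dec (Via ws u v)
  Via? []       u v = (u Fin.≟ v) ⊎-dec (u ⟶? v)
  Via? (w ∷ ws) u v = Via? ws u v ⊎-dec (Via? ws u w ×-dec Via? ws w v)

  sound : ∀ ws {u v} → Via ws u v → Star _⟶_ u v
  sound []       (inj₁ refl)    = ε
  sound []       (inj₂ e)       = e ◅ ε
  sound (w ∷ ws) (inj₁ p)       = sound ws p
  sound (w ∷ ws) (inj₂ (p , q)) = sound ws p ◅◅ sound ws q

  embed : ∀ ws {u v} → Via [] u v → Via ws u v
  embed []       p = p
  embed (w ∷ ws) p = inj₁ (embed ws p)

  join : ∀ ws {u v m} → m List.∈ ws → Via ws u m → Via ws m v → Via ws u v
  join (w ∷ ws) (here refl) p q = inj₂ (to p , from q)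
    where
    to : ∀ {u} → Via (w ∷ ws) u w → Via ws u w
    to (inj₁ p)       = p
    to (inj₂ (p , _)) = p
    from : ∀ {v} → Via (w ∷ ws) w v → Via ws w v
    from (inj₁ p)       = p
    from (inj₂ (_ , p)) = p
  join (w ∷ ws) (there m∈) (inj₁ p)       (inj₁ q)       = inj₁ (join ws m∈ p q)
  join (w ∷ ws) (there m∈) (inj₁ p)       (inj₂ (q , r)) = inj₂ (join ws m∈ p q , r)
  join (w ∷ ws) (there m∈) (inj₂ (p , q)) (inj₁ r)       = inj₂ (p , join ws m∈ q r)
  join (w ∷ ws) (there m∈) (inj₂ (p , _)) (inj₂ (_ , r)) = inj₂ (p , r)

  complete : ∀ {u v} → Star _⟶_ u v → Via (allFin n) u v
  complete ε       = embed (allFin n) (inj₁ refl)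
  complete (e ◅ p) = join (allFin n) (∈-allFin _) (embed (allFin n) (inj₂ e)) (complete p)

  reachable? : ∀ u v → Dec (Star _⟶_ u v)
  reachable? u v = map′ (sound (allFin n)) complete (Via? (allFin n) u v)

module MinCut (G : Graph) (s t : Graph.Vertex G) where
  open Graph G

  Survives : EdgeSet → Rel Vertex 0ℓ
  Survives S u v = ∃ λ e → e ∉ S × Joins e u v

  IsCut : EdgeSet → Set
  IsCut S = ¬ Star (Survives S) s t

  IsMinimumCut : EdgeSet → Set
  IsMinimumCut S = IsCut S × (∀ S′ → IsCut S′ → ∣ S ∣ ≤ ∣ S′ ∣)

  IsCut? : Decidable IsCut
  IsCut? S = ¬? (Reachability.reachable?
    (λ u v → any? λ e → ¬? (e ∈? S) ×-dec Joins? e u v) s t)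

  IsMinimumCut? : Decidable IsMinimumCut
  IsMinimumCut? S = IsCut? S ×-dec ∀Subset? (λ S′ → IsCut? S′ →-dec (∣ S ∣ ℕ.≤? ∣ S′ ∣))

------------------------------------------------------------------------
-- Odd cycle transversals

module OddCycle (G : Graph) where
  open Graph G

  record IsCycle {m} (c : Vec Vertex (suc m)) : Set where
    constructor isCycle
    field
      long     : 3 ≤ suc m
      distinct : Injective _≡_ _≡_ (lookup c)
      steps    : ∀ (i : Fin m) → Adj (lookup c (inject₁ i)) (lookup c (suc i))
      closing  : Adj (lookup c (fromℕ m)) (lookup c zero)

  IsOddCycleAvoiding : VertexSet → ∀ {m} → Vec Vertex (suc m) → Set
  IsOddCycleAvoiding S {m} c = ¬ (2 ∣ suc m) × IsCycle c × (∀ i → lookup c i ∉ S)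

  IsTransversal : VertexSet → Set
  IsTransversal S = ¬ (∃₂ λ m (c : Vec Vertex (suc m)) → IsOddCycleAvoiding S c)

  IsCycle? : ∀ {m} → Decidable (IsCycle {m})
  IsCycle? {m} c =
    map′ (λ (l , d , s , e) → isCycle l (λ {i} {j} → d i j) s e)
         (λ (isCycle l d s e) → l , (λ i j → d {i} {j}) , s , e)
         ((3 ℕ.≤? suc m)
          ×-dec (all? λ i → all? λ j → (lookup c i Fin.≟ lookup c j) →-dec (i Fin.≟ j))
          ×-dec (all? λ i → Adj? (lookup c (inject₁ i)) (lookup c (suc i)))
          ×-dec Adj? (lookup c (fromℕ m)) (lookup c zero))

  IsTransversal? : Decidable IsTransversal
  IsTransversal? S = ¬? (map′ widen narrow (any? λ m → cycle? (toℕ m)))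
    where
    open Enumeration (allFin order) ∈-allFin

    Hit : ℕ → Set
    Hit m = ∃ λ (c : Vec Vertex (suc m)) → IsOddCycleAvoiding S c

    cycle? : ∀ m → Dec (Hit m)
    cycle? m = ∃? λ c → ¬? (2 ∣? suc m) ×-dec IsCycle? c
                        ×-dec (all? λ i → ¬? (lookup c i ∈? S))

    widen : (∃ λ (m : Fin order) → Hit (toℕ m)) → ∃ Hit
    widen (m , h) = toℕ m , h

    narrow : ∃ Hit → ∃ λ (m : Fin order) → Hit (toℕ m)
    narrow (m , h@(c , _ , cyc , _)) = fromℕ< m< , subst Hit (sym (toℕ-fromℕ< m<)) h
      where m< = injective⇒≤ (IsCycle.distinct cyc)

------------------------------------------------------------------------
-- Vertex covers and matchings

module VertexCover (G : Graph) where
  open Graph G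

  IsVertexCover : VertexSet → Set
  IsVertexCover S = ∀ u v → Adj u v → u ∈ S ⊎ v ∈ S

  IsVertexCover? : Decidable IsVertexCover
  IsVertexCover? S = all? λ u → all? λ v → Adj? u v →-dec ((u ∈? S) ⊎-dec (v ∈? S))

  coversOfSize≤ : ℕ → ℕ
  coversOfSize≤ k = count λ S → IsVertexCover? S ×-dec (∣ S ∣ ℕ.≤? k)

module Matching (G : Graph) where
  open Graph G

  IsMatching : EdgeSet → Set
  IsMatching M = ∀ e f v → e ∈ M → f ∈ M → Incident e v → Incident f v → e ≡ f

  IsMaximumMatching : EdgeSet → Set
  IsMaximumMatching M = IsMatching M × (∀ M′ → IsMatching M′ → ∣ M′ ∣ ≤ ∣ M ∣)

  IsMatching? : Decidable IsMatching
  IsMatching? M = all? λ e → all? λ f → all? λ v →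
    (e ∈? M) →-dec ((f ∈? M) →-dec
    (Incident? e v →-dec (Incident? f v →-dec (e Fin.≟ f))))

  IsMaximumMatching? : Decidable IsMaximumMatching
  IsMaximumMatching? M =
    IsMatching? M ×-dec ∀Subset? (λ M′ → IsMatching? M′ →-dec (∣ M′ ∣ ℕ.≤? ∣ M ∣))

------------------------------------------------------------------------
-- The linear program for Vertex Cover
--
-- All data are rational, so the optimum over ℚ is the optimum over the reals.

fromℕ′ : ℕ → ℚ
fromℕ′ n = fromℤ (+ n)

fromℕ′-mono : ∀ {m n} → m ≤ n → fromℕ′ m ℚ.≤ fromℕ′ n
fromℕ′-mono m≤n = ℚ.*≤* (ℤ.*-monoʳ-≤-nonNeg (+ 1) (ℤ.+≤+ m≤n))

fromℕ′-cancel : ∀ {m n} → fromℕ′ m ℚ.≤ fromℕ′ n → m ≤ n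
fromℕ′-cancel (ℚ.*≤* p) = ℤ.drop‿+≤+ (subst₂ ℤ._≤_ (ℤ.*-identityʳ _) (ℤ.*-identityʳ _) p)

fromℕ′-+ : ∀ m n → fromℕ′ (m + n) ≡ fromℕ′ m ℚ.+ fromℕ′ n
fromℕ′-+ m n = ℚ.toℚᵘ-injective (ℚᵘ.≃-trans (ℚᵘ.*≡* eq) (ℚᵘ.≃-sym (ℚ.toℚᵘ-homo-+ (fromℕ′ m) (fromℕ′ n))))
  where
  eq : + (m + n) ℤ.* + 1 ≡ (+ m ℤ.* + 1 ℤ.+ + n ℤ.* + 1) ℤ.* + 1
  eq = cong (ℤ._* + 1) (sym (cong₂ ℤ._+_ (ℤ.*-identityʳ (+ m)) (ℤ.*-identityʳ (+ n))))

fromℕ′-* : ∀ m n → fromℕ′ (m * n) ≡ fromℕ′ m ℚ.* fromℕ′ n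
fromℕ′-* m n = ℚ.toℚᵘ-injective (ℚᵘ.≃-trans (ℚᵘ.*≡* eq) (ℚᵘ.≃-sym (ℚ.toℚᵘ-homo-* (fromℕ′ m) (fromℕ′ n))))
  where
  eq : + (m * n) ℤ.* + 1 ≡ (+ m ℤ.* + n) ℤ.* + 1
  eq = cong (ℤ._* + 1) (ℤ.pos-* m n)

fromℕ′-sum : ∀ {n} (f : Fin n → ℕ) → fromℕ′ (Σℕ.sum f) ≡ Σℚ.sum (fromℕ′ ∘ f)
fromℕ′-sum {zero}  f = refl
fromℕ′-sum {suc n} f = trans (fromℕ′-+ (f zero) _) (cong (fromℕ′ (f zero) ℚ.+_) (fromℕ′-sum (f ∘ suc)))

clear : ∀ q → 0ℚ ℚ.≤ q → ∃₂ λ d a → NonZero d × fromℕ′ d ℚ.* q ≡ fromℕ′ a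
clear q@(mkℚ (+ a) d-1 _) _ = suc d-1 , a , _ ,
  ℚ.toℚᵘ-injective (ℚᵘ.≃-trans (ℚ.toℚᵘ-homo-* (fromℕ′ (suc d-1)) q) (ℚᵘ.*≡* eq))
  where
  eq : (+ suc d-1 ℤ.* + a) ℤ.* + 1 ≡ + a ℤ.* (+ 1 ℤ.* + suc d-1)
  eq = trans (ℤ.*-identityʳ _) (trans (ℤ.*-comm (+ suc d-1) (+ a))
         (cong (+ a ℤ.*_) (sym (ℤ.*-identityˡ (+ suc d-1)))))
clear (mkℚ (ℤ.-[1+ a ]) d-1 _) (ℚ.*≤* ())

clearAll : ∀ {n} (x : Fin n → ℚ) → (∀ v → 0ℚ ℚ.≤ x v) →
           ∃₂ λ d (a : Fin n → ℕ) → NonZero d × (∀ v → fromℕ′ d ℚ.* x v ≡ fromℕ′ (a v))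
clearAll {zero}  x 0≤x = 1 , (λ ()) , _ , (λ ())
clearAll {suc n} x 0≤x with clear (x zero) (0≤x zero) | clearAll (x ∘ suc) (0≤x ∘ suc)
... | d , a , d≢0 , eq | e , b , e≢0 , eqs =
  d * e , c , ℕ.m*n≢0 d e {{d≢0}} {{e≢0}} , scaled
  where
  open ≡-Reasoning
  c : Fin (suc n) → ℕ
  c zero    = e * a
  c (suc v) = d * b v
  scaled : ∀ v → fromℕ′ (d * e) ℚ.* x v ≡ fromℕ′ (c v)
  scaled zero = begin
    fromℕ′ (d * e) ℚ.* x zero             ≡⟨ cong (λ z → fromℕ′ z ℚ.* x zero) (ℕ.*-comm d e) ⟩
    fromℕ′ (e * d) ℚ.* x zero             ≡⟨ cong (ℚ._* x zero) (fromℕ′-* e d) ⟩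
    fromℕ′ e ℚ.* fromℕ′ d ℚ.* x zero      ≡⟨ ℚ.*-assoc (fromℕ′ e) (fromℕ′ d) (x zero) ⟩
    fromℕ′ e ℚ.* (fromℕ′ d ℚ.* x zero)    ≡⟨ cong (fromℕ′ e ℚ.*_) eq ⟩
    fromℕ′ e ℚ.* fromℕ′ a                 ≡⟨ fromℕ′-* e a ⟨
    fromℕ′ (e * a)                        ∎
  scaled (suc v) = begin
    fromℕ′ (d * e) ℚ.* x (suc v)          ≡⟨ cong (ℚ._* x (suc v)) (fromℕ′-* d e) ⟩
    fromℕ′ d ℚ.* fromℕ′ e ℚ.* x (suc v)   ≡⟨ ℚ.*-assoc (fromℕ′ d) (fromℕ′ e) (x (suc v)) ⟩
    fromℕ′ d ℚ.* (fromℕ′ e ℚ.* x (suc v)) ≡⟨ cong (fromℕ′ d ℚ.*_) (eqs v) ⟩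
    fromℕ′ d ℚ.* fromℕ′ (b v)             ≡⟨ fromℕ′-* d (b v) ⟨
    fromℕ′ (d * b v)                      ∎

-- Threshold rounding: for b / 2D ∈ ℚ and i < D, round D i b / 2 ∈ {0, ½, 1}
-- is a rounding of b / 2D, and the average of these over i is at most b / 2D.
[_] : ∀ {P : Set} → Dec P → ℕ
[ d ] = if does d then 1 else 0

[]≤1 : ∀ {P : Set} (d : Dec P) → [ d ] ≤ 1
[]≤1 (yes _) = s≤s z≤n
[]≤1 (no _)  = z≤n

[]-yes : ∀ {P : Set} (d : Dec P) → P → [ d ] ≡ 1
[]-yes (yes _) _ = refl
[]-yes (no ¬p) p = contradiction p ¬p

module Rounding (D : ℕ) where

  round : ℕ → ℕ → ℕ
  round i b = [ i ℕ.<? b ] + [ (D + D) ℕ.≤? (b + i) ]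

  round<3 : ∀ i b → round i b < 3
  round<3 i b = s≤s (ℕ.+-mono-≤ ([]≤1 (i ℕ.<? b)) ([]≤1 ((D + D) ℕ.≤? (b + i))))

  round-zero : ∀ i b → i < D → ∀ c → D + D ≤ b + c → b ≤ i → 2 ≤ round i c
  round-zero i b i<D c 2D≤ b≤i = ℕ.≤-reflexive (sym (cong₂ _+_
      ([]-yes (i ℕ.<? c) i<c) ([]-yes ((D + D) ℕ.≤? (c + i)) 2D≤c+i)))
    where
    2D≤c+i : D + D ≤ c + i
    2D≤c+i = ℕ.≤-trans 2D≤ (ℕ.≤-trans (ℕ.+-monoˡ-≤ c b≤i) (ℕ.≤-reflexive (ℕ.+-comm i c)))
    i<c : i < c
    i<c = ℕ.≰⇒> λ c≤i → ℕ.<⇒≱ (ℕ.+-mono-< i<D i<D) (ℕ.≤-trans 2D≤c+i (ℕ.+-monoˡ-≤ i c≤i))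

  round-pos : ∀ i b → i < b → 1 ≤ round i b
  round-pos i b i<b = subst (λ z → 1 ≤ z + [ (D + D) ℕ.≤? (b + i) ]) (sym ([]-yes (i ℕ.<? b) i<b)) (s≤s z≤n)

  round-feasible : ∀ i b c → i < D → D + D ≤ b + c → 2 ≤ round i b + round i c
  round-feasible i b c i<D 2D≤ with ℕ.<-≤-connex i b | ℕ.<-≤-connex i c
  ... | inj₁ i<b | inj₁ i<c = ℕ.+-mono-≤ (round-pos i b i<b) (round-pos i c i<c)
  ... | inj₂ b≤i | _        = ℕ.≤-trans (round-zero i b i<D c 2D≤ b≤i) (ℕ.m≤n+m (round i c) (round i b))
  ... | inj₁ _   | inj₂ c≤i = ℕ.≤-trans
    (round-zero i c i<D b (subst (D + D ≤_) (ℕ.+-comm b c) 2D≤) c≤i) (ℕ.m≤m+n (round i b) (round i c))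

  total : ℕ → ℕ → ℕ
  total zero    b = 0
  total (suc m) b = round m b + total m b

  total-≤ : ∀ m b → total m b ≤ m ⊓ b + ((b + m) ∸ (D + D))
  total-≤ zero    b = z≤n
  total-≤ (suc m) b = begin
    [ m ℕ.<? b ] + [ (D + D) ℕ.≤? (b + m) ] + total m b
      ≤⟨ ℕ.+-monoʳ-≤ (round m b) (total-≤ m b) ⟩
    [ m ℕ.<? b ] + [ (D + D) ℕ.≤? (b + m) ] + (m ⊓ b + (b + m ∸ (D + D)))
      ≡⟨ shuffle [ m ℕ.<? b ] _ (m ⊓ b) _ ⟩
    ([ m ℕ.<? b ] + m ⊓ b) + ([ (D + D) ℕ.≤? (b + m) ] + (b + m ∸ (D + D)))
      ≤⟨ ℕ.+-mono-≤ (left (m ℕ.<? b)) (right ((D + D) ℕ.≤? (b + m))) ⟩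
    suc m ⊓ b + (b + suc m ∸ (D + D)) ∎
    where
    open ℕ.≤-Reasoning
    shuffle : ∀ p q r s → p + q + (r + s) ≡ (p + r) + (q + s)
    shuffle = solve-∀
    left : (d : Dec (m < b)) → [ d ] + m ⊓ b ≤ suc m ⊓ b
    left (yes m<b) = ℕ.≤-reflexive (trans (cong suc (ℕ.m≤n⇒m⊓n≡m (ℕ.<⇒≤ m<b))) (sym (ℕ.m≤n⇒m⊓n≡m m<b)))
    left (no _)    = ℕ.⊓-monoˡ-≤ b (ℕ.n≤1+n m)
    right : (d : Dec (D + D ≤ b + m)) → [ d ] + (b + m ∸ (D + D)) ≤ b + suc m ∸ (D + D)
    right (yes 2D≤) = ℕ.≤-reflexive (trans (sym (ℕ.+-∸-assoc 1 2D≤)) (cong (_∸ (D + D)) (sym (ℕ.+-suc b m))))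
    right (no _)    = ℕ.∸-monoˡ-≤ (D + D) (ℕ.+-monoʳ-≤ b (ℕ.n≤1+n m))

  total-D : ∀ b → total D b ≤ b
  total-D b = ℕ.≤-trans (total-≤ D b) (ℕ.≤-reflexive (trans
    (cong (λ z → D ⊓ b + z) (trans (cong (_∸ (D + D)) (ℕ.+-comm b D)) (ℕ.[m+n]∸[m+o]≡n∸o D b D)))
    (ℕ.m⊓n+n∸m≡n D b)))

  average : ∀ {n} (b : Fin n → ℕ) c → ∀ m → (∀ i → i < m → c ≤ Σℕ.sum (round i ∘ b)) →
            m * c ≤ Σℕ.sum (total m ∘ b)
  average b c zero    h = z≤n
  average b c (suc m) h = ℕ.≤-trans
    (ℕ.+-mono-≤ (h m ℕ.≤-refl) (average b c m (λ i i<m → h i (ℕ.m<n⇒m<1+n i<m))))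
    (ℕ.≤-reflexive (sym (Σℕ.∑-distrib-+ (round m ∘ b) (total m ∘ b))))

sum-mono : ∀ {n} {f g : Fin n → ℕ} → (∀ v → f v ≤ g v) → Σℕ.sum f ≤ Σℕ.sum g
sum-mono {zero}  f≤g = z≤n
sum-mono {suc n} f≤g = ℕ.+-mono-≤ (f≤g zero) (sum-mono (f≤g ∘ suc))

module LinearProgram (G : Graph) where
  open Graph G

  Feasible : (Vertex → ℚ) → Set
  Feasible x = (∀ u v → Adj u v → 1ℚ ℚ.≤ x u ℚ.+ x v) × (∀ v → 0ℚ ℚ.≤ x v)

  Optimal : (Vertex → ℚ) → Set
  Optimal x = Feasible x × (∀ y → Feasible y → Σℚ.sum x ℚ.≤ Σℚ.sum y)

  -- The optimum is attained at a half-integral point; a vector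
  -- h ∈ {0, 1, 2}ⁿ stands for the point h / 2.
  private
    levels : List (Vec (Fin 3) order)
    levels = vectors (allFin 3) order

    HalfFeasible : Vec (Fin 3) order → Set
    HalfFeasible h = ∀ u v → Adj u v → 2 ≤ toℕ (lookup h u) + toℕ (lookup h v)

    HalfFeasible? : Decidable HalfFeasible
    HalfFeasible? h = all? λ u → all? λ v → Adj? u v →-dec (2 ℕ.≤? _)

    cost : Vec (Fin 3) order → ℕ
    cost h = Σℕ.sum (λ v → toℕ (lookup h v))

    allHalf : Vec (Fin 3) order
    allHalf = tabulate (λ _ → suc zero)

    allHalf-feasible : HalfFeasible allHalf
    allHalf-feasible u v _ = ℕ.≤-reflexive (sym (cong₂ (λ i j → toℕ i + toℕ j)
      (lookup∘tabulate {n = order} (λ _ → suc zero) u)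
      (lookup∘tabulate {n = order} (λ _ → suc zero) v)))

    best : Vec (Fin 3) order
    best = argmin cost allHalf (filter HalfFeasible? levels)

    best-feasible : HalfFeasible best
    best-feasible = argmin-all cost allHalf-feasible (all-filter HalfFeasible? levels)

    best-optimal : ∀ h → HalfFeasible h → cost best ≤ cost h
    best-optimal h hf = All.lookup (f[argmin]≤f[xs] {f = cost} allHalf (filter HalfFeasible? levels))
      (∈-filter⁺ HalfFeasible? (Enumeration.vectors-complete (allFin 3) ∈-allFin h) hf)

    point : Vertex → ℚ
    point v = ½ ℚ.* fromℕ′ (toℕ (lookup best v))

    point-sum : Σℚ.sum point ≡ ½ ℚ.* fromℕ′ (cost best)
    point-sum = trans (sym (Σℚ.*-distribˡ-sum ½ (fromℕ′ ∘ toℕ ∘ lookup best)))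
                      (cong (½ ℚ.*_) (sym (fromℕ′-sum (toℕ ∘ lookup best))))

    point-feasible : Feasible point
    point-feasible = covers , λ v → ℚ.*-monoˡ-≤-nonNeg ½ (fromℕ′-mono {0} {toℕ (lookup best v)} z≤n)
      where
      covers : ∀ u v → Adj u v → 1ℚ ℚ.≤ point u ℚ.+ point v
      covers u v uv = subst (1ℚ ℚ.≤_)
        (trans (cong (½ ℚ.*_) (fromℕ′-+ (toℕ (lookup best u)) (toℕ (lookup best v))))
               (ℚ.*-distribˡ-+ ½ (fromℕ′ (toℕ (lookup best u))) (fromℕ′ (toℕ (lookup best v)))))
        (ℚ.*-monoˡ-≤-nonNeg ½ (fromℕ′-mono (best-feasible u v uv)))

    scaled-bound : ∀ (a : Vertex → ℕ) D → (∀ u v → Adj u v → D ≤ a u + a v) →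
                   D * cost best ≤ Σℕ.sum a + Σℕ.sum a
    scaled-bound a D h = begin
      D * cost best                 ≤⟨ average b (cost best) D each ⟩
      Σℕ.sum (λ v → total D (b v))  ≤⟨ sum-mono (λ v → total-D (b v)) ⟩
      Σℕ.sum b                      ≡⟨ Σℕ.∑-distrib-+ a a ⟩
      Σℕ.sum a + Σℕ.sum a           ∎
      where
      open ℕ.≤-Reasoning
      open Rounding D
      b : Vertex → ℕ
      b v = a v + a v

      double : ∀ p q → (p + q) + (p + q) ≡ (p + p) + (q + q)
      double = solve-∀

      module _ (i : ℕ) (i<D : i < D) where
        y : Vec (Fin 3) order
        y = tabulate (λ v → fromℕ< (round<3 i (b v)))

        y≡ : ∀ v → toℕ (lookup y v) ≡ round i (b v)
        y≡ v = trans (cong toℕ (lookup∘tabulate _ v)) (toℕ-fromℕ< _)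

        y-feasible : HalfFeasible y
        y-feasible u v uv = subst (2 ≤_) (sym (cong₂ _+_ (y≡ u) (y≡ v)))
          (round-feasible i (b u) (b v) i<D
            (subst (D + D ≤_) (double (a u) (a v)) (ℕ.+-mono-≤ (h u v uv) (h u v uv))))

      each : ∀ i → i < D → cost best ≤ Σℕ.sum (round i ∘ b)
      each i i<D = ℕ.≤-trans (best-optimal (y i i<D) (y-feasible i i<D))
                             (ℕ.≤-reflexive (Σℕ.sum-cong-≗ (y≡ i i<D)))

    point-optimal : ∀ x → Feasible x → Σℚ.sum point ℚ.≤ Σℚ.sum x
    point-optimal x (covers , 0≤x) with clearAll x 0≤x
    ... | D , a , D≢0 , Dx≡a = ℚ.*-cancelˡ-≤-pos (fromℕ′ D) {{pos D {{D≢0}}}} (begin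
      fromℕ′ D ℚ.* Σℚ.sum point                     ≡⟨ cong (fromℕ′ D ℚ.*_) point-sum ⟩
      fromℕ′ D ℚ.* (½ ℚ.* fromℕ′ (cost best))       ≡⟨ swap (fromℕ′ D) ½ (fromℕ′ (cost best)) ⟩
      ½ ℚ.* (fromℕ′ D ℚ.* fromℕ′ (cost best))       ≡⟨ cong (½ ℚ.*_) (fromℕ′-* D (cost best)) ⟨
      ½ ℚ.* fromℕ′ (D * cost best)                  ≤⟨ ℚ.*-monoˡ-≤-nonNeg ½ (fromℕ′-mono (scaled-bound a D h)) ⟩
      ½ ℚ.* fromℕ′ (Σℕ.sum a + Σℕ.sum a)            ≡⟨ cong (½ ℚ.*_) (fromℕ′-+ (Σℕ.sum a) (Σℕ.sum a)) ⟩
      ½ ℚ.* (A ℚ.+ A)                               ≡⟨ ℚ.*-distribˡ-+ ½ A A ⟩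
      ½ ℚ.* A ℚ.+ ½ ℚ.* A                           ≡⟨ ℚ.*-distribʳ-+ A ½ ½ ⟨
      1ℚ ℚ.* A                                      ≡⟨ ℚ.*-identityˡ A ⟩
      A                                             ≡⟨ fromℕ′-sum a ⟩
      Σℚ.sum (fromℕ′ ∘ a)                           ≡⟨ Σℚ.sum-cong-≗ Dx≡a ⟨
      Σℚ.sum (λ v → fromℕ′ D ℚ.* x v)               ≡⟨ Σℚ.*-distribˡ-sum (fromℕ′ D) x ⟨
      fromℕ′ D ℚ.* Σℚ.sum x                         ∎)
      where
      open ℚ.≤-Reasoning
      A : ℚ
      A = fromℕ′ (Σℕ.sum a)

      pos : ∀ d → {{NonZero d}} → ℚ.Positive (fromℕ′ d)
      pos (suc d) = _

      nonNeg : ∀ d → ℚ.NonNegative (fromℕ′ d)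
      nonNeg d = _

      swap : ∀ p q r → p ℚ.* (q ℚ.* r) ≡ q ℚ.* (p ℚ.* r)
      swap p q r = trans (sym (ℚ.*-assoc p q r))
        (trans (cong (ℚ._* r) (ℚ.*-comm p q)) (ℚ.*-assoc q p r))

      h : ∀ u v → Adj u v → D ≤ a u + a v
      h u v uv = fromℕ′-cancel (begin
        fromℕ′ D                                ≡⟨ ℚ.*-identityʳ _ ⟨
        fromℕ′ D ℚ.* 1ℚ                         ≤⟨ ℚ.*-monoˡ-≤-nonNeg (fromℕ′ D) {{nonNeg D}} (covers u v uv) ⟩
        fromℕ′ D ℚ.* (x u ℚ.+ x v)              ≡⟨ ℚ.*-distribˡ-+ (fromℕ′ D) (x u) (x v) ⟩
        fromℕ′ D ℚ.* x u ℚ.+ fromℕ′ D ℚ.* x v   ≡⟨ cong₂ ℚ._+_ (Dx≡a u) (Dx≡a v) ⟩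
        fromℕ′ (a u) ℚ.+ fromℕ′ (a v)           ≡⟨ fromℕ′-+ (a u) (a v) ⟨
        fromℕ′ (a u + a v)                      ∎)

  solution : ∃ Optimal
  solution = point , point-feasible , point-optimal

-- The optimal value; by definition of Optimal it does not depend on the
-- chosen solution.
LP-VC : Graph → ℚ
LP-VC G = Σℚ.sum (proj₁ (LinearProgram.solution G))

------------------------------------------------------------------------
-- Encodings of graphs

-- A number n is written 1ⁿ0.
readℕ : Word → Maybe (ℕ × Word)
readℕ []          = nothing
readℕ (false ∷ w) = just (0 , w)
readℕ (true ∷ w)  = readℕ w >>= λ (n , w′) → just (suc n , w′)

readVec : ∀ n → Word → Maybe (Vec Bool n)
readVec zero    []      = just []
readVec zero    (_ ∷ _) = nothing
readVec (suc n) []      = nothing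
readVec (suc n) (b ∷ w) = readVec n w >>= λ v → just (b ∷ v)

-- A graph is written as its order followed by its adjacency matrix, row by row.
entry : ∀ {n} → Vec Bool (n * n) → Fin n → Fin n → Bool
entry m u v = lookup m (combine u v)

fromMatrix : ∀ n → Vec Bool (n * n) → Maybe Graph
fromMatrix n m with all? (λ u → all? λ v → entry m u v Bool.≟ entry m v u)
                  | all? (λ v → entry m v v Bool.≟ false)
... | yes s | yes i = just (record { order = n ; adj = entry m ; symm = s ; irrefl = i })
... | _     | _     = nothing

readGraph : Word → Maybe Graph
readGraph w = readℕ w >>= λ (n , w′) → readVec (n * n) w′ >>= fromMatrix n

readGraph,k : Word → Maybe (Graph × ℕ)
readGraph,k w = readℕ w >>= λ (k , w′) → readGraph w′ >>= λ G → just (G , k)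

Terminals : Graph → Set
Terminals G = Σ[ s ∈ Graph.Vertex G ] Σ[ t ∈ Graph.Vertex G ] s ≢ t

terminals : ∀ G → ℕ → ℕ → Maybe (Terminals G)
terminals G a b with a ℕ.<? Graph.order G | b ℕ.<? Graph.order G
... | no _   | _      = nothing
... | yes _  | no _   = nothing
... | yes a< | yes b< with fromℕ< a< Fin.≟ fromℕ< b<
...   | yes _  = nothing
...   | no s≢t = just (fromℕ< a< , fromℕ< b< , s≢t)

readGraph,s,t : Word → Maybe (Σ Graph Terminals)
readGraph,s,t w = readℕ w >>= λ (a , w₁) → readℕ w₁ >>= λ (b , w₂) →
  readGraph w₂ >>= λ G → terminals G a b >>= λ st → just (G , st)

------------------------------------------------------------------------
-- The four problems
--
-- A pair (w , κ) in which w encodes no input, or κ is not the parameter of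
-- the input encoded by w, has the value 0.

onInput : ∀ {A : Set} → (Word → Maybe A) → (A → ℕ → ℕ) → ParameterizedCountingProblem
onInput read f (w , κ) = maybe′ (λ a → f a κ) 0 (read w)

#k-Min-st-Cut : ParameterizedCountingProblem
#k-Min-st-Cut = onInput readGraph,s,t λ (G , s , t , _) κ →
  let open MinCut G s t in
  count λ S → IsMinimumCut? S ×-dec (∣ S ∣ ℕ.≟ κ)

#k-Odd-Cycle-Transversal : ParameterizedCountingProblem
#k-Odd-Cycle-Transversal = onInput readGraph,k λ (G , k) κ →
  if does (κ ℕ.≟ k)
  then (count λ S → OddCycle.IsTransversal? G S ×-dec (∣ S ∣ ℕ.≤? k))
  else 0

-- The parameter k - LP-VC G is a half-integer, and negative only if G has no
-- vertex cover of size at most k; it is rounded up to an element of ℕ.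
#ℓ-Vertex-Cover : ParameterizedCountingProblem
#ℓ-Vertex-Cover = onInput readGraph,k λ (G , k) κ →
  if does (κ ℕ.≟ ℤ.∣ 0ℤ ℤ.⊔ ceiling (fromℕ′ k ℚ.- LP-VC G) ∣)
  then VertexCover.coversOfSize≤ G k
  else 0

-- Likewise, k - μ(G) is negative only if G has no vertex cover of size at
-- most k.
#m-Vertex-Cover : ParameterizedCountingProblem
#m-Vertex-Cover = onInput readGraph,k λ (G , k) κ →
  if does (∃Subset? λ M → Matching.IsMaximumMatching? G M ×-dec (κ ℕ.≟ k ∸ ∣ M ∣))
  then VertexCover.coversOfSize≤ G k
  else 0

{-# OPTIONS --safe #-}
-- The source of all four compositions is the number of closed sets of a digraph
-- (#Closed).  It is #P-hard by a single query: the tableau of a verifying machine is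
-- described by clauses that are purely positive or purely negative, and r nodes for each
-- clause make a truth assignment contribute 2 ^ (r · number of violated clauses) closed
-- sets, so the number of solutions is the number of closed sets modulo 2 ^ r.
--
-- The numbers of closed sets of t digraphs on n vertices are added as follows.  Separated
-- by single elements in a chain, the digraphs yield one digraph whose closed sets are
-- the vertex covers of size μ = LP of a bipartite graph with a perfect matching, and the
-- parameter is 0.  In series between s and t, each digraph as n² parallel
-- paths of length three with identifications for the arcs, they yield a graph whose minimum
-- cuts have n² edges, all in one block, and correspond to the closed sets of that block.
-- Subdividing the edges, replacing the vertices by many copies and joining the copies of
-- s to those of t turns these cuts into odd cycle transversals of size at most n².

module Submission where

open import Data.Bool.Base using (Bool; true; false; T; not; _∧_; _∨_; if_then_else_)
open import Data.Bool.Properties as Bool using (T?)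
open import Data.Empty using (⊥; ⊥-elim)
open import Data.Fin.Base as Fin using (Fin; zero; suc; toℕ; fromℕ; fromℕ<; inject₁; combine; remQuot; _↑ˡ_; _↑ʳ_; splitAt)
open import Data.Fin.Properties as Fin using (all?; any?; toℕ<n; toℕ-fromℕ<; toℕ-injective; fromℕ<-toℕ; combine-remQuot; remQuot-combine)
open import Data.Fin.Subset using (Subset; _∈_; _∉_; ∣_∣)
open import Data.Fin.Subset.Properties using (_∈?_)
open import Data.Integer.Base as ℤ using (0ℤ)
import Data.Integer.Properties as ℤ
open import Data.List.Base as List
  using (List; []; _∷_; _++_; _ʳ++_; length; filter; map; concatMap; upTo; allFin; cartesianProduct; replicate)
import Data.List.Properties as List
open import Data.List.Membership.Propositional as List using (lose) renaming (_∈_ to _∈ₗ_)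
open import Data.List.Membership.Propositional.Properties as List using (∈-allFin)
open import Data.List.NonEmpty.Base as List⁺ using (List⁺)
open import Data.List.Relation.Unary.All as All using (All; []; _∷_)
import Data.List.Relation.Unary.All.Properties as All
open import Data.List.Relation.Unary.AllPairs using (AllPairs; []; _∷_)
open import Data.List.Relation.Unary.Any as Any using (Any; here; there)
open import Data.List.Relation.Unary.Unique.Propositional using (Unique)
import Data.List.Relation.Unary.Unique.Propositional.Properties as Unique
open import Data.Maybe.Base using (Maybe; just; nothing; maybe′; _>>=_)
import Data.Maybe.Properties as Maybe
open import Data.Nat.Base as ℕ
  using (ℕ; zero; suc; _+_; _*_; _∸_; _⊔_; _^_; _≤_; _<_; _≡ᵇ_; _<ᵇ_; z≤n; s≤s)
open import Data.Nat.ListAction using (sum)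
import Data.Nat.ListAction.Properties as Sum
open import Data.Nat.Divisibility using (_∣_; _∣?_; divides; ∣m∣n⇒∣m+n; ∣m+n∣m⇒∣n)
open import Data.Nat.Logarithm using (⌈log₂_⌉)
import Data.Nat.Properties as ℕ
open import Data.Nat.Tactic.RingSolver using (solve-∀)
open import Data.Product.Base using (Σ; Σ-syntax; ∃; ∃₂; _×_; _,_; proj₁; proj₂)
open import Data.Rational.Base as ℚ using (ℚ; 0ℚ; 1ℚ; ceiling)
import Data.Rational.Properties as ℚ
open import Data.Sum.Base as Sum using (_⊎_; inj₁; inj₂)
open import Data.Unit.Base using (⊤; tt)
open import Data.Vec.Base as Vec using (Vec; []; _∷_; lookup; tabulate)
import Data.Vec.Properties as Vec
open import Function.Base using (_∘_; id; case_of_)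
open import Function.Definitions using (Injective)
open import Level using (0ℓ)
open import Relation.Binary.Construct.Closure.ReflexiveTransitive using (Star; ε; _◅_; _◅◅_)
open import Relation.Binary.Definitions using (Tri; tri<; tri≈; tri>)
open import Relation.Binary.PropositionalEquality
  using (_≡_; _≢_; refl; sym; trans; cong; cong₂; subst; subst₂; module ≡-Reasoning)
open import Relation.Nullary.Decidable
  using (Dec; yes; no; does; map′; ¬?; _×-dec_; _⊎-dec_; _→-dec_; dec-true; dec-false; decidable-stable)
open import Relation.Nullary.Negation using (¬_; contradiction)
open import Relation.Unary using (Pred; Decidable)
open import Defs

-- Closed sets are a common source because the same structure underlies the targets: in a bipartite
-- graph with a perfect matching the minimum vertex covers are the closed sets of a digraph, and so
-- are, in suitable networks, the minimum cuts. A sum calls for solutions that form a disjoint union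
-- over the inputs, while the parameter may grow only logarithmically with their number. So the
-- inputs are put in series, and the place where a solution changes sides selects one of them. All
-- places must then cost the same, whatever the arcs, which is why a pair that is not an arc also
-- receives a path.
--
-- In the hardness proof, a node joined to coordinates by arcs in one direction can only notice that
-- some member is true, or that some member is false. This admits pure clauses only, and it cannot
-- exclude a violating assignment but merely weigh it; hence the modulus.
--
-- Polynomial running time has to be shown for concrete programs. Every output is therefore an
-- expression in a small language of unary arithmetic whose constructors carry the program, a bound
-- on the value and a bound on the time.

-- Polynomial expressions and their coefficient lists

data Pol : Set where
  var       : Pol
  con       : ℕ → Pol
  _⊞_ _⊠_ _⊚_ : Pol → Pol → Pol

infixl 6 _⊞_
infixl 7 _⊠_
infixl 8 _⊚_

ev : Pol → ℕ → ℕ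
ev var       n = n
ev (con c)   n = c
ev (p ⊞ q) n = ev p n + ev q n
ev (p ⊠ q) n = ev p n * ev q n
ev (p ⊚ q) n = ev p (ev q n)

-- Constants are natural numbers, so every expression is monotone. A bound stated for the exact size
-- of an environment may thus be evaluated at any upper estimate of that size.
ev-mono : ∀ p {m n} → m ≤ n → ev p m ≤ ev p n
ev-mono var       m≤n = m≤n
ev-mono (con c)   m≤n = ℕ.≤-refl
ev-mono (p ⊞ q) m≤n = ℕ.+-mono-≤ (ev-mono p m≤n) (ev-mono q m≤n)
ev-mono (p ⊠ q) m≤n = ℕ.*-mono-≤ (ev-mono p m≤n) (ev-mono q m≤n)
ev-mono (p ⊚ q) m≤n = ev-mono p (ev-mono q m≤n)

infixl 6 _⊕ᵖ_
infixl 7 _⊗ᵖ_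

_⊕ᵖ_ : Polynomial → Polynomial → Polynomial
[]      ⊕ᵖ q       = q
(a ∷ p) ⊕ᵖ []      = a ∷ p
(a ∷ p) ⊕ᵖ (b ∷ q) = a + b ∷ p ⊕ᵖ q

⊕ᵖ-⟦⟧ : ∀ p q n → ⟦ p ⊕ᵖ q ⟧ n ≡ ⟦ p ⟧ n + ⟦ q ⟧ n
⊕ᵖ-⟦⟧ []      q       n = refl
⊕ᵖ-⟦⟧ (a ∷ p) []      n = sym (ℕ.+-identityʳ _)
⊕ᵖ-⟦⟧ (a ∷ p) (b ∷ q) n = trans (cong (λ z → a + b + n * z) (⊕ᵖ-⟦⟧ p q n)) (ring a b n (⟦ p ⟧ n) (⟦ q ⟧ n))
  where
  ring : ∀ a b n x y → a + b + n * (x + y) ≡ a + n * x + (b + n * y)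
  ring = solve-∀

scale : ℕ → Polynomial → Polynomial
scale a = map (a *_)

scale-⟦⟧ : ∀ a p n → ⟦ scale a p ⟧ n ≡ a * ⟦ p ⟧ n
scale-⟦⟧ a []      n = sym (ℕ.*-zeroʳ a)
scale-⟦⟧ a (c ∷ p) n = trans (cong (λ z → a * c + n * z) (scale-⟦⟧ a p n)) (ring a c n (⟦ p ⟧ n))
  where
  ring : ∀ a c n x → a * c + n * (a * x) ≡ a * (c + n * x)
  ring = solve-∀

_⊗ᵖ_ : Polynomial → Polynomial → Polynomial
[]      ⊗ᵖ q = []
(a ∷ p) ⊗ᵖ q = scale a q ⊕ᵖ (0 ∷ p ⊗ᵖ q)

⊗ᵖ-⟦⟧ : ∀ p q n → ⟦ p ⊗ᵖ q ⟧ n ≡ ⟦ p ⟧ n * ⟦ q ⟧ n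
⊗ᵖ-⟦⟧ []      q n = refl
⊗ᵖ-⟦⟧ (a ∷ p) q n = begin
  ⟦ scale a q ⊕ᵖ (0 ∷ p ⊗ᵖ q) ⟧ n       ≡⟨ ⊕ᵖ-⟦⟧ (scale a q) _ n ⟩
  ⟦ scale a q ⟧ n + n * ⟦ p ⊗ᵖ q ⟧ n    ≡⟨ cong₂ (λ y z → y + n * z) (scale-⟦⟧ a q n) (⊗ᵖ-⟦⟧ p q n) ⟩
  a * ⟦ q ⟧ n + n * (⟦ p ⟧ n * ⟦ q ⟧ n) ≡⟨ ring a n (⟦ p ⟧ n) (⟦ q ⟧ n) ⟩
  (a + n * ⟦ p ⟧ n) * ⟦ q ⟧ n           ∎
  where
  open ≡-Reasoning
  ring : ∀ a n x y → a * y + n * (x * y) ≡ (a + n * x) * y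
  ring = solve-∀

_⊚ᵖ_ : Polynomial → Polynomial → Polynomial
[]      ⊚ᵖ q = []
(a ∷ p) ⊚ᵖ q = (a ∷ []) ⊕ᵖ q ⊗ᵖ (p ⊚ᵖ q)

⊚ᵖ-⟦⟧ : ∀ p q n → ⟦ p ⊚ᵖ q ⟧ n ≡ ⟦ p ⟧ (⟦ q ⟧ n)
⊚ᵖ-⟦⟧ []      q n = refl
⊚ᵖ-⟦⟧ (a ∷ p) q n = trans (⊕ᵖ-⟦⟧ (a ∷ []) (q ⊗ᵖ (p ⊚ᵖ q)) n)
  (cong₂ _+_ (trans (cong (_+_ a) (ℕ.*-zeroʳ n)) (ℕ.+-identityʳ a))
             (trans (⊗ᵖ-⟦⟧ q (p ⊚ᵖ q) n) (cong (⟦ q ⟧ n *_) (⊚ᵖ-⟦⟧ p q n))))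

polynomial : Pol → Polynomial
polynomial var       = 0 ∷ 1 ∷ []
polynomial (con c)   = c ∷ []
polynomial (p ⊞ q) = polynomial p ⊕ᵖ polynomial q
polynomial (p ⊠ q) = polynomial p ⊗ᵖ polynomial q
polynomial (p ⊚ q) = polynomial p ⊚ᵖ polynomial q

polynomial-ev : ∀ p n → ⟦ polynomial p ⟧ n ≡ ev p n
polynomial-ev var       n = trans (cong (n *_) (cong (1 +_) (ℕ.*-zeroʳ n))) (ℕ.*-identityʳ n)
polynomial-ev (con c)   n = trans (cong (c +_) (ℕ.*-zeroʳ n)) (ℕ.+-identityʳ c)
polynomial-ev (p ⊞ q) n = trans (⊕ᵖ-⟦⟧ (polynomial p) _ n) (cong₂ _+_ (polynomial-ev p n) (polynomial-ev q n))
polynomial-ev (p ⊠ q) n = trans (⊗ᵖ-⟦⟧ (polynomial p) _ n) (cong₂ _*_ (polynomial-ev p n) (polynomial-ev q n))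
polynomial-ev (p ⊚ q) n = trans (⊚ᵖ-⟦⟧ (polynomial p) _ n)
  (trans (polynomial-ev p _) (cong (ev p) (polynomial-ev q n)))

-- Running programs

-- A triple of total correctness with a time bound. The final store is described by a predicate
-- because stores are functions and are compared only pointwise.
Run : ∀ {Q} → Oracle Q → Program Q → Store → (Store → Set) → ℕ → Set
Run O p σ P B = ∃₂ λ τ t → O ⊢⟨ p , σ ⟩⇓⟨ τ , t ⟩ × t ≤ B × P τ

Agree : Register → Store → Store → Set
Agree r σ τ = ∀ s → s ≢ r → τ s ≡ σ s

private
  variable
    Q : Set
    O : Oracle Q
    n : ℕ

≔-same : ∀ (σ : Store) r w → (σ [ r ≔ w ]) r ≡ w
≔-same σ r w = cong (λ b → if b then w else σ r) (dec-true (r ℕ.≟ r) refl)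

≔-agree : ∀ σ r w → Agree r σ (σ [ r ≔ w ])
≔-agree σ r w s s≢r = cong (λ b → if b then w else σ s) (dec-false (s ℕ.≟ r) s≢r)

Agree-trans : ∀ {r σ τ υ} → Agree r σ τ → Agree r τ υ → Agree r σ υ
Agree-trans f g s s≢r = trans (g s s≢r) (f s s≢r)

-- The scratch register e, once restored, does not count as changed.
Agree-scratch : ∀ {r e σ τ} → (∀ s → s ≢ r → s ≢ e → τ s ≡ σ s) → τ e ≡ σ e → Agree r σ τ
Agree-scratch {e = e} f eq s s≢r with s ℕ.≟ e
... | yes refl = eq
... | no s≢e   = f s s≢r s≢e

weaken : ∀ {p σ P P′ B B′} → Run O p σ P B → B ≤ B′ → (∀ τ → P τ → P′ τ) → Run O p σ P′ B′
weaken (τ , t , r , t≤ , Pτ) B≤ f = τ , t , r , ℕ.≤-trans t≤ B≤ , f τ Pτ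

infixr 4 _andThen_

_andThen_ : ∀ {p q σ P R B B′} → Run O p σ P B → (∀ τ → P τ → Run O q τ R B′) →
            Run O (p ⨾ q) σ R (B + B′)
(τ , s , r , s≤ , Pτ) andThen f with f τ Pτ
... | υ , t , r′ , t≤ , Rυ = υ , s + t , ⇓seq r r′ , ℕ.+-mono-≤ s≤ t≤ , Rυ

skip-run : ∀ {σ} (P : Store → Set) → P σ → Run O skip σ P 1
skip-run P Pσ = _ , _ , ⇓skip , ℕ.≤-refl , Pσ

push-run : ∀ b r σ → Run O (push b r) σ (λ τ → τ r ≡ b ∷ σ r × Agree r σ τ) 1
push-run b r σ = _ , _ , ⇓push , ℕ.≤-refl , ≔-same σ r _ , ≔-agree σ r _

pop-run : ∀ r σ → Run O (pop r) σ (λ τ → τ r ≡ List.drop 1 (σ r) × Agree r σ τ) 1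
pop-run r σ = _ , _ , ⇓pop , ℕ.≤-refl , ≔-same σ r _ , ≔-agree σ r _

branch-run : ∀ {p₀ p₁ p₂} r σ {P B} →
             (σ r ≡ [] → Run O p₀ σ P B) →
             (∀ w → σ r ≡ false ∷ w → Run O p₁ σ P B) →
             (∀ w → σ r ≡ true ∷ w → Run O p₂ σ P B) →
             Run O (branch r p₀ p₁ p₂) σ P (1 + B)
branch-run r σ f₀ f₁ f₂ with σ r in eq
... | []        = let τ , t , run , t≤ , Pτ = f₀ refl in τ , _ , ⇓empty eq run , s≤s t≤ , Pτ
... | false ∷ w = let τ , t , run , t≤ , Pτ = f₁ w refl in τ , _ , ⇓false eq run , s≤s t≤ , Pτ
... | true ∷ w  = let τ , t , run , t≤ , Pτ = f₂ w refl in τ , _ , ⇓true eq run , s≤s t≤ , Pτ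

-- Every loop of the generated code has this form, and `act` itself has to shorten `r`. The empty
-- branch cannot be reached inside the loop. An iteration costs two steps, for `while` and `branch`,
-- on top of the action.
drain : Register → (Bool → Program Q) → Program Q
drain r act = while r (branch r skip (act false) (act true))

-- The invariant is indexed by what is left of the register r that controls
-- the loop.
drain-run : ∀ {act} r (Inv : Word → Store → Set) B →
            (∀ {w σ} → Inv w σ → σ r ≡ w) →
            (∀ b w σ → Inv (b ∷ w) σ → Run O (act b) σ (Inv w) B) →
            ∀ w σ → Inv w σ → Run O (drain r act) σ (Inv []) (length w * (2 + B) + 1)
drain-run r Inv B left step []      σ inv = σ , 1 , ⇓done (left inv) , ℕ.≤-refl , inv
drain-run {O = O} {act = act} r Inv B left step (b ∷ w) σ inv
  with step b w σ inv
... | τ , s , run , s≤ , inv′ with drain-run {O = O} {act = act} r Inv B left step w τ inv′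
... | υ , t , run′ , t≤ , inv″ = υ , 1 + (1 + s) + t , ⇓loop (left inv) (choose b (left inv) run) run′ ,
    ℕ.≤-trans (s≤s (s≤s (ℕ.+-mono-≤ s≤ t≤))) (ℕ.≤-reflexive (ring B (length w))) , inv″
  where
  choose : ∀ b {σ τ s w} → σ r ≡ b ∷ w → O ⊢⟨ act b , σ ⟩⇓⟨ τ , s ⟩ →
           O ⊢⟨ branch r skip (act false) (act true) , σ ⟩⇓⟨ τ , 1 + s ⟩
  choose false eq run = ⇓false eq run
  choose true  eq run = ⇓true eq run
  ring : ∀ B l → 2 + (B + (l * (2 + B) + 1)) ≡ suc l * (2 + B) + 1
  ring = solve-∀

erase : Register → Program Q
erase r = drain r (λ _ → pop r)

erase-run : ∀ r σ → Run O (erase r) σ (λ τ → τ r ≡ [] × Agree r σ τ) (length (σ r) * 3 + 1)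
erase-run r σ = drain-run r (λ w τ → τ r ≡ w × Agree r σ τ) 1 proj₁
  (λ b w τ (eq , ag) → weaken (pop-run r τ) ℕ.≤-refl
     λ υ (eq′ , ag′) → trans eq′ (cong (List.drop 1) eq) , Agree-trans ag ag′)
  (σ r) σ (refl , λ _ _ → refl)

move : Register → Register → Program Q
move r s = drain r (λ b → push b s ⨾ pop r)

move-run : ∀ r s σ → r ≢ s →
           Run O (move r s) σ (λ τ → τ r ≡ [] × τ s ≡ σ r ʳ++ σ s × (∀ q → q ≢ r → q ≢ s → τ q ≡ σ q))
               (length (σ r) * 4 + 1)
move-run r s σ r≢s = weaken (drain-run r Inv 2 proj₁ step (σ r) σ (refl , refl , λ _ _ _ → refl)) ℕ.≤-refl λ _ → id
  where
  Inv : Word → Store → Set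
  Inv w τ = τ r ≡ w × w ʳ++ τ s ≡ σ r ʳ++ σ s × (∀ q → q ≢ r → q ≢ s → τ q ≡ σ q)
  step : ∀ b w τ → Inv (b ∷ w) τ → Run _ (push b s ⨾ pop r) τ (Inv w) 2
  step b w τ (eq , eqs , ag) = push-run b s τ andThen λ υ (e₁ , a₁) →
    weaken (pop-run r υ) ℕ.≤-refl λ ω (e₂ , a₂) →
      trans e₂ (cong (List.drop 1) (trans (a₁ r r≢s) eq)) ,
      trans (cong (w ʳ++_) (trans (a₂ s (r≢s ∘ sym)) e₁)) eqs ,
      λ q q≢r q≢s → trans (a₂ q q≢r) (trans (a₁ q q≢s) (ag q q≢r q≢s))

move₂ : Register → Register → Register → Program Q
move₂ r s s′ = drain r (λ b → push b s ⨾ (push b s′ ⨾ pop r))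

move₂-run : ∀ r s s′ σ → r ≢ s → r ≢ s′ → s ≢ s′ →
            Run O (move₂ r s s′) σ (λ τ → τ r ≡ [] × τ s ≡ σ r ʳ++ σ s × τ s′ ≡ σ r ʳ++ σ s′ ×
                                          (∀ q → q ≢ r → q ≢ s → q ≢ s′ → τ q ≡ σ q))
                (length (σ r) * 5 + 1)
move₂-run r s s′ σ r≢s r≢s′ s≢s′ =
  weaken (drain-run r Inv 3 proj₁ step (σ r) σ (refl , refl , refl , λ _ _ _ _ → refl)) ℕ.≤-refl λ _ → id
  where
  Inv : Word → Store → Set
  Inv w τ = τ r ≡ w × w ʳ++ τ s ≡ σ r ʳ++ σ s × w ʳ++ τ s′ ≡ σ r ʳ++ σ s′ ×
            (∀ q → q ≢ r → q ≢ s → q ≢ s′ → τ q ≡ σ q)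
  step : ∀ b w τ → Inv (b ∷ w) τ → Run _ (push b s ⨾ (push b s′ ⨾ pop r)) τ (Inv w) 3
  step b w τ (eq , eqs , eqs′ , ag) = push-run b s τ andThen λ υ (e₁ , a₁) →
    push-run b s′ υ andThen λ φ (e₂ , a₂) →
    weaken (pop-run r φ) ℕ.≤-refl λ ω (e₃ , a₃) →
      trans e₃ (cong (List.drop 1) (trans (a₂ r r≢s′) (trans (a₁ r r≢s) eq))) ,
      trans (cong (w ʳ++_) (trans (a₃ s (r≢s ∘ sym)) (trans (a₂ s s≢s′) e₁))) eqs ,
      trans (cong (w ʳ++_) (trans (a₃ s′ (r≢s′ ∘ sym)) (trans e₂ (cong (b ∷_) (a₁ s′ (s≢s′ ∘ sym)))))) eqs′ ,
      λ q q≢r q≢s q≢s′ → trans (a₃ q q≢r) (trans (a₂ q q≢s′) (trans (a₁ q q≢s) (ag q q≢r q≢s q≢s′)))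

-- A stack can be read only by emptying it. The contents go to `e` in reverse and from there back to
-- `r` and to `d` at once, which restores the order.
copy : Register → Register → Register → Program Q
copy r d e = move r e ⨾ move₂ e r d

copy-run : ∀ r d e σ → r ≢ d → r ≢ e → d ≢ e → σ d ≡ [] → σ e ≡ [] →
           Run O (copy r d e) σ (λ τ → τ d ≡ σ r × Agree d σ τ)
               (length (σ r) * 4 + 1 + (length (σ r) * 5 + 1))
copy-run {O = O} r d e σ r≢d r≢e d≢e d[] e[] = move-run r e σ r≢e andThen λ τ (r₁ , e₁ , a₁) →
  let τe : τ e ≡ σ r ʳ++ []
      τe = trans e₁ (cong (σ r ʳ++_) e[])
      len : length (τ e) ≡ length (σ r)
      len = trans (cong length τe) (trans (List.length-ʳ++ (σ r)) (ℕ.+-identityʳ _))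
      back : ∀ {x} → x ≡ [] → τ e ʳ++ x ≡ σ r
      back eq = trans (cong₂ _ʳ++_ τe eq) (trans (List.ʳ++-ʳ++ (σ r)) (List.++-identityʳ (σ r)))
  in weaken (move₂-run e r d τ (r≢e ∘ sym) (d≢e ∘ sym) r≢d)
       (ℕ.≤-reflexive (cong (λ l → l * 5 + 1) len))
       λ υ (e₂ , r₂ , d₂ , a₂) →
         trans d₂ (back (trans (a₁ d (r≢d ∘ sym) d≢e) d[])) ,
         Agree-scratch {e = e} (λ q q≢d q≢e → case q ℕ.≟ r of λ where
             (yes refl) → trans r₂ (back r₁)
             (no q≢r)   → trans (a₂ q q≢e q≢r q≢d) (a₁ q q≢r q≢e))
           (trans e₂ (sym e[]))

-- Since `pop` leaves an empty register empty, this is truncated subtraction on lengths; on a word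
-- it is the move to a given position.
popBoth : Register → Register → Program Q
popBoth r s = drain r (λ _ → pop s ⨾ pop r)

drop-drop : ∀ {A : Set} k (xs : List A) → List.drop k (List.drop 1 xs) ≡ List.drop (suc k) xs
drop-drop zero    xs       = refl
drop-drop (suc k) []       = refl
drop-drop (suc k) (x ∷ xs) = refl

popBoth-run : ∀ r s σ → r ≢ s →
              Run O (popBoth r s) σ (λ τ → τ r ≡ [] × τ s ≡ List.drop (length (σ r)) (σ s) ×
                                           (∀ q → q ≢ r → q ≢ s → τ q ≡ σ q))
                  (length (σ r) * 4 + 1)
popBoth-run r s σ r≢s = weaken (drain-run r Inv 2 proj₁ step (σ r) σ (refl , refl , λ _ _ _ → refl)) ℕ.≤-refl λ _ → id
  where
  Inv : Word → Store → Set
  Inv w τ = τ r ≡ w × List.drop (length w) (τ s) ≡ List.drop (length (σ r)) (σ s) ×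
            (∀ q → q ≢ r → q ≢ s → τ q ≡ σ q)
  step : ∀ b w τ → Inv (b ∷ w) τ → Run _ (pop s ⨾ pop r) τ (Inv w) 2
  step b w τ (eq , eqs , ag) = pop-run s τ andThen λ υ (e₁ , a₁) →
    weaken (pop-run r υ) ℕ.≤-refl λ ω (e₂ , a₂) →
      trans e₂ (cong (List.drop 1) (trans (a₁ r r≢s) eq)) ,
      trans (cong (List.drop (length w)) (trans (a₂ s (r≢s ∘ sym)) e₁))
            (trans (drop-drop (length w) (τ s)) eqs) ,
      λ q q≢r q≢s → trans (a₂ q q≢r) (trans (a₁ q q≢s) (ag q q≢r q≢s))

-- Arithmetic on unary registers.  An environment consists of two input words
-- (registers 0 and 1) and n numbers; register 2 collects output.

Env : ℕ → Set
Env zero    = Word × Word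
Env (suc n) = Env n × ℕ

size : Env n → ℕ
size {zero}  (x , y) = length x + length y
size {suc n} (ρ , i) = size ρ + i

-- The discipline of memory: `d` is the first free register, inputs and variables lie below it, and
-- `Empty≥` makes everything from `d` on available as blank scratch space. A number is the length of
-- its register, whatever the symbols are.
Rep : Vec Register n → Register → Env n → Store → Set
Rep []       d (x , y) σ = 2 < d × σ 0 ≡ x × σ 1 ≡ y
Rep (r ∷ rs) d (ρ , i) σ = Rep rs d ρ σ × 2 < r × r < d × length (σ r) ≡ i

2<d : ∀ (rs : Vec Register n) {d ρ σ} → Rep rs d ρ σ → 2 < d
2<d []       (d> , _)   = d>
2<d (r ∷ rs) (rep , _) = 2<d rs rep

Rep-cong : ∀ (rs : Vec Register n) {d d′ ρ σ τ} → Rep rs d ρ σ → d ≤ d′ →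
           (∀ s → s ≢ 2 → s < d → τ s ≡ σ s) → Rep rs d′ ρ τ
Rep-cong []       (d> , x , y) d≤ eq =
  ℕ.<-≤-trans d> d≤ , trans (eq 0 (λ ()) (ℕ.<-trans (s≤s z≤n) d>)) x ,
  trans (eq 1 (λ ()) (ℕ.<-trans (s≤s (s≤s z≤n)) d>)) y
Rep-cong (r ∷ rs) (rep , r> , r<d , l) d≤ eq =
  Rep-cong rs rep d≤ eq , r> , ℕ.<-≤-trans r<d d≤ ,
  trans (cong length (eq r (λ r≡2 → ℕ.<⇒≢ r> (sym r≡2)) r<d)) l

Empty≥ : Register → Store → Set
Empty≥ d σ = ∀ s → d ≤ s → σ s ≡ []

-- The value is bounded along with the time because numbers are unary: the value of a subexpression
-- is the cost of using it. The program does not depend on the type of oracles, so that the same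
-- code serves in ordinary computations and in the reduction with a query.
record Fun {n} (f : Env n → ℕ) : Set₁ where
  field
    prog  : ∀ {Q} → Vec Register n → Register → Program Q
    val   : Pol
    time  : Pol
    f≤val : ∀ ρ → f ρ ≤ ev val (size ρ)
    run   : ∀ {Q} {O : Oracle Q} rs d ρ σ → Rep rs d ρ σ → Empty≥ d σ →
            Run O (prog rs d) σ (λ τ → length (τ d) ≡ f ρ × Agree d σ τ) (ev time (size ρ))

open Fun

-- Words are only appended to, never read again, so one output register suffices and concatenation
-- is sequencing of programs.
record Gen {n} (g : Env n → Word) : Set₁ where
  field
    prog : ∀ {Q} → Vec Register n → Register → Program Q
    len  : Pol
    time : Pol
    ≤len : ∀ ρ → length (g ρ) ≤ ev len (size ρ)
    run  : ∀ {Q} {O : Oracle Q} rs d ρ σ → Rep rs d ρ σ → Empty≥ d σ →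
           Run O (prog rs d) σ (λ τ → τ 2 ≡ g ρ ʳ++ σ 2 × Agree 2 σ τ) (ev time (size ρ))

bit : Bool → ℕ
bit b = if b then 1 else 0

BFun : (Env n → Bool) → Set₁
BFun b = Fun (λ ρ → bit (b ρ))

ext : ∀ {f g : Env n → ℕ} → (∀ ρ → f ρ ≡ g ρ) → Fun f → Fun g
ext eq F .prog = prog F
ext eq F .val = val F
ext eq F .time = time F
ext eq F .f≤val ρ = subst (_≤ _) (eq ρ) (f≤val F ρ)
ext eq F .run rs d ρ σ rep emp = weaken (run F rs d ρ σ rep emp) ℕ.≤-refl
  λ τ (l , ag) → trans l (eq ρ) , ag

Empty-suc : ∀ {d σ τ} → Empty≥ d σ → Agree d σ τ → Empty≥ (suc d) τ
Empty-suc emp ag s d<s = trans (ag s (λ s≡d → ℕ.<⇒≢ d<s (sym s≡d))) (emp s (ℕ.<⇒≤ d<s))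

Rep-suc : ∀ (rs : Vec Register n) {d ρ σ τ} → Rep rs d ρ σ → Agree d σ τ → Rep rs (suc d) ρ τ
Rep-suc rs rep ag = Rep-cong rs rep (ℕ.n≤1+n _) (λ s _ s<d → ag s (ℕ.<⇒≢ s<d))

sd≢d : ∀ {d} → suc d ≢ d
sd≢d = ℕ.1+n≢n

d≢sd : ∀ {d} → d ≢ suc d
d≢sd = ℕ.1+n≢n ∘ sym

pushes : ℕ → Register → Program Q
pushes zero    d = skip
pushes (suc c) d = pushes c d ⨾ push true d

pushes-run : ∀ c d σ → σ d ≡ [] → Run O (pushes c d) σ (λ τ → length (τ d) ≡ c × Agree d σ τ) (suc c)
pushes-run zero    d σ d[] = skip-run _ (cong length d[] , λ _ _ → refl)
pushes-run (suc c) d σ d[] = weaken (pushes-run c d σ d[] andThen λ τ (l , ag) →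
    weaken (push-run true d τ) ℕ.≤-refl
      λ υ (e , ag′) → trans (cong length e) (cong suc l) , Agree-trans ag ag′)
  (ℕ.≤-reflexive (ℕ.+-comm (suc c) 1)) (λ _ → id)

litᶜ : ∀ c → Fun {n} (λ _ → c)
litᶜ c .prog rs d = pushes c d
litᶜ c .val = con c
litᶜ c .time = con (suc c)
litᶜ c .f≤val ρ = ℕ.≤-refl
litᶜ c .run rs d ρ σ rep emp = pushes-run c d σ (emp d ℕ.≤-refl)

copyTime : Pol
copyTime = var ⊠ con 4 ⊞ con 1 ⊞ (var ⊠ con 5 ⊞ con 1)

copyᶜ-run : ∀ (rs : Vec Register n) r d ρ σ → Rep rs d ρ σ → Empty≥ d σ → r < d → length (σ r) ≤ size ρ →
            Run O (copy r d (suc d)) σ (λ τ → τ d ≡ σ r × Agree d σ τ) (ev copyTime (size ρ))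
copyᶜ-run rs r d ρ σ rep emp r<d len = weaken
  (copy-run r d (suc d) σ (ℕ.<⇒≢ r<d) (ℕ.<⇒≢ (ℕ.m<n⇒m<1+n r<d)) d≢sd (emp d ℕ.≤-refl) (emp (suc d) (ℕ.n≤1+n d)))
  (ev-mono copyTime len) (λ _ → id)

get : Fin n → Env n → ℕ
get zero    (ρ , i) = i
get (suc k) (ρ , i) = get k ρ

get≤size : ∀ (k : Fin n) ρ → get k ρ ≤ size ρ
get≤size zero    (ρ , i) = ℕ.m≤n+m i _
get≤size (suc k) (ρ , i) = ℕ.≤-trans (get≤size k ρ) (ℕ.m≤m+n _ i)

Rep-lookup : ∀ (rs : Vec Register n) k {d ρ σ} → Rep rs d ρ σ →
             lookup rs k < d × 2 < lookup rs k × length (σ (lookup rs k)) ≡ get k ρ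
Rep-lookup (r ∷ rs) zero    (rep , r> , r<d , l) = r<d , r> , l
Rep-lookup (r ∷ rs) (suc k) (rep , _) = Rep-lookup rs k rep

varᶜ : (k : Fin n) → Fun (get k)
varᶜ k .prog rs d = copy (lookup rs k) d (suc d)
varᶜ k .val = var
varᶜ k .time = copyTime
varᶜ k .f≤val = get≤size k
varᶜ k .run rs d ρ σ rep emp with Rep-lookup rs k rep
... | r<d , _ , l = weaken
  (copyᶜ-run rs _ d ρ σ rep emp r<d (ℕ.≤-trans (ℕ.≤-reflexive l) (get≤size k ρ))) ℕ.≤-refl
  λ τ (e , ag) → trans (cong length e) l , ag

inputs : Env n → Word × Word
inputs {zero}  ρ = ρ
inputs {suc n} ρ = inputs (proj₁ ρ)

inputs≤size : (ρ : Env n) → length (proj₁ (inputs ρ)) + length (proj₂ (inputs ρ)) ≤ size ρ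
inputs≤size {zero}  ρ       = ℕ.≤-refl
inputs≤size {suc n} (ρ , i) = ℕ.≤-trans (inputs≤size ρ) (ℕ.m≤m+n _ i)

Rep-inputs : ∀ (rs : Vec Register n) {d ρ σ} → Rep rs d ρ σ →
             σ 0 ≡ proj₁ (inputs ρ) × σ 1 ≡ proj₂ (inputs ρ)
Rep-inputs []       (_ , x , y) = x , y
Rep-inputs (r ∷ rs) (rep , _)   = Rep-inputs rs rep

data Source : Set where
  first second : Source

word : Source → Env n → Word
word first  ρ = proj₁ (inputs ρ)
word second ρ = proj₂ (inputs ρ)

register : Source → Register
register first  = 0
register second = 1

Rep-word : ∀ w (rs : Vec Register n) {d ρ σ} → Rep rs d ρ σ →
           register w < d × σ (register w) ≡ word w ρ × length (word w ρ) ≤ size ρ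
Rep-word first  rs {ρ = ρ} rep = ℕ.<-trans (s≤s z≤n) (2<d rs rep) , proj₁ (Rep-inputs rs rep) ,
  ℕ.≤-trans (ℕ.m≤m+n _ _) (inputs≤size ρ)
Rep-word second rs {ρ = ρ} rep = ℕ.<-trans (s≤s (s≤s z≤n)) (2<d rs rep) , proj₂ (Rep-inputs rs rep) ,
  ℕ.≤-trans (ℕ.m≤n+m _ _) (inputs≤size ρ)

word≤size : ∀ w (ρ : Env n) → length (word w ρ) ≤ size ρ
word≤size first  ρ = ℕ.≤-trans (ℕ.m≤m+n _ _) (inputs≤size ρ)
word≤size second ρ = ℕ.≤-trans (ℕ.m≤n+m _ _) (inputs≤size ρ)

lenᶜ : ∀ w → Fun {n} (λ ρ → length (word w ρ))
lenᶜ w .prog rs d = copy (register w) d (suc d)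
lenᶜ w .val = var
lenᶜ w .time = copyTime
lenᶜ w .f≤val = word≤size w
lenᶜ w .run rs d ρ σ rep emp with Rep-word w rs rep
... | r<d , e , l = weaken
  (copyᶜ-run rs _ d ρ σ rep emp r<d (ℕ.≤-trans (ℕ.≤-reflexive (cong length e)) l)) ℕ.≤-refl
  λ τ (e′ , ag) → cong length (trans e′ e) , ag

wkᶜ : ∀ {f : Env n → ℕ} → Fun f → Fun {suc n} (f ∘ proj₁)
wkᶜ F .prog (r ∷ rs) d = prog F rs d
wkᶜ F .val = val F
wkᶜ F .time = time F
wkᶜ F .f≤val (ρ , i) = ℕ.≤-trans (f≤val F ρ) (ev-mono (val F) (ℕ.m≤m+n _ i))
wkᶜ F .run (r ∷ rs) d (ρ , i) σ (rep , _) emp = weaken (run F rs d ρ σ rep emp)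
  (ev-mono (time F) (ℕ.m≤m+n _ i)) (λ _ → id)

both-run : ∀ {f g : Env n → ℕ} (F : Fun f) (G : Fun g) rs d ρ σ → Rep rs d ρ σ → Empty≥ d σ →
           Run O (prog F rs d ⨾ prog G rs (suc d)) σ
               (λ τ → length (τ d) ≡ f ρ × length (τ (suc d)) ≡ g ρ ×
                      (∀ s → s ≢ d → s ≢ suc d → τ s ≡ σ s))
               (ev (time F ⊞ time G) (size ρ))
both-run F G rs d ρ σ rep emp = run F rs d ρ σ rep emp andThen λ τ (l , ag) →
  weaken (run G rs (suc d) ρ τ (Rep-suc rs rep ag) (Empty-suc emp ag)) ℕ.≤-refl
  λ υ (l′ , ag′) → trans (cong length (ag′ d d≢sd)) l , l′ ,
    λ s s≢d s≢sd → trans (ag′ s s≢sd) (ag s s≢d)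

infixl 6 _⊕ᶜ_ _⊖ᶜ_

_⊕ᶜ_ : ∀ {f g : Env n → ℕ} → Fun f → Fun g → Fun (λ ρ → f ρ + g ρ)
(F ⊕ᶜ G) .prog rs d = (prog F rs d ⨾ prog G rs (suc d)) ⨾ move (suc d) d
(F ⊕ᶜ G) .val = val F ⊞ val G
(F ⊕ᶜ G) .time = time F ⊞ time G ⊞ (val G ⊠ con 4 ⊞ con 1)
(F ⊕ᶜ G) .f≤val ρ = ℕ.+-mono-≤ (f≤val F ρ) (f≤val G ρ)
_⊕ᶜ_ {f = f} {g} F G .run rs d ρ σ rep emp = both-run F G rs d ρ σ rep emp andThen λ τ (l , l′ , ag) →
  weaken (move-run (suc d) d τ sd≢d)
    (ℕ.+-monoˡ-≤ 1 (ℕ.*-monoˡ-≤ 4 (ℕ.≤-trans (ℕ.≤-reflexive l′) (f≤val G ρ))))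
    λ υ (e , e′ , ag′) →
      trans (cong length e′) (trans (List.length-ʳ++ (τ (suc d)))
        (trans (cong₂ _+_ l′ l) (ℕ.+-comm (g ρ) (f ρ)))) ,
      Agree-scratch {e = suc d} (λ s s≢d s≢sd → trans (ag′ s s≢sd s≢d) (ag s s≢d s≢sd))
        (trans e (sym (emp (suc d) (ℕ.n≤1+n d))))

_⊖ᶜ_ : ∀ {f g : Env n → ℕ} → Fun f → Fun g → Fun (λ ρ → f ρ ∸ g ρ)
(F ⊖ᶜ G) .prog rs d = (prog F rs d ⨾ prog G rs (suc d)) ⨾ popBoth (suc d) d
(F ⊖ᶜ G) .val = val F
(F ⊖ᶜ G) .time = time F ⊞ time G ⊞ (val G ⊠ con 4 ⊞ con 1)
_⊖ᶜ_ {g = g} F G .f≤val ρ = ℕ.≤-trans (ℕ.m∸n≤m _ (g ρ)) (f≤val F ρ)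
(F ⊖ᶜ G) .run rs d ρ σ rep emp = both-run F G rs d ρ σ rep emp andThen λ τ (l , l′ , ag) →
  weaken (popBoth-run (suc d) d τ sd≢d)
    (ℕ.+-monoˡ-≤ 1 (ℕ.*-monoˡ-≤ 4 (ℕ.≤-trans (ℕ.≤-reflexive l′) (f≤val G ρ))))
    λ υ (e , e′ , ag′) →
      trans (cong length e′) (trans (List.length-drop (length (τ (suc d))) (τ d)) (cong₂ _∸_ l l′)) ,
      Agree-scratch {e = suc d} (λ s s≢d s≢sd → trans (ag′ s s≢sd s≢d) (ag s s≢d s≢sd))
        (trans e (sym (emp (suc d) (ℕ.n≤1+n d))))

-- Out-of-range positions read as false.
bitAt : Word → ℕ → Bool
bitAt []      k       = false
bitAt (b ∷ w) zero    = b
bitAt (b ∷ w) (suc k) = bitAt w k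

bitAt-drop : ∀ k w → bitAt w k ≡ bitAt (List.drop k w) 0
bitAt-drop zero    w       = refl
bitAt-drop (suc k) []      = refl
bitAt-drop (suc k) (b ∷ w) = bitAt-drop k w

-- At this point `d` holds the suffix of the word from position `k`. Its top symbol is turned into a
-- register of length 0 or 1; an exhausted suffix counts as false.
normalise : ∀ x k N d σ φ → length x ≤ N → σ (suc d) ≡ [] → φ d ≡ List.drop k x → φ (suc d) ≡ [] →
            (∀ s → s ≢ d → s ≢ suc d → φ s ≡ σ s) →
            Run O (branch d skip (erase d) (erase d ⨾ push true d)) φ
                (λ τ → length (τ d) ≡ bit (bitAt x k) × Agree d σ τ) (1 + (N * 3 + 1 + 1))
normalise {O = O} x k N d σ φ len empty φd φsd ag₀ = branch-run d φ
    (λ eq → weaken (skip-run (λ τ → length (τ d) ≡ bit (bitAt x k) × Agree d σ τ)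
                     (trans (cong length eq) (sym (value false (cong (λ v → bitAt v 0) eq))) , frame (λ _ _ → refl)))
                   (ℕ.m≤n+m 1 (N * 3 + 1)) (λ _ → id))
    (λ v eq → weaken (erase-run d φ) (ℕ.≤-trans small (ℕ.m≤m+n (N * 3 + 1) 1))
       λ ω (eω , aω) → trans (cong length eω) (sym (value false (cong (λ v → bitAt v 0) eq))) , frame aω)
    (λ v eq → weaken (erase-run d φ) small (λ _ → id) andThen λ ω (eω , aω) →
       weaken (push-run true d ω) ℕ.≤-refl λ χ (eχ , aχ) →
         trans (cong length eχ) (trans (cong (suc ∘ length) eω) (sym (value true (cong (λ v → bitAt v 0) eq)))) ,
         frame (λ s s≢d → trans (aχ s s≢d) (aω s s≢d)))
  where
  small : length (φ d) * 3 + 1 ≤ N * 3 + 1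
  small = ℕ.+-monoˡ-≤ 1 (ℕ.*-monoˡ-≤ 3 (ℕ.≤-trans (ℕ.≤-reflexive (trans (cong length φd)
    (List.length-drop k x))) (ℕ.≤-trans (ℕ.m∸n≤m (length x) k) len)))
  value : ∀ b → bitAt (φ d) 0 ≡ b → bit (bitAt x k) ≡ bit b
  value b eq = cong bit (trans (bitAt-drop k x) (trans (cong (λ v → bitAt v 0) (sym φd)) eq))
  frame : ∀ {ω} → (∀ s → s ≢ d → ω s ≡ φ s) → Agree d σ ω
  frame ag = Agree-scratch {e = suc d}
    (λ s s≢d s≢sd → trans (ag s s≢d) (ag₀ s s≢d s≢sd))
    (trans (ag (suc d) sd≢d) (trans φsd (sym empty)))

bitᶜ : ∀ w {f : Env n → ℕ} → Fun f → BFun (λ ρ → bitAt (word w ρ) (f ρ))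
bitᶜ w F .prog rs d =
  copy (register w) d (suc d) ⨾ (prog F rs (suc d) ⨾ (popBoth (suc d) d ⨾
  branch d skip (erase d) (erase d ⨾ push true d)))
bitᶜ w F .val = con 1
bitᶜ w F .time = copyTime ⊞ (time F ⊞ (val F ⊠ con 4 ⊞ con 1 ⊞ (con 1 ⊞ (var ⊠ con 3 ⊞ con 1 ⊞ con 1))))
bitᶜ w {f} F .f≤val ρ with bitAt (word w ρ) (f ρ)
... | false = z≤n
... | true  = ℕ.≤-refl
bitᶜ w {f} F .run {O = O} rs d ρ σ rep emp =
  copyᶜ-run rs (register w) d ρ σ rep emp r<d (ℕ.≤-trans (ℕ.≤-reflexive (cong length e)) len) andThen λ τ (e₁ , a₁) →
  run F rs (suc d) ρ τ (Rep-suc rs rep a₁) (Empty-suc emp a₁) andThen λ υ (l₂ , a₂) →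
  weaken (popBoth-run (suc d) d υ sd≢d)
    (ℕ.+-monoˡ-≤ 1 (ℕ.*-monoˡ-≤ 4 (ℕ.≤-trans (ℕ.≤-reflexive l₂) (f≤val F ρ)))) (λ _ → id) andThen λ φ (s₃ , e₃ , a₃) →
  normalise (word w ρ) (f ρ) (size ρ) d σ φ len (emp (suc d) (ℕ.n≤1+n d))
    (trans e₃ (cong₂ List.drop l₂ (trans (a₂ d d≢sd) (trans e₁ e)))) s₃
    (λ s s≢d s≢sd → trans (a₃ s s≢sd s≢d) (trans (a₂ s s≢sd) (a₁ s s≢d)))
  where
  r<d : register w < d
  r<d = proj₁ (Rep-word w rs rep)
  e : σ (register w) ≡ word w ρ
  e = proj₁ (proj₂ (Rep-word w rs rep))
  len : length (word w ρ) ≤ size ρ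
  len = proj₂ (proj₂ (Rep-word w rs rep))

-- Splitting off the last summand makes the partial sum after `i` iterations an instance of the same
-- function, which is the loop invariant of `sumᶜ`. The recursion of `loop`, `anyN` and `allN`
-- follows the same pattern.
sumN : ℕ → (ℕ → ℕ) → ℕ
sumN zero    f = 0
sumN (suc n) f = sumN n f + f n

sumN-cong : ∀ n {f g : ℕ → ℕ} → (∀ i → i < n → f i ≡ g i) → sumN n f ≡ sumN n g
sumN-cong zero    eq = refl
sumN-cong (suc n) eq = cong₂ _+_ (sumN-cong n (λ i i<n → eq i (ℕ.m<n⇒m<1+n i<n))) (eq n ℕ.≤-refl)

sumN-≤ : ∀ n {f : ℕ → ℕ} {B} → (∀ i → i < n → f i ≤ B) → sumN n f ≤ n * B
sumN-≤ zero    f≤B = z≤n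
sumN-≤ (suc n) {f} {B} f≤B = ℕ.≤-trans
  (ℕ.+-mono-≤ (sumN-≤ n (λ i i<n → f≤B i (ℕ.m<n⇒m<1+n i<n))) (f≤B n ℕ.≤-refl)) (ℕ.≤-reflexive (ℕ.+-comm (n * B) B))

loop : ∀ {A : Set} → ℕ → (ℕ → List A) → List A
loop zero    h = []
loop (suc n) h = loop n h ++ h n

loop-length : ∀ n {h : ℕ → Word} {B} → (∀ i → i < n → length (h i) ≤ B) → length (loop n h) ≤ n * B
loop-length zero    h≤ = z≤n
loop-length (suc n) {h} {B} h≤ = ℕ.≤-trans (ℕ.≤-reflexive (List.length-++ (loop n h)))
  (ℕ.≤-trans (ℕ.+-mono-≤ (loop-length n (λ i i<n → h≤ i (ℕ.m<n⇒m<1+n i<n))) (h≤ n ℕ.≤-refl))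
             (ℕ.≤-reflexive (ℕ.+-comm (n * B) B)))

-- The index of a loop is smaller than the number of iterations, so the environment of the body
-- grows only polynomially. The bounds of the body are composed with this expression, and this is
-- what nesting of loops costs.
size-inner : ∀ {f : Env n → ℕ} (F : Fun f) ρ i → i < f ρ → size {suc n} (ρ , i) ≤ ev (var ⊞ Fun.val F) (size ρ)
size-inner F ρ i i<f = ℕ.+-monoʳ-≤ (size ρ) (ℕ.≤-trans (ℕ.<⇒≤ i<f) (Fun.f≤val F ρ))

-- Registers d, d + 1 hold the iterations left to do and the iterations done.
module Loop {n} {f : Env n → ℕ} (F : Fun f) (rs : Vec Register n) (d : Register) (ρ : Env n) where

  Counted : Word → Store → Set
  Counted w τ = τ d ≡ w × length (τ (suc d)) + length w ≡ f ρ

  module Inside {b w τ} (counted : Counted (b ∷ w) τ) where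
    i : ℕ
    i = length (τ (suc d))

    i<f : i < f ρ
    i<f = ℕ.≤-trans (ℕ.≤-trans (s≤s (ℕ.m≤m+n i (length w))) (ℕ.≤-reflexive (sym (ℕ.+-suc i _))))
                    (ℕ.≤-reflexive (proj₂ counted))

    next : ∀ υ → υ d ≡ w → length (υ (suc d)) ≡ suc i → Counted w υ
    next υ e l = e , trans (cong (_+ length w) l) (trans (sym (ℕ.+-suc i _)) (proj₂ counted))

  start : ∀ {τ} → length (τ d) ≡ f ρ → τ (suc d) ≡ [] → Counted (τ d) τ
  start l e = refl , cong₂ _+_ (cong length e) l

  finish : ∀ τ → Counted [] τ → length (τ (suc d)) ≡ f ρ
  finish τ (_ , l) = trans (sym (ℕ.+-identityʳ _)) l

  bump : ∀ {τ w b} (P : Store → Set) → τ d ≡ b ∷ w →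
         (∀ υ → υ d ≡ w → length (υ (suc d)) ≡ suc (length (τ (suc d))) →
            (∀ s → s ≢ d → s ≢ suc d → υ s ≡ τ s) → P υ) →
         Run O (push true (suc d) ⨾ pop d) τ P 2
  bump {τ = τ} P eq k = push-run true (suc d) τ andThen λ υ (e , ag) →
    weaken (pop-run d υ) ℕ.≤-refl λ φ (e′ , ag′) →
      k φ (trans e′ (cong (List.drop 1) (trans (ag d d≢sd) eq)))
        (trans (cong length (ag′ (suc d) sd≢d)) (cong length e))
        (λ s s≢d s≢sd → trans (ag′ s s≢d) (ag s s≢sd))

scratch : ∀ {P : Register → Set} e {σ τ : Store} → τ e ≡ σ e →
          (∀ s → P s → s ≢ e → τ s ≡ σ s) → ∀ s → P s → τ s ≡ σ s
scratch e eq f s ps with s ℕ.≟ e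
... | yes refl = eq
... | no s≢e   = f s ps s≢e

2+ : ∀ d {s} → s < d → s ≢ suc (suc d)
2+ d s<d = ℕ.<⇒≢ (ℕ.m<n⇒m<1+n (ℕ.m<n⇒m<1+n s<d))

sumᶜ : ∀ {f : Env n → ℕ} {g : Env (suc n) → ℕ} → Fun f → Fun g →
       Fun (λ ρ → sumN (f ρ) (λ i → g (ρ , i)))
sumᶜ {n} {f} {g} F G = record
  { prog  = λ rs d → sumProg rs d
  ; val   = Fun.val F ⊠ (Fun.val G ⊚ V)
  ; time  = Fun.time F ⊞ ((Fun.val F ⊠ (con 2 ⊞ body) ⊞ con 1) ⊞ ((Fun.val F ⊠ con 3 ⊞ con 1) ⊞ (total ⊠ con 4 ⊞ con 1)))
  ; f≤val = bounded
  ; run   = λ rs d ρ σ rep emp → sum-run rs d ρ σ rep emp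
  }
  where
  V body total : Pol
  V = var ⊞ Fun.val F
  body = (Fun.time G ⊚ V) ⊞ ((Fun.val G ⊚ V ⊠ con 4 ⊞ con 1) ⊞ con 2)
  total = Fun.val F ⊠ (Fun.val G ⊚ V)
  value : Env n → ℕ
  value ρ = sumN (f ρ) (λ i → g (ρ , i))
  bounded : ∀ ρ → value ρ ≤ ev total (size ρ)
  bounded ρ = ℕ.≤-trans
    (sumN-≤ (f ρ) (λ i i<f → ℕ.≤-trans (Fun.f≤val G (ρ , i)) (ev-mono (Fun.val G) (size-inner F ρ i i<f))))
    (ℕ.*-monoˡ-≤ _ (Fun.f≤val F ρ))
  -- The registers are: d iterations left, d + 1 index, d + 2 sum, d + 3 summand.
  step : Vec Register n → Register → Program Q
  step rs d = Fun.prog G (suc d ∷ rs) (3 + d) ⨾ (move (3 + d) (2 + d) ⨾ (push true (suc d) ⨾ pop d))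
  sumProg : Vec Register n → Register → Program Q
  sumProg rs d = Fun.prog F rs d ⨾ (drain d (λ _ → step rs d) ⨾ (erase (suc d) ⨾ move (2 + d) d))
  module _ {Q} {O : Oracle Q} (rs : Vec Register n) (d : Register) (ρ : Env n) (σ : Store)
           (rep : Rep rs d ρ σ) (emp : Empty≥ d σ) where
    open Loop F rs d ρ
    Inv : Word → Store → Set
    Inv w τ = Counted w τ × length (τ (2 + d)) ≡ sumN (length (τ (suc d))) (λ i → g (ρ , i)) ×
              (∀ s → s ≢ d → s ≢ suc d → s ≢ 2 + d → τ s ≡ σ s)
    Outside : Register → Set
    Outside s = s ≢ d × s ≢ suc d × s ≢ 2 + d
    stepBound : ℕ
    stepBound = ev body (size ρ)
    inv-step : ∀ b w τ → Inv (b ∷ w) τ → Run O (step rs d) τ (Inv w) stepBound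
    inv-step b w τ (counted , acc , ag) =
      weaken (Fun.run G (suc d ∷ rs) (3 + d) (ρ , i) τ
               (Rep-cong rs rep (ℕ.m≤n+m d 3) (λ s s≢2 s<d →
                  ag s (ℕ.<⇒≢ s<d) (ℕ.<⇒≢ (ℕ.m<n⇒m<1+n s<d)) (2+ d s<d)) ,
                ℕ.m<n⇒m<1+n (2<d rs rep) , s≤s (ℕ.m≤n+m (suc d) 1) , refl)
               (λ s d≤s → trans (ag s (λ { refl → ℕ.<⇒≱ d≤s (ℕ.m≤n+m s 2) })
                                      (λ { refl → ℕ.<⇒≱ d≤s (ℕ.m≤n+m s 1) })
                                      (λ { refl → ℕ.<⇒≱ d≤s ℕ.≤-refl }))
                                (emp s (ℕ.≤-trans (ℕ.m≤n+m d 3) d≤s))))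
             (ev-mono (Fun.time G) inner) (λ _ → id) andThen λ υ (l₁ , a₁) →
      weaken (move-run (3 + d) (2 + d) υ sd≢d)
             (ℕ.+-monoˡ-≤ 1 (ℕ.*-monoˡ-≤ 4 (ℕ.≤-trans (ℕ.≤-reflexive l₁)
               (ℕ.≤-trans (Fun.f≤val G (ρ , i)) (ev-mono (Fun.val G) inner))))) (λ _ → id) andThen λ φ (e₂ , e₂′ , a₂) →
      bump (Inv w) (trans (a₂ d (ℕ.<⇒≢ (ℕ.m≤n+m (suc d) 2)) (ℕ.<⇒≢ (ℕ.m≤n+m (suc d) 1)))
                     (trans (a₁ d (ℕ.<⇒≢ (ℕ.m≤n+m (suc d) 2))) (proj₁ counted)))
        λ ω e₃ l₃ a₃ →
          let l₃′ : length (ω (suc d)) ≡ suc i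
              l₃′ = trans l₃ (cong (suc ∘ length) (trans (a₂ (suc d) (ℕ.<⇒≢ (s≤s (ℕ.m≤n+m (suc d) 1))) (d≢sd {suc d}))
                       (a₁ (suc d) (ℕ.<⇒≢ (s≤s (ℕ.m≤n+m (suc d) 1))))))
          in next ω e₃ l₃′ ,
             trans (cong length (trans (a₃ (2 + d) (λ ()) sd≢d) e₂′))
               (trans (List.length-ʳ++ (υ (3 + d))) (trans (cong₂ _+_ l₁ (trans (cong length (a₁ (2 + d) d≢sd)) acc))
               (trans (ℕ.+-comm (g (ρ , i)) _) (cong (λ k → sumN k (λ i → g (ρ , i))) (sym l₃′))))) ,
             λ s s≢d s≢1 s≢2 → trans (a₃ s s≢d s≢1) (scratch {P = Outside} (3 + d) {σ} {φ}
               (trans e₂ (sym (emp (3 + d) (ℕ.m≤n+m d 3))))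
               (λ s (s≢d , s≢1 , s≢2) s≢3 → trans (a₂ s s≢3 s≢2) (trans (a₁ s s≢3) (ag s s≢d s≢1 s≢2)))
               s (s≢d , s≢1 , s≢2))
      where
      open Inside {b} {w} {τ} counted
      inner : size {suc n} (ρ , i) ≤ ev V (size ρ)
      inner = size-inner F ρ i i<f
    sum-run : Run O (sumProg rs d) σ (λ τ → length (τ d) ≡ value ρ × Agree d σ τ) _
    sum-run = Fun.run F rs d ρ σ rep emp andThen λ τ (l₁ , a₁) →
      weaken (drain-run d Inv stepBound (proj₁ ∘ proj₁) inv-step (τ d) τ
                (start {τ} l₁ (trans (a₁ (suc d) sd≢d) (emp (suc d) (ℕ.n≤1+n d))) ,
                 trans (cong length (trans (a₁ (2 + d) (λ ())) (emp (2 + d) (ℕ.m≤n+m d 2))))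
                       (cong (λ v → sumN (length v) (λ i → g (ρ , i))) (sym (trans (a₁ (suc d) sd≢d) (emp (suc d) (ℕ.n≤1+n d))))) ,
                 λ s s≢d _ _ → a₁ s s≢d))
             (ℕ.+-monoˡ-≤ 1 (ℕ.*-monoˡ-≤ (2 + stepBound) (ℕ.≤-trans (ℕ.≤-reflexive l₁) (Fun.f≤val F ρ))))
             (λ _ → id) andThen λ υ (counted , acc , a₂) →
      weaken (erase-run (suc d) υ)
             (ℕ.+-monoˡ-≤ 1 (ℕ.*-monoˡ-≤ 3 (ℕ.≤-trans (ℕ.≤-reflexive (finish υ counted)) (Fun.f≤val F ρ)))) (λ _ → id)
        andThen λ φ (e₃ , a₃) →
      let l₃ : length (φ (2 + d)) ≡ value ρ
          l₃ = trans (cong length (a₃ (2 + d) sd≢d)) (trans acc (cong (λ k → sumN k (λ i → g (ρ , i))) (finish υ counted)))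
      in weaken (move-run (2 + d) d φ (λ ()))
           (ℕ.+-monoˡ-≤ 1 (ℕ.*-monoˡ-≤ 4 (ℕ.≤-trans (ℕ.≤-reflexive l₃) (bounded ρ))))
           λ ω (e₄ , e₄′ , a₄) →
             trans (cong length e₄′) (trans (List.length-ʳ++ (φ (2 + d)))
               (trans (cong₂ _+_ l₃ (cong length (trans (a₃ d d≢sd) (proj₁ counted)))) (ℕ.+-identityʳ _))) ,
             scratch (2 + d) (trans e₄ (sym (emp (2 + d) (ℕ.m≤n+m d 2)))) λ s s≢d s≢2 → trans (a₄ s s≢2 s≢d)
               (scratch {P = λ s → s ≢ d × s ≢ 2 + d} (suc d) {σ} {φ} (trans e₃ (sym (emp (suc d) (ℕ.n≤1+n d))))
                 (λ s (s≢d , s≢2) s≢1 → trans (a₃ s s≢1) (a₂ s s≢d s≢1 s≢2)) s (s≢d , s≢2))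

-- Output accumulates in reverse on register 2.

emitᶜ : ∀ {b : Env n → Bool} → BFun b → Gen (λ ρ → b ρ ∷ [])
emitᶜ {n} {b} F = record
  { prog = λ rs d → emit rs d
  ; len  = con 1
  ; ≤len = λ ρ → ℕ.≤-refl
  ; time = Fun.time F ⊞ (con 2 ⊞ (Fun.val F ⊠ con 3 ⊞ con 1))
  ; run  = λ rs d ρ σ rep emp → emit-run rs d ρ σ rep emp
  }
  where
  emit : Vec Register n → Register → Program Q
  -- A truth value is the length of a register, so any top symbol means true.
  emit rs d = Fun.prog F rs d ⨾ (branch d (push false 2) (push true 2) (push true 2) ⨾ erase d)
  module _ {Q} {O : Oracle Q} (rs : Vec Register n) (d : Register) (ρ : Env n) (σ : Store)
           (rep : Rep rs d ρ σ) (emp : Empty≥ d σ) where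
    d≢2 : d ≢ 2
    d≢2 d≡2 = ℕ.<⇒≢ (2<d rs rep) (sym d≡2)
    value : ∀ c k → k ≡ bit (b ρ) → (k ≡ 0 × c ≡ false) ⊎ (∃ λ j → k ≡ suc j × c ≡ true) → c ≡ b ρ
    value c k eq h with b ρ | h
    ... | false | inj₁ (_ , c≡) = c≡
    ... | true  | inj₁ (refl , _) = contradiction eq λ ()
    ... | false | inj₂ (_ , refl , _) = contradiction eq λ ()
    ... | true  | inj₂ (_ , _ , c≡) = c≡
    emit-run : Run O (emit rs d) σ (λ τ → τ 2 ≡ b ρ ∷ σ 2 × Agree 2 σ τ) _
    emit-run = Fun.run F rs d ρ σ rep emp andThen λ τ (l₁ , a₁) →
      let put : ∀ c → (length (τ d) ≡ 0 × c ≡ false) ⊎ (∃ λ j → length (τ d) ≡ suc j × c ≡ true) →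
                Run O (push c 2) τ (λ υ → υ 2 ≡ b ρ ∷ σ 2 × Agree 2 τ υ) 1
          put c h = weaken (push-run c 2 τ) ℕ.≤-refl λ υ (e , ag) →
            trans e (cong₂ _∷_ (value c _ l₁ h) (a₁ 2 (d≢2 ∘ sym))) , ag
      in branch-run d τ (λ eq → put false (inj₁ (cong length eq , refl)))
                        (λ w eq → put true (inj₂ (_ , cong length eq , refl)))
                        (λ w eq → put true (inj₂ (_ , cong length eq , refl))) andThen λ υ (e₂ , a₂) →
      weaken (erase-run d υ) (ℕ.+-monoˡ-≤ 1 (ℕ.*-monoˡ-≤ 3
               (ℕ.≤-trans (ℕ.≤-reflexive (trans (cong length (a₂ d d≢2)) l₁)) (Fun.f≤val F ρ))))
        λ φ (e₃ , a₃) → trans (a₃ 2 (d≢2 ∘ sym)) e₂ ,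
          Agree-scratch {e = d} (λ s s≢2 s≢d → trans (a₃ s s≢d) (trans (a₂ s s≢2) (a₁ s s≢d)))
            (trans e₃ (sym (emp d ℕ.≤-refl)))

infixr 5 _++ᶜ_

_++ᶜ_ : ∀ {g h : Env n → Word} → Gen g → Gen h → Gen (λ ρ → g ρ ++ h ρ)
_++ᶜ_ {g = g} {h} G H = record
  { prog = λ rs d → Gen.prog G rs d ⨾ Gen.prog H rs d
  ; len  = Gen.len G ⊞ Gen.len H
  ; ≤len = λ ρ → ℕ.≤-trans (ℕ.≤-reflexive (List.length-++ (g ρ))) (ℕ.+-mono-≤ (Gen.≤len G ρ) (Gen.≤len H ρ))
  ; time = Gen.time G ⊞ Gen.time H
  ; run  = λ rs d ρ σ rep emp → Gen.run G rs d ρ σ rep emp andThen λ τ (e₁ , a₁) →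
      weaken (Gen.run H rs d ρ τ
                (Rep-cong rs rep ℕ.≤-refl (λ s s≢2 _ → a₁ s s≢2))
                (λ s d≤s → trans (a₁ s λ { refl → ℕ.<⇒≱ (2<d rs rep) d≤s }) (emp s d≤s))) ℕ.≤-refl
        λ υ (e₂ , a₂) → trans e₂ (trans (cong (h ρ ʳ++_) e₁) (sym (List.++-ʳ++ (g ρ)))) , Agree-trans a₁ a₂
  }

loopᶜ : ∀ {f : Env n → ℕ} {g : Env (suc n) → Word} → Fun f → Gen g →
        Gen (λ ρ → loop (f ρ) (λ i → g (ρ , i)))
loopᶜ {n} {f} {g} F G = record
  { prog = λ rs d → loopProg rs d
  ; len  = Fun.val F ⊠ (Gen.len G ⊚ V)
  ; ≤len = λ ρ → ℕ.≤-trans (loop-length (f ρ) (λ i i<f →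
               ℕ.≤-trans (Gen.≤len G (ρ , i)) (ev-mono (Gen.len G) (size-inner F ρ i i<f))))
             (ℕ.*-monoˡ-≤ _ (Fun.f≤val F ρ))
  ; time = Fun.time F ⊞ ((Fun.val F ⊠ (con 2 ⊞ body) ⊞ con 1) ⊞ (Fun.val F ⊠ con 3 ⊞ con 1))
  ; run  = λ rs d ρ σ rep emp → loop-run rs d ρ σ rep emp
  }
  where
  V body : Pol
  V = var ⊞ Fun.val F
  body = (Gen.time G ⊚ V) ⊞ con 2
  step : Vec Register n → Register → Program Q
  step rs d = Gen.prog G (suc d ∷ rs) (2 + d) ⨾ (push true (suc d) ⨾ pop d)
  loopProg : Vec Register n → Register → Program Q
  loopProg rs d = Fun.prog F rs d ⨾ (drain d (λ _ → step rs d) ⨾ erase (suc d))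
  module _ {Q} {O : Oracle Q} (rs : Vec Register n) (d : Register) (ρ : Env n) (σ : Store)
           (rep : Rep rs d ρ σ) (emp : Empty≥ d σ) where
    open Loop F rs d ρ
    2<d₀ : 2 < d
    2<d₀ = 2<d rs rep
    2≢ : ∀ {s} → d ≤ s → 2 ≢ s
    2≢ d≤s = ℕ.<⇒≢ (ℕ.<-≤-trans 2<d₀ d≤s)
    Inv : Word → Store → Set
    Inv w τ = Counted w τ × τ 2 ≡ loop (length (τ (suc d))) (λ i → g (ρ , i)) ʳ++ σ 2 ×
              (∀ s → s ≢ d → s ≢ suc d → s ≢ 2 → τ s ≡ σ s)
    stepBound : ℕ
    stepBound = ev body (size ρ)
    inv-step : ∀ b w τ → Inv (b ∷ w) τ → Run O (step rs d) τ (Inv w) stepBound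
    inv-step b w τ (counted , acc , ag) =
      weaken (Gen.run G (suc d ∷ rs) (2 + d) (ρ , i) τ
               (Rep-cong rs rep (ℕ.m≤n+m d 2) (λ s s≢2 s<d →
                  ag s (ℕ.<⇒≢ s<d) (ℕ.<⇒≢ (ℕ.m<n⇒m<1+n s<d)) s≢2) ,
                ℕ.m<n⇒m<1+n 2<d₀ , ℕ.≤-refl , refl)
               (λ s d≤s → trans (ag s (λ { refl → ℕ.<⇒≱ d≤s (ℕ.m≤n+m s 1) })
                                      (λ { refl → ℕ.<⇒≱ d≤s ℕ.≤-refl })
                                      (λ { refl → 2≢ {2 + d} (ℕ.m≤n+m d 2) (ℕ.≤-antisym (ℕ.m≤m+n 2 d) d≤s) }))
                                (emp s (ℕ.≤-trans (ℕ.m≤n+m d 2) d≤s))))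
             (ev-mono (Gen.time G) inner) (λ _ → id) andThen λ υ (e₁ , a₁) →
      bump (Inv w) (trans (a₁ d (2≢ ℕ.≤-refl ∘ sym)) (proj₁ counted))
        λ ω e₃ l₃ a₃ →
          let l₃′ : length (ω (suc d)) ≡ suc i
              l₃′ = trans l₃ (cong (suc ∘ length) (a₁ (suc d) (2≢ (ℕ.n≤1+n d) ∘ sym)))
          in next ω e₃ l₃′ ,
             trans (a₃ 2 (2≢ ℕ.≤-refl) (2≢ (ℕ.n≤1+n d)))
               (trans e₁ (trans (cong (g (ρ , i) ʳ++_) acc)
                 (trans (sym (List.++-ʳ++ (loop i (λ i → g (ρ , i)))))
                   (cong (λ k → loop k (λ i → g (ρ , i)) ʳ++ σ 2) (sym l₃′))))) ,
             λ s s≢d s≢1 s≢2 → trans (a₃ s s≢d s≢1) (trans (a₁ s s≢2) (ag s s≢d s≢1 s≢2))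
      where
      open Inside {b} {w} {τ} counted
      inner : size {suc n} (ρ , i) ≤ ev V (size ρ)
      inner = size-inner F ρ i i<f
    loop-run : Run O (loopProg rs d) σ (λ τ → τ 2 ≡ loop (f ρ) (λ i → g (ρ , i)) ʳ++ σ 2 × Agree 2 σ τ) _
    loop-run = Fun.run F rs d ρ σ rep emp andThen λ τ (l₁ , a₁) →
      weaken (drain-run d Inv stepBound (proj₁ ∘ proj₁) inv-step (τ d) τ
                (start {τ} l₁ (trans (a₁ (suc d) sd≢d) (emp (suc d) (ℕ.n≤1+n d))) ,
                 trans (a₁ 2 (2≢ ℕ.≤-refl))
                       (cong (λ v → loop (length v) (λ i → g (ρ , i)) ʳ++ σ 2)
                             (sym (trans (a₁ (suc d) sd≢d) (emp (suc d) (ℕ.n≤1+n d))))) ,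
                 λ s s≢d _ _ → a₁ s s≢d))
             (ℕ.+-monoˡ-≤ 1 (ℕ.*-monoˡ-≤ (2 + stepBound) (ℕ.≤-trans (ℕ.≤-reflexive l₁) (Fun.f≤val F ρ))))
             (λ _ → id) andThen λ υ (counted , acc , a₂) →
      weaken (erase-run (suc d) υ)
             (ℕ.+-monoˡ-≤ 1 (ℕ.*-monoˡ-≤ 3 (ℕ.≤-trans (ℕ.≤-reflexive (finish υ counted)) (Fun.f≤val F ρ))))
        λ φ (e₃ , a₃) →
          trans (a₃ 2 (2≢ (ℕ.n≤1+n d)))
            (trans acc (cong (λ k → loop k (λ i → g (ρ , i)) ʳ++ σ 2) (finish υ counted))) ,
          scratch d (trans (a₃ d d≢sd) (trans (proj₁ counted) (sym (emp d ℕ.≤-refl)))) λ s s≢2 s≢d →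
            scratch {P = λ s → s ≢ 2 × s ≢ d} (suc d) {σ} {φ} (trans e₃ (sym (emp (suc d) (ℕ.n≤1+n d))))
              (λ s (s≢2 , s≢d) s≢1 → trans (a₃ s s≢1) (a₂ s s≢d s≢1 s≢2)) s (s≢2 , s≢d)

extGen : ∀ {g h : Env n → Word} → (∀ ρ → g ρ ≡ h ρ) → Gen g → Gen h
extGen eq G = record
  { prog = λ rs d → Gen.prog G rs d
  ; len  = Gen.len G
  ; ≤len = λ ρ → subst (λ w → length w ≤ _) (eq ρ) (Gen.≤len G ρ)
  ; time = Gen.time G
  ; run  = λ rs d ρ σ rep emp → weaken (Gen.run G rs d ρ σ rep emp) ℕ.≤-refl
      λ τ (e , ag) → trans e (cong (_ʳ++ σ 2) (eq ρ)) , ag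
  }

-- Products, truth functions, bounded quantifiers and finite tables

infixl 7 _⊗ᶜ_
infixr 4 _∧ᶜ_
infixr 3 _∨ᶜ_
infix 5 _≡ᶜ_ _<ᶜ_

_⊗ᶜ_ : ∀ {f g : Env n → ℕ} → Fun f → Fun g → Fun (λ ρ → f ρ * g ρ)
_⊗ᶜ_ {f = f} {g} F G = ext (λ ρ → sum-const (f ρ) (g ρ)) (sumᶜ F (wkᶜ G))
  where
  sum-const : ∀ m c → sumN m (λ _ → c) ≡ m * c
  sum-const zero    c = refl
  sum-const (suc m) c = trans (cong (_+ c) (sum-const m c)) (ℕ.+-comm (m * c) c)

boolᶜ : ∀ b → BFun {n} (λ _ → b)
boolᶜ b = litᶜ (bit b)

notᶜ : ∀ {b : Env n → Bool} → BFun b → BFun (λ ρ → not (b ρ))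
notᶜ {b = b} B = ext (λ ρ → table (b ρ)) (litᶜ 1 ⊖ᶜ B)
  where
  table : ∀ b → 1 ∸ bit b ≡ bit (not b)
  table false = refl
  table true  = refl

_∧ᶜ_ : ∀ {a b : Env n → Bool} → BFun a → BFun b → BFun (λ ρ → a ρ ∧ b ρ)
_∧ᶜ_ {a = a} {b} A B = ext (λ ρ → table (a ρ) (b ρ)) (A ⊗ᶜ B)
  where
  table : ∀ a b → bit a * bit b ≡ bit (a ∧ b)
  table false b = refl
  table true  b = ℕ.+-identityʳ (bit b)

_∨ᶜ_ : ∀ {a b : Env n → Bool} → BFun a → BFun b → BFun (λ ρ → a ρ ∨ b ρ)
_∨ᶜ_ {a = a} {b} A B = ext (λ ρ → table (a ρ) (b ρ)) (litᶜ 1 ⊖ᶜ (litᶜ 1 ⊖ᶜ (A ⊕ᶜ B)))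
  where
  table : ∀ a b → 1 ∸ (1 ∸ (bit a + bit b)) ≡ bit (a ∨ b)
  table false false = refl
  table false true  = refl
  table true  false = refl
  table true  true  = refl

_≡ᶜ_ : ∀ {f g : Env n → ℕ} → Fun f → Fun g → BFun (λ ρ → f ρ ≡ᵇ g ρ)
_≡ᶜ_ {f = f} {g} F G = ext (λ ρ → table (f ρ) (g ρ)) (litᶜ 1 ⊖ᶜ ((F ⊖ᶜ G) ⊕ᶜ (G ⊖ᶜ F)))
  where
  table : ∀ a b → 1 ∸ ((a ∸ b) + (b ∸ a)) ≡ bit (a ≡ᵇ b)
  table zero    zero    = refl
  table zero    (suc b) = ℕ.0∸n≡0 b
  table (suc a) zero    = ℕ.0∸n≡0 (a + 0)
  table (suc a) (suc b) = table a b

_<ᶜ_ : ∀ {f g : Env n → ℕ} → Fun f → Fun g → BFun (λ ρ → f ρ <ᵇ g ρ)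
_<ᶜ_ {f = f} {g} F G = ext (λ ρ → table (f ρ) (g ρ)) (litᶜ 1 ⊖ᶜ (litᶜ 1 ⊖ᶜ (G ⊖ᶜ F)))
  where
  table : ∀ a b → 1 ∸ (1 ∸ (b ∸ a)) ≡ bit (a <ᵇ b)
  table zero    zero    = refl
  table zero    (suc b) = cong (1 ∸_) (ℕ.0∸n≡0 b)
  table (suc a) zero    = refl
  table (suc a) (suc b) = table a b

anyN : ℕ → (ℕ → Bool) → Bool
anyN zero    p = false
anyN (suc n) p = anyN n p ∨ p n

allN : ℕ → (ℕ → Bool) → Bool
allN zero    p = true
allN (suc n) p = allN n p ∧ p n

allᶜ : ∀ {f : Env n → ℕ} {p : Env (suc n) → Bool} → Fun f → BFun p →
       BFun (λ ρ → allN (f ρ) (λ i → p (ρ , i)))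
allᶜ {f = f} {p} F P = ext (λ ρ → table (f ρ) _) (litᶜ 1 ⊖ᶜ sumᶜ F (notᶜ P))
  where
  table : ∀ m p → 1 ∸ sumN m (λ i → bit (not (p i))) ≡ bit (allN m p)
  table zero    p = refl
  table (suc m) p = trans (sym (ℕ.∸-+-assoc 1 (sumN m _) _)) (trans (cong (_∸ bit (not (p m))) (table m p)) (and (allN m p) (p m)))
    where
    and : ∀ a b → bit a ∸ bit (not b) ≡ bit (a ∧ b)
    and false false = refl
    and false true  = refl
    and true  false = refl
    and true  true  = refl

not-allN : ∀ m p → not (allN m (not ∘ p)) ≡ anyN m p
not-allN zero    p = refl
not-allN (suc m) p = trans (deMorgan (allN m (not ∘ p)) (p m)) (cong (_∨ p m) (not-allN m p))
  where
  deMorgan : ∀ a b → not (a ∧ not b) ≡ not a ∨ b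
  deMorgan false b     = refl
  deMorgan true  false = refl
  deMorgan true  true  = refl

anyᶜ : ∀ {f : Env n → ℕ} {p : Env (suc n) → Bool} → Fun f → BFun p →
       BFun (λ ρ → anyN (f ρ) (λ i → p (ρ , i)))
anyᶜ {f = f} F P = ext (λ ρ → cong bit (not-allN (f ρ) _)) (notᶜ (allᶜ F (notᶜ P)))

-- This carries a predicate on a finite set that is fixed with the machine, such as its transition
-- rule, into the language of numbers. The set has constant size, so `tableᶜ` can unroll it into a
-- case distinction.
table : ∀ k → (Fin k → Bool) → ℕ → Bool
table zero    F i       = false
table (suc k) F zero    = F zero
table (suc k) F (suc i) = table k (F ∘ suc) i

table-toℕ : ∀ {k} (F : Fin k → Bool) i → table k F (toℕ i) ≡ F i
table-toℕ F zero    = refl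
table-toℕ F (suc i) = table-toℕ (F ∘ suc) i

tableᶜ : ∀ {k} {F : Fin k → Env n → Bool} {f : Env n → ℕ} → (∀ i → BFun (F i)) → Fun f →
         BFun (λ ρ → table k (λ i → F i ρ) (f ρ))
tableᶜ {k = zero}          B N = boolᶜ false
tableᶜ {k = suc k} {F} {f} B N = ext (λ ρ → cong bit (cases (λ i → F i ρ) (f ρ)))
  ((N ≡ᶜ litᶜ 0) ∧ᶜ B zero ∨ᶜ litᶜ 0 <ᶜ N ∧ᶜ tableᶜ (B ∘ suc) (N ⊖ᶜ litᶜ 1))
  where
  cases : ∀ (G : Fin (suc k) → Bool) i →
          (i ≡ᵇ 0) ∧ G zero ∨ (0 <ᵇ i) ∧ table k (G ∘ suc) (i ∸ 1) ≡ table (suc k) G i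
  cases G zero    = Bool.∨-identityʳ (G zero)
  cases G (suc i) = refl

polyᶜ : ∀ p {f : Env n → ℕ} → Fun f → Fun (λ ρ → ⟦ p ⟧ (f ρ))
polyᶜ []      F = litᶜ 0
polyᶜ (c ∷ p) F = litᶜ c ⊕ᶜ F ⊗ᶜ polyᶜ p F

-- From generated words to polynomial time

unaryMove : Register → Register → Program Q
unaryMove r s = drain r (λ _ → push true s ⨾ pop r)

unaryMove-run : ∀ r s σ → r ≢ s → σ s ≡ [] →
                Run O (unaryMove r s) σ (λ τ → τ s ≡ unary (length (σ r)) × (∀ q → q ≢ r → q ≢ s → τ q ≡ σ q))
                    (length (σ r) * 4 + 1)
unaryMove-run r s σ r≢s s[] = weaken (drain-run r Inv 2 proj₁ step (σ r) σ
    (refl , (0 , s[] , ℕ.+-identityʳ _) , λ _ _ _ → refl)) ℕ.≤-refl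
    λ τ (_ , (k , e , l) , ag) → trans e (cong unary l) , ag
  where
  Inv : Word → Store → Set
  Inv w τ = τ r ≡ w × (∃ λ k → τ s ≡ unary k × length w + k ≡ length (σ r)) ×
            (∀ q → q ≢ r → q ≢ s → τ q ≡ σ q)
  step : ∀ b w τ → Inv (b ∷ w) τ → Run _ (push true s ⨾ pop r) τ (Inv w) 2
  step b w τ (eq , (k , eqs , l) , ag) = push-run true s τ andThen λ υ (e₁ , a₁) →
    weaken (pop-run r υ) ℕ.≤-refl λ ω (e₂ , a₂) →
      trans e₂ (cong (List.drop 1) (trans (a₁ r r≢s) eq)) ,
      (suc k , trans (a₂ s (r≢s ∘ sym)) (trans e₁ (cong (true ∷_) eqs)) , trans (ℕ.+-suc (length w) k) l) ,
      λ q q≢r q≢s → trans (a₂ q q≢r) (trans (a₁ q q≢s) (ag q q≢r q≢s))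

-- Results are expected in registers 0 and 1, which still hold the inputs. They are cleared as late
-- as possible, and the move from 2 to 0 undoes the reversal of the accumulated output. The number
-- is rewritten with `true` symbols to match the unary code of a parameter.
module Output {o : Word × Word → Word} {k : Word × Word → ℕ} (G : Gen {0} o) (F : Fun {0} k) where

  outputs : Program Q
  outputs = Gen.prog G [] 3 ⨾ (Fun.prog F [] 3 ⨾ (erase 0 ⨾ (move 2 0 ⨾ (erase 1 ⨾ unaryMove 3 1))))

  outputsTime : Pol
  outputsTime = Gen.time G ⊞ (Fun.time F ⊞ (var ⊠ con 3 ⊞ con 1 ⊞
    (Gen.len G ⊠ con 4 ⊞ con 1 ⊞ (var ⊠ con 3 ⊞ con 1 ⊞ (Fun.val F ⊠ con 4 ⊞ con 1)))))

  outputs-run : ∀ x y σ → σ 0 ≡ x → σ 1 ≡ y → (∀ s → σ (2 + s) ≡ []) →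
                Run O outputs σ (λ τ → τ 0 ≡ o (x , y) × τ 1 ≡ unary (k (x , y)))
                    (ev outputsTime (length x + length y))
  outputs-run x y σ σ0 σ1 emp =
    Gen.run G [] 3 (x , y) σ rep empty andThen λ τ (e₁ , a₁) →
    Fun.run F [] 3 (x , y) τ (Rep-cong [] {σ = σ} rep ℕ.≤-refl (λ s s≢2 _ → a₁ s s≢2))
      (λ s 3≤s → trans (a₁ s λ { refl → ℕ.<⇒≱ 3≤s ℕ.≤-refl }) (empty s 3≤s)) andThen λ υ (e₂ , a₂) →
    weaken (erase-run 0 υ)
      (ℕ.+-monoˡ-≤ 1 (ℕ.*-monoˡ-≤ 3 (ℕ.≤-trans (ℕ.≤-reflexive (cong length (trans (a₂ 0 λ ()) (trans (a₁ 0 λ ()) σ0))))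
        (ℕ.m≤m+n (length x) (length y))))) (λ _ → id) andThen λ φ (e₃ , a₃) →
    let out : φ 2 ≡ o (x , y) ʳ++ []
        out = trans (a₃ 2 λ ()) (trans (a₂ 2 λ ()) (trans e₁ (cong (o (x , y) ʳ++_) (emp 0))))
    in weaken (move-run 2 0 φ λ ())
      (ℕ.+-monoˡ-≤ 1 (ℕ.*-monoˡ-≤ 4 (ℕ.≤-trans (ℕ.≤-reflexive (trans (cong length out)
        (trans (List.length-ʳ++ (o (x , y))) (ℕ.+-identityʳ _)))) (Gen.≤len G (x , y))))) (λ _ → id)
      andThen λ χ (_ , e₄ , a₄) →
    weaken (erase-run 1 χ)
      (ℕ.+-monoˡ-≤ 1 (ℕ.*-monoˡ-≤ 3 (ℕ.≤-trans (ℕ.≤-reflexive (cong length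
         (trans (a₄ 1 (λ ()) λ ()) (trans (a₃ 1 λ ()) (trans (a₂ 1 λ ()) (trans (a₁ 1 λ ()) σ1))))))
        (ℕ.m≤n+m (length y) (length x))))) (λ _ → id) andThen λ ψ (e₅ , a₅) →
    let num : length (ψ 3) ≡ k (x , y)
        num = trans (cong length (trans (a₅ 3 λ ()) (trans (a₄ 3 (λ ()) λ ()) (a₃ 3 λ ())))) e₂
    in weaken (unaryMove-run 3 1 ψ (λ ()) e₅)
      (ℕ.+-monoˡ-≤ 1 (ℕ.*-monoˡ-≤ 4 (ℕ.≤-trans (ℕ.≤-reflexive num) (Fun.f≤val F (x , y)))))
      λ ω (e₆ , a₆) →
        trans (a₆ 0 (λ ()) λ ()) (trans (a₅ 0 λ ()) (trans e₄ (trans (cong₂ _ʳ++_ out e₃)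
          (trans (List.ʳ++-ʳ++ (o (x , y))) (List.++-identityʳ _))))) ,
        trans e₆ (cong unary num)
    where
    rep : Rep [] 3 (x , y) σ
    rep = s≤s (s≤s (s≤s z≤n)) , σ0 , σ1
    empty : Empty≥ 3 σ
    empty (suc (suc s)) _ = emp s
    empty (suc zero) (s≤s ())

halts : ∀ {p : Program Q} {σ : Store} {P : Store → Set} {B} q k {m} {w : Vec Word m} → Run O p σ P B → B ≤ ev q k →
        (∀ τ → P τ → unload m τ ≡ w) →
        ∃₂ λ τ t → O ⊢⟨ p , σ ⟩⇓⟨ τ , t ⟩ × t ≤ ⟦ polynomial q ⟧ k × unload m τ ≡ w
halts q k (τ , t , run , t≤ , Pτ) B≤ f =
  τ , t , run , ℕ.≤-trans t≤ (ℕ.≤-trans B≤ (ℕ.≤-reflexive (sym (polynomial-ev q k)))) , f τ Pτ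

gen-FP : ∀ {g : Word → Word} → Gen {0} (g ∘ proj₁) → {I : Set} (input : I → Word) →
         FP (λ i → input i ∷ []) (λ i → g (input i) ∷ [])
gen-FP {g} G input = record
  { program = outputs
  ; bound   = polynomial outputsTime
  ; correct = λ i → halts outputsTime (length (input i) + 0)
      (outputs-run (input i) [] (load (input i ∷ [])) refl refl (λ _ → refl)) ℕ.≤-refl
      (λ τ (e , _) → cong (_∷ []) e)
  }
  where open Output {o = g ∘ proj₁} {k = λ _ → 0} G (litᶜ 0)

gen-FP₂ : ∀ {g : Word × Word → Word} → Gen {0} g → {I : Set} (input : I → Word × Word) →
          FP (λ i → proj₁ (input i) ∷ proj₂ (input i) ∷ []) (λ i → g (input i) ∷ [])
gen-FP₂ {g} G input = record
  { program = outputs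
  ; bound   = polynomial outputsTime
  ; correct = λ i → halts outputsTime (length (proj₁ (input i)) + (length (proj₂ (input i)) + 0))
      (outputs-run (proj₁ (input i)) (proj₂ (input i)) (load (proj₁ (input i) ∷ proj₂ (input i) ∷ []))
        refl refl (λ _ → refl))
      (ℕ.≤-reflexive (cong (λ n → ev outputsTime (length (proj₁ (input i)) + n)) (sym (ℕ.+-identityʳ _))))
      (λ τ (e , _) → cong (_∷ []) e)
  }
  where open Output {o = g} {k = λ _ → 0} G (litᶜ 0)

-- A reduction by one question `g x` whose answer is processed together with `x`. The bound `A`
-- enters because a query is charged for the length of the answer.
query-FP : ∀ (P : CountingProblem) (A : Pol) → (∀ w → length (binary (P w)) ≤ ev A (length w)) →
           ∀ {g : Word → Word} {h : Word × Word → Word} → Gen {0} (g ∘ proj₁) → Gen {0} h →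
           PolyTime {Q = ⊤} (λ _ → binary ∘ P) length (λ x → x ∷ []) (λ x → h (x , binary (P (g x))) ∷ [])
query-FP P A ans {g} {h} G H = record
  { program = program
  ; bound   = polynomial bound
  ; correct = λ x → halts bound (length x) (program-run x) ℕ.≤-refl (λ τ e → cong (_∷ []) e)
  }
  where
  open Output {o = h} {k = λ _ → 0} H (litᶜ 0)
  program : Program ⊤
  program = Gen.prog G [] 3 ⨾ (move 2 3 ⨾ (query tt 3 1 ⨾ (erase 3 ⨾ outputs)))
  L bound : Pol
  L = Gen.len G
  bound = Gen.time G ⊚ var ⊞ (L ⊠ con 4 ⊞ con 1 ⊞ (con 1 ⊞ L ⊞ A ⊚ L ⊞ (L ⊠ con 3 ⊞ con 1 ⊞ outputsTime ⊚ (var ⊞ A ⊚ L))))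
  oracle : Oracle ⊤
  oracle _ = binary ∘ P
  query-run : ∀ σ → Run oracle (query tt 3 1) σ (λ τ → τ 1 ≡ binary (P (σ 3)) × Agree 1 σ τ)
                        (1 + length (σ 3) + length (binary (P (σ 3))))
  query-run σ = _ , _ , ⇓query , ℕ.≤-refl , ≔-same σ 1 _ , ≔-agree σ 1 _
  module _ (x : Word) where
    σ : Store
    σ = load (x ∷ [])
    N : ℕ
    N = length x
    len : length (g x) ≤ ev L N
    len = subst (λ n → length (g x) ≤ ev L n) (ℕ.+-identityʳ N) (Gen.≤len G (x , []))
    answer : length (binary (P (g x))) ≤ ev A (ev L N)
    answer = ℕ.≤-trans (ans (g x)) (ev-mono A len)
    program-run : Run oracle program σ (λ τ → τ 0 ≡ h (x , binary (P (g x)))) (ev bound N)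
    program-run = weaken (Gen.run G [] 3 (x , []) σ (s≤s (s≤s (s≤s z≤n)) , refl , refl) empty)
        (ℕ.≤-reflexive (cong (ev (Gen.time G)) (ℕ.+-identityʳ N))) (λ _ → id) andThen λ τ (e₁ , a₁) →
      let out : τ 2 ≡ g x ʳ++ []
          out = e₁
      in weaken (move-run 2 3 τ λ ())
        (ℕ.+-monoˡ-≤ 1 (ℕ.*-monoˡ-≤ 4 (ℕ.≤-trans (ℕ.≤-reflexive (trans (cong length out)
          (trans (List.length-ʳ++ (g x)) (ℕ.+-identityʳ _)))) len))) (λ _ → id) andThen λ υ (e₂ , e₂′ , a₂) →
      let question : υ 3 ≡ g x
          question = trans e₂′ (trans (cong₂ _ʳ++_ out (a₁ 3 λ ()))
            (trans (List.ʳ++-ʳ++ (g x)) (List.++-identityʳ _)))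
      in weaken (query-run υ)
        (s≤s (ℕ.+-mono-≤ (ℕ.≤-trans (ℕ.≤-reflexive (cong length question)) len)
                         (ℕ.≤-trans (ℕ.≤-reflexive (cong (length ∘ binary ∘ P) question)) answer)))
        (λ _ → id) andThen λ φ (e₃ , a₃) →
      weaken (erase-run 3 φ)
        (ℕ.+-monoˡ-≤ 1 (ℕ.*-monoˡ-≤ 3 (ℕ.≤-trans (ℕ.≤-reflexive (cong length (trans (a₃ 3 λ ()) question))) len)))
        (λ _ → id) andThen λ χ (e₄ , a₄) →
      weaken (outputs-run x (binary (P (g x))) χ
               (trans (a₄ 0 λ ()) (trans (a₃ 0 λ ()) (trans (a₂ 0 (λ ()) λ ()) (a₁ 0 λ ()))))
               (trans (a₄ 1 λ ()) (trans e₃ (cong (binary ∘ P) question)))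
               (λ where zero          → trans (a₄ 2 λ ()) (trans (a₃ 2 λ ()) e₂)
                        (suc zero)    → e₄
                        (suc (suc s)) → trans (a₄ (4 + s) λ ()) (trans (a₃ (4 + s) λ ())
                                          (trans (a₂ (4 + s) (λ ()) λ ()) (a₁ (4 + s) λ ())))))
             (ev-mono outputsTime (ℕ.+-monoʳ-≤ N answer)) (λ _ → proj₁)
      where
      empty : Empty≥ 3 σ
      empty (suc s) _ = refl

-- Counting

⊆-length : ∀ {A : Set} {xs ys : List A} → Unique xs → (∀ {x} → x ∈ₗ xs → x ∈ₗ ys) → length xs ≤ length ys
⊆-length {xs = []}     {ys} []       sub = z≤n
⊆-length {xs = x ∷ xs} {ys} (x∉ ∷ u) sub with List.∈-∃++ (sub (here refl))
... | as , bs , refl = ℕ.≤-trans (s≤s (⊆-length u sub′)) (ℕ.≤-reflexive eq)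
  where
  sub′ : ∀ {y} → y ∈ₗ xs → y ∈ₗ as ++ bs
  sub′ {y} y∈ with List.∈-++⁻ as (sub (there y∈))
  ... | inj₁ y∈as         = List.∈-++⁺ˡ y∈as
  ... | inj₂ (here refl)  = contradiction refl (All.lookup x∉ y∈)
  ... | inj₂ (there y∈bs) = List.∈-++⁺ʳ as y∈bs
  eq : suc (length (as ++ bs)) ≡ length (as ++ x ∷ bs)
  eq = trans (cong suc (List.length-++ as)) (trans (sym (ℕ.+-suc (length as) (length bs))) (sym (List.length-++ as)))

map-unique : ∀ {A B : Set} {xs : List A} (f : A → B) → Unique xs →
             (∀ {x y} → x ∈ₗ xs → y ∈ₗ xs → f x ≡ f y → x ≡ y) → Unique (map f xs)
map-unique f []       inj = []
map-unique f (x∉ ∷ u) inj = All.map⁺ (All.tabulate λ y∈ fx≡fy → All.lookup x∉ y∈ (inj (here refl) (there y∈) fx≡fy))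
                          ∷ map-unique f u (λ x∈ y∈ → inj (there x∈) (there y∈))

inj-length : ∀ {A B : Set} {xs : List A} {ys : List B} (f : A → B) → Unique xs →
             (∀ {x} → x ∈ₗ xs → f x ∈ₗ ys) →
             (∀ {x y} → x ∈ₗ xs → y ∈ₗ xs → f x ≡ f y → x ≡ y) → length xs ≤ length ys
inj-length {xs = xs} f u into inj = ℕ.≤-trans (ℕ.≤-reflexive (sym (List.length-map f xs)))
  (⊆-length (map-unique f u inj) λ z∈ → let x , x∈ , z≡ = List.∈-map⁻ f z∈ in subst (_∈ₗ _) (sym z≡) (into x∈))

vectors-unique : ∀ n → Unique (vectors bools n)
vectors-unique zero    = [] ∷ []
vectors-unique (suc n) = Unique.cartesianProductWith⁺ _∷_ (λ { refl → refl , refl })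
  (((λ ()) ∷ []) ∷ [] ∷ []) (vectors-unique n)

∈-vectors : ∀ {n} (v : Vec Bool n) → v ∈ₗ vectors bools n
∈-vectors = Enumeration.vectors-complete bools bools-complete

length-filter-product : ∀ {A B : Set} {P : A → B → Set} (P? : ∀ a → Decidable (P a)) (xs : List A) ys →
  length (filter (λ (x , y) → P? x y) (cartesianProduct xs ys)) ≡ sum (map (λ x → length (filter (P? x) ys)) xs)
length-filter-product P? []       ys = refl
length-filter-product P? (x ∷ xs) ys =
  trans (cong length (List.filter-++ _ (map (x ,_) ys) _))
  (trans (List.length-++ (filter _ (map (x ,_) ys)))
         (cong₂ _+_ (row ys) (length-filter-product P? xs ys)))
  where
  row : ∀ ys → length (filter (λ (x , y) → P? x y) (map (x ,_) ys)) ≡ length (filter (P? x) ys)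
  row []       = refl
  row (y ∷ ys) with does (P? x y)
  ... | true  = cong suc (row ys)
  ... | false = row ys

module _ {t m n : ℕ} {P : Fin t → Pred (Vec Bool m) 0ℓ} {Q : Pred (Vec Bool n) 0ℓ}
         (P? : ∀ i → Decidable (P i)) (Q? : Decidable Q)
         (f : Fin t → Vec Bool m → Vec Bool n)
         (into : ∀ i v → P i v → Q (f i v))
         (inj : ∀ i j v w → P i v → P j w → f i v ≡ f j w → (i , v) ≡ (j , w))
         (onto : ∀ w → Q w → ∃₂ λ i v → P i v × f i v ≡ w) where

  -- This is the form in which the compositions produce their sum: a solution of the composed
  -- instance is the index of a block together with a solution of that block.
  count-Σ : count Q? ≡ sum (map (λ i → count (P? i)) (allFin t))
  count-Σ = trans (ℕ.≤-antisym upper lower) (length-filter-product P? (allFin t) (vectors bools m))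
    where
    all pairs : List (Fin t × Vec Bool m)
    all = cartesianProduct (allFin t) (vectors bools m)
    pairs = filter (λ (i , v) → P? i v) all
    sols : List (Vec Bool n)
    sols = filter Q? (vectors bools n)
    g : Fin t × Vec Bool m → Vec Bool n
    g (i , v) = f i v
    unique : Unique pairs
    unique = Unique.filter⁺ _ (Unique.cartesianProduct⁺ (Unique.allFin⁺ t) (vectors-unique m))
    P∈ : ∀ {i v} → (i , v) ∈ₗ pairs → P i v
    P∈ iv∈ = proj₂ (List.∈-filter⁻ (λ (i , v) → P? i v) {xs = all} iv∈)
    lower : length pairs ≤ length sols
    lower = inj-length g unique
      (λ {(i , v)} iv∈ → List.∈-filter⁺ Q? (∈-vectors _) (into i v (P∈ iv∈)))
      (λ {(i , v)} {(j , w)} iv∈ jw∈ eq → inj i j v w (P∈ iv∈) (P∈ jw∈) eq)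
    upper : length sols ≤ length pairs
    upper = ℕ.≤-trans (⊆-length {ys = map g pairs} (Unique.filter⁺ Q? (vectors-unique n)) λ {w} w∈ →
        let i , v , Pv , eq = onto w (proj₂ (List.∈-filter⁻ Q? {xs = vectors bools n} w∈))
        in subst (_∈ₗ _) eq (List.∈-map⁺ g (List.∈-filter⁺ (λ (i , v) → P? i v)
             (List.∈-cartesianProduct⁺ (∈-allFin i) (∈-vectors v)) Pv)))
      (ℕ.≤-reflexive (List.length-map g pairs))

count-≡ : ∀ {m n} {P : Pred (Vec Bool m) 0ℓ} {Q : Pred (Vec Bool n) 0ℓ}
          (P? : Decidable P) (Q? : Decidable Q) (f : Vec Bool m → Vec Bool n) →
          (∀ v → P v → Q (f v)) → (∀ v w → P v → P w → f v ≡ f w → v ≡ w) →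
          (∀ w → Q w → ∃ λ v → P v × f v ≡ w) → count P? ≡ count Q?
count-≡ P? Q? f into inj onto = sym (trans
  (count-Σ {t = 1} (λ _ → P?) Q? (λ _ → f) (λ _ → into)
    (λ { zero zero v w Pv Pw eq → cong (zero ,_) (inj v w Pv Pw eq) })
    (λ w Qw → let v , Pv , eq = onto w Qw in zero , v , Pv , eq))
  (ℕ.+-identityʳ _))

count-cong : ∀ {n} {P Q : Pred (Vec Bool n) 0ℓ} (P? : Decidable P) (Q? : Decidable Q) →
             (∀ v → P v → Q v) → (∀ v → Q v → P v) → count P? ≡ count Q?
count-cong P? Q? to from = count-≡ P? Q? id to (λ _ _ _ _ → id) (λ w Qw → w , from w Qw , refl)

vectors-length : ∀ n → length (vectors bools n) ≡ 2 ^ n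
vectors-length zero    = refl
vectors-length (suc n) = trans (List.length-++ (map (false ∷_) vs))
  (cong₂ _+_ (trans (List.length-map _ vs) (vectors-length n))
             (trans (List.length-++ (map (true ∷_) vs))
                    (cong (_+ 0) (trans (List.length-map _ vs) (vectors-length n)))))
  where
  vs : List (Vec Bool n)
  vs = vectors bools n

count≤ : ∀ {n} {P : Pred (Vec Bool n) 0ℓ} (P? : Decidable P) → count P? ≤ 2 ^ n
count≤ {n} P? = ℕ.≤-trans (List.length-filter P? (vectors bools n)) (ℕ.≤-reflexive (vectors-length n))

-- Cardinalities of subsets

elements : ∀ {n} → Subset n → List (Fin n)
elements []          = []
elements (true ∷ C)  = zero ∷ map suc (elements C)
elements (false ∷ C) = map suc (elements C)

length-elements : ∀ {n} (C : Subset n) → length (elements C) ≡ ∣ C ∣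
length-elements []          = refl
length-elements (true ∷ C)  = cong suc (trans (List.length-map suc (elements C)) (length-elements C))
length-elements (false ∷ C) = trans (List.length-map suc (elements C)) (length-elements C)

∈-elements⁺ : ∀ {n} {C : Subset n} {x} → x ∈ C → x ∈ₗ elements C
∈-elements⁺ Vec.here = here refl
∈-elements⁺ {C = true ∷ C}  (Vec.there x∈) = there (List.∈-map⁺ suc (∈-elements⁺ x∈))
∈-elements⁺ {C = false ∷ C} (Vec.there x∈) = List.∈-map⁺ suc (∈-elements⁺ x∈)

∈-elements⁻ : ∀ {n} {C : Subset n} {x} → x ∈ₗ elements C → x ∈ C
∈-elements⁻ {C = true ∷ C} (here refl) = Vec.here
∈-elements⁻ {C = true ∷ C} (there x∈) with List.∈-map⁻ suc x∈
... | y , y∈ , refl = Vec.there (∈-elements⁻ y∈)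
∈-elements⁻ {C = false ∷ C} x∈ with List.∈-map⁻ suc x∈
... | y , y∈ , refl = Vec.there (∈-elements⁻ y∈)

elements-unique : ∀ {n} (C : Subset n) → Unique (elements C)
elements-unique []          = []
elements-unique (true ∷ C)  = All.map⁺ (All.tabulate λ _ ()) ∷ Unique.map⁺ Fin.suc-injective (elements-unique C)
elements-unique (false ∷ C) = Unique.map⁺ Fin.suc-injective (elements-unique C)

module _ {n k : ℕ} {C : Subset n} (g : Fin k → Fin n) where

  injected⇒≤ : Injective _≡_ _≡_ g → (∀ i → g i ∈ C) → k ≤ ∣ C ∣
  injected⇒≤ inj g∈ = subst₂ _≤_ (List.length-tabulate id) (length-elements C)
    (inj-length {xs = allFin k} g (Unique.allFin⁺ k) (λ {i} _ → ∈-elements⁺ (g∈ i)) (λ _ _ → inj))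

  covered⇒≤ : (∀ {x} → x ∈ C → ∃ λ i → g i ≡ x) → ∣ C ∣ ≤ k
  covered⇒≤ cover = subst₂ _≤_ (length-elements C) (trans (List.length-map g (allFin k)) (List.length-tabulate id))
    (⊆-length (elements-unique C) λ x∈ → let i , eq = cover (∈-elements⁻ x∈)
                                         in subst (_∈ₗ _) eq (List.∈-map⁺ g (∈-allFin i)))

  -- An element outside the image would be one too many. This equality case of the pigeonhole
  -- principle shows that a solution of least size consists of exactly one element from each of `k`
  -- disjoint obstructions.
  tight⇒covered : Injective _≡_ _≡_ g → (∀ i → g i ∈ C) → ∣ C ∣ ≤ k → ∀ {x} → x ∈ C → ∃ λ i → g i ≡ x
  tight⇒covered inj g∈ C≤k {x} x∈ with any? (λ i → g i Fin.≟ x)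
  ... | yes found = found
  ... | no  ¬found = contradiction
    (subst₂ _≤_ (cong suc (trans (List.length-map g (allFin k)) (List.length-tabulate id))) (length-elements C)
      (⊆-length {xs = x ∷ map g (allFin k)}
        (All.map⁺ (All.tabulate λ {i} _ x≡ → ¬found (i , sym x≡)) ∷ Unique.map⁺ inj (Unique.allFin⁺ k))
        λ { (here refl) → ∈-elements⁺ x∈
          ; (there y∈) → let i , _ , y≡ = List.∈-map⁻ g y∈ in subst (_∈ₗ _) (sym y≡) (∈-elements⁺ (g∈ i)) }))
    (ℕ.<⇒≱ (s≤s C≤k))

-- Boolean tests and the propositions that they decide

T⇒≡ : ∀ {b} → T b → b ≡ true
T⇒≡ {true} _ = refl

≡⇒T : ∀ {b} → b ≡ true → T b
≡⇒T refl = tt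

∈-tabulate⁺ : ∀ {n} {p : Fin n → Bool} {x} → T (p x) → x ∈ tabulate p
∈-tabulate⁺ {p = p} {x} px = Vec.lookup⇒[]= x (tabulate p) (trans (Vec.lookup∘tabulate p x) (T⇒≡ px))

∈-tabulate⁻ : ∀ {n} {p : Fin n → Bool} {x} → x ∈ tabulate p → T (p x)
∈-tabulate⁻ {p = p} {x} x∈ = ≡⇒T (trans (sym (Vec.lookup∘tabulate p x)) (Vec.[]=⇒lookup x∈))

∈⇒T : ∀ {n} {C : Subset n} {x} → x ∈ C → T (lookup C x)
∈⇒T x∈ = ≡⇒T (Vec.[]=⇒lookup x∈)

T⇒∈ : ∀ {n} {C : Subset n} {x} → T (lookup C x) → x ∈ C
T⇒∈ {C = C} {x} t = Vec.lookup⇒[]= x C (T⇒≡ t)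

≡-by-T : ∀ {a b} → (T a → T b) → (T b → T a) → a ≡ b
≡-by-T {false} {false} f g = refl
≡-by-T {true}  {true}  f g = refl
≡-by-T {false} {true}  f g = ⊥-elim (g tt)
≡-by-T {true}  {false} f g = ⊥-elim (f tt)

≡ᵇ-sound : ∀ {m n} → T (m ≡ᵇ n) → m ≡ n
≡ᵇ-sound {m} {n} = ℕ.≡ᵇ⇒≡ m n

≡ᵇ-complete : ∀ {m n} → m ≡ n → T (m ≡ᵇ n)
≡ᵇ-complete {m} {n} = ℕ.≡⇒≡ᵇ m n

∧-sound : ∀ {a b} → T (a ∧ b) → T a × T b
∧-sound {true} t = tt , t

∧-complete : ∀ {a b} → T a → T b → T (a ∧ b)
∧-complete {true} _ t = t

∨-sound : ∀ {a b} → T (a ∨ b) → T a ⊎ T b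
∨-sound {true}  t = inj₁ tt
∨-sound {false} t = inj₂ t

∨-inj₁ : ∀ {a b} → T a → T (a ∨ b)
∨-inj₁ {true} _ = tt

∨-inj₂ : ∀ {a b} → T b → T (a ∨ b)
∨-inj₂ {true}  _ = tt
∨-inj₂ {false} t = t

any-sound : ∀ n {p} → T (anyN n p) → ∃ λ i → i < n × T (p i)
any-sound (suc n) t with ∨-sound t
... | inj₁ t′ = let i , i<n , pi = any-sound n t′ in i , ℕ.m<n⇒m<1+n i<n , pi
... | inj₂ pn = n , ℕ.≤-refl , pn

any-complete : ∀ n {p} i → i < n → T (p i) → T (anyN n p)
any-complete (suc n) i i<1+n pi with ℕ.m<1+n⇒m<n∨m≡n i<1+n
... | inj₁ i<n  = ∨-inj₁ (any-complete n i i<n pi)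
... | inj₂ refl = ∨-inj₂ pi

all-sound : ∀ n {p} → T (allN n p) → ∀ i → i < n → T (p i)
all-sound (suc n) t i i<1+n with ℕ.m<1+n⇒m<n∨m≡n i<1+n
... | inj₁ i<n  = all-sound n (proj₁ (∧-sound t)) i i<n
... | inj₂ refl = proj₂ (∧-sound {allN n _} t)

all-complete : ∀ n {p} → (∀ i → i < n → T (p i)) → T (allN n p)
all-complete zero    f = tt
all-complete (suc n) f = ∧-complete (all-complete n (λ i i<n → f i (ℕ.m<n⇒m<1+n i<n))) (f n ℕ.≤-refl)

-- Square matrices read off a word

-- The integer square root.
rt : ℕ → ℕ
rt l = sumN l (λ q → bit (suc q * suc q <ᵇ suc l))

-- Searching is replaced by counting: the threshold of a monotone test is the number of places where
-- it succeeds. The square root, the length of a block and the number of blocks are computed in this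
-- way.
sumN-threshold : ∀ N c → c ≤ N → sumN N (λ i → bit (i <ᵇ c)) ≡ c
sumN-threshold zero    c       z≤n = refl
sumN-threshold (suc N) c       c≤  with ℕ.m≤n⇒m<n∨m≡n c≤
... | inj₁ (s≤s c≤N) = trans (cong₂ _+_ (sumN-threshold N c c≤N) (cong bit N≮c)) (ℕ.+-identityʳ c)
  where
  N≮c : (N <ᵇ c) ≡ false
  N≮c = dec-false (N ℕ.<? c) (ℕ.≤⇒≯ c≤N)
... | inj₂ refl = trans (cong₂ _+_ all (cong bit (dec-true (N ℕ.<? suc N) ℕ.≤-refl))) (ℕ.+-comm N 1)
  where
  all : sumN N (λ i → bit (i <ᵇ suc N)) ≡ N
  all = trans (sumN-cong N (λ i i<N → cong bit (trans (dec-true (i ℕ.<? suc N) (ℕ.m<n⇒m<1+n i<N)) (sym (dec-true (i ℕ.<? N) i<N)))))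
              (sumN-threshold N N ℕ.≤-refl)

<ᵇ-cong : ∀ {a b c d} → (a < b → c < d) → (c < d → a < b) → (a <ᵇ b) ≡ (c <ᵇ d)
<ᵇ-cong {a} {b} {c} {d} f g = ≡-by-T (λ t → ℕ.<⇒<ᵇ (f (ℕ.<ᵇ⇒< a b t))) (λ t → ℕ.<⇒<ᵇ (g (ℕ.<ᵇ⇒< c d t)))

square-cancel : ∀ {a b} → a * a ≤ b * b → a ≤ b
square-cancel {a} {b} a²≤b² = ℕ.≮⇒≥ λ b<a → ℕ.<⇒≱ (ℕ.*-mono-< b<a b<a) a²≤b²

n≤n² : ∀ n → n ≤ n * n
n≤n² zero    = z≤n
n≤n² (suc n) = ℕ.m≤m+n (suc n) (n * suc n)

rt-square : ∀ n → rt (n * n) ≡ n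
rt-square n = trans (sumN-cong (n * n) λ q _ → cong bit (<ᵇ-cong {suc q * suc q} {suc (n * n)} {q} {n}
    (λ { (s≤s sq) → square-cancel sq }) (λ q<n → s≤s (ℕ.*-mono-≤ q<n q<n))))
  (sumN-threshold (n * n) n (n≤n² n))

rt²≤ : ∀ l → rt l * rt l ≤ l
rt²≤ l = bounded l
  where
  p : ℕ → ℕ
  p q = bit (suc q * suc q <ᵇ suc l)
  bounded : ∀ m → sumN m p * sumN m p ≤ l
  full : ∀ m → suc m * suc m ≤ l → sumN m p ≡ m
  full zero    h = refl
  full (suc m) h = trans (cong₂ _+_ (full m sq) (cong bit (T⇒≡ (ℕ.<⇒<ᵇ (s≤s sq))))) (ℕ.+-comm m 1)
    where
    sq : suc m * suc m ≤ l
    sq = ℕ.≤-trans (ℕ.*-mono-≤ (ℕ.n≤1+n (suc m)) (ℕ.n≤1+n (suc m))) h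
  bounded zero    = z≤n
  bounded (suc m) with suc m * suc m <ᵇ suc l in eq
  ... | false = subst (λ k → k * k ≤ l) (sym (ℕ.+-identityʳ (sumN m p))) (bounded m)
  ... | true  = subst (λ k → k * k ≤ l) (sym (trans (cong (_+ 1) (full m sq)) (ℕ.+-comm m 1))) sq
    where
    sq : suc m * suc m ≤ l
    sq = ℕ.s≤s⁻¹ (ℕ.<ᵇ⇒< (suc m * suc m) (suc l) (≡⇒T eq))

rt>0 : ∀ l → 0 < l → 0 < rt l
rt>0 (suc l) _ = positive l
  where
  positive : ∀ m → 0 < sumN (suc m) (λ q → bit (suc q * suc q <ᵇ suc (suc l)))
  positive zero    = s≤s z≤n
  positive (suc m) = ℕ.≤-trans (positive m) (ℕ.m≤m+n _ _)

rtᶜ : ∀ {f : Env n → ℕ} → Fun f → Fun (λ ρ → rt (f ρ))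
rtᶜ F = sumᶜ F ((litᶜ 1 ⊕ᶜ varᶜ zero) ⊗ᶜ (litᶜ 1 ⊕ᶜ varᶜ zero) <ᶜ (litᶜ 1 ⊕ᶜ wkᶜ F))

-- Sets closed under the arcs of a digraph

-- These are the up-sets of the preorder generated by the arcs. The relation lives on numbers, so
-- that the digraph stored in a word can be addressed by arithmetic without proofs about indices.
Closed : ∀ n → (ℕ → ℕ → Bool) → Pred (Vec Bool n) 0ℓ
Closed n R S = ∀ (u v : Fin n) → T (R (toℕ u) (toℕ v)) → T (lookup S u) → T (lookup S v)

closed? : ∀ n R → Decidable (Closed n R)
closed? n R S = all? λ u → all? λ v → T? _ →-dec (T? _ →-dec T? _)

closedSets : ∀ n → (ℕ → ℕ → Bool) → ℕ
closedSets n R = count (closed? n R)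

arcs : Word → ℕ → ℕ → ℕ → Bool
arcs w n u v = bitAt w (u * n + v)

-- The empty word has value 0 because a sequence of empty words has to be
-- processed in constant time.
#Closed : CountingProblem
#Closed []        = 0
#Closed w@(_ ∷ _) = closedSets (rt (length w)) (arcs w (rt (length w)))

#Closed-matrix : ∀ w n → length w ≡ n * n → 0 < n → #Closed w ≡ closedSets n (arcs w n)
#Closed-matrix []        (suc n) () _
#Closed-matrix w@(_ ∷ _) n eq _ =
  cong (λ m → closedSets m (arcs w m)) (trans (cong rt eq) (rt-square n))

#Closed-bound : ∀ w → #Closed w ≤ 2 ^ length w
#Closed-bound []        = z≤n
#Closed-bound w@(_ ∷ _) = ℕ.≤-trans (count≤ (closed? (rt (length w)) (arcs w (rt (length w)))))
  (ℕ.^-monoʳ-≤ 2 (ℕ.≤-trans (n≤n² (rt (length w))) (rt²≤ (length w))))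

-- Equal lengths give all digraphs the same number of elements, hence a common cut size, and allow
-- block boundaries to be found by multiplication.
sameLength : PolynomialEquivalence
sameLength = record
  { _∼_             = λ x y → length x ≡ length y
  ; isEquivalence   = record { refl = refl ; sym = sym ; trans = trans }
  ; _∼?_            = λ x y → length x ℕ.≟ length y
  ; ∼?-FP           = gen-FP₂ (emitᶜ (lenᶜ first ≡ᶜ lenᶜ second)) id
  ; classes         = 1 ∷ 1 ∷ []
  ; representatives = λ n → map unary (upTo (suc n))
  ; few             = λ n → ℕ.≤-reflexive (trans (List.length-map unary (upTo (suc n)))
                        (trans (List.length-upTo (suc n)) (sym (polynomial-ev (con 1 ⊞ var) n))))
  ; exhaustive      = λ n x x≤n → lose (List.∈-map⁺ unary (List.∈-upTo⁺ (s≤s x≤n))) (sym (List.length-replicate (length x)))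
  }

-- Reading a sequence of words of equal length

stride : ℕ → ℕ
stride l = suc (l + l)

length-delimit : ∀ x → length (delimit x) ≡ stride (length x)
length-delimit []      = refl
length-delimit (b ∷ x) = cong suc (trans (cong suc (length-delimit x)) (cong suc (sym (ℕ.+-suc (length x) (length x)))))

bitAt-++ʳ : ∀ x {y} k → bitAt (x ++ y) (length x + k) ≡ bitAt y k
bitAt-++ʳ []      k = refl
bitAt-++ʳ (b ∷ x) k = bitAt-++ʳ x k

bitAt-++ˡ : ∀ x {y} k → k < length x → bitAt (x ++ y) k ≡ bitAt x k
bitAt-++ˡ (b ∷ x) zero    _         = refl
bitAt-++ˡ (b ∷ x) (suc k) (s≤s k<x) = bitAt-++ˡ x k k<x

-- Flags sit at the even positions. Past the terminator the even positions belong to the rest of the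
-- sequence, whence the second alternative.
bitAt-flag : ∀ x {y} k → bitAt (delimit x ++ y) (k + k) ≡ (k <ᵇ length x) ⊎ length x < k
bitAt-flag []      zero    = inj₁ refl
bitAt-flag []      (suc k) = inj₂ (s≤s z≤n)
bitAt-flag (b ∷ x) zero    = inj₁ refl
bitAt-flag (b ∷ x) {y} (suc k) with bitAt-flag x {y} k
... | inj₁ eq = inj₁ (trans (cong (bitAt (b ∷ delimit x ++ y)) (ℕ.+-suc k k)) eq)
... | inj₂ x<k = inj₂ (s≤s x<k)

bitAt-delimit : ∀ x k → bitAt (delimit x) (suc (k + k)) ≡ bitAt x k
bitAt-delimit []      zero    = refl
bitAt-delimit []      (suc k) = refl
bitAt-delimit (b ∷ x) zero    = refl
bitAt-delimit (b ∷ x) (suc k) = trans (cong (bitAt (delimit x)) (ℕ.+-suc k k)) (bitAt-delimit x k)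

length-encodeList : ∀ {l} xs → All (λ x → length x ≡ l) xs → length (encodeList xs) ≡ length xs * stride l
length-encodeList []       []         = refl
length-encodeList (x ∷ xs) (eq ∷ eqs) = trans (List.length-++ (delimit x))
  (cong₂ _+_ (trans (length-delimit x) (cong stride eq)) (length-encodeList xs eqs))

bitAt-encodeList : ∀ {l} xs → All (λ x → length x ≡ l) xs → ∀ (i : Fin (length xs)) k → k < l →
                   bitAt (encodeList xs) (toℕ i * stride l + suc (k + k)) ≡ bitAt (List.lookup xs i) k
bitAt-encodeList (x ∷ xs) (refl ∷ eqs) zero k k<l = trans
  (bitAt-++ˡ (delimit x) (suc (k + k)) (ℕ.≤-trans (s≤s (ℕ.+-mono-< k<l k<l)) (ℕ.≤-reflexive (sym (length-delimit x)))))
  (bitAt-delimit x k)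
bitAt-encodeList {l} (x ∷ xs) (refl ∷ eqs) (suc i) k k<l = trans
  (cong (bitAt (encodeList (x ∷ xs))) (trans (ℕ.+-assoc (stride l) (toℕ i * stride l) _)
    (cong (_+ (toℕ i * stride l + suc (k + k))) (sym (length-delimit x)))))
  (trans (bitAt-++ʳ (delimit x) _) (bitAt-encodeList xs eqs i k k<l))

-- The length of the first word is the number of flags before the first terminator. As all words
-- have this length, their number is the number of multiples of the stride below the length of the
-- code.
wordLength wordCount : Word → ℕ
wordLength w = sumN (length w) (λ q → bit (allN (suc q) (λ r → bitAt w (r + r))))
wordCount w = sumN (length w) (λ i → bit (i * stride (wordLength w) <ᵇ length w))

side : Word → ℕ
side w = rt (wordLength w)

blockArc : Word → ℕ → ℕ → ℕ → Bool
blockArc w i u v = bitAt w (i * stride (wordLength w) + suc ((u * side w + v) + (u * side w + v)))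

module _ {x : Word} {xs : List Word} (same : All (λ y → length y ≡ length x) (x ∷ xs)) where
  private
    l t : ℕ
    l = length x
    t = length (x ∷ xs)
    w : Word
    w = encodeList (x ∷ xs)
    length-w : length w ≡ t * stride l
    length-w = length-encodeList (x ∷ xs) same

  wordLength≡ : wordLength w ≡ l
  wordLength≡ = trans (sumN-cong (length w) λ q _ → cong bit (≡-by-T (to q) (from q)))
    (sumN-threshold (length w) l (ℕ.≤-trans (ℕ.≤-trans (ℕ.m≤m+n l l) (ℕ.n≤1+n _))
      (ℕ.≤-trans (ℕ.m≤m+n (stride l) _) (ℕ.≤-reflexive (sym length-w)))))
    where
    to : ∀ q → T (allN (suc q) (λ r → bitAt w (r + r))) → T (q <ᵇ l)
    to q t with ℕ.<-≤-connex q l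
    ... | inj₁ q<l = ℕ.<⇒<ᵇ q<l
    ... | inj₂ l≤q with bitAt-flag x {encodeList xs} l | all-sound (suc q) t l (s≤s l≤q)
    ...   | inj₁ eq | t′ = contradiction (ℕ.<ᵇ⇒< l l (subst T eq t′)) (ℕ.<-irrefl refl)
    ...   | inj₂ l<l | _ = contradiction l<l (ℕ.<-irrefl refl)
    from : ∀ q → T (q <ᵇ l) → T (allN (suc q) (λ r → bitAt w (r + r)))
    from q t = all-complete (suc q) λ r r≤q → flag r (ℕ.≤-<-trans (ℕ.s≤s⁻¹ r≤q) (ℕ.<ᵇ⇒< q l t))
      where
      flag : ∀ r → r < l → T (bitAt w (r + r))
      flag r r<l with bitAt-flag x {encodeList xs} r
      ... | inj₁ eq  = subst T (sym eq) (ℕ.<⇒<ᵇ r<l)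
      ... | inj₂ l<r = contradiction l<r (ℕ.<-asym r<l)

  wordCount≡ : wordCount w ≡ t
  wordCount≡ = trans (sumN-cong (length w) λ i _ → cong bit (trans
      (cong₂ (λ s b → i * stride s <ᵇ b) wordLength≡ length-w)
      (<ᵇ-cong (ℕ.*-cancelʳ-< (stride l) i t) (ℕ.*-monoˡ-< (stride l)))))
    (sumN-threshold (length w) t (ℕ.≤-trans (ℕ.m≤m*n t (stride l)) (ℕ.≤-reflexive (sym length-w))))

  side≡ : side w ≡ rt l
  side≡ = cong rt wordLength≡

  blockArc≡ : ∀ (i : Fin t) u v → u < rt l → v < rt l →
              blockArc w (toℕ i) u v ≡ arcs (List.lookup (x ∷ xs) i) (rt l) u v
  blockArc≡ i u v u< v< = trans
    (cong₂ (λ s m → bitAt w (toℕ i * stride s + suc ((u * m + v) + (u * m + v)))) wordLength≡ side≡)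
    (bitAt-encodeList (x ∷ xs) same i (u * rt l + v) (ℕ.<-≤-trans
      (ℕ.<-≤-trans (ℕ.+-monoʳ-< (u * rt l) v<) (ℕ.≤-trans (ℕ.≤-reflexive (ℕ.+-comm (u * rt l) (rt l))) (ℕ.*-monoˡ-≤ (rt l) u<)))
      (rt²≤ l)))

wordLengthᶜ wordCountᶜ sideᶜ : ∀ {n} → Fun {n} _
wordLengthᶜ = ext {f = λ ρ → wordLength (word first ρ)} (λ _ → refl)
  (sumᶜ (lenᶜ first) (allᶜ (litᶜ 1 ⊕ᶜ varᶜ zero) (bitᶜ first (varᶜ zero ⊕ᶜ varᶜ zero))))
wordCountᶜ = ext {f = λ ρ → wordCount (word first ρ)} (λ _ → refl)
  (sumᶜ (lenᶜ first) (varᶜ zero ⊗ᶜ (litᶜ 1 ⊕ᶜ (wordLengthᶜ ⊕ᶜ wordLengthᶜ)) <ᶜ lenᶜ first))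
sideᶜ = ext {f = λ ρ → side (word first ρ)} (λ _ → refl) (rtᶜ wordLengthᶜ)

blockArcᶜ : ∀ {f g h : Env n → ℕ} → Fun f → Fun g → Fun h →
            BFun (λ ρ → blockArc (word first ρ) (f ρ) (g ρ) (h ρ))
blockArcᶜ F G H = bitᶜ first (F ⊗ᶜ (litᶜ 1 ⊕ᶜ (wordLengthᶜ ⊕ᶜ wordLengthᶜ)) ⊕ᶜ
  (litᶜ 1 ⊕ᶜ ((G ⊗ᶜ sideᶜ ⊕ᶜ H) ⊕ᶜ (G ⊗ᶜ sideᶜ ⊕ᶜ H))))

-- Generated words

loop≡concatMap : ∀ {A : Set} n (h : ℕ → List A) → loop n h ≡ concatMap h (upTo n)
loop≡concatMap zero    h = refl
loop≡concatMap (suc n) h = begin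
  loop n h ++ h n                         ≡⟨ cong₂ _++_ (loop≡concatMap n h) (sym (List.++-identityʳ (h n))) ⟩
  concatMap h (upTo n) ++ concatMap h (n ∷ []) ≡⟨ List.concatMap-++ h (upTo n) (n ∷ []) ⟨
  concatMap h (upTo n ++ n ∷ [])          ≡⟨ cong (concatMap h) (List.upTo-∷ʳ n) ⟩
  concatMap h (upTo (suc n))              ∎
  where open ≡-Reasoning

concatMap-product : ∀ {A B C : Set} (g : A × B → List C) xs ys →
  concatMap g (cartesianProduct xs ys) ≡ concatMap (λ x → concatMap (λ y → g (x , y)) ys) xs
concatMap-product g []       ys = refl
concatMap-product g (x ∷ xs) ys = trans (List.concatMap-++ g (map (x ,_) ys) (cartesianProduct xs ys))
  (cong₂ _++_ (List.concatMap-map g (x ,_) ys) (concatMap-product g xs ys))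

concatMap-[-] : ∀ {A : Set} (p : A → Bool) xs → concatMap (λ x → p x ∷ []) xs ≡ map p xs
concatMap-[-] p []       = refl
concatMap-[-] p (x ∷ xs) = cong (p x ∷_) (concatMap-[-] p xs)

loop-true : ∀ n → loop n (λ _ → true ∷ []) ≡ unary n
loop-true zero    = refl
loop-true (suc n) = trans (cong (_++ true ∷ []) (loop-true n)) (snoc n)
  where
  snoc : ∀ n → unary n ++ true ∷ [] ≡ unary (suc n)
  snoc zero    = refl
  snoc (suc n) = cong (true ∷_) (snoc n)

unaryᶜ : ∀ {f : Env n → ℕ} → Fun f → Gen (λ ρ → unary (f ρ))
unaryᶜ {f = f} F = extGen (λ ρ → loop-true (f ρ)) (loopᶜ F (emitᶜ (boolᶜ true)))

-- Binary numerals of powers of two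

binary-double : ∀ m → binary (suc m + suc m) ≡ false ∷ binary (suc m)
binary-double zero    = refl
binary-double (suc m) = trans (cong (increment ∘ binary ∘ suc) (ℕ.+-suc m (suc m)))
  (cong (increment ∘ increment) (trans (cong binary (sym (ℕ.+-suc m (suc m)))) (trans
    (cong binary (ℕ.+-suc m (suc m))) (binary-double m))))

binary-^ : ∀ n → binary (2 ^ n) ≡ List.replicate n false ++ true ∷ []
binary-^ zero    = refl
binary-^ (suc n) with 2 ^ n in eq | ℕ.m^n>0 2 n
... | suc m | _ = trans (cong binary (cong (suc m +_) (ℕ.+-identityʳ (suc m))))
  (trans (binary-double m) (cong (false ∷_) (trans (cong binary (sym eq)) (binary-^ n))))

length-increment : ∀ w → length w ≤ length (increment w)
length-increment []          = z≤n
length-increment (false ∷ w) = ℕ.≤-refl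
length-increment (true ∷ w)  = s≤s (length-increment w)

length-binary-mono : ∀ {m n} → m ≤ n → length (binary m) ≤ length (binary n)
length-binary-mono {n = n} m≤n with ℕ.m≤n⇒m<n∨m≡n m≤n
... | inj₂ refl = ℕ.≤-refl
... | inj₁ (s≤s {n = k} m≤n′) = ℕ.≤-trans (length-binary-mono m≤n′) (length-increment (binary k))

length-binary : ∀ {k} n → k ≤ 2 ^ n → length (binary k) ≤ suc n
length-binary n k≤ = ℕ.≤-trans (length-binary-mono k≤) (ℕ.≤-reflexive (trans (cong length (binary-^ n))
  (trans (List.length-++ (List.replicate n false)) (trans (cong (_+ 1) (List.length-replicate n)) (ℕ.+-comm n 1)))))

PolyTime-cong : ∀ {Q I : Set} {O : Oracle Q} {sz : I → ℕ} {a b} {input : I → Vec Word a} {o o′ : I → Vec Word b} →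
                (∀ i → o i ≡ o′ i) → PolyTime O sz input o → PolyTime O sz input o′
PolyTime-cong {O = O} {input = input} {o = o} {o′} eq P = record
  { program = program ; bound = bound ; correct = λ i → cast i (correct i) }
  where
  open PolyTime P
  cast : ∀ i → (∃₂ λ τ t → O ⊢⟨ program , load (input i) ⟩⇓⟨ τ , t ⟩ × t ≤ _ × unload _ τ ≡ o i) →
         ∃₂ λ τ t → O ⊢⟨ program , load (input i) ⟩⇓⟨ τ , t ⟩ × t ≤ _ × unload _ τ ≡ o′ i
  cast i (τ , t , run , t≤ , e) = τ , t , run , t≤ , trans e (eq i)

2^-FP : FP (λ n → unary n ∷ []) (λ n → binary (2 ^ n) ∷ [])
2^-FP = PolyTime-cong (λ n → cong (λ k → binary (2 ^ k) ∷ []) (List.length-replicate n)) (gen-FP gen unary)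
  where
  loop-false : ∀ n → loop n (λ _ → false ∷ []) ≡ List.replicate n false
  loop-false zero    = refl
  loop-false (suc n) = trans (cong (_++ false ∷ []) (loop-false n)) (snoc n)
    where
    snoc : ∀ n → List.replicate n false ++ false ∷ [] ≡ List.replicate (suc n) false
    snoc zero    = refl
    snoc (suc n) = cong (false ∷_) (snoc n)
  gen : Gen {0} (λ ρ → binary (2 ^ length (proj₁ ρ)))
  gen = extGen (λ ρ → trans (cong (_++ true ∷ []) (loop-false (length (proj₁ ρ)))) (sym (binary-^ (length (proj₁ ρ)))))
    (loopᶜ (lenᶜ first) (emitᶜ (boolᶜ false)) ++ᶜ emitᶜ (boolᶜ true))

-- A count of subsets of an `m`-element set is at most the `m`-th power of 2, and `m`, the number of
-- vertices or of edges, is at most the length of a word that contains the adjacency matrix. So one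
-- bound serves for all four problems.
wellBehaved : ∀ {A : Set} (read : Word → Maybe A) (f : A → ℕ → ℕ) →
              (∀ w a κ → read w ≡ just a → f a κ ≤ 2 ^ length w) → WellBehaved (onInput read f)
wellBehaved read f f≤ = record { N = 2 ^_ ; N-FP = 2^-FP ; bounded = bounded }
  where
  bounded : ∀ n i → instanceSize i ≤ n → onInput read f i ≤ 2 ^ n
  bounded n (w , κ) size≤ with read w in eq
  ... | nothing = z≤n
  ... | just a  = ℕ.≤-trans (f≤ w a κ eq) (ℕ.^-monoʳ-≤ 2 (ℕ.≤-trans (ℕ.m≤m+n (length w) κ) size≤))

-- Reading graphs

readℕ-length : ∀ w {k w′} → readℕ w ≡ just (k , w′) → length w ≡ suc (k + length w′)
readℕ-length (false ∷ w) refl = refl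
readℕ-length (true ∷ w) eq with readℕ w in eq′
readℕ-length (true ∷ w) refl | just (k , w′) = cong suc (readℕ-length w eq′)

readVec-length : ∀ n w {v} → readVec n w ≡ just v → length w ≡ n
readVec-length zero    []      eq = refl
readVec-length (suc n) (b ∷ w) eq with readVec n w in eq′
... | just v = cong suc (readVec-length n w eq′)

fromMatrix-order : ∀ n m {G} → fromMatrix n m ≡ just G → Graph.order G ≡ n
fromMatrix-order n m with all? (λ u → all? λ v → entry {n} m u v Bool.≟ entry {n} m v u)
                        | all? (λ v → entry {n} m v v Bool.≟ false)
... | yes _ | yes _ = λ { refl → refl }
... | yes _ | no _  = λ ()
... | no _  | _     = λ ()

readGraph-length : ∀ w {G} → readGraph w ≡ just G → Graph.order G + Graph.order G * Graph.order G ≤ length w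
readGraph-length w eq with readℕ w in eq₁
... | just (n , w′) with readVec (n * n) w′ in eq₂
...   | just m with fromMatrix-order n m eq
...     | refl = ℕ.≤-trans (ℕ.≤-reflexive (cong (n +_) (sym (readVec-length (n * n) w′ eq₂))))
                 (ℕ.≤-trans (ℕ.n≤1+n _) (ℕ.≤-reflexive (sym (readℕ-length w eq₁))))

readGraph,k-length : ∀ w {G k} → readGraph,k w ≡ just (G , k) → Graph.order G ≤ length w
readGraph,k-length w eq with readℕ w in eq₁
... | just (k , w′) with readGraph w′ in eq₂
readGraph,k-length w refl | just (k , w′) | just G =
  ℕ.≤-trans (ℕ.m≤m+n _ _) (ℕ.≤-trans (readGraph-length w′ eq₂)
    (ℕ.≤-trans (ℕ.m≤n+m (length w′) (suc k)) (ℕ.≤-reflexive (sym (readℕ-length w eq₁)))))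

length-product : ∀ {A B : Set} (xs : List A) (ys : List B) → length (cartesianProduct xs ys) ≡ length xs * length ys
length-product []       ys = refl
length-product (x ∷ xs) ys = trans (List.length-++ (map (x ,_) ys))
  (cong₂ _+_ (List.length-map (x ,_) ys) (length-product xs ys))

edges≤ : ∀ G → length (Graph.edges G) ≤ Graph.order G * Graph.order G
edges≤ G = ℕ.≤-trans (List.length-filter _ (cartesianProduct (allFin order) (allFin order)))
  (ℕ.≤-reflexive (trans (length-product (allFin order) (allFin order))
    (cong₂ _*_ (List.length-tabulate {n = order} id) (List.length-tabulate {n = order} id))))
  where
  open Graph G

readGraph,s,t-length : ∀ w {G st} → readGraph,s,t w ≡ just (G , st) → length (Graph.edges G) ≤ length w
readGraph,s,t-length w eq with readℕ w in eq₁
... | just (a , w₁) with readℕ w₁ in eq₂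
...   | just (b , w₂) with readGraph w₂ in eq₃
...     | just G with terminals G a b
readGraph,s,t-length w refl | just (a , w₁) | just (b , w₂) | just G | just st =
  ℕ.≤-trans (edges≤ G) (ℕ.≤-trans (ℕ.m≤n+m _ (Graph.order G)) (ℕ.≤-trans (readGraph-length w₂ eq₃)
    (ℕ.≤-trans (ℕ.m≤n+m (length w₂) (suc b)) (ℕ.≤-trans (ℕ.≤-reflexive (sym (readℕ-length w₁ eq₂)))
    (ℕ.≤-trans (ℕ.m≤n+m (length w₁) (suc a)) (ℕ.≤-reflexive (sym (readℕ-length w eq₁))))))))

if≤ : ∀ b {x B} → x ≤ B → (if b then x else 0) ≤ B
if≤ true  x≤ = x≤
if≤ false x≤ = z≤n

k-wellBehaved : ∀ {f : Graph × ℕ → ℕ → ℕ} → (∀ G k κ → f (G , k) κ ≤ 2 ^ Graph.order G) →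
                WellBehaved (onInput readGraph,k f)
k-wellBehaved f≤ = wellBehaved readGraph,k _ λ w (G , k) κ eq →
  ℕ.≤-trans (f≤ G k κ) (ℕ.^-monoʳ-≤ 2 (readGraph,k-length w eq))

st-wellBehaved : WellBehaved #k-Min-st-Cut
st-wellBehaved = wellBehaved readGraph,s,t _ λ w (G , s , t , _) κ eq →
  ℕ.≤-trans
    (count≤ (λ S → MinCut.IsMinimumCut? G s t S ×-dec (∣ S ∣ ℕ.≟ κ)))
    (ℕ.^-monoʳ-≤ 2 (readGraph,s,t-length w eq))

-- The graph on the positions of a list of labels

matrixWord : ∀ {L : Set} → (L → L → Bool) → List L → Word
matrixWord A xs = concatMap (λ x → map (A x) xs) xs

graphWord : ∀ {L : Set} → (L → L → Bool) → List L → Word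
graphWord A xs = unary (length xs) ++ false ∷ matrixWord A xs

module _ {L : Set} (A : L → L → Bool) (xs : List L) where

  rows : (ys : List L) → Vec Bool (length ys * length xs)
  rows []       = []
  rows (y ∷ ys) = Vec.map (A y) (Vec.fromList xs) Vec.++ rows ys

  toList-rows : ∀ ys → Vec.toList (rows ys) ≡ concatMap (λ y → map (A y) xs) ys
  toList-rows []       = refl
  toList-rows (y ∷ ys) = trans (Vec.toList-++ (Vec.map (A y) (Vec.fromList xs)) (rows ys))
    (cong₂ _++_ (trans (Vec.toList-map (A y) (Vec.fromList xs)) (cong (map (A y)) (Vec.toList∘fromList xs))) (toList-rows ys))

  lookup-fromList : ∀ (zs : List L) i → lookup (Vec.fromList zs) i ≡ List.lookup zs i
  lookup-fromList (z ∷ zs) zero    = refl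
  lookup-fromList (z ∷ zs) (suc i) = lookup-fromList zs i

  lookup-rows : ∀ ys u v → lookup (rows ys) (combine u v) ≡ A (List.lookup ys u) (List.lookup xs v)
  lookup-rows (y ∷ ys) zero    v = trans (Vec.lookup-++ˡ (Vec.map (A y) (Vec.fromList xs)) (rows ys) v)
    (trans (Vec.lookup-map v (A y) (Vec.fromList xs)) (cong (A y) (lookup-fromList xs v)))
  lookup-rows (y ∷ ys) (suc u) v = trans (Vec.lookup-++ʳ (Vec.map (A y) (Vec.fromList xs)) (rows ys) (combine u v))
    (lookup-rows ys u v)

readVec-toList : ∀ {n} (v : Vec Bool n) → readVec n (Vec.toList v) ≡ just v
readVec-toList []      = refl
readVec-toList (b ∷ v) = cong (_>>= λ v → just (b ∷ v)) (readVec-toList v)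

readℕ-unary : ∀ k w → readℕ (unary k ++ false ∷ w) ≡ just (k , w)
readℕ-unary zero    w = refl
readℕ-unary (suc k) w = cong (_>>= λ (n , w′) → just (suc n , w′)) (readℕ-unary k w)

fromMatrix-just : ∀ n (m : Vec Bool (n * n)) → (∀ u v → entry {n} m u v ≡ entry {n} m v u) → (∀ v → entry {n} m v v ≡ false) →
                  ∃₂ λ s i → fromMatrix n m ≡ just (record { order = n ; adj = entry m ; symm = s ; irrefl = i })
fromMatrix-just n m s i with all? (λ u → all? λ v → entry {n} m u v Bool.≟ entry {n} m v u)
                           | all? (λ v → entry {n} m v v Bool.≟ false)
... | yes s′ | yes i′ = s′ , i′ , refl
... | yes _  | no ¬i  = contradiction i ¬i
... | no ¬s  | _      = contradiction s ¬s

module _ {L : Set} (A : L → L → Bool) (A-sym : ∀ x y → A x y ≡ A y x) (A-irr : ∀ x → A x x ≡ false)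
         (xs : List L) where

  -- The proofs of symmetry and irreflexivity are those found by the decision procedure in
  -- `fromMatrix`, so the graph is exposed only through a description of its adjacency. The
  -- combinatorial modules are therefore parameterized by `adj`, its two proofs and `adj≡`.
  readGraph-graphWord : ∃ λ (adj : Fin (length xs) → Fin (length xs) → Bool) → ∃₂ λ s i →
    readGraph (graphWord A xs) ≡ just (record { order = length xs ; adj = adj ; symm = s ; irrefl = i }) ×
    (∀ u v → adj u v ≡ A (List.lookup xs u) (List.lookup xs v))
  readGraph-graphWord = entry m , s , i , eq , adj≡
    where
    N : ℕ
    N = length xs
    m : Vec Bool (N * N)
    m = rows A xs xs
    adj≡ : ∀ u v → entry m u v ≡ A (List.lookup xs u) (List.lookup xs v)
    adj≡ = lookup-rows A xs xs
    just! : ∃₂ λ s i → fromMatrix N m ≡ just (record { order = N ; adj = entry m ; symm = s ; irrefl = i })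
    just! = fromMatrix-just N m (λ u v → trans (adj≡ u v) (trans (A-sym _ _) (sym (adj≡ v u))))
              (λ v → trans (adj≡ v v) (A-irr _))
    s = proj₁ just!
    i = proj₁ (proj₂ just!)
    eq : readGraph (graphWord A xs) ≡ just (record { order = N ; adj = entry m ; symm = s ; irrefl = i })
    eq = trans (cong (_>>= λ (n , w′) → readVec (n * n) w′ >>= fromMatrix n) (readℕ-unary N (matrixWord A xs)))
         (trans (cong (_>>= fromMatrix N) (trans (cong (readVec (N * N)) (sym (toList-rows A xs xs))) (readVec-toList m)))
                (proj₂ (proj₂ just!)))

-- Compositions computed from the code of the whole sequence

maximum-first : ∀ n ns → n ≤ maximum (n ∷ ns)
maximum-first n ns = ℕ.m≤m⊔n n (maximum ns)

-- A code that starts with a terminator stems from empty words only, and then the total length is 0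
-- and just constant time is allowed. Pushing one symbol turns the leading number into 1, which
-- yields an unreadable instance or one with a mismatched parameter, of value 0. Without it the code
-- could denote the empty graph with `k` equal to 0, which has a solution.
composeWord : (Word → Word) → (Word → ℕ) → Word → Instance
composeWord g k []            = [] , 0
composeWord g k w@(false ∷ _) = true ∷ w , 0
composeWord g k w@(true ∷ _)  = g w , k w

module Composition (Q : ParameterizedCountingProblem) {g : Word → Word} {k : Word → ℕ}
  (G : Gen {0} (g ∘ proj₁)) (F : Fun {0} (k ∘ proj₁))
  (empty : ∀ t → Q (true ∷ false ∷ List.replicate t false , 0) ≡ 0)
  (small : ∀ x xs → All (λ y → length y ≡ length x) (x ∷ xs) → k (encodeList (x ∷ xs)) ≤ length x * length x)
  (value : ∀ x xs → All (λ y → length y ≡ length x) (x ∷ xs) → 0 < length x →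
           Q (g (encodeList (x ∷ xs)) , k (encodeList (x ∷ xs))) ≡ sum (map #Closed (x ∷ xs))) where

  open Output {o = g ∘ proj₁} {k = k ∘ proj₁} G F

  private
    program : ∀ {Q} → Program Q
    program = branch 0 skip (push true 0) outputs

    bound : Pol
    bound = con 2 ⊞ outputsTime ⊚ (con 3 ⊠ var)

    Sequence : Set
    Sequence = Σ[ xs ∈ List⁺ Word ] AllPairs (λ x y → length x ≡ length y) (List⁺.toList xs)

    strings : Sequence → List Word
    strings (xs , _) = List⁺.toList xs

    total : Sequence → ℕ
    total i = sum (map length (strings i))

    code : Sequence → Word
    code i = encodeList (strings i)

    compose : Sequence → Instance
    compose = composeWord g k ∘ code

    same : ∀ {x : Word} {xs} → AllPairs (λ x y → length x ≡ length y) (x ∷ xs) → All (λ y → length y ≡ length x) (x ∷ xs)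
    same (eqs ∷ _) = refl ∷ All.map sym eqs

    code-false : ∀ xs → All (λ (y : Word) → length y ≡ 0) xs → encodeList xs ≡ List.replicate (length xs) false
    code-false []        []        = refl
    code-false ([] ∷ xs) (_ ∷ eqs) = cong (false ∷_) (code-false xs eqs)

    sum-lengths : ∀ {l} xs → All (λ (y : Word) → length y ≡ l) xs → sum (map length xs) ≡ length xs * l
    sum-lengths []       []         = refl
    sum-lengths (x ∷ xs) (eq ∷ eqs) = cong₂ _+_ eq (sum-lengths xs eqs)

    sum-empty : ∀ xs → All (λ (y : Word) → length y ≡ 0) xs → sum (map #Closed xs) ≡ 0
    sum-empty []        []        = refl
    sum-empty ([] ∷ xs) (_ ∷ eqs) = sum-empty xs eqs

    program-run : ∀ i → Run noOracle program (load (code i ∷ []))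
                            (λ τ → unload 2 τ ≡ encode (compose i)) (ev bound (total i))
    program-run (([] List⁺.∷ xs) , _) = _ , 2 , ⇓false refl ⇓push , ℕ.m≤m+n 2 _ , refl
    program-run i@(((b ∷ x) List⁺.∷ xs) , pairs) = weaken
      (branch-run {p₀ = skip} {push true 0} {outputs} 0 (load (code i ∷ [])) (λ ()) (λ _ ())
        (λ _ _ → outputs-run (code i) [] (load (code i ∷ [])) refl refl (λ _ → refl)))
      (s≤s (ℕ.≤-trans (ev-mono outputsTime len) (ℕ.n≤1+n _)))
      λ τ (e , e′) → cong₂ (λ u v → u ∷ v ∷ []) e e′
      where
      l t : ℕ
      l = length (b ∷ x)
      t = length (strings i)
      -- Time is measured in the lengths of the words, whereas the code also contains a terminator
      -- for each of them; nonempty words pay for their terminators.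
      stride≤ : stride l ≤ 3 * l
      stride≤ = ℕ.≤-trans (ℕ.+-monoˡ-≤ (l + l) (s≤s z≤n)) (ℕ.≤-reflexive (ring l))
        where
        ring : ∀ l → l + (l + l) ≡ 3 * l
        ring = solve-∀
      len : length (code i) + 0 ≤ 3 * total i
      len = ℕ.≤-trans (ℕ.≤-reflexive (trans (ℕ.+-identityʳ _) (length-encodeList (strings i) (same pairs))))
        (ℕ.≤-trans (ℕ.*-monoʳ-≤ t stride≤) (ℕ.≤-reflexive (trans (ring t l) (cong (3 *_) (sym (sum-lengths (strings i) (same pairs)))))))
        where
        ring : ∀ t l → t * (3 * l) ≡ 3 * (t * l)
        ring = solve-∀

    values : ∀ i → Q (compose i) ≡ sum (map #Closed (strings i))
    values (([] List⁺.∷ xs) , pairs) = trans (cong (λ w → Q (true ∷ false ∷ w , 0)) (code-false xs (All.tail (same pairs))))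
      (trans (empty (length xs)) (sym (sum-empty xs (All.tail (same pairs)))))
    values (((b ∷ x) List⁺.∷ xs) , pairs) = value (b ∷ x) xs (same pairs) (s≤s z≤n)

    parameter : ∀ i → proj₂ (compose i) ≤ ⟦ polynomial (var ⊠ var) ⟧ (maximum (map length (strings i)) + ⌈log₂ length (strings i) ⌉)
    parameter (([] List⁺.∷ xs) , pairs) = z≤n
    parameter (((b ∷ x) List⁺.∷ xs) , pairs) = ℕ.≤-trans (small (b ∷ x) xs (same pairs))
      (ℕ.≤-trans (ℕ.*-mono-≤ max max) (ℕ.≤-reflexive (sym (polynomial-ev (var ⊠ var) m))))
      where
      m : ℕ
      m = maximum (map length ((b ∷ x) ∷ xs)) + ⌈log₂ length ((b ∷ x) ∷ xs) ⌉
      max : length (b ∷ x) ≤ m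
      max = ℕ.≤-trans (maximum-first (length (b ∷ x)) (map length xs)) (ℕ.m≤m+n _ _)

  composition : SUMCrossComposition #Closed Q
  composition = record
    { equivalence    = sameLength
    ; compose        = compose
    ; compose-FP     = record
      { program = program
      ; bound   = polynomial bound
      ; correct = λ i → halts bound (total i) (program-run i) ℕ.≤-refl (λ _ → id)
      }
    ; parameterBound = polynomial (var ⊠ var)
    ; smallParameter = parameter
    ; sums           = values
    }

-- Counting by coordinates

count-suc : ∀ {n} {P : Pred (Vec Bool (suc n)) 0ℓ} (P? : Decidable P) →
            count P? ≡ count (P? ∘ (false ∷_)) + count (P? ∘ (true ∷_))
count-suc {n} P? = trans (cong length (List.filter-++ P? (map (false ∷_) vs) _))
  (trans (List.length-++ (filter P? (map (false ∷_) vs)))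
  (cong₂ _+_ (half false vs) (trans (cong (length ∘ filter P?) (List.++-identityʳ (map (true ∷_) vs))) (half true vs))))
  where
  vs : List (Vec Bool n)
  vs = vectors bools n
  half : ∀ b vs → length (filter P? (map (b ∷_) vs)) ≡ length (filter (P? ∘ (b ∷_)) vs)
  half b []       = refl
  half b (v ∷ vs) with does (P? (b ∷ v))
  ... | true  = cong suc (half b vs)
  ... | false = half b vs

count-++ : ∀ m {n} {P : Pred (Vec Bool (m + n)) 0ℓ} (P? : Decidable P) →
           count P? ≡ sum (map (λ x → count (λ y → P? (x Vec.++ y))) (vectors bools m))
count-++ zero    P? = sym (ℕ.+-identityʳ _)
count-++ (suc m) P? = trans (count-suc P?) (trans
  (cong₂ _+_ (count-++ m (P? ∘ (false ∷_))) (count-++ m (P? ∘ (true ∷_))))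
  (sym (trans (cong sum (List.map-++ h (map (false ∷_) vs) _)) (trans (Sum.sum-++ (map h (map (false ∷_) vs)) _)
    (cong₂ _+_ (cong sum (sym (List.map-∘ vs)))
      (trans (cong (sum ∘ map h) (List.++-identityʳ (map (true ∷_) vs))) (cong sum (sym (List.map-∘ vs)))))))))
  where
  vs = vectors bools m
  h = λ x → count (λ y → P? (x Vec.++ y))

product : List ℕ → ℕ
product = List.foldr _*_ 1

count-Π : ∀ {A : Set} (xs : List A) {P : A → Bool → Set} (P? : ∀ a b → Dec (P a b)) →
          count {length xs} (λ c → all? λ k → P? (List.lookup xs k) (lookup c k)) ≡
          product (map (λ a → [ P? a false ] + [ P? a true ]) xs)
count-Π []       P? = refl
count-Π (x ∷ xs) {P} P? = trans (count-suc all′) (trans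
  (cong₂ _+_ (split false (P? x false)) (split true (P? x true)))
  (trans (sym (ℕ.*-distribʳ-+ rest [ P? x false ] [ P? x true ])) (cong (([ P? x false ] + [ P? x true ]) *_) (count-Π xs P?))))
  where
  All′ : Vec Bool (suc (length xs)) → Set
  All′ c = ∀ k → P (List.lookup (x ∷ xs) k) (lookup c k)
  all′ : Decidable All′
  all′ c = all? λ k → P? (List.lookup (x ∷ xs) k) (lookup c k)
  tail? : Decidable (λ (c : Vec Bool (length xs)) → ∀ k → P (List.lookup xs k) (lookup c k))
  tail? c = all? λ k → P? (List.lookup xs k) (lookup c k)
  rest : ℕ
  rest = count tail?
  split : ∀ b (d : Dec (P x b)) → count (all′ ∘ (b ∷_)) ≡ [ d ] * rest
  split b (yes p) = trans (count-cong (all′ ∘ (b ∷_)) tail? (λ c f → f ∘ suc)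
                        (λ { c f zero → p ; c f (suc k) → f k })) (sym (ℕ.+-identityʳ rest))
  split b (no ¬p) = cong length (List.filter-none (all′ ∘ (b ∷_)) (All.tabulate {xs = vectors bools (length xs)} λ _ f → ¬p (f zero)))

[]-no : ∀ {P : Set} (d : Dec P) → ¬ P → [ d ] ≡ 0
[]-no (yes p) ¬p = contradiction p ¬p
[]-no (no _)  _  = refl

sum-mod : ∀ {A : Set} {P : Pred A 0ℓ} (P? : Decidable P) m (h : A → ℕ) → (∀ a → P a → h a ≡ 1) → (∀ a → ¬ P a → m ∣ h a) →
          ∀ xs → ∃ λ z → sum (map h xs) ≡ length (filter P? xs) + z * m
sum-mod P? m h one div []       = 0 , refl
sum-mod P? m h one div (x ∷ xs) with sum-mod P? m h one div xs | P? x
... | z , eq | yes p = z , cong₂ _+_ (one x p) eq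
... | z , eq | no ¬p with div x ¬p
...   | divides q hx = q + z , trans (cong₂ _+_ hx eq) (ring q m (length (filter P? xs)) z)
  where
  ring : ∀ q m l z → q * m + (l + z * m) ≡ l + (q + z) * m
  ring = solve-∀

-- Monotone constraints as closed sets
--
-- A clause (s , mem) on the coordinates labelled by LX is violated if every
-- coordinate in mem has the value not s.  A node with arcs from (s = true)
-- or to (s = false) the members of the clause is free if the clause is
-- violated and determined otherwise, so r copies of it contribute the factor
-- 2 ^ r or 1.

module Constraints {𝕏 : Set} (LX : List 𝕏) (LC : List (Bool × (𝕏 → Bool))) (r : ℕ) where

  Clause : Set
  Clause = Bool × (𝕏 → Bool)

  private
    a : ℕ
    a = length LX

  Violated : Vec Bool a → Clause → Set
  Violated S (s , mem) = ∀ x → T (mem (List.lookup LX x)) → lookup S x ≡ not s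

  violated? : ∀ S c → Dec (Violated S c)
  violated? S (s , mem) = all? λ x → T? _ →-dec (lookup S x Bool.≟ not s)

  Good : Vec Bool a → Set
  Good S = All (λ c → ¬ Violated S c) LC

  good? : Decidable Good
  good? S = All.all? (λ c → ¬? (violated? S c)) LC

  abstract
    #good : ℕ
    #good = count good?

    #good≡ : #good ≡ count good?
    #good≡ = refl

  CC : List Clause
  CC = concatMap (replicate r) LC

  nodes : List (𝕏 ⊎ Clause)
  nodes = map inj₁ LX ++ map inj₂ CC

  A : 𝕏 ⊎ Clause → 𝕏 ⊎ Clause → Bool
  A (inj₁ x) (inj₂ (s , mem)) = s ∧ mem x
  A (inj₂ (s , mem)) (inj₁ x) = not s ∧ mem x
  A _        _                = false

  private
    b : ℕ
    b = length CC

  length-nodes : length nodes ≡ a + b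
  length-nodes = trans (List.length-++ (map inj₁ LX)) (cong₂ _+_ (List.length-map inj₁ LX) (List.length-map inj₂ CC))

  Allowed : Vec Bool a → Clause → Bool → Set
  Allowed S c β = β ≡ proj₁ c ⊎ Violated S c

  allowed? : ∀ S c β → Dec (Allowed S c β)
  allowed? S c β = (β Bool.≟ proj₁ c) ⊎-dec violated? S c

  node : Fin (a + b) → 𝕏 ⊎ Clause
  node u = Sum.map (List.lookup LX) (List.lookup CC) (splitAt a u)

  ways : Vec Bool a → Clause → ℕ
  ways S c = [ allowed? S c false ] + [ allowed? S c true ]

  ways-good : ∀ S c → ¬ Violated S c → ways S c ≡ 1
  ways-good S c@(false , mem) ¬v = cong₂ _+_ ([]-yes (allowed? S c false) (inj₁ refl))
    ([]-no (allowed? S c true) λ { (inj₂ v) → ¬v v })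
  ways-good S c@(true , mem) ¬v = cong₂ _+_ ([]-no (allowed? S c false) λ { (inj₂ v) → ¬v v })
    ([]-yes (allowed? S c true) (inj₁ refl))

  ways-bad : ∀ S c → Violated S c → ways S c ≡ 2
  ways-bad S c v = cong₂ _+_ ([]-yes (allowed? S c false) (inj₂ v)) ([]-yes (allowed? S c true) (inj₂ v))

  product-++ : ∀ xs ys → product (xs ++ ys) ≡ product xs * product ys
  product-++ []       ys = sym (ℕ.+-identityʳ _)
  product-++ (x ∷ xs) ys = trans (cong (x *_) (product-++ xs ys)) (sym (ℕ.*-assoc x (product xs) (product ys)))

  product-replicate : ∀ k (c : Clause) S → product (map (ways S) (replicate k c)) ≡ ways S c ^ k
  product-replicate zero    c S = refl
  product-replicate (suc k) c S = cong (ways S c *_) (product-replicate k c S)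

  extensions : Vec Bool a → ℕ
  extensions S = product (map (ways S) CC)

  expand : ∀ S c cs → product (map (ways S) (concatMap (replicate r) (c ∷ cs))) ≡
                      ways S c ^ r * product (map (ways S) (concatMap (replicate r) cs))
  expand S c cs = trans (cong product (List.map-++ (ways S) (replicate r c) _))
    (trans (product-++ (map (ways S) (replicate r c)) _) (cong (_* _) (product-replicate r c S)))

  extensions-good : ∀ S → Good S → extensions S ≡ 1
  extensions-good S = go LC
    where
    go : ∀ cs → All (λ c → ¬ Violated S c) cs → product (map (ways S) (concatMap (replicate r) cs)) ≡ 1
    go []       []       = refl
    go (c ∷ cs) (¬v ∷ g) = trans (expand S c cs) (cong₂ _*_ (trans (cong (_^ r) (ways-good S c ¬v)) (ℕ.^-zeroˡ r)) (go cs g))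

  extensions-bad : ∀ S → ¬ Good S → 2 ^ r ∣ extensions S
  extensions-bad S = go LC
    where
    open import Data.Nat.Divisibility using (∣n⇒∣m*n; ∣m⇒∣m*n; ∣-reflexive)
    go : ∀ cs → ¬ All (λ c → ¬ Violated S c) cs → 2 ^ r ∣ product (map (ways S) (concatMap (replicate r) cs))
    go []       ¬g = contradiction [] ¬g
    go (c ∷ cs) ¬g with violated? S c
    ... | yes v = subst (2 ^ r ∣_) (sym (expand S c cs))
                    (∣m⇒∣m*n _ (∣-reflexive (cong (_^ r) (sym (ways-bad S c v)))))
    ... | no ¬v = subst (2 ^ r ∣_) (sym (expand S c cs)) (∣n⇒∣m*n (ways S c ^ r) (go cs (λ g → ¬g (¬v ∷ g))))

  module _ (R : ℕ → ℕ → Bool) (R≡ : ∀ u v → R (toℕ u) (toℕ v) ≡ A (node u) (node v)) where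

    private
      node-X : ∀ x → node (x ↑ˡ b) ≡ inj₁ (List.lookup LX x)
      node-X x = cong (Sum.map _ _) (Fin.splitAt-↑ˡ a x b)

      node-C : ∀ k → node (a ↑ʳ k) ≡ inj₂ (List.lookup CC k)
      node-C k = cong (Sum.map _ _) (Fin.splitAt-↑ʳ a b k)

      up : ∀ x k → R (toℕ (x ↑ˡ b)) (toℕ (a ↑ʳ k)) ≡ proj₁ (List.lookup CC k) ∧ proj₂ (List.lookup CC k) (List.lookup LX x)
      up x k = trans (R≡ _ _) (cong₂ A (node-X x) (node-C k))

      down : ∀ x k → R (toℕ (a ↑ʳ k)) (toℕ (x ↑ˡ b)) ≡ not (proj₁ (List.lookup CC k)) ∧ proj₂ (List.lookup CC k) (List.lookup LX x)
      down x k = trans (R≡ _ _) (cong₂ A (node-C k) (node-X x))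

    closed⇒allowed : ∀ S c → Closed (a + b) R (S Vec.++ c) → ∀ k → Allowed S (List.lookup CC k) (lookup c k)
    closed⇒allowed S c closed k with List.lookup CC k in eqC | lookup c k in eqc
    ... | true  , mem | true  = inj₁ refl
    ... | false , mem | false = inj₁ refl
    ... | true , mem | false = inj₂ violated
      where
      violated : ∀ x → T (mem (List.lookup LX x)) → lookup S x ≡ false
      violated x m with lookup S x in eqS
      ... | false = refl
      ... | true  = contradiction (closed (x ↑ˡ b) (a ↑ʳ k)
            (subst T (sym (trans (up x k) (cong (λ c → proj₁ c ∧ proj₂ c (List.lookup LX x)) eqC))) m)
            (≡⇒T (trans (Vec.lookup-++ˡ S c x) eqS)))
            (subst (¬_ ∘ T) (sym (trans (Vec.lookup-++ʳ S c k) eqc)) id)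
    ... | false , mem | true = inj₂ λ x m → trans (sym (Vec.lookup-++ˡ S c x)) (T⇒≡ (closed (a ↑ʳ k) (x ↑ˡ b)
            (subst T (sym (trans (down x k) (cong (λ c → not (proj₁ c) ∧ proj₂ c (List.lookup LX x)) eqC))) m)
            (≡⇒T (trans (Vec.lookup-++ʳ S c k) eqc))))

    allowed⇒closed : ∀ S c → (∀ k → Allowed S (List.lookup CC k) (lookup c k)) → Closed (a + b) R (S Vec.++ c)
    allowed⇒closed S c allowed u v Ruv Su = split (splitAt a u) (splitAt a v)
        (Fin.join-splitAt a b u) (Fin.join-splitAt a b v)
      where
      split : (p q : Fin a ⊎ Fin b) → Fin.join a b p ≡ u → Fin.join a b q ≡ v → T (lookup (S Vec.++ c) v)
      split (inj₁ x) (inj₁ y) refl refl = ⊥-elim (subst T (trans (R≡ _ _) (cong₂ A (node-X x) (node-X y))) Ruv)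
      split (inj₂ k) (inj₂ l) refl refl = ⊥-elim (subst T (trans (R≡ _ _) (cong₂ A (node-C k) (node-C l))) Ruv)
      split (inj₁ x) (inj₂ k) refl refl with List.lookup CC k in eqC | allowed k
      ... | s , mem | h with subst T (trans (up x k) (cong (λ c → proj₁ c ∧ proj₂ c (List.lookup LX x)) eqC)) Ruv
      split (inj₁ x) (inj₂ k) refl refl | true , mem | inj₁ c≡ | m = ≡⇒T (trans (Vec.lookup-++ʳ S c k) c≡)
      split (inj₁ x) (inj₂ k) refl refl | true , mem | inj₂ viol | m =
        ⊥-elim (subst T (trans (Vec.lookup-++ˡ S c x) (viol x m)) Su)
      split (inj₂ k) (inj₁ x) refl refl with List.lookup CC k in eqC | allowed k
      ... | s , mem | h with subst T (trans (down x k) (cong (λ c → not (proj₁ c) ∧ proj₂ c (List.lookup LX x)) eqC)) Ruv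
      split (inj₂ k) (inj₁ x) refl refl | false , mem | inj₁ c≡ | m =
        ⊥-elim (subst T (trans (Vec.lookup-++ʳ S c k) c≡) Su)
      split (inj₂ k) (inj₁ x) refl refl | false , mem | inj₂ viol | m = ≡⇒T (trans (Vec.lookup-++ˡ S c x) (viol x m))

    -- Closed sets are grouped by their restriction `S` to the coordinates. Clause nodes are not
    -- joined to each other, so their values are chosen independently and the number of extensions
    -- of `S` is a product: 1 if no clause is violated, and otherwise divisible by the contribution
    -- of the copies of a violated clause.
    closedSets-mod : ∃ λ z → closedSets (a + b) R ≡ #good + z * 2 ^ r
    closedSets-mod with sum-mod good? (2 ^ r) extensions extensions-good extensions-bad (vectors bools a)
    ... | z , eq = z , trans (count-++ a (closed? (a + b) R)) (trans (cong sum (List.map-cong inner (vectors bools a)))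
        (trans eq (cong (_+ z * 2 ^ r) (sym #good≡))))
      where
      inner : ∀ S → count (λ c → closed? (a + b) R (S Vec.++ c)) ≡ extensions S
      inner S = trans (count-cong _ (λ c → all? λ k → allowed? S (List.lookup CC k) (lookup c k))
                         (closed⇒allowed S) (allowed⇒closed S))
                      (count-Π CC (allowed? S))

bitAt-toList : ∀ {n} (v : Vec Bool n) i → bitAt (Vec.toList v) (toℕ i) ≡ lookup v i
bitAt-toList (b ∷ v) zero    = refl
bitAt-toList (b ∷ v) (suc i) = bitAt-toList v i

bitAt-matrixWord : ∀ {L : Set} (A : L → L → Bool) xs u v →
                   arcs (matrixWord A xs) (length xs) (toℕ u) (toℕ v) ≡ A (List.lookup xs u) (List.lookup xs v)
bitAt-matrixWord A xs u v = begin
  bitAt (matrixWord A xs) (toℕ u * length xs + toℕ v)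
    ≡⟨ cong₂ bitAt (sym (toList-rows A xs xs)) (trans (cong (_+ toℕ v) (ℕ.*-comm (toℕ u) (length xs))) (sym (Fin.toℕ-combine u v))) ⟩
  bitAt (Vec.toList (rows A xs xs)) (toℕ (combine u v)) ≡⟨ bitAt-toList (rows A xs xs) (combine u v) ⟩
  lookup (rows A xs xs) (combine u v)                   ≡⟨ lookup-rows A xs xs u v ⟩
  A (List.lookup xs u) (List.lookup xs v)               ∎
  where open ≡-Reasoning

length-matrixWord : ∀ {L : Set} (A : L → L → Bool) xs → length (matrixWord A xs) ≡ length xs * length xs
length-matrixWord A xs = trans (cong length (sym (toList-rows A xs xs))) (Vec.length-toList (rows A xs xs))

-- Programs as flat code

clamp : ∀ m → ℕ → Fin (suc m)
clamp m k = fromℕ< (s≤s (ℕ.m⊓n≤n k m))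

toℕ-clamp : ∀ {m k} → k ≤ m → toℕ (clamp m k) ≡ k
toℕ-clamp k≤m = trans (toℕ-fromℕ< _) (ℕ.m≤n⇒m⊓n≡m k≤m)

codeSize : Program ⊥ → ℕ
codeSize (p ⨾ q)          = codeSize p + codeSize q
codeSize (branch r p q s) = suc (codeSize p + (codeSize q + codeSize s))
codeSize (while r p)      = suc (codeSize p)
codeSize _                = 1

registers : Program ⊥ → ℕ
registers (push b r)       = r
registers (pop r)          = r
registers (p ⨾ q)          = registers p ⊔ registers q
registers (branch r p q s) = r ⊔ (registers p ⊔ (registers q ⊔ registers s))
registers (while r p)      = r ⊔ registers p
registers skip             = 0

nth : Word → ℕ → Maybe Bool
nth []      j       = nothing
nth (b ∷ w) zero    = just b
nth (b ∷ w) (suc j) = nth w j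

data Instr (L R : ℕ) : Set where
  jump : Fin L → Instr L R
  put  : Bool → Fin R → Fin L → Instr L R
  drop : Fin R → Fin L → Instr L R
  test : Fin R → (ifEmpty ifFalse ifTrue : Fin L) → Instr L R

choose : ∀ {A : Set} → Maybe Bool → A → A → A → A
choose nothing      e f t = e
choose (just false) e f t = f
choose (just true)  e f t = t

Config : ℕ → Set
Config L = Fin L × Store

exec : ∀ {L R} → Instr L R → Store → Config L
exec (jump n)       σ = n , σ
exec (put b q n)    σ = n , σ [ toℕ q ≔ b ∷ σ (toℕ q) ]
exec (drop q n)     σ = n , σ [ toℕ q ≔ List.drop 1 (σ (toℕ q)) ]
exec (test q e f t) σ = choose (nth (σ (toℕ q)) 0) e f t , σ

module Code {h R : ℕ} (C : Fin (suc h) → Instr (suc h) (suc R)) where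

  step : Config (suc h) → Config (suc h)
  step (l , σ) = exec (C l) σ

  steps : ℕ → Config (suc h) → Config (suc h)
  steps zero    c = c
  steps (suc t) c = steps t (step c)

  steps-+ : ∀ s t c → steps (s + t) c ≡ steps t (steps s c)
  steps-+ zero    t c = refl
  steps-+ (suc s) t c = steps-+ s t (step c)

  steps-suc : ∀ t c → steps (suc t) c ≡ step (steps t c)
  steps-suc t c = trans (cong (λ k → steps k c) (ℕ.+-comm 1 t)) (steps-+ t 1 c)

  reg : ℕ → Fin (suc R)
  reg = clamp R

  -- The code of p occupies C with entry a and exit b.
  At : Program ⊥ → Fin (suc h) → Fin (suc h) → Set
  At skip             a b = C a ≡ jump b
  At (push β r)       a b = C a ≡ put β (reg r) b
  At (pop r)          a b = C a ≡ drop (reg r) b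
  At (p ⨾ q)          a b = ∃ λ m → At p a m × At q m b
  At (branch r p q s) a b = ∃ λ p₀ → ∃₂ λ q₀ s₀ → C a ≡ test (reg r) p₀ q₀ s₀ × At p p₀ b × At q q₀ b × At s s₀ b
  At (while r p)      a b = ∃ λ m → C a ≡ test (reg r) b m m × At p m a

  -- The number of steps is preserved exactly: sequencing is free in both semantics, since the exit
  -- of one part is the entry of the next, and every other construct is one instruction. The body of
  -- a loop has the test as its exit.
  simulate : ∀ p {a b σ τ t} → At p a b → registers p ≤ R → noOracle ⊢⟨ p , σ ⟩⇓⟨ τ , t ⟩ →
             steps t (a , σ) ≡ (b , τ)
  simulate skip at r≤ ⇓skip = cong (λ i → exec i _) at
  simulate (push β r) {σ = σ} at r≤ ⇓push rewrite at | toℕ-clamp r≤ = refl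
  simulate (pop r) {σ = σ} at r≤ ⇓pop rewrite at | toℕ-clamp r≤ = refl
  simulate (p ⨾ q) {a} {σ = σ} (m , at₁ , at₂) r≤ (⇓seq {s = s} {t} run₁ run₂) =
    trans (steps-+ s t (a , σ)) (trans (cong (steps t) (simulate p at₁ (ℕ.m⊔n≤o⇒m≤o _ _ r≤) run₁))
      (simulate q at₂ (ℕ.m⊔n≤o⇒n≤o _ _ r≤) run₂))
  simulate (branch r p q s) {σ = σ} (p₀ , q₀ , s₀ , at , atp , atq , ats) r≤ (⇓empty {t = t} eq run)
    rewrite at | toℕ-clamp (ℕ.m⊔n≤o⇒m≤o r _ r≤) | eq =
      simulate p atp (ℕ.m⊔n≤o⇒m≤o _ _ (ℕ.m⊔n≤o⇒n≤o r _ r≤)) run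
  simulate (branch r p q s) {σ = σ} (p₀ , q₀ , s₀ , at , atp , atq , ats) r≤ (⇓false {t = t} eq run)
    rewrite at | toℕ-clamp (ℕ.m⊔n≤o⇒m≤o r _ r≤) | eq =
      simulate q atq (ℕ.m⊔n≤o⇒m≤o _ _ (ℕ.m⊔n≤o⇒n≤o (registers p) _ (ℕ.m⊔n≤o⇒n≤o r _ r≤))) run
  simulate (branch r p q s) {σ = σ} (p₀ , q₀ , s₀ , at , atp , atq , ats) r≤ (⇓true {t = t} eq run)
    rewrite at | toℕ-clamp (ℕ.m⊔n≤o⇒m≤o r _ r≤) | eq =
      simulate s ats (ℕ.m⊔n≤o⇒n≤o (registers q) _ (ℕ.m⊔n≤o⇒n≤o (registers p) _ (ℕ.m⊔n≤o⇒n≤o r _ r≤))) run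
  simulate (while r p) (m , at , atp) r≤ (⇓done eq)
    rewrite at | toℕ-clamp (ℕ.m⊔n≤o⇒m≤o r _ r≤) | eq = refl
  simulate (while r p) {a} {σ = σ} loop@(m , at , atp) r≤ (⇓loop {s = s} {t = t} {b = β} eq run₁ run₂) =
    trans (cong (steps (s + t)) enter) (trans (steps-+ s t (m , σ))
      (trans (cong (steps t) (simulate p atp (ℕ.m⊔n≤o⇒n≤o r _ r≤) run₁)) (simulate (while r p) loop r≤ run₂)))
    where
    both : ∀ β → choose (just β) _ m m ≡ m
    both false = refl
    both true  = refl
    enter : step (a , σ) ≡ (m , σ)
    enter rewrite at | toℕ-clamp (ℕ.m⊔n≤o⇒m≤o r (registers p) r≤) | eq = cong (_, σ) (both β)

-- Code for a fixed program

module Flat (prog : Program ⊥) where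

  h R : ℕ
  h = codeSize prog
  -- The added 1 guarantees that `Symbols` has at least two entries, for the input in register 0 and
  -- the witness in register 1, even if the program mentions register 0 only.
  R = suc (registers prog)

  loc : ℕ → Fin (suc h)
  loc = clamp h

  codeAt : Program ⊥ → ℕ → Fin (suc h) → ℕ → Instr (suc h) (suc R)
  codeAt skip       a b k = jump b
  codeAt (push β r) a b k = put β (clamp R r) b
  codeAt (pop r)    a b k = drop (clamp R r) b
  codeAt (p ⨾ q)    a b k = if k <ᵇ codeSize p then codeAt p a (loc (a + codeSize p)) k
                                               else codeAt q (a + codeSize p) b (k ∸ codeSize p)
  codeAt (branch r p q s) a b zero = test (clamp R r) (loc (suc a)) (loc (suc a + codeSize p)) (loc (suc a + codeSize p + codeSize q))
  codeAt (branch r p q s) a b (suc k) =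
    if k <ᵇ codeSize p then codeAt p (suc a) b k
    else if (k ∸ codeSize p) <ᵇ codeSize q then codeAt q (suc a + codeSize p) b (k ∸ codeSize p)
    else codeAt s (suc a + codeSize p + codeSize q) b (k ∸ codeSize p ∸ codeSize q)
  codeAt (while r p) a b zero    = test (clamp R r) b (loc (suc a)) (loc (suc a))
  codeAt (while r p) a b (suc k) = codeAt p (suc a) (loc a) k

  -- The location `h` behind the code is the exit and jumps to itself. A halted configuration
  -- therefore persists and can be inspected at a time fixed in advance.
  C : Fin (suc h) → Instr (suc h) (suc R)
  C l = if toℕ l <ᵇ h then codeAt prog 0 (loc h) (toℕ l) else jump (loc h)

  open Code C public

  private
    if-yes : ∀ {A : Set} {k n} {x y : A} → k < n → (if k <ᵇ n then x else y) ≡ x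
    if-yes {k = k} {n} {x} {y} k<n = cong (λ b → if b then x else y) (dec-true (k ℕ.<? n) k<n)

    if-no : ∀ {A : Set} {k n} {x y : A} → n ≤ k → (if k <ᵇ n then x else y) ≡ y
    if-no {k = k} {n} {x} {y} n≤k = cong (λ b → if b then x else y) (dec-false (k ℕ.<? n) (ℕ.≤⇒≯ n≤k))

  Placed : Program ⊥ → ℕ → Fin (suc h) → Set
  Placed p a b = ∀ k → k < codeSize p → C (loc (a + k)) ≡ codeAt p a b k

  first-instr : ∀ {p a b} → Placed p a b → 0 < codeSize p → C (loc a) ≡ codeAt p a b 0
  first-instr {a = a} placed pos = trans (cong (C ∘ loc) (sym (ℕ.+-identityʳ a))) (placed 0 pos)

  left : ∀ {p q a b} → Placed (p ⨾ q) a b → Placed p a (loc (a + codeSize p))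
  left placed k k< = trans (placed k (ℕ.<-≤-trans k< (ℕ.m≤m+n _ _))) (if-yes k<)

  right : ∀ {p q a b} → Placed (p ⨾ q) a b → Placed q (a + codeSize p) b
  right {p} {q} {a} {b} placed k k< = trans (cong (C ∘ loc) (ℕ.+-assoc a (codeSize p) k))
    (trans (placed (codeSize p + k) (ℕ.+-monoʳ-< (codeSize p) k<))
      (trans (if-no (ℕ.m≤m+n (codeSize p) k)) (cong (codeAt q (a + codeSize p) b) (ℕ.m+n∸m≡n (codeSize p) k))))

  placed⇒At : ∀ p a b → Placed p a b → At p (loc a) b
  placed⇒At skip       a b placed = first-instr {skip} {a} {b} placed (s≤s z≤n)
  placed⇒At (push β r) a b placed = first-instr {push β r} {a} {b} placed (s≤s z≤n)
  placed⇒At (pop r)    a b placed = first-instr {pop r} {a} {b} placed (s≤s z≤n)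
  placed⇒At (p ⨾ q)    a b placed = loc (a + codeSize p) ,
    placed⇒At p a (loc (a + codeSize p)) (left {p} {q} {a} {b} placed) ,
    placed⇒At q (a + codeSize p) b (right {p} {q} {a} {b} placed)
  placed⇒At (branch r p q s) a b placed = _ , _ , _ , first-instr {branch r p q s} {a} {b} placed (s≤s z≤n) ,
    placed⇒At p (suc a) b (λ k k< → trans (shift k) (trans (placed (suc k) (s≤s (ℕ.<-≤-trans k< (ℕ.m≤m+n |p| _)))) (if-yes k<))) ,
    placed⇒At q (suc a + |p|) b (λ k k< → trans (cong (C ∘ loc) (ℕ.+-assoc (suc a) |p| k)) (trans (shift (|p| + k))
      (trans (placed (suc (|p| + k)) (s≤s (ℕ.+-monoʳ-< |p| (ℕ.<-≤-trans k< (ℕ.m≤m+n |q| _)))))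
      (trans (if-no (ℕ.m≤m+n |p| k)) (trans (if-yes (subst (_< |q|) (sym (ℕ.m+n∸m≡n |p| k)) k<))
        (cong (codeAt q (suc a + |p|) b) (ℕ.m+n∸m≡n |p| k))))))) ,
    placed⇒At s (suc a + |p| + |q|) b (λ k k< → trans (cong (C ∘ loc) (trans (ℕ.+-assoc (suc a + |p|) |q| k) (ℕ.+-assoc (suc a) |p| (|q| + k))))
      (trans (shift (|p| + (|q| + k)))
      (trans (placed (suc (|p| + (|q| + k))) (s≤s (ℕ.+-monoʳ-< |p| (ℕ.+-monoʳ-< |q| k<))))
      (trans (if-no (ℕ.m≤m+n |p| (|q| + k))) (trans (if-no (subst (|q| ≤_) (sym (ℕ.m+n∸m≡n |p| (|q| + k))) (ℕ.m≤m+n |q| k)))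
        (cong (codeAt s (suc a + |p| + |q|) b) (trans (cong (_∸ |q|) (ℕ.m+n∸m≡n |p| (|q| + k))) (ℕ.m+n∸m≡n |q| k))))))))
    where
    |p| |q| : ℕ
    |p| = codeSize p
    |q| = codeSize q
    shift : ∀ k → C (loc (suc a + k)) ≡ C (loc (a + suc k))
    shift k = cong (C ∘ loc) (sym (ℕ.+-suc a k))
  placed⇒At (while r p) a b placed = _ , first-instr {while r p} {a} {b} placed (s≤s z≤n) ,
    placed⇒At p (suc a) (loc a) λ k k< → trans (cong (C ∘ loc) (sym (ℕ.+-suc a k))) (placed (suc k) (s≤s k<))

  start exit : Fin (suc h)
  start = loc 0
  exit  = loc h

  prog-at : At prog start exit
  prog-at = placed⇒At prog 0 exit λ k k< → trans
    (cong (λ i → if i <ᵇ h then codeAt prog 0 exit i else jump exit) (toℕ-clamp (ℕ.<⇒≤ k<))) (if-yes k<)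

  stays : ∀ t σ → steps t (exit , σ) ≡ (exit , σ)
  stays zero    σ = refl
  stays (suc t) σ = trans (cong (λ i → steps t (exec i σ)) (trans
    (cong (λ i → if i <ᵇ h then codeAt prog 0 exit i else jump exit) (toℕ-clamp ℕ.≤-refl)) (if-no (ℕ.≤-refl {h})))) (stays t σ)

  halted : ∀ {σ τ t} T → noOracle ⊢⟨ prog , σ ⟩⇓⟨ τ , t ⟩ → t ≤ T → steps T (start , σ) ≡ (exit , τ)
  halted {σ} {τ} {t} T run t≤T = begin
    steps T (start , σ)               ≡⟨ cong (λ k → steps k (start , σ)) (sym (ℕ.m+[n∸m]≡n t≤T)) ⟩
    steps (t + (T ∸ t)) (start , σ)   ≡⟨ steps-+ t (T ∸ t) (start , σ) ⟩
    steps (T ∸ t) (steps t (start , σ)) ≡⟨ cong (steps (T ∸ t)) (simulate prog prog-at (ℕ.n≤1+n _) run) ⟩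
    steps (T ∸ t) (exit , τ)          ≡⟨ stays (T ∸ t) τ ⟩
    (exit , τ)                        ∎
    where open ≡-Reasoning

  -- Column j of a configuration holds the control location and the j-th
  -- symbol of every register.

  Symbols State : Set
  Symbols = Vec (Maybe Bool) (suc R)
  State   = Fin (suc h) × Symbols

  column : Config (suc h) → ℕ → State
  column (l , σ) j = l , tabulate (λ r → nth (σ (toℕ r)) j)

  -- A push or pop shifts a whole register by one place, so the new column depends on its two
  -- neighbours. Only a test needs the tops of the stacks, which are found in column 0; the control
  -- location is repeated in every column to keep the rule local.
  advance : Bool → Instr (suc h) (suc R) → (head left self right : Symbols) → State
  advance z (jump n)       H L S R = n , S
  advance z (put b q n)    H L S R = n , S Vec.[ q ]≔ (if z then just b else lookup L q)
  advance z (drop q n)     H L S R = n , S Vec.[ q ]≔ lookup R q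
  advance z (test q e f t) H L S R = choose (lookup H q) e f t , S

  -- The local rule; z marks column 0.
  next : Bool → (head left self right : State) → State
  next z (l , H) (_ , L) (_ , S) (_ , R) = advance z (C l) H L S R

  ext-vec : ∀ {A : Set} {n} {v w : Vec A n} → (∀ i → lookup v i ≡ lookup w i) → v ≡ w
  ext-vec {v = v} {w} eq = trans (sym (Vec.tabulate∘lookup v)) (trans (Vec.tabulate-cong eq) (Vec.tabulate∘lookup w))

  update : ∀ σ (q : Fin (suc R)) w j {x} → nth w j ≡ x →
           tabulate (λ (r : Fin (suc R)) → nth ((σ [ toℕ q ≔ w ]) (toℕ r)) j) ≡
           tabulate (λ r → nth (σ (toℕ r)) j) Vec.[ q ]≔ x
  update σ q w j {x} eq = ext-vec λ r → trans (Vec.lookup∘tabulate (λ r → nth ((σ [ toℕ q ≔ w ]) (toℕ r)) j) r) (symbolAt r)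
    where
    V : Symbols
    V = tabulate (λ r → nth (σ (toℕ r)) j)
    symbolAt : ∀ r → nth ((σ [ toℕ q ≔ w ]) (toℕ r)) j ≡ lookup (V Vec.[ q ]≔ x) r
    symbolAt r with r Fin.≟ q
    ... | yes refl = trans (cong (λ v → nth v j) (≔-same σ (toℕ q) w)) (trans eq (sym (Vec.lookup∘updateAt q V)))
    ... | no r≢q = trans (cong (λ v → nth v j) (≔-agree σ (toℕ q) w (toℕ r) (r≢q ∘ toℕ-injective)))
                     (trans (sym (Vec.lookup∘tabulate (λ r → nth (σ (toℕ r)) j) r)) (sym (Vec.lookup∘updateAt′ r q r≢q V)))

  nth-drop : ∀ w j → nth (List.drop 1 w) j ≡ nth w (suc j)
  nth-drop []      j = refl
  nth-drop (b ∷ w) j = refl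

  -- Column 0 has no left neighbour: there `j ∸ 1` is 0 again, and the flag makes the rule insert
  -- the pushed bit.
  column-step : ∀ c j → column (step c) j ≡
                next (j ≡ᵇ 0) (column c 0) (column c (j ∸ 1)) (column c j) (column c (suc j))
  column-step (l , σ) j = by (C l)
    where
    by : ∀ i → column (exec i σ) j ≡ advance (j ≡ᵇ 0) i (proj₂ (column (l , σ) 0))
           (proj₂ (column (l , σ) (j ∸ 1))) (proj₂ (column (l , σ) j)) (proj₂ (column (l , σ) (suc j)))
    by (jump n)       = refl
    by (put b q n)    = cong (n ,_) (update σ q (b ∷ σ (toℕ q)) j (pushed j))
      where
      pushed : ∀ j → nth (b ∷ σ (toℕ q)) j ≡
               (if j ≡ᵇ 0 then just b else lookup (tabulate (λ (r : Fin (suc R)) → nth (σ (toℕ r)) (j ∸ 1))) q)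
      pushed zero    = refl
      pushed (suc j) = sym (Vec.lookup∘tabulate (λ r → nth (σ (toℕ r)) j) q)
    by (drop q n)     = cong (n ,_) (update σ q (List.drop 1 (σ (toℕ q))) j
                          (trans (nth-drop (σ (toℕ q)) j) (sym (Vec.lookup∘tabulate (λ r → nth (σ (toℕ r)) (suc j)) q))))
    by (test q e f t) = cong (_, proj₂ (column (l , σ) j)) (cong (λ s → choose s e f t) (sym (Vec.lookup∘tabulate (λ (r : Fin (suc R)) → nth (σ (toℕ r)) 0) q)))

  symbol : Maybe Bool → Fin 3
  symbol nothing      = zero
  symbol (just false) = suc zero
  symbol (just true)  = suc (suc zero)

  unsymbol : Fin 3 → Maybe Bool
  unsymbol zero             = nothing
  unsymbol (suc zero)       = just false
  unsymbol (suc (suc zero)) = just true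

  -- Base-three digits. States are numbered so that membership in a clause becomes an arithmetical
  -- condition on the label of a coordinate.
  number : ∀ {n} → Vec (Maybe Bool) n → Fin (3 ^ n)
  number []      = zero
  number (s ∷ v) = combine (symbol s) (number v)

  unnumber : ∀ n → Fin (3 ^ n) → Vec (Maybe Bool) n
  unnumber zero    i = []
  unnumber (suc n) i = unsymbol (proj₁ (remQuot {3} (3 ^ n) i)) ∷ unnumber n (proj₂ (remQuot {3} (3 ^ n) i))

  unsymbol-symbol : ∀ s → unsymbol (symbol s) ≡ s
  unsymbol-symbol nothing      = refl
  unsymbol-symbol (just false) = refl
  unsymbol-symbol (just true)  = refl

  symbol-unsymbol : ∀ i → symbol (unsymbol i) ≡ i
  symbol-unsymbol zero             = refl
  symbol-unsymbol (suc zero)       = refl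
  symbol-unsymbol (suc (suc zero)) = refl

  unnumber-number : ∀ {n} (v : Vec (Maybe Bool) n) → unnumber n (number v) ≡ v
  unnumber-number []      = refl
  unnumber-number {suc n} (s ∷ v) = cong₂ _∷_
    (trans (cong (unsymbol ∘ proj₁) (remQuot-combine (symbol s) (number v))) (unsymbol-symbol s))
    (trans (cong (unnumber n ∘ proj₂) (remQuot-combine (symbol s) (number v))) (unnumber-number v))

  number-unnumber : ∀ n i → number (unnumber n i) ≡ i
  number-unnumber zero    zero = refl
  number-unnumber (suc n) i = trans
    (cong₂ combine (symbol-unsymbol (proj₁ (remQuot {3} (3 ^ n) i))) (number-unnumber n (proj₂ (remQuot {3} (3 ^ n) i))))
    (combine-remQuot {3} (3 ^ n) i)

  abstract
    #State : ℕ
    #State = suc h * 3 ^ suc R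

    enc : State → Fin #State
    enc (l , v) = combine l (number v)

    dec : Fin #State → State
    dec i = proj₁ (remQuot {suc h} (3 ^ suc R) i) , unnumber (suc R) (proj₂ (remQuot {suc h} (3 ^ suc R) i))

    dec-enc : ∀ s → dec (enc s) ≡ s
    dec-enc (l , v) = cong₂ _,_ (cong proj₁ (remQuot-combine l (number v)))
      (trans (cong (unnumber (suc R) ∘ proj₂) (remQuot-combine l (number v))) (unnumber-number v))

    enc-dec : ∀ i → enc (dec i) ≡ i
    enc-dec i = trans (cong (combine (proj₁ (remQuot {suc h} (3 ^ suc R) i))) (number-unnumber (suc R) _))
      (combine-remQuot {suc h} (3 ^ suc R) i)

-- Lists produced by loops

∈-loop⁺ : ∀ {A : Set} {n i} {h : ℕ → List A} {x} → i < n → x ∈ₗ h i → x ∈ₗ loop n h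
∈-loop⁺ {n = suc n} {i} {h} i<1+n x∈ with ℕ.m<1+n⇒m<n∨m≡n i<1+n
... | inj₁ i<n  = List.∈-++⁺ˡ (∈-loop⁺ i<n x∈)
... | inj₂ refl = List.∈-++⁺ʳ (loop n h) x∈

∈-loop⁻ : ∀ {A : Set} n {h : ℕ → List A} {x} → x ∈ₗ loop n h → ∃ λ i → i < n × x ∈ₗ h i
∈-loop⁻ (suc n) {h} x∈ with List.∈-++⁻ (loop n h) x∈
... | inj₁ x∈′ = let i , i<n , p = ∈-loop⁻ n x∈′ in i , ℕ.m<n⇒m<1+n i<n , p
... | inj₂ x∈′ = n , ℕ.≤-refl , x∈′

loop-unique : ∀ {A : Set} (key : A → ℕ) n {h : ℕ → List A} → (∀ i → i < n → Unique (h i)) →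
              (∀ i {x} → x ∈ₗ h i → key x ≡ i) → Unique (loop n h)
loop-unique key zero    u k = []
loop-unique key (suc n) u k = Unique.++⁺ (loop-unique key n (λ i i<n → u i (ℕ.m<n⇒m<1+n i<n)) k) (u n ℕ.≤-refl)
  λ (x∈ , x∈′) → let i , i<n , p = ∈-loop⁻ n x∈ in ℕ.<-irrefl (trans (sym (k i p)) (k n x∈′)) i<n

All-loop⁺ : ∀ {A : Set} {P : Pred A 0ℓ} n {h : ℕ → List A} → (∀ i → i < n → All P (h i)) → All P (loop n h)
All-loop⁺ zero    f = []
All-loop⁺ (suc n) f = All.++⁺ (All-loop⁺ n (λ i i<n → f i (ℕ.m<n⇒m<1+n i<n))) (f n ℕ.≤-refl)

All-loop⁻ : ∀ {A : Set} {P : Pred A 0ℓ} n {h : ℕ → List A} → All P (loop n h) → ∀ i → i < n → All P (h i)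
All-loop⁻ (suc n) {h} ps i i<1+n with ℕ.m<1+n⇒m<n∨m≡n i<1+n
... | inj₁ i<n  = All-loop⁻ n (All.++⁻ˡ (loop n h) ps) i i<n
... | inj₂ refl = All.++⁻ʳ (loop n h) ps

lookup-injective : ∀ {A : Set} {xs : List A} → Unique xs → ∀ {i j} → List.lookup xs i ≡ List.lookup xs j → i ≡ j
lookup-injective (x∉ ∷ u) {zero}  {zero}  eq = refl
lookup-injective (x∉ ∷ u) {zero}  {suc j} eq = contradiction eq (All.lookup x∉ (List.∈-lookup j))
lookup-injective (x∉ ∷ u) {suc i} {zero}  eq = contradiction (sym eq) (All.lookup x∉ (List.∈-lookup i))
lookup-injective (x∉ ∷ u) {suc i} {suc j} eq = cong suc (lookup-injective u eq)

when : ∀ {A : Set} → Bool → List A → List A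
when b xs = loop (bit b) (λ _ → xs)

All-when⁺ : ∀ {A : Set} {P : Pred A 0ℓ} b {xs : List A} → (T b → All P xs) → All P (when b xs)
All-when⁺ false f = []
All-when⁺ true  f = f tt

All-when⁻ : ∀ {A : Set} {P : Pred A 0ℓ} b {xs : List A} → All P (when b xs) → T b → All P xs
All-when⁻ true ps _ = ps

-- The tableau of a computation
--
-- Column j at time τ is recorded for τ + j ≤ T only, which is all that the top
-- symbols at time T depend on.

isTrue : Maybe Bool → Bool
isTrue (just b) = b
isTrue nothing  = false

matchBit : Word → Maybe Bool → ℕ → Bool
matchBit x nothing      j = not (j <ᵇ length x)
matchBit x (just false) j = (j <ᵇ length x) ∧ not (bitAt x j)
matchBit x (just true)  j = (j <ᵇ length x) ∧ bitAt x j

matchGuess : ℕ → Maybe Bool → ℕ → Bool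
matchGuess m nothing  j = not (j <ᵇ m)
matchGuess m (just _) j = j <ᵇ m

blank : ∀ {n} → Vec (Maybe Bool) n → Bool
blank []            = true
blank (nothing ∷ v) = blank v
blank (just _ ∷ v)  = false

not-sound : ∀ {b} → T (not b) → ¬ T b
not-sound {false} _ ()

not-complete : ∀ {b} → ¬ T b → T (not b)
not-complete {false} _ = tt
not-complete {true}  f = ⊥-elim (f tt)

nth-length : ∀ w j → length w ≤ j → nth w j ≡ nothing
nth-length []      j       _         = refl
nth-length (b ∷ w) (suc j) (s≤s w≤j) = nth-length w j w≤j

nth-bitAt : ∀ w j → j < length w → nth w j ≡ just (bitAt w j)
nth-bitAt (b ∷ w) zero    _         = refl
nth-bitAt (b ∷ w) (suc j) (s≤s j<w) = nth-bitAt w j j<w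

matchBit-complete : ∀ x j → T (matchBit x (nth x j) j)
matchBit-complete x j with ℕ.<-≤-connex j (length x)
... | inj₂ x≤j rewrite nth-length x j x≤j = not-complete λ t → ℕ.<⇒≱ (ℕ.<ᵇ⇒< j (length x) t) x≤j
... | inj₁ j<x rewrite nth-bitAt x j j<x with bitAt x j in eq
...   | false = ∧-complete (ℕ.<⇒<ᵇ j<x) (subst (T ∘ not) (sym eq) tt)
...   | true  = ∧-complete (ℕ.<⇒<ᵇ j<x) (subst T (sym eq) tt)

matchBit-sound : ∀ x s j → T (matchBit x s j) → s ≡ nth x j
matchBit-sound x nothing j t = sym (nth-length x j (ℕ.≮⇒≥ λ j<x → not-sound t (ℕ.<⇒<ᵇ j<x)))
matchBit-sound x (just false) j t with ∧-sound {j <ᵇ length x} t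
... | j<x , b = trans (cong just (b≡ b)) (sym (nth-bitAt x j (ℕ.<ᵇ⇒< j (length x) j<x)))
  where
  b≡ : ∀ {b} → T (not b) → false ≡ b
  b≡ {false} _ = refl
matchBit-sound x (just true) j t with ∧-sound {j <ᵇ length x} t
... | j<x , b = trans (cong just (sym (T⇒≡ b))) (sym (nth-bitAt x j (ℕ.<ᵇ⇒< j (length x) j<x)))

module Tableau (prog : Program ⊥) where
  open Flat prog public

  𝕏 : Set
  𝕏 = ℕ × ℕ × ℕ

  initial : Word → ℕ → State → ℕ → Bool
  initial x m (l , s₀ ∷ s₁ ∷ v) j = does (l Fin.≟ start) ∧ matchBit x s₀ j ∧ matchGuess m s₁ j ∧ blank v

  accepting : State → Bool
  accepting (l , s₀ ∷ v) = isTrue s₀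

  wrong : Bool → (head left self right new : Fin #State) → Bool
  wrong z h l s r b = not (does (enc (next z (dec h) (dec l) (dec s) (dec r)) Fin.≟ b))

  -- This decides for which `a` and `b` the clause `notBoth` is imposed, and serves three purposes.
  -- For distinct states it makes the state of a column unique; with `b` equal to `a` it becomes a
  -- unit clause that forbids wrong states in row 0 and rejecting ones at the top of the last row.
  unfinished : Word → ℕ → ℕ → ℕ → ℕ → ℕ → ℕ → Bool
  unfinished x m N τ j a b = not (a ≡ᵇ b)
    ∨ (τ ≡ᵇ 0) ∧ not (table #State (λ a → initial x m (dec a) j) a)
    ∨ (τ ≡ᵇ N) ∧ (j ≡ᵇ 0) ∧ not (table #State (λ a → accepting (dec a)) a)

  -- The rule of the machine as a finite table in numbers. The outermost index `1 ∸ j` is 1 exactly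
  -- in column 0.
  wrongStep : ℕ → ℕ → ℕ → ℕ → ℕ → ℕ → Bool
  wrongStep j h l s r b =
    table 2 (λ z → table #State (λ h → table #State (λ l → table #State (λ s → table #State (λ r → table #State (λ b →
      wrong (does (z Fin.≟ suc zero)) h l s r b) b) r) s) l) h) (1 ∸ j)

  someState : ℕ → ℕ → Bool × (𝕏 → Bool)
  someState τ j = true , λ (τ′ , j′ , a′) → (τ′ ≡ᵇ τ) ∧ (j′ ≡ᵇ j)

  notBoth : ℕ → ℕ → ℕ → ℕ → Bool × (𝕏 → Bool)
  notBoth τ j a b = false , λ (τ′ , j′ , a′) → (τ′ ≡ᵇ τ) ∧ (j′ ≡ᵇ j) ∧ ((a′ ≡ᵇ a) ∨ (a′ ≡ᵇ b))

  -- As an implication from four old states to the new one, a transition would mix signs. Forbidding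
  -- every wrong new state is purely negative, and the positive clauses `someState` then leave only
  -- the correct one.
  notStep : ℕ → ℕ → ℕ → ℕ → ℕ → ℕ → ℕ → Bool × (𝕏 → Bool)
  notStep τ j h l s r b = false , λ (τ′ , j′ , a′) →
    (τ′ ≡ᵇ τ) ∧ ((j′ ≡ᵇ 0) ∧ (a′ ≡ᵇ h) ∨ (j′ ≡ᵇ j ∸ 1) ∧ (a′ ≡ᵇ l) ∨ (j′ ≡ᵇ j) ∧ (a′ ≡ᵇ s) ∨ (j′ ≡ᵇ suc j) ∧ (a′ ≡ᵇ r))
    ∨ (τ′ ≡ᵇ suc τ) ∧ (j′ ≡ᵇ j) ∧ (a′ ≡ᵇ b)

  module _ (x : Word) (m N : ℕ) where

    LX : List 𝕏
    LX = loop (suc N) λ τ → loop (suc N ∸ τ) λ j → loop #State λ a → (τ , j , a) ∷ []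

    someStates notBoths notSteps LC : List (Bool × (𝕏 → Bool))
    someStates = loop (suc N) λ τ → loop (suc N ∸ τ) λ j → someState τ j ∷ []
    notBoths = loop (suc N) λ τ → loop (suc N ∸ τ) λ j → loop #State λ a → loop #State λ b →
      when (unfinished x m N τ j a b) (notBoth τ j a b ∷ [])
    notSteps = loop N λ τ → loop (N ∸ τ) λ j → loop #State λ h → loop #State λ l → loop #State λ s → loop #State λ r →
      loop #State λ b → when (wrongStep j h l s r b) (notStep τ j h l s r b ∷ [])
    LC = someStates ++ (notBoths ++ notSteps)

  guessed : State → Maybe Bool
  guessed (l , s₀ ∷ s₁ ∷ v) = s₁

  inputStore : ∀ {m} → Word → Vec Bool m → Store
  inputStore x y = load (x ∷ Vec.toList y ∷ [])

  nth-toList : ∀ {m} (y : Vec Bool m) (i : Fin m) → nth (Vec.toList y) (toℕ i) ≡ just (lookup y i)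
  nth-toList (b ∷ y) zero    = refl
  nth-toList (b ∷ y) (suc i) = nth-toList y i

  nth-toList-≥ : ∀ {m} (y : Vec Bool m) j → m ≤ j → nth (Vec.toList y) j ≡ nothing
  nth-toList-≥ y j m≤j = nth-length (Vec.toList y) j (ℕ.≤-trans (ℕ.≤-reflexive (Vec.length-toList y)) m≤j)

  blank-nothing : ∀ n → T (blank {n} (tabulate (λ _ → nothing)))
  blank-nothing zero    = tt
  blank-nothing (suc n) = blank-nothing n

  blank-sound : ∀ {n} (v : Vec (Maybe Bool) n) → T (blank v) → v ≡ tabulate (λ _ → nothing)
  blank-sound []            t = refl
  blank-sound (nothing ∷ v) t = cong (nothing ∷_) (blank-sound v t)

  initial-complete : ∀ x {m} (y : Vec Bool m) j → T (initial x m (column (start , inputStore x y) j) j)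
  initial-complete x {m} y j = ∧-complete (subst T (sym (dec-true (start Fin.≟ start) refl)) tt)
      (∧-complete (matchBit-complete x j) (∧-complete guess (blank-nothing (registers prog))))
    where
    guess : T (matchGuess m (nth (Vec.toList y) j) j)
    guess with ℕ.<-≤-connex j m
    ... | inj₂ m≤j rewrite nth-toList-≥ y j m≤j = not-complete λ t → ℕ.<⇒≱ (ℕ.<ᵇ⇒< j m t) m≤j
    ... | inj₁ j<m rewrite trans (cong (nth (Vec.toList y)) (sym (toℕ-fromℕ< j<m))) (nth-toList y (fromℕ< j<m)) = ℕ.<⇒<ᵇ j<m

  initial-sound : ∀ x {m} (y : Vec Bool m) j s → T (initial x m s j) →
                  (∀ i → toℕ i ≡ j → lookup y i ≡ isTrue (guessed s)) → s ≡ column (start , inputStore x y) j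
  initial-sound x {m} y j (l , s₀ ∷ s₁ ∷ v) t y≡ with l Fin.≟ start
  ... | no _ = ⊥-elim t
  ... | yes refl with ∧-sound {matchBit x s₀ j} t
  ...   | t₀ , t′ with ∧-sound {matchGuess m s₁ j} t′
  ...     | t₁ , t₂ = cong (start ,_) (cong₂ _∷_ (matchBit-sound x s₀ j t₀)
                        (cong₂ _∷_ (guess s₁ t₁ y≡) (blank-sound v t₂)))
    where
    guess : ∀ s₁ → T (matchGuess m s₁ j) → (∀ i → toℕ i ≡ j → lookup y i ≡ isTrue s₁) → s₁ ≡ nth (Vec.toList y) j
    guess nothing  t y≡ = sym (nth-toList-≥ y j (ℕ.≮⇒≥ λ j<m → not-sound t (ℕ.<⇒<ᵇ j<m)))
    guess (just b) t y≡ = trans (cong just (sym (y≡ i (toℕ-fromℕ< j<m))))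
      (trans (sym (nth-toList y i)) (cong (nth (Vec.toList y)) (toℕ-fromℕ< j<m)))
      where
      j<m : j < m
      j<m = ℕ.<ᵇ⇒< j m t
      i : Fin m
      i = fromℕ< j<m

  -- Satisfying assignments are matched with accepted witnesses. The condition `m ≤ N` ensures that
  -- the recorded part of row 0 contains the whole witness.
  module Counting (x : Word) (m N : ℕ) (m≤N : m ≤ N) (r : ℕ) where
    open Constraints (LX x m N) (LC x m N) r public

    private
      a : ℕ
      a = length (LX x m N)

      label : Fin a → 𝕏
      label = List.lookup (LX x m N)

    config : Vec Bool m → ℕ → Config (suc h)
    config y τ = steps τ (start , inputStore x y)

    Accepts : Vec Bool m → Set
    Accepts y = isTrue (nth (proj₂ (config y N) 0) 0) ≡ true

    accepts? : Decidable Accepts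
    accepts? y = _ Bool.≟ true

    st : Vec Bool m → ℕ → ℕ → Fin #State
    st y τ j = enc (column (config y τ) j)

    ∈-LX : ∀ {τ j b} → τ < suc N → j < suc N ∸ τ → b < #State → (τ , j , b) ∈ₗ LX x m N
    ∈-LX τ< j< b< = ∈-loop⁺ τ< (∈-loop⁺ j< (∈-loop⁺ b< (here refl)))

    LX-unique : Unique (LX x m N)
    LX-unique = loop-unique proj₁ (suc N) (λ τ _ → loop-unique (proj₁ ∘ proj₂) (suc N ∸ τ)
        (λ j _ → loop-unique (proj₂ ∘ proj₂) #State (λ b _ → [] ∷ []) λ { b (here refl) → refl })
        λ j p → case ∈-loop⁻ #State p of λ { (_ , _ , here refl) → refl })
      λ τ p → case ∈-loop⁻ (suc N ∸ τ) p of λ (_ , _ , p′) → case ∈-loop⁻ #State p′ of λ { (_ , _ , here refl) → refl }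

    label-bounds : ∀ u → let τ , j , b = label u in τ < suc N × j < suc N ∸ τ × b < #State
    label-bounds u with label u | List.∈-lookup {xs = LX x m N} u
    ... | _ | p with ∈-loop⁻ (suc N) p
    ...   | τ , τ< , p₁ with ∈-loop⁻ (suc N ∸ τ) p₁
    ...     | j , j< , p₂ with ∈-loop⁻ #State p₂
    ...       | b , b< , here refl = τ< , j< , b<

    Holds : Vec Bool a → 𝕏 → Set
    Holds S l = ∃ λ u → label u ≡ l × T (lookup S u)

    encode-y : Vec Bool m → Vec Bool a
    encode-y y = tabulate λ u → let τ , j , b = label u in b ≡ᵇ toℕ (st y τ j)

    encode-y⁻ : ∀ y {u τ j b} → label u ≡ (τ , j , b) → T (lookup (encode-y y) u) → b ≡ toℕ (st y τ j)
    encode-y⁻ y {u} eq t with label u | subst T (Vec.lookup∘tabulate (λ u → let τ , j , b = label u in b ≡ᵇ toℕ (st y τ j)) u) t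
    encode-y⁻ y refl t | _ | t′ = ≡ᵇ-sound t′

    encode-y⁺ : ∀ y u → let τ , j , b = label u in b ≡ toℕ (st y τ j) → T (lookup (encode-y y) u)
    encode-y⁺ y u eq = subst T (sym (Vec.lookup∘tabulate (λ u → let τ , j , b = label u in b ≡ᵇ toℕ (st y τ j)) u)) (≡ᵇ-complete eq)

    index : ∀ {l} → l ∈ₗ LX x m N → ∃ λ u → label u ≡ l
    index p = Any.index p , sym (AnyP.lookup-index p)
      where import Data.List.Relation.Unary.Any.Properties as AnyP

    holds-y : ∀ y τ j → τ < suc N → j < suc N ∸ τ → Holds (encode-y y) (τ , j , toℕ (st y τ j))
    holds-y y τ j τ< j< with index (∈-LX τ< j< (toℕ<n (st y τ j)))
    ... | u , eq = u , eq , encode-y⁺ y u (go (label u) eq)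
      where
      go : ∀ l → l ≡ (τ , j , toℕ (st y τ j)) → let τ , j , b = l in b ≡ toℕ (st y τ j)
      go _ refl = refl

    -- A violated negative clause has all its recorded members true.
    member : ∀ {S mem l} → Violated S (false , mem) → l ∈ₗ LX x m N → T (mem l) → Holds S l
    member {S} {mem} viol l∈ t = let u , eq = index l∈ in
      u , eq , ≡⇒T (viol u (subst (T ∘ mem) (sym eq) t))

    wrongStep-toℕ : ∀ j (h l s r b : Fin #State) →
                    wrongStep j (toℕ h) (toℕ l) (toℕ s) (toℕ r) (toℕ b) ≡ wrong (j ≡ᵇ 0) h l s r b
    wrongStep-toℕ j h l s r b = trans (column0 j)
      (trans (table-toℕ {k = #State} _ h) (trans (table-toℕ {k = #State} _ l) (trans (table-toℕ {k = #State} _ s)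
        (trans (table-toℕ {k = #State} _ r) (table-toℕ {k = #State} (λ b → wrong (j ≡ᵇ 0) h l s r b) b)))))
      where
      inner : Bool → Bool
      inner z = table #State (λ h → table #State (λ l → table #State (λ s → table #State (λ r → table #State (λ b →
        wrong z h l s r b) (toℕ b)) (toℕ r)) (toℕ s)) (toℕ l)) (toℕ h)
      column0 : ∀ j → table 2 (λ z → inner (does (z Fin.≟ suc zero))) (1 ∸ j) ≡ inner (j ≡ᵇ 0)
      column0 zero    = refl
      column0 (suc j) = cong (table 2 (λ z → inner (does (z Fin.≟ suc zero)))) (ℕ.0∸n≡0 j)

    module Solution {S} (good : Good S) where
      private
        pos : ∀ τ j → τ < suc N → j < suc N ∸ τ → ¬ Violated S (someState τ j)
        pos τ j τ< j< = All.head (All-loop⁻ (suc N ∸ τ) (All-loop⁻ (suc N) (All.++⁻ˡ (someStates x m N) good) τ τ<) j j<)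

        two : ∀ τ j a b → τ < suc N → j < suc N ∸ τ → a < #State → b < #State → T (unfinished x m N τ j a b) →
              ¬ Violated S (notBoth τ j a b)
        two τ j a b τ< j< a< b< t = All.head (All-when⁻ _ (All-loop⁻ #State (All-loop⁻ #State (All-loop⁻ (suc N ∸ τ)
          (All-loop⁻ (suc N) (All.++⁻ˡ (notBoths x m N) (All.++⁻ʳ (someStates x m N) good)) τ τ<) j j<) a a<) b b<) t)

        five : ∀ τ j (h l s r b : Fin #State) → τ < N → j < N ∸ τ → T (wrong (j ≡ᵇ 0) h l s r b) →
               ¬ Violated S (notStep τ j (toℕ h) (toℕ l) (toℕ s) (toℕ r) (toℕ b))
        five τ j h l s r b τ< j< t = All.head (All-when⁻ _
          (All-loop⁻ #State (All-loop⁻ #State (All-loop⁻ #State (All-loop⁻ #State (All-loop⁻ #State (All-loop⁻ (N ∸ τ)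
            (All-loop⁻ N (All.++⁻ʳ (notBoths x m N) (All.++⁻ʳ (someStates x m N) good)) τ τ<) j j<)
            (toℕ h) (toℕ<n h)) (toℕ l) (toℕ<n l)) (toℕ s) (toℕ<n s)) (toℕ r) (toℕ<n r)) (toℕ b) (toℕ<n b))
          (subst T (sym (wrongStep-toℕ j h l s r b)) t))

      bounded : ∀ {τ j b} → Holds S (τ , j , b) → τ < suc N × j < suc N ∸ τ × b < #State
      bounded (u , eq , _) = subst (λ l → let τ , j , b = l in τ < suc N × j < suc N ∸ τ × b < #State) eq (label-bounds u)

      exists : ∀ τ j → τ < suc N → j < suc N ∸ τ → ∃ λ (s : Fin #State) → Holds S (τ , j , toℕ s)
      exists τ j τ< j< with any? (λ u → T? (proj₂ (someState τ j) (label u)) ×-dec T? (lookup S u))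
      ... | no none = contradiction (λ u t → ¬T⇒false (λ t′ → none (u , t , t′))) (pos τ j τ< j<)
        where
        ¬T⇒false : ∀ {b} → ¬ T b → b ≡ false
        ¬T⇒false {false} _ = refl
        ¬T⇒false {true}  f = ⊥-elim (f tt)
      ... | yes (u , t , t′) = fromℕ< b< , u , eq , t′
        where
        b< : proj₂ (proj₂ (label u)) < #State
        b< = proj₂ (proj₂ (label-bounds u))
        eq : label u ≡ (τ , j , toℕ (fromℕ< b<))
        eq = cong₂ _,_ (≡ᵇ-sound (proj₁ (∧-sound {proj₁ (label u) ≡ᵇ τ} t)))
               (cong₂ _,_ (≡ᵇ-sound (proj₂ (∧-sound {proj₁ (label u) ≡ᵇ τ} t))) (sym (toℕ-fromℕ< b<)))

      -- Only the clause that is not violated is needed: two true labels violate it.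
      violated₂ : ∀ {τ j a b} → Holds S (τ , j , a) → Holds S (τ , j , b) → Violated S (notBoth τ j a b)
      violated₂ {τ} {j} {a} {b} (u , eq , t) (v , eq′ , t′) w mem = T⇒≡ (either (∨-sound (proj₂ (∧-sound {proj₁ (proj₂ (label w)) ≡ᵇ j} (proj₂ (∧-sound {proj₁ (label w) ≡ᵇ τ} mem))))))
        where
        τ≡ : proj₁ (label w) ≡ τ
        τ≡ = ≡ᵇ-sound (proj₁ (∧-sound {proj₁ (label w) ≡ᵇ τ} mem))
        j≡ : proj₁ (proj₂ (label w)) ≡ j
        j≡ = ≡ᵇ-sound (proj₁ (∧-sound {proj₁ (proj₂ (label w)) ≡ᵇ j} (proj₂ (∧-sound {proj₁ (label w) ≡ᵇ τ} mem))))
        either : T (proj₂ (proj₂ (label w)) ≡ᵇ a) ⊎ T (proj₂ (proj₂ (label w)) ≡ᵇ b) → T (lookup S w)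
        either (inj₁ e) = subst (T ∘ lookup S) (lookup-injective LX-unique
          (trans eq (sym (cong₂ _,_ τ≡ (cong₂ _,_ j≡ (≡ᵇ-sound e)))))) t
        either (inj₂ e) = subst (T ∘ lookup S) (lookup-injective LX-unique
          (trans eq′ (sym (cong₂ _,_ τ≡ (cong₂ _,_ j≡ (≡ᵇ-sound e)))))) t′

      two-hold : ∀ {τ j a b} → Holds S (τ , j , a) → Holds S (τ , j , b) → ¬ T (unfinished x m N τ j a b)
      two-hold {τ} {j} {a} {b} ha hb t = two τ j a b (proj₁ (bounded ha)) (proj₁ (proj₂ (bounded ha)))
        (proj₂ (proj₂ (bounded ha))) (proj₂ (proj₂ (bounded hb))) t (violated₂ ha hb)

      unique : ∀ {τ j a b} → Holds S (τ , j , a) → Holds S (τ , j , b) → a ≡ b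
      unique {τ} {j} {a} {b} ha hb with a ℕ.≟ b
      ... | yes eq = eq
      ... | no a≢b = contradiction (∨-inj₁ (not-complete {a ≡ᵇ b} (a≢b ∘ ≡ᵇ-sound))) (two-hold {τ} {j} ha hb)

      follows : ∀ τ j {h l s r b : Fin #State} → τ < N → j < N ∸ τ →
                Holds S (τ , 0 , toℕ h) → Holds S (τ , j ∸ 1 , toℕ l) → Holds S (τ , j , toℕ s) → Holds S (τ , suc j , toℕ r) →
                Holds S (suc τ , j , toℕ b) → enc (next (j ≡ᵇ 0) (dec h) (dec l) (dec s) (dec r)) ≡ b
      follows τ j {h} {l} {s} {r} {b} τ< j< hh hl hs hr hb
        with enc (next (j ≡ᵇ 0) (dec h) (dec l) (dec s) (dec r)) Fin.≟ b in dec≡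
      ... | yes eq = eq
      ... | no neq = contradiction violated (five τ j h l s r b τ< j< (subst (T ∘ not) (sym (cong does dec≡)) tt))
        where
        true-at : ∀ {l} w → Holds S l → label w ≡ l → lookup S w ≡ true
        true-at w (u , eq , t) eq′ = T⇒≡ (subst (T ∘ lookup S) (lookup-injective LX-unique (trans eq (sym eq′))) t)
        here? : ∀ {t′ j′ a′} w → proj₁ (label w) ≡ t′ → Holds S (t′ , j′ , a′) →
                T ((proj₁ (proj₂ (label w)) ≡ᵇ j′) ∧ (proj₂ (proj₂ (label w)) ≡ᵇ a′)) → lookup S w ≡ true
        here? {j′ = j′} w τ≡ hold t = true-at w hold (cong₂ _,_ τ≡ (cong₂ _,_
          (≡ᵇ-sound (proj₁ (∧-sound {proj₁ (proj₂ (label w)) ≡ᵇ j′} t)))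
          (≡ᵇ-sound (proj₂ (∧-sound {proj₁ (proj₂ (label w)) ≡ᵇ j′} t)))))
        violated : Violated S (notStep τ j (toℕ h) (toℕ l) (toℕ s) (toℕ r) (toℕ b))
        violated w mem with ∨-sound mem
        ... | inj₂ t = here? w (≡ᵇ-sound (proj₁ (∧-sound {proj₁ (label w) ≡ᵇ suc τ} t))) hb (proj₂ (∧-sound {proj₁ (label w) ≡ᵇ suc τ} t))
        ... | inj₁ t with ≡ᵇ-sound {proj₁ (label w)} {τ} (proj₁ (∧-sound {proj₁ (label w) ≡ᵇ τ} t)) | ∨-sound (proj₂ (∧-sound {proj₁ (label w) ≡ᵇ τ} t))
        ...   | τ≡ | inj₁ t₁ = here? w τ≡ hh t₁
        ...   | τ≡ | inj₂ t₁ with ∨-sound t₁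
        ...     | inj₁ t₂ = here? w τ≡ hl t₂
        ...     | inj₂ t₂ with ∨-sound t₂
        ...       | inj₁ t₃ = here? w τ≡ hs t₃
        ...       | inj₂ t₃ = here? w τ≡ hr t₃

      -- Row 0 determines the guess, and the guess determines the tableau.
      guess<N : ∀ (i : Fin m) → toℕ i < suc N
      guess<N i = s≤s (ℕ.≤-trans (ℕ.<⇒≤ (toℕ<n i)) m≤N)

      y : Vec Bool m
      y = tabulate λ i → isTrue (guessed (dec (proj₁ (exists 0 (toℕ i) (s≤s z≤n) (guess<N i)))))

      is-initial : ∀ j {b : Fin #State} → Holds S (0 , j , toℕ b) → T (initial x m (dec b) j)
      is-initial j {b} hold with T? (initial x m (dec b) j)
      ... | yes t = t
      ... | no ¬t = contradiction
        (∨-inj₂ {not (toℕ b ≡ᵇ toℕ b)} (∨-inj₁ (not-complete λ t → ¬t (subst T (table-toℕ (λ a → initial x m (dec a) j) b) t))))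
        (two-hold {0} {j} hold hold)

      row₀ : ∀ j {b : Fin #State} → Holds S (0 , j , toℕ b) → b ≡ st y 0 j
      row₀ j {b} hold = trans (sym (enc-dec b)) (cong enc (initial-sound x y j (dec b) (is-initial j hold) same))
        where
        same : ∀ i → toℕ i ≡ j → lookup y i ≡ isTrue (guessed (dec b))
        same i refl = trans (Vec.lookup∘tabulate _ i) (cong (isTrue ∘ guessed ∘ dec)
          (toℕ-injective (unique (proj₂ (exists 0 (toℕ i) (s≤s z≤n) (guess<N i))) hold)))

      -- Induction on time. The neighbours of column `j` at time `τ` lie in the recorded triangle
      -- whenever column `j` at time `suc τ` does, so their states are already the true ones, and
      -- `follows` identifies the new state.
      agree : ∀ τ j → τ < suc N → j < suc N ∸ τ → Holds S (τ , j , toℕ (st y τ j))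
      agree zero    j τ< j< with exists 0 j τ< j<
      ... | b , hold = subst (λ b → Holds S (0 , j , toℕ b)) (row₀ j hold) hold
      agree (suc τ) j (s≤s τ<) j< with exists (suc τ) j (s≤s τ<) j<
      ... | b , hold = subst (λ b → Holds S (suc τ , j , toℕ b)) (sym st≡) hold
        where
        earlier : ∀ i → i ≤ suc j → Holds S (τ , i , toℕ (st y τ i))
        earlier i i≤ = agree τ i (ℕ.m<n⇒m<1+n τ<) (ℕ.<-≤-trans (s≤s (ℕ.≤-trans i≤ j<))
          (ℕ.≤-reflexive (sym (ℕ.+-∸-assoc 1 (ℕ.<⇒≤ τ<)))))
        c : Config (suc h)
        c = config y τ
        undo : ∀ i → dec (st y τ i) ≡ column c i
        undo i = dec-enc (column c i)
        st≡ : st y (suc τ) j ≡ b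
        st≡ = begin
          enc (column (config y (suc τ)) j)   ≡⟨ cong (λ c → enc (column c j)) (steps-suc τ (start , inputStore x y)) ⟩
          enc (column (step c) j)             ≡⟨ cong enc (column-step c j) ⟩
          enc (next (j ≡ᵇ 0) (column c 0) (column c (j ∸ 1)) (column c j) (column c (suc j)))
            ≡⟨ cong enc (next-cong (undo 0) (undo (j ∸ 1)) (undo j) (undo (suc j))) ⟨
          enc (next (j ≡ᵇ 0) (dec (st y τ 0)) (dec (st y τ (j ∸ 1))) (dec (st y τ j)) (dec (st y τ (suc j))))
            ≡⟨ follows τ j τ< j< (earlier 0 z≤n) (earlier (j ∸ 1) (ℕ.≤-trans (ℕ.m∸n≤m j 1) (ℕ.n≤1+n j)))
                 (earlier j (ℕ.n≤1+n j)) (earlier (suc j) ℕ.≤-refl) hold ⟩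
          b                                   ∎
          where
          open ≡-Reasoning
          next-cong : ∀ {h h′ l l′ s s′ r r′} → h ≡ h′ → l ≡ l′ → s ≡ s′ → r ≡ r′ →
                      next (j ≡ᵇ 0) h l s r ≡ next (j ≡ᵇ 0) h′ l′ s′ r′
          next-cong refl refl refl refl = refl

      accepted : Accepts y
      accepted with T? (accepting (dec (st y N 0)))
      ... | yes t = T⇒≡ (subst (T ∘ accepting) (dec-enc (column (config y N) 0)) t)
      ... | no ¬t = contradiction
        (∨-inj₂ {not (toℕ b ≡ᵇ toℕ b)} (∨-inj₂ {(N ≡ᵇ 0) ∧ not (table #State (λ a → initial x m (dec a) 0) (toℕ b))}
          (∧-complete (≡ᵇ-complete {N} refl) (not-complete λ t → ¬t (subst T (table-toℕ (λ a → accepting (dec a)) b) t)))))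
        (two-hold {N} {0} {toℕ b} {toℕ b} hold hold)
        where
        b : Fin #State
        b = st y N 0
        hold : Holds S (N , 0 , toℕ b)
        hold = agree N 0 ℕ.≤-refl (ℕ.m<n⇒0<n∸m (ℕ.n<1+n N))

      determined : encode-y y ≡ S
      determined = ext-vec λ u → ≡-by-T (to u) (from u)
        where
        here′ : ∀ u → Holds S (proj₁ (label u) , proj₁ (proj₂ (label u)) , toℕ (st y (proj₁ (label u)) (proj₁ (proj₂ (label u)))))
        here′ u = agree _ _ (proj₁ (label-bounds u)) (proj₁ (proj₂ (label-bounds u)))
        to : ∀ u → T (lookup (encode-y y) u) → T (lookup S u)
        to u t = let v , eq , t′ = here′ u in subst (T ∘ lookup S) (lookup-injective LX-unique
          (trans eq (cong (λ b → proj₁ (label u) , proj₁ (proj₂ (label u)) , b) (sym (encode-y⁻ y refl t))))) t′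
        from : ∀ u → T (lookup S u) → T (lookup (encode-y y) u)
        from u t = encode-y⁺ y u (unique (u , refl , t) (here′ u))

    module _ (y : Vec Bool m) (acc : Accepts y) where
      private
        S : Vec Bool a
        S = encode-y y

        value : ∀ {τ j b} → Holds S (τ , j , b) → b ≡ toℕ (st y τ j)
        value (u , eq , t) = encode-y⁻ y eq t

        good₁ : ∀ τ j → τ < suc N → j < suc N ∸ τ → ¬ Violated S (someState τ j)
        good₁ τ j τ< j< viol = let u , eq , t = holds-y y τ j τ< j< in
          subst T (viol u (subst (T ∘ proj₂ (someState τ j)) (sym eq) (∧-complete (≡ᵇ-complete {τ} refl) (≡ᵇ-complete {j} refl)))) t

        good₂ : ∀ τ j b b′ → τ < suc N → j < suc N ∸ τ → b < #State → b′ < #State → T (unfinished x m N τ j b b′) →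
                ¬ Violated S (notBoth τ j b b′)
        good₂ τ j b b′ τ< j< b< b′< t viol = impossible (∨-sound t)
          where
          b≡ : b ≡ toℕ (st y τ j)
          b≡ = value {τ} {j} (member {S} {proj₂ (notBoth τ j b b′)} viol (∈-LX τ< j< b<) (∧-complete (≡ᵇ-complete {τ} refl) (∧-complete (≡ᵇ-complete {j} refl) (∨-inj₁ {b ≡ᵇ b} {b ≡ᵇ b′} (≡ᵇ-complete {b} refl)))))
          b′≡ : b′ ≡ toℕ (st y τ j)
          b′≡ = value {τ} {j} (member {S} {proj₂ (notBoth τ j b b′)} viol (∈-LX τ< j< b′<) (∧-complete (≡ᵇ-complete {τ} refl) (∧-complete (≡ᵇ-complete {j} refl) (∨-inj₂ {b′ ≡ᵇ b} (≡ᵇ-complete {b′} refl)))))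
          start-ok : ∀ τ → b ≡ toℕ (st y τ j) → τ ≡ 0 → T (not (table #State (λ a → initial x m (dec a) j) b)) → ⊥
          start-ok .0 b≡ refl t = not-sound t (subst (T ∘ table #State (λ a → initial x m (dec a) j)) (sym b≡)
            (subst T (sym (table-toℕ (λ a → initial x m (dec a) j) (st y 0 j)))
              (subst (λ s → T (initial x m s j)) (sym (dec-enc (column (config y 0) j))) (initial-complete x y j))))
          end-ok : ∀ τ j → b ≡ toℕ (st y τ j) → τ ≡ N → j ≡ 0 → T (not (table #State (λ a → accepting (dec a)) b)) → ⊥
          end-ok _ _ b≡ refl refl t = not-sound t (subst (T ∘ table #State (λ a → accepting (dec a))) (sym b≡)
            (subst T (sym (table-toℕ (λ a → accepting (dec a)) (st y N 0)))
              (subst (T ∘ accepting) (sym (dec-enc (column (config y N) 0))) (≡⇒T acc))))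
          impossible : T (not (b ≡ᵇ b′)) ⊎ _ → ⊥
          impossible (inj₁ t) = not-sound t (≡ᵇ-complete {b} (trans b≡ (sym b′≡)))
          impossible (inj₂ t) with ∨-sound t
          ... | inj₁ t₁ = start-ok τ b≡ (≡ᵇ-sound (proj₁ (∧-sound {τ ≡ᵇ 0} t₁))) (proj₂ (∧-sound {τ ≡ᵇ 0} t₁))
          ... | inj₂ t₂ = end-ok τ j b≡ (≡ᵇ-sound (proj₁ (∧-sound {τ ≡ᵇ N} t₂)))
                (≡ᵇ-sound (proj₁ (∧-sound {j ≡ᵇ 0} (proj₂ (∧-sound {τ ≡ᵇ N} t₂)))))
                (proj₂ (∧-sound {j ≡ᵇ 0} (proj₂ (∧-sound {τ ≡ᵇ N} t₂))))

        good₃ : ∀ τ j h l s r b → τ < N → j < N ∸ τ → h < #State → l < #State → s < #State → r < #State → b < #State →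
                T (wrongStep j h l s r b) → ¬ Violated S (notStep τ j h l s r b)
        good₃ τ j h l s r b τ< j< h< l< s< r< b< t viol = not-sound wrong-st
            (subst T (sym (dec-true (rule Fin.≟ st y (suc τ) j) (sym st≡))) tt)
          where
          j<′ : suc j < suc N ∸ τ
          j<′ = ℕ.<-≤-trans (s≤s j<) (ℕ.≤-reflexive (sym (ℕ.+-∸-assoc 1 (ℕ.<⇒≤ τ<))))
          τ<′ : τ < suc N
          τ<′ = ℕ.m<n⇒m<1+n τ<
          now : ∀ {i c} → i ≤ suc j → c < #State →
                T ((i ≡ᵇ 0) ∧ (c ≡ᵇ h) ∨ (i ≡ᵇ j ∸ 1) ∧ (c ≡ᵇ l) ∨ (i ≡ᵇ j) ∧ (c ≡ᵇ s) ∨ (i ≡ᵇ suc j) ∧ (c ≡ᵇ r)) → c ≡ toℕ (st y τ i)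
          now {i} {c} i≤ c< t = value {τ} {i} (member {S} {proj₂ (notStep τ j h l s r b)} viol (∈-LX τ<′ (ℕ.≤-<-trans i≤ j<′) c<)
            (∨-inj₁ (∧-complete (≡ᵇ-complete {τ} refl) t)))
          h≡ : h ≡ toℕ (st y τ 0)
          h≡ = now {0} {h} z≤n h< (∨-inj₁ (≡ᵇ-complete {h} refl))
          l≡ : l ≡ toℕ (st y τ (j ∸ 1))
          l≡ = now {j ∸ 1} {l} (ℕ.≤-trans (ℕ.m∸n≤m j 1) (ℕ.n≤1+n j)) l< (∨-inj₂ {(j ∸ 1 ≡ᵇ 0) ∧ (l ≡ᵇ h)}
            (∨-inj₁ (∧-complete (≡ᵇ-complete {j ∸ 1} refl) (≡ᵇ-complete {l} refl))))
          s≡ : s ≡ toℕ (st y τ j)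
          s≡ = now {j} {s} (ℕ.n≤1+n j) s< (∨-inj₂ {(j ≡ᵇ 0) ∧ (s ≡ᵇ h)} (∨-inj₂ {(j ≡ᵇ j ∸ 1) ∧ (s ≡ᵇ l)}
            (∨-inj₁ (∧-complete (≡ᵇ-complete {j} refl) (≡ᵇ-complete {s} refl)))))
          r≡ : r ≡ toℕ (st y τ (suc j))
          r≡ = now {suc j} {r} ℕ.≤-refl r< (∨-inj₂ {(suc j ≡ᵇ 0) ∧ (r ≡ᵇ h)} (∨-inj₂ {(suc j ≡ᵇ j ∸ 1) ∧ (r ≡ᵇ l)}
            (∨-inj₂ {(suc j ≡ᵇ j) ∧ (r ≡ᵇ s)} (∧-complete (≡ᵇ-complete {suc j} refl) (≡ᵇ-complete {r} refl)))))
          b≡ : b ≡ toℕ (st y (suc τ) j)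
          b≡ = value {suc τ} {j} (member {S} {proj₂ (notStep τ j h l s r b)} viol (∈-LX (s≤s τ<) j< b<)
            (∨-inj₂ {(suc τ ≡ᵇ τ) ∧ ((j ≡ᵇ 0) ∧ (b ≡ᵇ h) ∨ (j ≡ᵇ j ∸ 1) ∧ (b ≡ᵇ l) ∨ (j ≡ᵇ j) ∧ (b ≡ᵇ s) ∨ (j ≡ᵇ suc j) ∧ (b ≡ᵇ r))} (∧-complete (≡ᵇ-complete {suc τ} refl) (∧-complete (≡ᵇ-complete {j} refl) (≡ᵇ-complete {b} refl)))))
          rule : Fin #State
          rule = enc (next (j ≡ᵇ 0) (dec (st y τ 0)) (dec (st y τ (j ∸ 1))) (dec (st y τ j)) (dec (st y τ (suc j))))
          st≡ : st y (suc τ) j ≡ rule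
          st≡ = trans (cong (λ c → enc (column c j)) (steps-suc τ (start , inputStore x y)))
            (cong enc (trans (column-step (config y τ) j) (sym (next-cong (dec-enc _) (dec-enc _) (dec-enc _) (dec-enc _)))))
            where
            next-cong : ∀ {h h′ l l′ s s′ r r′} → h ≡ h′ → l ≡ l′ → s ≡ s′ → r ≡ r′ →
                        next (j ≡ᵇ 0) h l s r ≡ next (j ≡ᵇ 0) h′ l′ s′ r′
            next-cong refl refl refl refl = refl
          wrong-st : T (wrong (j ≡ᵇ 0) (st y τ 0) (st y τ (j ∸ 1)) (st y τ j) (st y τ (suc j)) (st y (suc τ) j))
          wrong-st = subst T (wrongStep-toℕ j (st y τ 0) (st y τ (j ∸ 1)) (st y τ j) (st y τ (suc j)) (st y (suc τ) j))
            (subst T (go h≡ l≡ s≡ r≡ b≡) t)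
            where
            go : ∀ {h h′ l l′ s s′ r r′ b b′} → h ≡ h′ → l ≡ l′ → s ≡ s′ → r ≡ r′ → b ≡ b′ →
                 wrongStep j h l s r b ≡ wrongStep j h′ l′ s′ r′ b′
            go refl refl refl refl refl = refl

      encode-good : Good S
      encode-good = All.++⁺ (All-loop⁺ (suc N) λ τ τ< → All-loop⁺ (suc N ∸ τ) λ j j< → good₁ τ j τ< j< ∷ [])
        (All.++⁺ (All-loop⁺ (suc N) λ τ τ< → All-loop⁺ (suc N ∸ τ) λ j j< → All-loop⁺ #State λ b b< → All-loop⁺ #State λ b′ b′< →
                   All-when⁺ (unfinished x m N τ j b b′) λ t → good₂ τ j b b′ τ< j< b< b′< t ∷ [])
                 (All-loop⁺ N λ τ τ< → All-loop⁺ (N ∸ τ) λ j j< → All-loop⁺ #State λ h h< → All-loop⁺ #State λ l l< →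
                   All-loop⁺ #State λ s s< → All-loop⁺ #State λ r r< → All-loop⁺ #State λ b b< →
                   All-when⁺ (wrongStep j h l s r b) λ t → good₃ τ j h l s r b τ< j< h< l< s< r< b< t ∷ []))

    -- Row 0 displays the contents of register 1, which is the witness.
    encode-injective : ∀ y y′ → encode-y y ≡ encode-y y′ → y ≡ y′
    encode-injective y y′ eq = ext-vec λ i → Maybe.just-injective (trans (sym (nth-toList y i)) (trans (symbols i) (nth-toList y′ i)))
      where
      same : ∀ j → j < suc N → column (config y 0) j ≡ column (config y′ 0) j
      same j j< = let u , l≡ , t = holds-y y 0 j (s≤s z≤n) j< in
        trans (sym (dec-enc _)) (trans (cong dec (toℕ-injective (encode-y⁻ y′ l≡ (subst (λ S → T (lookup S u)) eq t)))) (dec-enc _))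
      symbols : ∀ (i : Fin m) → nth (Vec.toList y) (toℕ i) ≡ nth (Vec.toList y′) (toℕ i)
      symbols i = cong guessed (same (toℕ i) (s≤s (ℕ.≤-trans (ℕ.<⇒≤ (toℕ<n i)) m≤N)))

    count-good : #good ≡ count accepts?
    count-good = trans #good≡ (sym (count-≡ accepts? good? encode-y encode-good
      (λ y y′ _ _ → encode-injective y y′)
      (λ S good → Solution.y {S} good , Solution.accepted {S} good , Solution.determined {S} good)))

-- The r low bits of a numeral

-- The answer has to be the canonical numeral, without zeros at its most significant end. So the
-- first `r` bits are cut off behind the last set bit; its position plus one is the number of places
-- at or above which some bit is set.
lastBit : ℕ → Word → ℕ
lastBit r w = sumN r (λ i → bit (anyN r (λ j → (i <ᵇ suc j) ∧ bitAt w j)))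

lowBits : ℕ → Word → Word
lowBits r w = loop (lastBit r w) (λ i → bitAt w i ∷ [])

sumN-first : ∀ n f → sumN (suc n) f ≡ f 0 + sumN n (f ∘ suc)
sumN-first zero    f = ℕ.+-comm 0 (f 0)
sumN-first (suc n) f = trans (cong (_+ f (suc n)) (sumN-first n f)) (ℕ.+-assoc (f 0) _ _)

anyN-first : ∀ n p → anyN (suc n) p ≡ p 0 ∨ anyN n (p ∘ suc)
anyN-first zero    p = sym (Bool.∨-identityʳ (p 0))
anyN-first (suc n) p = trans (cong (_∨ p (suc n)) (anyN-first n p)) (Bool.∨-assoc (p 0) _ _)

loop-first : ∀ {A : Set} n (h : ℕ → List A) → loop (suc n) h ≡ h 0 ++ loop n (h ∘ suc)
loop-first zero    h = sym (List.++-identityʳ (h 0))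
loop-first (suc n) h = trans (cong (_++ h (suc n)) (loop-first n h)) (List.++-assoc (h 0) _ _)

-- Doubling on canonical numerals: zero remains the empty word.
cons : Bool → Word → Word
cons false []      = []
cons b     w       = b ∷ w

low : ℕ → Word → Word
low zero    w       = []
low (suc r) []      = []
low (suc r) (b ∷ w) = cons b (low r w)

lastBit-[] : ∀ r → lastBit r [] ≡ 0
lastBit-[] r = trans (sumN-cong r (λ i _ → cong bit (none r i))) (zeros r)
  where
  none : ∀ r i → anyN r (λ j → (i <ᵇ suc j) ∧ false) ≡ false
  none zero    i = refl
  none (suc r) i = trans (cong (_∨ ((i <ᵇ suc r) ∧ false)) (none r i)) (Bool.∧-zeroʳ (i <ᵇ suc r))
  zeros : ∀ r → sumN r (λ _ → 0) ≡ 0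
  zeros zero    = refl
  zeros (suc r) = cong (_+ 0) (zeros r)

lastBit-∷ : ∀ r b w → lastBit (suc r) (b ∷ w) ≡ bit (b ∨ anyN r (bitAt w)) + lastBit r w
lastBit-∷ r b w = trans (sumN-first r _) (cong₂ _+_
  (cong bit (anyN-first r _)) (sumN-cong r λ i _ → cong bit (anyN-first r _)))

lastBit-none : ∀ r w → anyN r (bitAt w) ≡ false → lastBit r w ≡ 0
lastBit-none r w none = trans (sumN-cong r λ i _ → cong bit (¬any i)) (zeros r)
  where
  zeros : ∀ r → sumN r (λ _ → 0) ≡ 0
  zeros zero    = refl
  zeros (suc r) = cong (_+ 0) (zeros r)
  ¬any : ∀ i → anyN r (λ j → (i <ᵇ suc j) ∧ bitAt w j) ≡ false
  ¬any i with anyN r (λ j → (i <ᵇ suc j) ∧ bitAt w j) in eq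
  ... | false = refl
  ... | true  = let j , j<r , t = any-sound r (≡⇒T eq) in
    contradiction (any-complete r j j<r (proj₂ (∧-sound {i <ᵇ suc j} t))) (subst (¬_ ∘ T) (sym none) id)

lastBit-some : ∀ r w → anyN r (bitAt w) ≡ true → 0 < lastBit r w
lastBit-some (suc r) w some = ℕ.≤-trans
  (ℕ.≤-reflexive (cong bit (sym some))) (ℕ.≤-trans (ℕ.m≤m+n _ _) (ℕ.≤-reflexive (sym (sumN-first r _))))

lowBits≡low : ∀ r w → lowBits r w ≡ low r w
lowBits≡low zero    w       = refl
lowBits≡low (suc r) []      = cong (λ k → loop k (λ i → false ∷ [])) (lastBit-[] (suc r))
lowBits≡low (suc r) (b ∷ w) = trans (cong (λ k → loop k (λ i → bitAt (b ∷ w) i ∷ [])) (lastBit-∷ r b w))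
  (trans (by b (anyN r (bitAt w)) refl) (cong (cons b) (lowBits≡low r w)))
  where
  cons-nonempty : ∀ b w → 0 < length w → b ∷ w ≡ cons b w
  cons-nonempty false (_ ∷ _) _ = refl
  cons-nonempty true  (_ ∷ _) _ = refl
  length-loop : ∀ n (p : ℕ → Bool) → length (loop n (λ i → p i ∷ [])) ≡ n
  length-loop zero    p = refl
  length-loop (suc n) p = trans (List.length-++ (loop n _)) (trans (cong (_+ 1) (length-loop n p)) (ℕ.+-comm n 1))
  by : ∀ b c → anyN r (bitAt w) ≡ c →
       loop (bit (b ∨ anyN r (bitAt w)) + lastBit r w) (λ i → bitAt (b ∷ w) i ∷ []) ≡ cons b (lowBits r w)
  by b true eq rewrite eq | Bool.∨-zeroʳ b = trans (loop-first (lastBit r w) _)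
    (cons-nonempty b _ (ℕ.≤-trans (lastBit-some r w eq) (ℕ.≤-reflexive (sym (length-loop (lastBit r w) _)))))
  by false false eq rewrite eq | lastBit-none r w eq = refl
  by true  false eq rewrite lastBit-none r w eq = refl

binary-even : ∀ k → binary (k + k) ≡ cons false (binary k)
binary-even zero    = refl
binary-even (suc k) = trans (binary-double k) (nonempty (binary k))
  where
  nonempty : ∀ w → false ∷ increment w ≡ cons false (increment w)
  nonempty []          = refl
  nonempty (false ∷ w) = refl
  nonempty (true ∷ w)  = refl

binary-odd : ∀ k → binary (suc (k + k)) ≡ true ∷ binary k
binary-odd zero    = refl
binary-odd (suc k) = cong increment (binary-double k)

halve : ∀ g → ∃₂ λ b k → g ≡ bit b + (k + k)
halve zero    = false , 0 , refl
halve (suc g) with halve g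
... | false , k , eq = true , k , cong suc eq
... | true  , k , eq = false , suc k , trans (cong suc eq) (cong suc (sym (ℕ.+-suc k k)))

-- Induction by halving: a multiple of a power of 2 with exponent `suc r` does not affect the lowest
-- bit and contributes a multiple of the next smaller power to the half.
low-binary : ∀ r g z → g < 2 ^ r → low r (binary (g + z * 2 ^ r)) ≡ binary g
low-binary zero    zero z _ = refl
low-binary zero    (suc g) z (s≤s ())
low-binary (suc r) g z g< with halve g
... | b , k , refl = trans (cong (low (suc r) ∘ binary) (ring (bit b) k z (2 ^ r))) (by b g<)
  where
  ring : ∀ b k z q → b + (k + k) + z * (q + (q + 0)) ≡ b + ((k + z * q) + (k + z * q))
  ring = solve-∀
  M : ℕ
  M = k + z * 2 ^ r
  half : ∀ c → c + (k + k) < 2 ^ r + (2 ^ r + 0) → k < 2 ^ r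
  half c lt = ℕ.≰⇒> λ q≤k → ℕ.<⇒≱ lt (ℕ.≤-trans (ℕ.+-mono-≤ q≤k (ℕ.≤-trans (ℕ.≤-reflexive (ℕ.+-identityʳ _)) q≤k)) (ℕ.m≤n+m (k + k) c))
  low-cons : ∀ w → low (suc r) (cons false w) ≡ cons false (low r w)
  low-cons []      = cong (cons false) (low-[] r)
    where
    low-[] : ∀ r → [] ≡ low r []
    low-[] zero    = refl
    low-[] (suc r) = refl
  low-cons (b ∷ w) = refl
  by : ∀ b → bit b + (k + k) < 2 ^ suc r → low (suc r) (binary (bit b + (M + M))) ≡ binary (bit b + (k + k))
  by false lt = trans (cong (low (suc r)) (binary-even M)) (trans (low-cons (binary M))
    (trans (cong (cons false) (low-binary r k z (half 0 lt))) (sym (binary-even k))))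
  by true lt = trans (cong (low (suc r)) (binary-odd M))
    (trans (cong (true ∷_) (low-binary r k z (half 1 lt))) (sym (binary-odd k)))

-- Variables of the language and the flattening of nested loops

v₀ : Fun {1 + n} (get zero)
v₀ = varᶜ zero
v₁ : Fun {2 + n} (get (suc zero))
v₁ = varᶜ (suc zero)
v₂ : Fun {3 + n} (get (suc (suc zero)))
v₂ = varᶜ (suc (suc zero))
v₃ : Fun {4 + n} (get (suc (suc (suc zero))))
v₃ = varᶜ (suc (suc (suc zero)))
v₄ : Fun {5 + n} (get (suc (suc (suc (suc zero)))))
v₄ = varᶜ (suc (suc (suc (suc zero))))
v₅ : Fun {6 + n} (get (suc (suc (suc (suc (suc zero))))))
v₅ = varᶜ (suc (suc (suc (suc (suc zero)))))
v₆ : Fun {7 + n} (get (suc (suc (suc (suc (suc (suc zero)))))))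
v₆ = varᶜ (suc (suc (suc (suc (suc (suc zero))))))
v₇ : Fun {8 + n} (get (suc (suc (suc (suc (suc (suc (suc zero))))))))
v₇ = varᶜ (suc (suc (suc (suc (suc (suc (suc zero)))))))
v₈ : Fun {9 + n} (get (suc (suc (suc (suc (suc (suc (suc (suc zero)))))))))
v₈ = varᶜ (suc (suc (suc (suc (suc (suc (suc (suc zero))))))))
v₉ : Fun {10 + n} (get (suc (suc (suc (suc (suc (suc (suc (suc (suc zero))))))))))
v₉ = varᶜ (suc (suc (suc (suc (suc (suc (suc (suc (suc zero)))))))))
v₁₀ : Fun {11 + n} (get (suc (suc (suc (suc (suc (suc (suc (suc (suc (suc zero)))))))))))
v₁₀ = varᶜ (suc (suc (suc (suc (suc (suc (suc (suc (suc (suc zero))))))))))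
v₁₁ : Fun {12 + n} (get (suc (suc (suc (suc (suc (suc (suc (suc (suc (suc (suc zero))))))))))))
v₁₁ = varᶜ (suc (suc (suc (suc (suc (suc (suc (suc (suc (suc (suc zero)))))))))))

concatMap-loop : ∀ {A B : Set} (g : A → List B) n h → concatMap g (loop n h) ≡ loop n (concatMap g ∘ h)
concatMap-loop g zero    h = refl
concatMap-loop g (suc n) h = trans (List.concatMap-++ g (loop n h) (h n)) (cong (_++ concatMap g (h n)) (concatMap-loop g n h))

loop-≗ : ∀ {A : Set} n {g h : ℕ → List A} → (∀ i → g i ≡ h i) → loop n g ≡ loop n h
loop-≗ zero    eq = refl
loop-≗ (suc n) eq = cong₂ _++_ (loop-≗ n eq) (eq n)

concatMap-∷[] : ∀ {A B : Set} (g : A → List B) a → concatMap g (a ∷ []) ≡ g a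
concatMap-∷[] g a = List.++-identityʳ (g a)

concatMap-replicate : ∀ {A B : Set} (g : A → List B) r a → concatMap g (replicate r a) ≡ loop r (λ _ → g a)
concatMap-replicate g zero    a = refl
concatMap-replicate g (suc r) a = trans (cong (g a ++_) (concatMap-replicate g r a)) (sym (loop-first r (λ _ → g a)))

concatMap-concatMap : ∀ {A B C : Set} (g : B → List C) (f : A → List B) xs →
                      concatMap g (concatMap f xs) ≡ concatMap (concatMap g ∘ f) xs
concatMap-concatMap g f []       = refl
concatMap-concatMap g f (x ∷ xs) = trans (List.concatMap-++ g (f x) _) (cong (concatMap g (f x) ++_) (concatMap-concatMap g f xs))

-- The clause matrix of a tableau is generated in polynomial time.

module TableauCode (prog : Program ⊥) (mF NF : Word → ℕ)
  (mᶜ : ∀ {n} → Fun {n} (λ ρ → mF (word first ρ))) (Nᶜ : ∀ {n} → Fun {n} (λ ρ → NF (word first ρ))) where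
  open Tableau prog

  private
    Clause : Set
    Clause = Bool × (𝕏 → Bool)

    labels : Word → List 𝕏
    labels x = LX x (mF x) (NF x)

    clauses : Word → List Clause
    clauses x = LC x (mF x) (NF x)

  module M (x : Word) = Constraints (labels x) (clauses x) (suc (mF x))

  genLabels : {g : Env n → 𝕏 → Word} → Gen {3 + n} (λ (((ρ , τ) , j) , a) → g ρ (τ , j , a)) →
              Gen (λ ρ → concatMap (g ρ) (labels (word first ρ)))
  genLabels {g = g} G = extGen
    (λ ρ → sym (trans (concatMap-loop (g ρ) (suc (NF (word first ρ))) _) (loop-≗ (suc (NF (word first ρ))) λ τ →
      trans (concatMap-loop (g ρ) (suc (NF (word first ρ)) ∸ τ) _) (loop-≗ (suc (NF (word first ρ)) ∸ τ) λ j →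
      trans (concatMap-loop (g ρ) #State _) (loop-≗ #State λ a → concatMap-∷[] (g ρ) _)))))
    (loopᶜ (litᶜ 1 ⊕ᶜ Nᶜ) (loopᶜ ((litᶜ 1 ⊕ᶜ Nᶜ) ⊖ᶜ v₀) (loopᶜ (litᶜ #State) G)))

  matchBitᶜ : ∀ s {f : Env n → ℕ} → Fun f → BFun (λ ρ → matchBit (word first ρ) s (f ρ))
  matchBitᶜ nothing      J = notᶜ (J <ᶜ lenᶜ first)
  matchBitᶜ (just false) J = (J <ᶜ lenᶜ first) ∧ᶜ notᶜ (bitᶜ first J)
  matchBitᶜ (just true)  J = (J <ᶜ lenᶜ first) ∧ᶜ bitᶜ first J

  matchGuessᶜ : ∀ s {f : Env n → ℕ} → Fun f → BFun (λ ρ → matchGuess (mF (word first ρ)) s (f ρ))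
  matchGuessᶜ nothing  J = notᶜ (J <ᶜ mᶜ)
  matchGuessᶜ (just _) J = J <ᶜ mᶜ

  initialᶜ : ∀ s {f : Env n → ℕ} → Fun f → BFun (λ ρ → initial (word first ρ) (mF (word first ρ)) s (f ρ))
  initialᶜ (l , s₀ ∷ s₁ ∷ v) J = boolᶜ (does (l Fin.≟ start)) ∧ᶜ matchBitᶜ s₀ J ∧ᶜ matchGuessᶜ s₁ J ∧ᶜ boolᶜ (blank v)

  unfinishedᶜ : ∀ {τ j a b : Env n → ℕ} → Fun τ → Fun j → Fun a → Fun b →
                BFun (λ ρ → unfinished (word first ρ) (mF (word first ρ)) (NF (word first ρ)) (τ ρ) (j ρ) (a ρ) (b ρ))
  unfinishedᶜ Τ J A B = notᶜ (A ≡ᶜ B)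
    ∨ᶜ (Τ ≡ᶜ litᶜ 0) ∧ᶜ notᶜ (tableᶜ (λ i → initialᶜ (dec i) J) A)
    ∨ᶜ (Τ ≡ᶜ Nᶜ) ∧ᶜ (J ≡ᶜ litᶜ 0) ∧ᶜ notᶜ (tableᶜ (λ i → boolᶜ (accepting (dec i))) A)

  wrongStepᶜ : ∀ {j h l s r b : Env n → ℕ} → Fun j → Fun h → Fun l → Fun s → Fun r → Fun b →
               BFun (λ ρ → wrongStep (j ρ) (h ρ) (l ρ) (s ρ) (r ρ) (b ρ))
  wrongStepᶜ J H L S R B = tableᶜ {k = 2} (λ z → tableᶜ {k = #State} (λ h → tableᶜ {k = #State} (λ l → tableᶜ {k = #State} (λ s →
    tableᶜ {k = #State} (λ r → tableᶜ {k = #State} (λ b → boolᶜ (wrong (does (z Fin.≟ suc zero)) h l s r b)) B) R) S) L) H) (litᶜ 1 ⊖ᶜ J)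

  -- The list of clauses is traversed by loops in its own order. The loops over states have a
  -- constant number of iterations, `when` is a loop with at most one iteration, and the innermost
  -- loop makes the copies, so everything stays polynomial in the input.
  genClauses : {g : Env n → Clause → Word} →
    Gen {3 + n} (λ (((ρ , τ) , j) , _) → g ρ (someState τ j)) →
    Gen {6 + n} (λ ((((((ρ , τ) , j) , a) , b) , _) , _) → g ρ (notBoth τ j a b)) →
    Gen {9 + n} (λ (((((((((ρ , τ) , j) , h) , l) , s) , r) , b) , _) , _) → g ρ (notStep τ j h l s r b)) →
    Gen (λ ρ → concatMap (g ρ) (M.CC (word first ρ)))
  genClauses {n} {g} G₁ G₂ G₃ = extGen (λ ρ → sym (eq ρ (word first ρ)))
    (loopᶜ (litᶜ 1 ⊕ᶜ Nᶜ) (loopᶜ ((litᶜ 1 ⊕ᶜ Nᶜ) ⊖ᶜ v₀) (loopᶜ (litᶜ 1 ⊕ᶜ mᶜ) G₁))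
     ++ᶜ (loopᶜ (litᶜ 1 ⊕ᶜ Nᶜ) (loopᶜ ((litᶜ 1 ⊕ᶜ Nᶜ) ⊖ᶜ v₀) (loopᶜ (litᶜ #State) (loopᶜ (litᶜ #State)
            (loopᶜ (unfinishedᶜ v₃ v₂ v₁ v₀) (loopᶜ (litᶜ 1 ⊕ᶜ mᶜ) G₂)))))
     ++ᶜ loopᶜ Nᶜ (loopᶜ (Nᶜ ⊖ᶜ v₀) (loopᶜ (litᶜ #State) (loopᶜ (litᶜ #State) (loopᶜ (litᶜ #State) (loopᶜ (litᶜ #State)
            (loopᶜ (litᶜ #State) (loopᶜ (wrongStepᶜ v₅ v₄ v₃ v₂ v₁ v₀) (loopᶜ (litᶜ 1 ⊕ᶜ mᶜ) G₃))))))))))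
    where
    module _ (ρ : Env n) (x : Word) where
      N r : ℕ
      N = NF x
      r = suc (mF x)
      f : Clause → Word
      f c = loop r (λ _ → g ρ c)
      down : ∀ n {h h′} → (∀ i → concatMap f (h i) ≡ h′ i) → concatMap f (loop n h) ≡ loop n h′
      down n {h} eq = trans (concatMap-loop f n h) (loop-≗ n eq)
      leaf : ∀ c → concatMap f (c ∷ []) ≡ f c
      leaf c = concatMap-∷[] f c
      out₁ out₂ out₃ : Word
      out₁ = loop (suc N) λ τ → loop (suc N ∸ τ) λ j → f (someState τ j)
      out₂ = loop (suc N) λ τ → loop (suc N ∸ τ) λ j → loop #State λ a → loop #State λ b →
        loop (bit (unfinished x (mF x) N τ j a b)) λ _ → f (notBoth τ j a b)
      out₃ = loop N λ τ → loop (N ∸ τ) λ j → loop #State λ h → loop #State λ l → loop #State λ s → loop #State λ r → loop #State λ b →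
        loop (bit (wrongStep j h l s r b)) λ _ → f (notStep τ j h l s r b)
      eq₁ : concatMap f (someStates x (mF x) N) ≡ out₁
      eq₁ = down (suc N) λ τ → down (suc N ∸ τ) λ j → leaf (someState τ j)
      eq₂ : concatMap f (notBoths x (mF x) N) ≡ out₂
      eq₂ = down (suc N) λ τ → down (suc N ∸ τ) λ j → down #State λ a → down #State λ b →
        down (bit (unfinished x (mF x) N τ j a b)) λ _ → leaf (notBoth τ j a b)
      eq₃ : concatMap f (notSteps x (mF x) N) ≡ out₃
      eq₃ = down N λ τ → down (N ∸ τ) λ j → down #State λ h → down #State λ l → down #State λ s → down #State λ r →
        down #State λ b → down (bit (wrongStep j h l s r b)) λ _ → leaf (notStep τ j h l s r b)
      eq : concatMap (g ρ) (M.CC x) ≡ out₁ ++ (out₂ ++ out₃)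
      eq = trans (concatMap-concatMap (g ρ) (replicate r) (clauses x))
        (trans (List.concatMap-cong (concatMap-replicate (g ρ) r) (clauses x))
        (trans (List.concatMap-++ f (someStates x (mF x) N) _) (cong₂ _++_ eq₁
          (trans (List.concatMap-++ f (notBoths x (mF x) N) _) (cong₂ _++_ eq₂ eq₃)))))

  genNodes : {g : Env n → 𝕏 ⊎ Clause → Word} →
    Gen {3 + n} (λ (((ρ , τ) , j) , a) → g ρ (inj₁ (τ , j , a))) →
    Gen {3 + n} (λ (((ρ , τ) , j) , _) → g ρ (inj₂ (someState τ j))) →
    Gen {6 + n} (λ ((((((ρ , τ) , j) , a) , b) , _) , _) → g ρ (inj₂ (notBoth τ j a b))) →
    Gen {9 + n} (λ (((((((((ρ , τ) , j) , h) , l) , s) , r) , b) , _) , _) → g ρ (inj₂ (notStep τ j h l s r b))) →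
    Gen (λ ρ → concatMap (g ρ) (M.nodes (word first ρ)))
  genNodes {g = g} G₀ G₁ G₂ G₃ = extGen
    (λ ρ → sym (trans (List.concatMap-++ (g ρ) (map inj₁ (labels (word first ρ))) _)
      (cong₂ _++_ (List.concatMap-map (g ρ) inj₁ (labels (word first ρ))) (List.concatMap-map (g ρ) inj₂ (M.CC (word first ρ))))))
    (genLabels {g = λ ρ → g ρ ∘ inj₁} G₀ ++ᶜ genClauses {g = λ ρ → g ρ ∘ inj₂} G₁ G₂ G₃)

  matrix : Word → Word
  matrix x = matrixWord (M.A x) (M.nodes x)

  zeroᶜ : Gen {n} (λ _ → false ∷ [])
  zeroᶜ = emitᶜ (boolᶜ false)

  -- The matrix consists of blocks by the kind of the row and of the column: coordinates, positive
  -- clauses, negative clauses for pairs, negative clauses for steps. Arcs lead only from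
  -- coordinates to positive clauses and from negative clauses to coordinates; all other blocks are
  -- zero. Row variables have higher indices than column variables.
  matrixᶜ : Gen {0} (matrix ∘ proj₁)
  matrixᶜ = extGen (λ ρ → List.concatMap-cong (λ u → concatMap-[-] (M.A (proj₁ ρ) u) (M.nodes (proj₁ ρ))) (M.nodes (proj₁ ρ)))
    (genNodes {g = λ ρ u → concatMap (λ v → M.A (proj₁ ρ) u v ∷ []) (M.nodes (proj₁ ρ))}
      (genNodes {g = λ (((ρ , τ′) , j′) , a′) v → M.A (proj₁ ρ) (inj₁ (τ′ , j′ , a′)) v ∷ []}
         zeroᶜ (emitᶜ ((v₅ ≡ᶜ v₂) ∧ᶜ (v₄ ≡ᶜ v₁))) zeroᶜ zeroᶜ)
      (genNodes {g = λ (((ρ , τ) , j) , _) v → M.A (proj₁ ρ) (inj₂ (someState τ j)) v ∷ []}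
         zeroᶜ zeroᶜ zeroᶜ zeroᶜ)
      (genNodes {g = λ ((((((ρ , τ) , j) , a) , b) , _) , _) v → M.A (proj₁ ρ) (inj₂ (notBoth τ j a b)) v ∷ []}
         (emitᶜ ((v₂ ≡ᶜ v₈) ∧ᶜ (v₁ ≡ᶜ v₇) ∧ᶜ ((v₀ ≡ᶜ v₆) ∨ᶜ (v₀ ≡ᶜ v₅)))) zeroᶜ zeroᶜ zeroᶜ)
      (genNodes {g = λ (((((((((ρ , τ) , j) , h) , l) , s) , r) , b) , _) , _) v → M.A (proj₁ ρ) (inj₂ (notStep τ j h l s r b)) v ∷ []}
         (emitᶜ ((v₂ ≡ᶜ v₁₁) ∧ᶜ ((v₁ ≡ᶜ litᶜ 0) ∧ᶜ (v₀ ≡ᶜ v₉) ∨ᶜ (v₁ ≡ᶜ v₁₀ ⊖ᶜ litᶜ 1) ∧ᶜ (v₀ ≡ᶜ v₈) ∨ᶜ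
                                  (v₁ ≡ᶜ v₁₀) ∧ᶜ (v₀ ≡ᶜ v₇) ∨ᶜ (v₁ ≡ᶜ litᶜ 1 ⊕ᶜ v₁₀) ∧ᶜ (v₀ ≡ᶜ v₆))
                 ∨ᶜ (v₂ ≡ᶜ litᶜ 1 ⊕ᶜ v₁₁) ∧ᶜ (v₁ ≡ᶜ v₁₀) ∧ᶜ (v₀ ≡ᶜ v₅)))
         zeroᶜ zeroᶜ zeroᶜ))

-- #P-hardness

lookup-⊎ : ∀ {A B : Set} (xs : List A) (ys : List B) (v : Fin (length (map inj₁ xs ++ map inj₂ ys)))
           (u : Fin (length xs + length ys)) → toℕ v ≡ toℕ u →
           List.lookup (map inj₁ xs ++ map inj₂ ys) v ≡ Sum.map (List.lookup xs) (List.lookup ys) (splitAt (length xs) u)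
lookup-⊎ []       (y ∷ ys) zero    zero    eq = refl
lookup-⊎ []       (y ∷ ys) (suc v) (suc u) eq = lookup-⊎ [] ys v u (ℕ.suc-injective eq)
lookup-⊎ (x ∷ xs) ys       zero    zero    eq = refl
lookup-⊎ (x ∷ xs) ys       (suc v) (suc u) eq = trans (lookup-⊎ xs ys v u (ℕ.suc-injective eq)) (shift (splitAt (length xs) u))
  where
  shift : ∀ s → Sum.map (List.lookup xs) (List.lookup ys) s ≡
                Sum.map (List.lookup (x ∷ xs)) (List.lookup ys) (Sum.map suc id s)
  shift (inj₁ i) = refl
  shift (inj₂ j) = refl

module Hardness (F : CountingProblem) (F∈ : F ∈#P) where
  open _∈#P F∈
  open PolyTime verify-FP renaming (program to verifier; bound to runtime; correct to halting)

  mF NF : Word → ℕ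
  mF x = ⟦ witnessLength ⟧ (length x)
  -- The last summand makes the time bound at least the length of a witness, as the tableau
  -- requires; waiting longer is harmless because the exit is a fixed point.
  NF x = ⟦ runtime ⟧ (length x + (mF x + 0)) + mF x

  open TableauCode verifier mF NF (polyᶜ witnessLength (lenᶜ first))
    (polyᶜ runtime (lenᶜ first ⊕ᶜ (polyᶜ witnessLength (lenᶜ first) ⊕ᶜ litᶜ 0)) ⊕ᶜ polyᶜ witnessLength (lenᶜ first))
  open Tableau verifier

  module _ (x : Word) where
    private
      m N : ℕ
      m = mF x
      N = NF x
      module X = Counting x m N (ℕ.m≤n+m m _) (suc m)

    verdict : ∀ (y : Vec Bool m) → nth (proj₂ (X.config y N) 0) 0 ≡ just (verify x (Vec.toList y))
    verdict y = final (halting (x , Vec.toList y))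
      where
      final : (∃₂ λ τ t → noOracle ⊢⟨ verifier , load (x ∷ Vec.toList y ∷ []) ⟩⇓⟨ τ , t ⟩ ×
                t ≤ ⟦ runtime ⟧ (length x + (length (Vec.toList y) + 0)) × unload 1 τ ≡ (verify x (Vec.toList y) ∷ []) ∷ []) →
              nth (proj₂ (X.config y N) 0) 0 ≡ just (verify x (Vec.toList y))
      final (τ , t , run , t≤ , out) = trans (cong (λ c → nth (proj₂ c 0) 0) (halted N run t≤N))
        (cong (λ v → nth (Vec.head v) 0) out)
        where
        t≤N : t ≤ N
        t≤N = ℕ.≤-trans (ℕ.≤-trans t≤ (ℕ.≤-reflexive (cong (λ l → ⟦ runtime ⟧ (length x + (l + 0))) (Vec.length-toList y))))
                        (ℕ.m≤m+n _ m)

    count-accepting : count X.accepts? ≡ F x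
    count-accepting = trans (count-cong X.accepts? (λ y → T? (verify x (Vec.toList y)))
        (λ y acc → ≡⇒T (trans (sym (bit≡ y)) acc)) (λ y t → trans (bit≡ y) (T⇒≡ t))) (sym (counts x))
      where
      bit≡ : ∀ y → isTrue (nth (proj₂ (X.config y N) 0) 0) ≡ verify x (Vec.toList y)
      bit≡ y = cong isTrue (verdict y)

    private
      |X| : ℕ
      |X| = length (M.nodes x)
      E : ℕ → ℕ → Bool
      E = arcs (matrix x) |X|
      a b : ℕ
      a = length (LX x m N)
      b = length (M.CC x)

    E≡ : ∀ u v → E (toℕ u) (toℕ v) ≡ M.A x (M.node x u) (M.node x v)
    E≡ u v = trans (cong₂ E (sym (Fin.toℕ-cast n≡ u)) (sym (Fin.toℕ-cast n≡ v)))
      (trans (bitAt-matrixWord (M.A x) (M.nodes x) (Fin.cast n≡ u) (Fin.cast n≡ v))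
        (cong₂ (M.A x) (lookup-⊎ (LX x m N) (M.CC x) (Fin.cast n≡ u) u (Fin.toℕ-cast n≡ u))
                       (lookup-⊎ (LX x m N) (M.CC x) (Fin.cast n≡ v) v (Fin.toℕ-cast n≡ v))))
      where
      n≡ : a + b ≡ |X|
      n≡ = sym (M.length-nodes x)

    |X|>0 : 0 < |X|
    |X|>0 = ℕ.≤-trans (List.∈-length label) (ℕ.≤-trans (ℕ.m≤m+n a b) (ℕ.≤-reflexive (sym (M.length-nodes x))))
      where
      label : (0 , 0 , toℕ (enc (start , tabulate (λ _ → nothing)))) ∈ₗ LX x m N
      label = X.∈-LX (s≤s z≤n) (s≤s z≤n) (toℕ<n _)

    #Closed-matrix≡ : ∃ λ z → #Closed (matrix x) ≡ F x + z * 2 ^ suc m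
    #Closed-matrix≡ = from (M.closedSets-mod x E E≡)
      where
      open ≡-Reasoning
      from : (∃ λ z → closedSets (a + b) E ≡ M.#good x + z * 2 ^ suc m) → ∃ λ z → #Closed (matrix x) ≡ F x + z * 2 ^ suc m
      from (z , eq) = z , (begin
        #Closed (matrix x)                ≡⟨ #Closed-matrix (matrix x) |X| (length-matrixWord (M.A x) (M.nodes x)) |X|>0 ⟩
        closedSets |X| E                  ≡⟨ cong (λ k → closedSets k E) (M.length-nodes x) ⟩
        closedSets (a + b) E              ≡⟨ eq ⟩
        M.#good x + z * 2 ^ suc m         ≡⟨ cong (_+ z * 2 ^ suc m) (trans X.count-good count-accepting) ⟩
        F x + z * 2 ^ suc m               ∎)

    -- If every witness is accepted, `F x` reaches the `m`-th power of 2. This is why one copy more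
    -- than the number of witness bits is taken.
    F< : F x < 2 ^ suc m
    F< = ℕ.≤-<-trans (ℕ.≤-trans (ℕ.≤-reflexive (counts x)) (count≤ {m} (λ y → T? (verify x (Vec.toList y))))) (ℕ.^-monoʳ-< 2 (s≤s (s≤s z≤n)) (ℕ.n<1+n m))

    answer : lowBits (suc m) (binary (#Closed (matrix x))) ≡ binary (F x)
    answer = let z , eq = #Closed-matrix≡ in trans (lowBits≡low (suc m) (binary (#Closed (matrix x))))
      (trans (cong (low (suc m) ∘ binary) eq) (low-binary (suc m) (F x) z F<))

  reduction : PolyTime {Q = ⊤} (λ _ → binary ∘ #Closed) length (λ x → x ∷ []) (λ x → binary (F x) ∷ [])
  reduction = PolyTime-cong (λ x → cong (_∷ []) (answer x))
    (query-FP #Closed (con 1 ⊞ var) (λ w → length-binary (length w) (#Closed-bound w))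
      {g = matrix} {h = λ (x , w) → lowBits (suc (mF x)) w} matrixᶜ
      (loopᶜ (sumᶜ r (anyᶜ (wkᶜ r) ((v₁ <ᶜ litᶜ 1 ⊕ᶜ v₀) ∧ᶜ bitᶜ second v₀))) (emitᶜ (bitᶜ second v₀))))
    where
    r : ∀ {n} → Fun {n} (λ ρ → suc (mF (word first ρ)))
    r = litᶜ 1 ⊕ᶜ polyᶜ witnessLength (lenᶜ first)

#Closed-hard : #P-hard #Closed
#Closed-hard F F∈ = Hardness.reduction F F∈

-- Edges as positions in the list of edges

module Edges (G : Graph) where
  open Graph G

  private
    Listed? : ∀ (e : Vertex × Vertex) → Dec (proj₁ e Fin.< proj₂ e × Adj (proj₁ e) (proj₂ e))
    Listed? (u , v) = (u Fin.<? v) ×-dec Adj? u v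

    pairs : List (Vertex × Vertex)
    pairs = cartesianProduct (allFin order) (allFin order)

  ends : Edge → Vertex × Vertex
  ends = List.lookup edges

  ends-injective : ∀ {e f} → ends e ≡ ends f → e ≡ f
  ends-injective = lookup-injective (Unique.filter⁺ Listed?
    (Unique.cartesianProduct⁺ (Unique.allFin⁺ order) (Unique.allFin⁺ order)))

  ends-listed : ∀ e → proj₁ (ends e) Fin.< proj₂ (ends e) × Adj (proj₁ (ends e)) (proj₂ (ends e))
  ends-listed e = proj₂ (List.∈-filter⁻ Listed? {xs = pairs} (List.∈-lookup e))

  private
    listed : ∀ {u v} → u Fin.< v → Adj u v → ∃ λ e → ends e ≡ (u , v)
    listed {u} {v} u<v uv = Any.index e∈ , sym (AnyP.lookup-index e∈)
      where
      import Data.List.Relation.Unary.Any.Properties as AnyP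
      e∈ : (u , v) ∈ₗ edges
      e∈ = List.∈-filter⁺ Listed? (List.∈-cartesianProduct⁺ (∈-allFin u) (∈-allFin v)) (u<v , uv)

  Adj-sym : ∀ {u v} → Adj u v → Adj v u
  Adj-sym {u} {v} = subst T (symm u v)

  edge : ∀ {u v} → Adj u v → ∃ λ e → Joins e u v
  edge {u} {v} uv with Fin.<-cmp u v
  ... | tri< u<v _ _ = let e , eq = listed u<v uv in e , inj₁ eq
  ... | tri> _ _ v<u = let e , eq = listed v<u (Adj-sym uv) in e , inj₂ eq
  ... | tri≈ _ refl _ = ⊥-elim (subst T (irrefl u) uv)

  joins-unique : ∀ {e f u v} → Joins e u v → Joins f u v → e ≡ f
  joins-unique (inj₁ p) (inj₁ q) = ends-injective (trans p (sym q))
  joins-unique (inj₂ p) (inj₂ q) = ends-injective (trans p (sym q))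
  joins-unique {e} {f} (inj₁ p) (inj₂ q) = contradiction
    (subst (λ p → proj₁ p Fin.< proj₂ p) p (proj₁ (ends-listed e)))
    (ℕ.<-asym (subst (λ p → proj₁ p Fin.< proj₂ p) q (proj₁ (ends-listed f))))
  joins-unique {e} {f} (inj₂ p) (inj₁ q) = contradiction
    (subst (λ p → proj₁ p Fin.< proj₂ p) p (proj₁ (ends-listed e)))
    (ℕ.<-asym (subst (λ p → proj₁ p Fin.< proj₂ p) q (proj₁ (ends-listed f))))

-- Lower bounds for the linear program and for the matching number from disjoint
-- edges

zeroed : ∀ {n} → (Fin n → ℚ) → Fin n → Fin n → ℚ
zeroed y i v = if does (v Fin.≟ i) then 0ℚ else y v

sum-zeroed : ∀ {n} (y : Fin n → ℚ) i → Σℚ.sum y ≡ y i ℚ.+ Σℚ.sum (zeroed y i)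
sum-zeroed y zero    = cong (y zero ℚ.+_) (sym (ℚ.+-identityˡ _))
sum-zeroed y (suc i) = trans (cong (y zero ℚ.+_) (sum-zeroed (y ∘ suc) i)) (trans (sym (ℚ.+-assoc (y zero) (y (suc i)) _))
  (trans (cong (ℚ._+ Σℚ.sum (zeroed (y ∘ suc) i)) (ℚ.+-comm (y zero) (y (suc i)))) (ℚ.+-assoc (y (suc i)) (y zero) _)))

zeroed-other : ∀ {n} (y : Fin n → ℚ) {i v} → v ≢ i → zeroed y i v ≡ y v
zeroed-other y {i} {v} v≢i = cong (λ b → if b then 0ℚ else y v) (dec-false (v Fin.≟ i) v≢i)

zeroed≥0 : ∀ {n} (y : Fin n → ℚ) i → (∀ v → 0ℚ ℚ.≤ y v) → ∀ v → 0ℚ ℚ.≤ zeroed y i v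
zeroed≥0 y i y≥0 v with does (v Fin.≟ i)
... | true  = ℚ.≤-refl
... | false = y≥0 v

sum≥0 : ∀ {n} (y : Fin n → ℚ) → (∀ v → 0ℚ ℚ.≤ y v) → 0ℚ ℚ.≤ Σℚ.sum y
sum≥0 {zero}  y y≥0 = ℚ.≤-refl
sum≥0 {suc n} y y≥0 = ℚ.+-mono-≤ (y≥0 zero) (sum≥0 (y ∘ suc) (y≥0 ∘ suc))

-- Weak duality between fractional covers and matchings. The values at the first pair are split off
-- and replaced by zero, which by disjointness does not affect the remaining pairs.
sum-pairs : ∀ {n} k (y : Fin n → ℚ) (a b : Fin k → Fin n) → Injective _≡_ _≡_ a → Injective _≡_ _≡_ b →
            (∀ i j → a i ≢ b j) → (∀ v → 0ℚ ℚ.≤ y v) → (∀ i → 1ℚ ℚ.≤ y (a i) ℚ.+ y (b i)) → fromℕ′ k ℚ.≤ Σℚ.sum y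
sum-pairs zero    y a b a-inj b-inj a≢b y≥0 y≥1 = sum≥0 y y≥0
sum-pairs (suc k) y a b a-inj b-inj a≢b y≥0 y≥1 = ℚ.≤-trans (ℚ.≤-reflexive (fromℕ′-+ 1 k))
  (ℚ.≤-trans (ℚ.+-mono-≤ (y≥1 zero) rest) (ℚ.≤-reflexive (sym total)))
  where
  y₁ y₂ : _ → ℚ
  y₁ = zeroed y (a zero)
  y₂ = zeroed y₁ (b zero)
  keep : ∀ {v} → v ≢ a zero → v ≢ b zero → y₂ v ≡ y v
  keep v≢a v≢b = trans (zeroed-other y₁ v≢b) (zeroed-other y v≢a)
  rest : fromℕ′ k ℚ.≤ Σℚ.sum y₂
  rest = sum-pairs k y₂ (a ∘ suc) (b ∘ suc) (Fin.suc-injective ∘ a-inj) (Fin.suc-injective ∘ b-inj)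
    (λ i j → a≢b (suc i) (suc j)) (zeroed≥0 y₁ (b zero) (zeroed≥0 y (a zero) y≥0))
    (λ i → subst (1ℚ ℚ.≤_) (sym (cong₂ ℚ._+_
       (keep (λ eq → case a-inj eq of λ ()) (a≢b (suc i) zero))
       (keep (λ eq → a≢b zero (suc i) (sym eq)) (λ eq → case b-inj eq of λ ())))) (y≥1 (suc i)))
  total : Σℚ.sum y ≡ (y (a zero) ℚ.+ y (b zero)) ℚ.+ Σℚ.sum y₂
  total = trans (sum-zeroed y (a zero)) (trans (cong (y (a zero) ℚ.+_) (trans (sum-zeroed y₁ (b zero))
    (cong (ℚ._+ Σℚ.sum y₂) (zeroed-other y (a≢b zero zero ∘ sym))))) (sym (ℚ.+-assoc (y (a zero)) (y (b zero)) _)))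

-- The ceiling of a negative number is minus the floor of a positive one, hence minus a natural
-- number.
ceiling≤0 : ∀ p → p ℚ.≤ 0ℚ → ℤ.∣ 0ℤ ℤ.⊔ ceiling p ∣ ≡ 0
ceiling≤0 (ℚ.mkℚ (ℤ.+ zero) d _) _ = refl
ceiling≤0 (ℚ.mkℚ (ℤ.+ suc k) d _) (ℚ.*≤* (ℤ.+≤+ ()))
ceiling≤0 (ℚ.mkℚ ℤ.-[1+ k ] d _) _ = nonneg (ℤ.1ℤ ℤ.* ℤ.+ (suc k DM./ suc d)) (ℤ.*-identityˡ _)
  where
  import Data.Nat.DivMod as DM
  nonneg : ∀ q → q ≡ ℤ.+ (suc k DM./ suc d) → ℤ.∣ 0ℤ ℤ.⊔ (ℤ.- q) ∣ ≡ 0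
  nonneg (ℤ.+ zero)  _ = refl
  nonneg (ℤ.+ suc q) _ = refl

-- Both parameters are truncated at 0, so it is enough that the budget `k` does not exceed the
-- optimum of the linear program and the matching number. As many disjoint edges bound both from
-- below.
module Disjoint (G : Graph) (k : ℕ) (a b : Fin k → Graph.Vertex G)
  (a-injective : Injective _≡_ _≡_ a) (b-injective : Injective _≡_ _≡_ b) (a≢b : ∀ i j → a i ≢ b j)
  (a~b : ∀ i → Graph.Adj G (a i) (b i)) where
  open Graph G
  open Edges G
  open Matching G

  parameter-ℓ : ℤ.∣ 0ℤ ℤ.⊔ ceiling (fromℕ′ k ℚ.- LP-VC G) ∣ ≡ 0
  parameter-ℓ = ceiling≤0 _ (ℚ.≤-trans
    (ℚ.+-monoˡ-≤ (ℚ.- LP-VC G) (sum-pairs k _ a b a-injective b-injective a≢b (proj₂ feasible) (λ i → proj₁ feasible _ _ (a~b i))))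
    (ℚ.≤-reflexive (ℚ.+-inverseʳ (LP-VC G))))
    where
    feasible : LinearProgram.Feasible G (proj₁ (LinearProgram.solution G))
    feasible = proj₁ (proj₂ (LinearProgram.solution G))

  private
    e : Fin k → Edge
    e i = proj₁ (edge (a~b i))

    e-joins : ∀ i → Joins (e i) (a i) (b i)
    e-joins i = proj₂ (edge (a~b i))

    incident : ∀ i {v} → Incident (e i) v → v ≡ a i ⊎ v ≡ b i
    incident i inc with e-joins i | inc
    ... | inj₁ eq | inj₁ v≡ = inj₁ (trans (sym v≡) (cong proj₁ eq))
    ... | inj₁ eq | inj₂ v≡ = inj₂ (trans (sym v≡) (cong proj₂ eq))
    ... | inj₂ eq | inj₁ v≡ = inj₂ (trans (sym v≡) (cong proj₁ eq))
    ... | inj₂ eq | inj₂ v≡ = inj₁ (trans (sym v≡) (cong proj₂ eq))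

    meet : ∀ i j {v} → Incident (e i) v → Incident (e j) v → i ≡ j
    meet i j p q with incident i p | incident j q
    ... | inj₁ x | inj₁ y = a-injective (trans (sym x) y)
    ... | inj₂ x | inj₂ y = b-injective (trans (sym x) y)
    ... | inj₁ x | inj₂ y = contradiction (trans (sym x) y) (a≢b i j)
    ... | inj₂ x | inj₁ y = contradiction (trans (sym y) x) (a≢b j i)

    e-injective : Injective _≡_ _≡_ e
    e-injective {i} {j} eq = meet i j (inj₁ refl) (inj₁ (cong (proj₁ ∘ ends) (sym eq)))

    M : EdgeSet
    M = tabulate λ f → does (any? λ i → e i Fin.≟ f)

    M⁻ : ∀ {f} → f ∈ M → ∃ λ i → e i ≡ f
    M⁻ {f} f∈ with any? (λ i → e i Fin.≟ f) | ∈-tabulate⁻ {p = λ f → does (any? λ i → e i Fin.≟ f)} f∈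
    ... | yes p | _ = p

    M-matching : IsMatching M
    M-matching f g v f∈ g∈ fv gv with M⁻ f∈ | M⁻ g∈
    ... | i , refl | j , refl = cong e (meet i j fv gv)

    k≤M : k ≤ ∣ M ∣
    k≤M = injected⇒≤ e e-injective λ i → ∈-tabulate⁺ (≡⇒T (dec-true (any? λ j → e j Fin.≟ e i) (i , refl)))

    open import Data.List.Extrema ℕ.≤-totalOrder using (argmax; argmax-all; f[xs]≤f[argmax])

    matchings : List EdgeSet
    matchings = filter IsMatching? (vectors bools (length edges))

    best : EdgeSet
    best = argmax ∣_∣ M matchings

    largest : ∀ M′ → IsMatching M′ → ∣ M′ ∣ ≤ ∣ best ∣
    largest M′ m = All.lookup (f[xs]≤f[argmax] {f = ∣_∣} M matchings) (List.∈-filter⁺ IsMatching? (∈-vectors M′) m)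

  parameter-m : does (Enumeration.∃? bools bools-complete λ M → IsMaximumMatching? M ×-dec (0 ℕ.≟ k ∸ ∣ M ∣)) ≡ true
  parameter-m = dec-true (Enumeration.∃? bools bools-complete λ M → IsMaximumMatching? M ×-dec (0 ℕ.≟ k ∸ ∣ M ∣))
    (best , (argmax-all ∣_∣ M-matching (All.all-filter IsMatching? (vectors bools (length edges))) , largest) ,
     sym (ℕ.m≤n⇒m∸n≡0 (ℕ.≤-trans k≤M (largest M M-matching))))

-- Vertex Cover
--
-- The closed sets of a chain of blocks separated by single elements, all of
-- block i and separator i lying below block i + 1, are the closed sets of the
-- single blocks, each extended by everything below.  In the graph with edges
-- a_z b_z and a_u b_v for every arc u → v, the vertex covers of size at most M
-- take exactly one of a_z and b_z, and the z for which b_z is taken form a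
-- closed set.

-- Block `i` has the elements with `c < n`, and `c` equal to `n` is the separator behind it. The
-- separator behind the last block would have position `M` and lies just out of range, so the chain
-- ends with a block.
position : ℕ → ℕ → ℕ → ℕ
position n i c = i * suc n + c

chainArc : ℕ → ℕ → (ℕ → ℕ → ℕ → Bool) → ℕ → ℕ → Bool
chainArc t n B z z′ = anyN t λ i →
  anyN n (λ u → anyN n λ v → (z ≡ᵇ position n i u) ∧ (z′ ≡ᵇ position n i v) ∧ B i u v)
  ∨ anyN n (λ u → (z ≡ᵇ position n i n) ∧ (z′ ≡ᵇ position n i u))
  ∨ anyN n (λ u → (z ≡ᵇ position n (suc i) u) ∧ (z′ ≡ᵇ position n i n))

coverAdj : (ℕ → ℕ → Bool) → ℕ × ℕ → ℕ × ℕ → Bool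
coverAdj arc (s , z) (s′ , z′) =
  (s ≡ᵇ 0) ∧ (s′ ≡ᵇ 1) ∧ ((z ≡ᵇ z′) ∨ arc z z′) ∨ (s′ ≡ᵇ 0) ∧ (s ≡ᵇ 1) ∧ ((z′ ≡ᵇ z) ∨ arc z′ z)

coverAdj-sym : ∀ arc x y → coverAdj arc x y ≡ coverAdj arc y x
coverAdj-sym arc (s , z) (s′ , z′) = Bool.∨-comm ((s ≡ᵇ 0) ∧ (s′ ≡ᵇ 1) ∧ ((z ≡ᵇ z′) ∨ arc z z′)) _

coverAdj-irrefl : ∀ arc x → coverAdj arc x x ≡ false
coverAdj-irrefl arc (zero , z)        = refl
coverAdj-irrefl arc (suc zero , z)    = refl
coverAdj-irrefl arc (suc (suc s) , z) = refl

coverLabels : ℕ → List (ℕ × ℕ)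
coverLabels M = cartesianProduct (upTo 2) (upTo M)

label-index : ∀ {A : Set} {xs : List A} {l} → l ∈ₗ xs → ∃ λ u → List.lookup xs u ≡ l
label-index p = Any.index p , sym (AnyP.lookup-index p)
  where import Data.List.Relation.Unary.Any.Properties as AnyP

-- The result `m` stands for the absence of a failure. This locates the block of a solution, by the
-- first missing separator in a chain or by the first joint that is not reached in a network.
first-failure : ∀ m (p : ℕ → Bool) → ∃ λ i → i ≤ m × (∀ j → j < i → T (p j)) × (i < m → ¬ T (p i))
first-failure zero    p = 0 , z≤n , (λ _ ()) , (λ ())
first-failure (suc m) p with T? (p 0)
... | no ¬p0 = 0 , z≤n , (λ _ ()) , λ _ → ¬p0
... | yes p0 with first-failure m (p ∘ suc)
...   | i , i≤m , before , fails = suc i , s≤s i≤m ,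
        (λ { zero _ → p0 ; (suc j) (s≤s j<i) → before j j<i }) , λ { (s≤s i<m) → fails i<m }

module Cover (t′ n : ℕ) (0<n : 0 < n) (B : ℕ → ℕ → ℕ → Bool) where

  private
    t M : ℕ
    t = suc t′
    M = n + t′ * suc n

    pos : ℕ → ℕ → ℕ
    pos = position n

    arc : ℕ → ℕ → Bool
    arc = chainArc t n B

    A : ℕ × ℕ → ℕ × ℕ → Bool
    A = coverAdj arc

    inner-arc : ∀ {i u v} → i < t → u < n → v < n → T (B i u v) → T (arc (pos i u) (pos i v))
    inner-arc {i} {u} {v} i<t u<n v<n b = any-complete t i i<t (∨-inj₁ (any-complete n u u<n (any-complete n v v<n
      (∧-complete (≡ᵇ-complete {pos i u} refl) (∧-complete (≡ᵇ-complete {pos i v} refl) b)))))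

    down-arc : ∀ {i u} → i < t → u < n → T (arc (pos i n) (pos i u))
    down-arc {i} {u} i<t u<n = any-complete t i i<t (∨-inj₂ {anyN n λ u₁ → anyN n λ v → (pos i n ≡ᵇ pos i u₁) ∧ (pos i u ≡ᵇ pos i v) ∧ B i u₁ v}
      (∨-inj₁ (any-complete n u u<n (∧-complete (≡ᵇ-complete {pos i n} refl) (≡ᵇ-complete {pos i u} refl)))))

    up-arc : ∀ {i u} → i < t → u < n → T (arc (pos (suc i) u) (pos i n))
    up-arc {i} {u} i<t u<n = any-complete t i i<t
      (∨-inj₂ {anyN n λ u₁ → anyN n λ v → (pos (suc i) u ≡ᵇ pos i u₁) ∧ (pos i n ≡ᵇ pos i v) ∧ B i u₁ v}
      (∨-inj₂ {anyN n λ u₁ → (pos (suc i) u ≡ᵇ pos i n) ∧ (pos i n ≡ᵇ pos i u₁)}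
        (any-complete n u u<n (∧-complete (≡ᵇ-complete {pos (suc i) u} refl) (≡ᵇ-complete {pos i n} refl)))))

    data Arc : ℕ → ℕ → Set where
      inner : ∀ {i u v} → i < t → u < n → v < n → T (B i u v) → Arc (pos i u) (pos i v)
      down  : ∀ {i u} → u < n → Arc (pos i n) (pos i u)
      up    : ∀ {i u} → u < n → Arc (pos (suc i) u) (pos i n)

    arc-sound : ∀ {z z′} → T (arc z z′) → Arc z z′
    arc-sound {z} {z′} a with any-sound t a
    ... | i , i<t , a₁ with ∨-sound a₁
    ...   | inj₁ a₂ with any-sound n a₂
    ...     | u , u<n , a₃ with any-sound n a₃
    ...       | v , v<n , a₄ = subst₂ Arc (sym (≡ᵇ-sound (proj₁ (∧-sound {z ≡ᵇ pos i u} a₄))))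
                  (sym (≡ᵇ-sound (proj₁ (∧-sound {z′ ≡ᵇ pos i v} (proj₂ (∧-sound {z ≡ᵇ pos i u} a₄))))))
                  (inner i<t u<n v<n (proj₂ (∧-sound {z′ ≡ᵇ pos i v} (proj₂ (∧-sound {z ≡ᵇ pos i u} a₄)))))
    arc-sound {z} {z′} a | i , i<t , a₁ | inj₂ a₂ with ∨-sound a₂
    ... | inj₁ a₃ with any-sound n a₃
    ...   | u , u<n , a₄ = subst₂ Arc (sym (≡ᵇ-sound (proj₁ (∧-sound {z ≡ᵇ pos i n} a₄))))
              (sym (≡ᵇ-sound (proj₂ (∧-sound {z ≡ᵇ pos i n} a₄)))) (down {i} u<n)
    arc-sound {z} {z′} a | i , i<t , a₁ | inj₂ a₂ | inj₂ a₃ with any-sound n a₃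
    ...   | u , u<n , a₄ = subst₂ Arc (sym (≡ᵇ-sound (proj₁ (∧-sound {z ≡ᵇ pos (suc i) u} a₄))))
              (sym (≡ᵇ-sound (proj₂ (∧-sound {z ≡ᵇ pos (suc i) u} a₄)))) (up {i} u<n)

    pos<M : ∀ {i c} → i ≤ t′ → c < n → pos i c < M
    pos<M {i} {c} i≤ c<n = ℕ.<-≤-trans (ℕ.+-mono-≤-< (ℕ.*-monoˡ-≤ (suc n) i≤) c<n) (ℕ.≤-reflexive (ℕ.+-comm (t′ * suc n) n))

    pos<next : ∀ {i j c} → i < j → c ≤ n → pos i c < j * suc n
    pos<next {i} {j} {c} i<j c≤n = ℕ.<-≤-trans (ℕ.+-monoʳ-< (i * suc n) (s≤s c≤n))
      (ℕ.≤-trans (ℕ.≤-reflexive (ℕ.+-comm (i * suc n) (suc n))) (ℕ.*-monoˡ-≤ (suc n) i<j))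

    sep<M : ∀ {i} → i < t′ → pos i n < M
    sep<M i< = ℕ.<-≤-trans (pos<next i< ℕ.≤-refl) (ℕ.m≤n+m _ n)

    sep<M⁻ : ∀ {i} → pos i n < M → i < t′
    sep<M⁻ {i} lt = ℕ.≰⇒> λ t′≤i → ℕ.<⇒≱ lt (ℕ.≤-trans (ℕ.≤-reflexive (ℕ.+-comm n (t′ * suc n))) (ℕ.+-monoˡ-≤ n (ℕ.*-monoˡ-≤ (suc n) t′≤i)))

    block<M⁻ : ∀ {i c} → pos i c < M → i ≤ t′
    block<M⁻ {i} {c} lt = ℕ.≮⇒≥ λ t′<i → ℕ.<⇒≱ lt (ℕ.≤-trans (ℕ.≤-trans (ℕ.n≤1+n M) (ℕ.*-monoˡ-≤ (suc n) t′<i)) (ℕ.m≤m+n _ c))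

    decompose : ∀ z → ∃₂ λ i c → c ≤ n × z ≡ pos i c
    decompose z = z DM./ suc n , z DM.% suc n , ℕ.s≤s⁻¹ (DM.m%n<n z (suc n)) ,
      trans (DM.m≡m%n+[m/n]*n z (suc n)) (ℕ.+-comm (z DM.% suc n) _)
      where import Data.Nat.DivMod as DM

    -- The closed set of the chain that contains S in block i.
    below : ℕ → Vec Bool n → ℕ → Bool
    below i S z = (z <ᵇ i * suc n) ∨ bitAt (Vec.toList S) (z ∸ i * suc n)

    below-under : ∀ {i S z} → z < i * suc n → T (below i S z)
    below-under z< = ∨-inj₁ (ℕ.<⇒<ᵇ z<)

    below-in : ∀ i S c → below i S (pos i c) ≡ bitAt (Vec.toList S) c
    below-in i S c = cong₂ (λ b k → b ∨ bitAt (Vec.toList S) k)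
      (dec-false (pos i c ℕ.<? i * suc n) (ℕ.≤⇒≯ (ℕ.m≤m+n (i * suc n) c))) (ℕ.m+n∸m≡n (i * suc n) c)

    bitAt-over : ∀ w k → length w ≤ k → bitAt w k ≡ false
    bitAt-over []      k       _         = refl
    bitAt-over (b ∷ w) (suc k) (s≤s w≤k) = bitAt-over w k w≤k

    below-over : ∀ {i S z} → pos i n ≤ z → ¬ T (below i S z)
    below-over {i} {S} {z} p≤z b with ∨-sound {z <ᵇ i * suc n} b
    ... | inj₁ z< = ℕ.<⇒≱ (ℕ.<ᵇ⇒< z (i * suc n) z<) (ℕ.≤-trans (ℕ.m≤m+n (i * suc n) n) p≤z)
    ... | inj₂ s  = subst T (bitAt-over (Vec.toList S) (z ∸ i * suc n) (ℕ.≤-trans (ℕ.≤-reflexive (Vec.length-toList S))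
          (ℕ.≤-trans (ℕ.≤-reflexive (sym (ℕ.m+n∸m≡n (i * suc n) n))) (ℕ.∸-monoˡ-≤ (i * suc n) p≤z)))) s

    over : ∀ {i j c} → i < j → pos i n ≤ pos j c
    over i<j = ℕ.≤-trans (ℕ.<⇒≤ (pos<next i<j ℕ.≤-refl)) (ℕ.m≤m+n _ _)

    below-closed : ∀ i S → Closed n (B i) S → ∀ {z z′} → Arc z z′ → T (below i S z) → T (below i S z′)
    below-closed i S closed (inner {j} {u} {v} j<t u<n v<n b) x with ℕ.<-cmp j i
    ... | tri< j<i _ _ = below-under {i} {S} (pos<next j<i (ℕ.<⇒≤ v<n))
    ... | tri> _ _ i<j = contradiction x (below-over {i} {S} (over i<j))
    ... | tri≈ _ refl _ = subst T (sym (trans (below-in i S v) (at v<n)))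
        (closed (fromℕ< u<n) (fromℕ< v<n) (subst₂ (λ u v → T (B i u v)) (sym (toℕ-fromℕ< u<n)) (sym (toℕ-fromℕ< v<n)) b)
          (subst T (trans (below-in i S u) (at u<n)) x))
      where
      at : ∀ {c} (c<n : c < n) → bitAt (Vec.toList S) c ≡ lookup S (fromℕ< c<n)
      at c<n = trans (cong (bitAt (Vec.toList S)) (sym (toℕ-fromℕ< c<n))) (bitAt-toList S (fromℕ< c<n))
    below-closed i S closed (down {j} {u} u<n) x with ℕ.<-≤-connex j i
    ... | inj₁ j<i = below-under {i} {S} (pos<next j<i (ℕ.<⇒≤ u<n))
    ... | inj₂ i≤j = contradiction x (below-over {i} {S} (ℕ.+-monoˡ-≤ n (ℕ.*-monoˡ-≤ (suc n) i≤j)))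
    below-closed i S closed (up {j} {u} u<n) x with ℕ.<-≤-connex j i
    ... | inj₁ j<i = below-under {i} {S} (pos<next j<i ℕ.≤-refl)
    ... | inj₂ i≤j = contradiction x (below-over {i} {S} (over (s≤s i≤j)))

    -- The first separator outside `X` singles out the block in front of it, or the last block if
    -- there is none. Everything below that block is forced into `X`, everything above is forced
    -- out, and only the part of `X` inside the block is free.
    module Extract (X : ℕ → Bool) (closed : ∀ {z z′} → z < M → z′ < M → T (arc z z′) → T (X z) → T (X z′)) where

      found : ∃ λ i → i ≤ t′ × (∀ j → j < i → T (X (pos j n))) × (i < t′ → ¬ T (X (pos i n)))
      found = first-failure t′ (λ j → X (pos j n))

      i : ℕ
      i = proj₁ found

      i≤t′ : i ≤ t′
      i≤t′ = proj₁ (proj₂ found)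

      S : Vec Bool n
      S = tabulate λ u → X (pos i (toℕ u))

      S-closed : Closed n (B i) S
      S-closed u v b su = subst T (sym (Vec.lookup∘tabulate _ v)) (closed (pos<M i≤t′ (toℕ<n u)) (pos<M i≤t′ (toℕ<n v))
        (inner-arc (s≤s i≤t′) (toℕ<n u) (toℕ<n v) b) (subst T (Vec.lookup∘tabulate (λ u → X (pos i (toℕ u))) u) su))

      under : ∀ {j c} → j < i → c ≤ n → T (X (pos j c))
      under {j} {c} j<i c≤n with ℕ.m≤n⇒m<n∨m≡n c≤n
      ... | inj₂ refl = proj₁ (proj₂ (proj₂ found)) j j<i
      ... | inj₁ c<n = closed (sep<M j<t′) (pos<M (ℕ.<⇒≤ j<t′) c<n) (down-arc (ℕ.m<n⇒m<1+n j<t′) c<n) (proj₁ (proj₂ (proj₂ found)) j j<i)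
        where
        j<t′ : j < t′
        j<t′ = ℕ.<-≤-trans j<i i≤t′

      sep : ∀ {j} → i ≤ j → pos j n < M → ¬ T (X (pos j n))
      block : ∀ {j c} → i < j → c < n → pos j c < M → ¬ T (X (pos j c))
      sep {j} i≤j j< x with ℕ.m≤n⇒m<n∨m≡n i≤j
      ... | inj₂ refl = proj₂ (proj₂ (proj₂ found)) (sep<M⁻ {i} j<) x
      -- Consecutive separators are linked only through an element of the block between them;
      -- element 0 exists because blocks are nonempty.
      sep {suc j} i≤j j< x | inj₁ i<j = block i<j 0<n j0< (closed j< j0< (down-arc {suc j} (s≤s (ℕ.<⇒≤ (sep<M⁻ {suc j} j<))) 0<n) x)
        where
        j0< : pos (suc j) 0 < M
        j0< = pos<M {suc j} (ℕ.<⇒≤ (sep<M⁻ {suc j} j<)) 0<n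
      block {suc j} {c} (s≤s i≤j) c<n j< x = sep i≤j (sep<M j<t′) (closed j< (sep<M j<t′) (up-arc (ℕ.m<n⇒m<1+n j<t′) c<n) x)
        where
        j<t′ : j < t′
        j<t′ = block<M⁻ {suc j} {c} j<

      agrees : ∀ z → z < M → X z ≡ below i S z
      agrees z z<M with decompose z
      ... | j , c , c≤n , refl with ℕ.<-cmp j i
      ...   | tri< j<i _ _ = trans (T⇒≡ (under j<i c≤n)) (sym (T⇒≡ (below-under {i} {S} (pos<next j<i c≤n))))
      ...   | tri> _ _ i<j = ≡-by-T (λ x → ⊥-elim (outside x)) (λ x → contradiction x (below-over {i} {S} (over i<j)))
        where
        outside : ¬ T (X (pos j c))
        outside with ℕ.m≤n⇒m<n∨m≡n c≤n
        ... | inj₁ c<n  = block i<j c<n z<M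
        ... | inj₂ refl = sep (ℕ.<⇒≤ i<j) z<M
      ...   | tri≈ _ refl _ with ℕ.m≤n⇒m<n∨m≡n c≤n
      ...     | inj₂ refl = ≡-by-T (λ x → contradiction x (sep ℕ.≤-refl z<M)) (λ x → contradiction x (below-over {i} {S} ℕ.≤-refl))
      ...     | inj₁ c<n = sym (trans (below-in i S c) (trans (cong (bitAt (Vec.toList S)) (sym (toℕ-fromℕ< c<n)))
                  (trans (bitAt-toList S (fromℕ< c<n)) (trans (Vec.lookup∘tabulate _ (fromℕ< c<n)) (cong (X ∘ pos i) (toℕ-fromℕ< c<n))))))

  labels : List (ℕ × ℕ)
  labels = coverLabels M

  module _ (adj : Fin (length labels) → Fin (length labels) → Bool) (symm : ∀ u v → adj u v ≡ adj v u)
           (irrefl : ∀ v → adj v v ≡ false)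
           (adj≡ : ∀ u v → adj u v ≡ A (List.lookup labels u) (List.lookup labels v)) where

    G : Graph
    G = record { order = length labels ; adj = adj ; symm = symm ; irrefl = irrefl }

    open Graph G using (Vertex; VertexSet; Adj; order)
    open VertexCover G

    private
      lab : Vertex → ℕ × ℕ
      lab = List.lookup labels

      lab-injective : ∀ {u v} → lab u ≡ lab v → u ≡ v
      lab-injective = lookup-injective (Unique.cartesianProduct⁺ (Unique.upTo⁺ 2) (Unique.upTo⁺ M))

      lab-bounds : ∀ u → proj₁ (lab u) < 2 × proj₂ (lab u) < M
      lab-bounds u = let s∈ , z∈ = List.∈-cartesianProduct⁻ (upTo 2) (upTo M) (List.∈-lookup {xs = labels} u)
                     in List.∈-upTo⁻ s∈ , List.∈-upTo⁻ z∈

      vertex : ∀ {s z} → s < 2 → z < M → ∃ λ u → lab u ≡ (s , z)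
      vertex s< z< = label-index (List.∈-cartesianProduct⁺ (List.∈-upTo⁺ s<) (List.∈-upTo⁺ z<))

    a b : Fin M → Vertex
    a z = proj₁ (vertex (s≤s z≤n) (toℕ<n z))
    b z = proj₁ (vertex (s≤s (s≤s z≤n)) (toℕ<n z))

    lab-a : ∀ z → lab (a z) ≡ (0 , toℕ z)
    lab-a z = proj₂ (vertex (s≤s z≤n) (toℕ<n z))

    lab-b : ∀ z → lab (b z) ≡ (1 , toℕ z)
    lab-b z = proj₂ (vertex (s≤s (s≤s z≤n)) (toℕ<n z))

    a-injective : Injective _≡_ _≡_ a
    a-injective {i} {j} eq = toℕ-injective (cong proj₂ (trans (sym (lab-a i)) (trans (cong lab eq) (lab-a j))))

    b-injective : Injective _≡_ _≡_ b
    b-injective {i} {j} eq = toℕ-injective (cong proj₂ (trans (sym (lab-b i)) (trans (cong lab eq) (lab-b j))))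

    a≢b : ∀ i j → a i ≢ b j
    a≢b i j eq = case cong proj₁ (trans (sym (lab-a i)) (trans (cong lab eq) (lab-b j))) of λ ()

    a~b′ : ∀ i j → T ((toℕ i ≡ᵇ toℕ j) ∨ arc (toℕ i) (toℕ j)) → Adj (a i) (b j)
    a~b′ i j l = subst T (sym (trans (adj≡ (a i) (b j)) (cong₂ A (lab-a i) (lab-b j)))) (∨-inj₁ l)

    a~b : ∀ i → Adj (a i) (b i)
    a~b i = a~b′ i i (∨-inj₁ (≡ᵇ-complete {toℕ i} refl))

    private
      R : Fin t → ℕ → ℕ → Bool
      R i = B (toℕ i)

      side′ : (ℕ → Bool) → ℕ × ℕ → Bool
      side′ X (zero  , z) = not (X z)
      side′ X (suc s , z) = X z

      cover : Fin t → Vec Bool n → VertexSet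
      cover i S = tabulate (side′ (below (toℕ i) S) ∘ lab)

      pair-sound : ∀ {u v} → Adj u v → ∃₂ λ z z′ → z < M × z′ < M × T ((z ≡ᵇ z′) ∨ arc z z′) ×
                   (lab u ≡ (0 , z) × lab v ≡ (1 , z′) ⊎ lab u ≡ (1 , z′) × lab v ≡ (0 , z))
      pair-sound {u} {v} uv with ∨-sound (subst T (adj≡ u v) uv)
      ... | inj₁ h = proj₂ (lab u) , proj₂ (lab v) , proj₂ (lab-bounds u) , proj₂ (lab-bounds v) ,
              proj₂ (∧-sound {proj₁ (lab v) ≡ᵇ 1} (proj₂ (∧-sound {proj₁ (lab u) ≡ᵇ 0} h))) ,
              inj₁ (cong (_, proj₂ (lab u)) (≡ᵇ-sound (proj₁ (∧-sound {proj₁ (lab u) ≡ᵇ 0} h))) ,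
                    cong (_, proj₂ (lab v)) (≡ᵇ-sound (proj₁ (∧-sound {proj₁ (lab v) ≡ᵇ 1} (proj₂ (∧-sound {proj₁ (lab u) ≡ᵇ 0} h))))))
      ... | inj₂ h = proj₂ (lab v) , proj₂ (lab u) , proj₂ (lab-bounds v) , proj₂ (lab-bounds u) ,
              proj₂ (∧-sound {proj₁ (lab u) ≡ᵇ 1} (proj₂ (∧-sound {proj₁ (lab v) ≡ᵇ 0} h))) ,
              inj₂ (cong (_, proj₂ (lab u)) (≡ᵇ-sound (proj₁ (∧-sound {proj₁ (lab u) ≡ᵇ 1} (proj₂ (∧-sound {proj₁ (lab v) ≡ᵇ 0} h))))) ,
                    cong (_, proj₂ (lab v)) (≡ᵇ-sound (proj₁ (∧-sound {proj₁ (lab v) ≡ᵇ 0} h))))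

      Small : VertexSet → Set
      Small C = IsVertexCover C × ∣ C ∣ ≤ M

      into : ∀ i S → Closed n (R i) S → Small (cover i S)
      into i S closed = covers , covered⇒≤ pick picked
        where
        X : ℕ → Bool
        X = below (toℕ i) S
        in-cover : ∀ {u l} → lab u ≡ l → T (side′ X l) → u ∈ cover i S
        in-cover {u} eq x = ∈-tabulate⁺ {p = side′ X ∘ lab} (subst (T ∘ side′ X) (sym eq) x)
        covers : IsVertexCover (cover i S)
        covers u v uv with pair-sound uv
        ... | z , z′ , z< , z′< , link , ends = place ends (T? (X z))
          where
          implied : T (X z) → T (X z′)
          implied x with ∨-sound {z ≡ᵇ z′} link
          ... | inj₁ eq = subst (T ∘ X) (≡ᵇ-sound eq) x
          ... | inj₂ a  = below-closed (toℕ i) S closed (arc-sound a) x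
          place : _ → Dec (T (X z)) → u ∈ cover i S ⊎ v ∈ cover i S
          place (inj₁ (ua , vb)) (yes x) = inj₂ (in-cover vb (implied x))
          place (inj₁ (ua , vb)) (no ¬x) = inj₁ (in-cover ua (not-complete ¬x))
          place (inj₂ (ub , va)) (yes x) = inj₁ (in-cover ub (implied x))
          place (inj₂ (ub , va)) (no ¬x) = inj₂ (in-cover va (not-complete ¬x))
        pickᵇ : Bool → Fin M → Vertex
        pickᵇ true  = b
        pickᵇ false = a
        pick : Fin M → Vertex
        pick z = pickᵇ (X (toℕ z)) z
        picked : ∀ {u} → u ∈ cover i S → ∃ λ z → pick z ≡ u
        picked {u} u∈ with lab u in eq | lab-bounds u | ∈-tabulate⁻ {p = side′ X ∘ lab} u∈
        ... | s , z | s< , z< | x = fromℕ< z< , lab-injective (trans (chosen s s< x) (sym eq))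
          where
          chosen : ∀ s → s < 2 → T (side′ X (s , z)) → lab (pick (fromℕ< z<)) ≡ (s , z)
          ẑ : Fin M
          ẑ = fromℕ< z<
          X≡ : ∀ c → X z ≡ c → pick ẑ ≡ pickᵇ c ẑ
          X≡ c eq = cong (λ c → pickᵇ c ẑ) (trans (cong X (toℕ-fromℕ< z<)) eq)
          not⇒false : ∀ {c} → T (not c) → c ≡ false
          not⇒false {false} _ = refl
          chosen zero       _ x = trans (cong lab (X≡ false (not⇒false x))) (trans (lab-a ẑ) (cong (0 ,_) (toℕ-fromℕ< z<)))
          chosen (suc zero) _ x = trans (cong lab (X≡ true (T⇒≡ x))) (trans (lab-b ẑ) (cong (1 ,_) (toℕ-fromℕ< z<)))
          chosen (suc (suc s)) (s≤s (s≤s ())) x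

      below≡ : ∀ i j S S′ → cover i S ≡ cover j S′ → ∀ z → z < M → below (toℕ i) S z ≡ below (toℕ j) S′ z
      below≡ i j S S′ eq z z< = trans (at i S) (trans (cong (λ C → lookup C u) eq) (sym (at j S′)))
        where
        u : Vertex
        u = b (fromℕ< z<)
        at : ∀ i S → below (toℕ i) S z ≡ lookup (cover i S) u
        at i S = sym (trans (Vec.lookup∘tabulate (side′ (below (toℕ i) S) ∘ lab) u)
          (cong (side′ (below (toℕ i) S)) (trans (lab-b (fromℕ< z<)) (cong (1 ,_) (toℕ-fromℕ< z<)))))

      -- The separator behind block `i` belongs to every closed set of a later block and to none of
      -- block `i`.
      ordered : ∀ i j S S′ → cover i S ≡ cover j S′ → ¬ toℕ i < toℕ j
      ordered i j S S′ eq i<j = below-over {toℕ i} {S} ℕ.≤-refl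
        (subst T (sym (below≡ i j S S′ eq _ (sep<M (ℕ.<-≤-trans i<j (ℕ.s≤s⁻¹ (toℕ<n j))))))
                 (below-under {toℕ j} {S′} (pos<next i<j ℕ.≤-refl)))

      cover-injective : ∀ i j S S′ → Closed n (R i) S → Closed n (R j) S′ → cover i S ≡ cover j S′ → (i , S) ≡ (j , S′)
      cover-injective i j S S′ _ _ eq with ℕ.<-cmp (toℕ i) (toℕ j)
      ... | tri< i<j _ _ = contradiction i<j (ordered i j S S′ eq)
      ... | tri> _ _ j<i = contradiction j<i (ordered j i S′ S (sym eq))
      ... | tri≈ _ i≡j _ with toℕ-injective i≡j
      ...   | refl = cong (i ,_) (trans (sym (Vec.tabulate∘lookup S)) (trans (Vec.tabulate-cong λ c →
                trans (at S c) (trans (below≡ i i S S′ eq _ (pos<M (ℕ.s≤s⁻¹ (toℕ<n i)) (toℕ<n c))) (sym (at S′ c)))) (Vec.tabulate∘lookup S′)))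
        where
        at : ∀ S c → lookup S c ≡ below (toℕ i) S (pos (toℕ i) (toℕ c))
        at S c = sym (trans (below-in (toℕ i) S (toℕ c)) (bitAt-toList S c))

      onto : ∀ C → Small C → ∃₂ λ i S → Closed n (R i) S × cover i S ≡ C
      onto C (covers , C≤M) = i , S , S-closed′ , trans (Vec.tabulate-cong same) (Vec.tabulate∘lookup C)
        where
        choice : ∀ z → ∃ λ u → u ∈ C × (u ≡ a z ⊎ u ≡ b z)
        choice z with covers (a z) (b z) (a~b z)
        ... | inj₁ a∈ = a z , a∈ , inj₁ refl
        ... | inj₂ b∈ = b z , b∈ , inj₂ refl
        g : Fin M → Vertex
        g z = proj₁ (choice z)
        lab-g : ∀ z → proj₂ (lab (g z)) ≡ toℕ z
        lab-g z with choice z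
        ... | u , _ , inj₁ refl = cong proj₂ (lab-a z)
        ... | u , _ , inj₂ refl = cong proj₂ (lab-b z)
        -- A cover contains an end of each of the `M` disjoint edges joining `a z` to `b z`, and its
        -- size leaves room for nothing else.
        only : ∀ {u} → u ∈ C → ∃ λ z → g z ≡ u
        only = tight⇒covered g (λ {z} {z′} eq → toℕ-injective (trans (sym (lab-g z)) (trans (cong (proj₂ ∘ lab) eq) (lab-g z′))))
          (λ z → proj₁ (proj₂ (choice z))) C≤M
        index≡ : ∀ {u} i → g i ≡ u → toℕ i ≡ proj₂ (lab u)
        index≡ i refl = sym (lab-g i)
        not-both : ∀ z → a z ∈ C → b z ∈ C → ⊥
        not-both z a∈ b∈ = clash (only a∈) (only b∈)
          where
          clash : (∃ λ i → g i ≡ a z) → (∃ λ j → g j ≡ b z) → ⊥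
          clash (i , eq) (j , eq′) = a≢b z z (trans (sym eq) (trans (cong g i≡j) eq′))
            where
            i≡j : i ≡ j
            i≡j = toℕ-injective (trans (index≡ i eq) (trans (cong proj₂ (lab-a z))
              (sym (trans (index≡ j eq′) (cong proj₂ (lab-b z))))))
        X : ℕ → Bool
        X z with z ℕ.<? M
        ... | yes z< = lookup C (b (fromℕ< z<))
        ... | no _   = false
        X≡ : ∀ z → X (toℕ z) ≡ lookup C (b z)
        X≡ z with toℕ z ℕ.<? M
        ... | yes z< = cong (lookup C ∘ b) (fromℕ<-toℕ z z<)
        ... | no z≮  = contradiction (toℕ<n z) z≮
        -- If `b z` is taken then `a z` is not, so the edge for the arc has to be covered at `b z′`.
        X-closed′ : ∀ z z′ → T (arc (toℕ z) (toℕ z′)) → T (X (toℕ z)) → T (X (toℕ z′))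
        X-closed′ z z′ h x with covers (a z) (b z′) (a~b′ z z′ (∨-inj₂ {toℕ z ≡ᵇ toℕ z′} h))
        ... | inj₂ b∈ = subst T (sym (X≡ z′)) (∈⇒T b∈)
        ... | inj₁ a∈ = contradiction (T⇒∈ (subst T (X≡ z) x)) (not-both z a∈)
        X-closed : ∀ {z z′} → z < M → z′ < M → T (arc z z′) → T (X z) → T (X z′)
        X-closed z< z′< h x = subst (T ∘ X) (toℕ-fromℕ< z′<) (X-closed′ (fromℕ< z<) (fromℕ< z′<)
          (subst₂ (λ z z′ → T (arc z z′)) (sym (toℕ-fromℕ< z<)) (sym (toℕ-fromℕ< z′<)) h) (subst (T ∘ X) (sym (toℕ-fromℕ< z<)) x))
        module E = Extract X X-closed
        i : Fin t
        i = fromℕ< (s≤s E.i≤t′)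
        i≡ : toℕ i ≡ E.i
        i≡ = toℕ-fromℕ< (s≤s E.i≤t′)
        S : Vec Bool n
        S = E.S
        S-closed′ : Closed n (R i) S
        S-closed′ = subst (λ i → Closed n (B i) S) (sym i≡) E.S-closed
        a∈b : ∀ z → lookup C (a z) ≡ not (X (toℕ z))
        a∈b z = ≡-by-T (λ a∈ → not-complete λ x → not-both z (T⇒∈ a∈) (T⇒∈ (subst T (X≡ z) x)))
          λ ¬x → case covers (a z) (b z) (a~b z) of λ where
            (inj₁ a∈) → ∈⇒T a∈
            (inj₂ b∈) → contradiction (subst T (sym (X≡ z)) (∈⇒T b∈)) (not-sound ¬x)
        same : ∀ u → side′ (below (toℕ i) S) (lab u) ≡ lookup C u
        same u with lab u in eq | lab-bounds u
        ... | zero , z | _ , z< = trans (cong not (trans (cong (λ i → below i S z) i≡) (sym (E.agrees z z<))))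
              (trans (cong (not ∘ X) (sym (toℕ-fromℕ< z<))) (trans (sym (a∈b (fromℕ< z<)))
                (cong (lookup C) (lab-injective (trans (lab-a (fromℕ< z<)) (trans (cong (0 ,_) (toℕ-fromℕ< z<)) (sym eq)))))))
        ... | suc zero , z | _ , z< = trans (trans (cong (λ i → below i S z) i≡) (sym (E.agrees z z<)))
              (trans (cong X (sym (toℕ-fromℕ< z<))) (trans (X≡ (fromℕ< z<))
                (cong (lookup C) (lab-injective (trans (lab-b (fromℕ< z<)) (trans (cong (1 ,_) (toℕ-fromℕ< z<)) (sym eq)))))))
        ... | suc (suc s) , z | s≤s (s≤s ()) , z<

    covers-count : coversOfSize≤ M ≡ sum (map (λ i → closedSets n (B (toℕ i))) (allFin t))
    covers-count = count-Σ (λ i → closed? n (R i)) (λ S → IsVertexCover? S ×-dec (∣ S ∣ ℕ.≤? M)) cover into cover-injective onto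

closedSets-cong : ∀ n {R R′ : ℕ → ℕ → Bool} → (∀ u v → u < n → v < n → R u v ≡ R′ u v) → closedSets n R ≡ closedSets n R′
closedSets-cong n {R} {R′} eq = count-cong (closed? n R) (closed? n R′)
  (λ S closed u v r → closed u v (subst T (sym (eq _ _ (toℕ<n u) (toℕ<n v))) r))
  (λ S closed u v r → closed u v (subst T (eq _ _ (toℕ<n u) (toℕ<n v)) r))

map-lookup : ∀ {A B : Set} (f : A → B) xs → map (f ∘ List.lookup xs) (allFin (length xs)) ≡ map f xs
map-lookup f xs = trans (List.map-∘ (allFin (length xs))) (cong (map f)
  (trans (List.map-tabulate id (List.lookup xs)) (List.tabulate-lookup xs)))

module _ {x : Word} {xs : List Word} (same : All (λ y → length y ≡ length x) (x ∷ xs)) (x>0 : 0 < length x) where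

  blocks-sum : sum (map (λ i → closedSets (rt (length x)) (blockArc (encodeList (x ∷ xs)) (toℕ i))) (allFin (length (x ∷ xs)))) ≡
               sum (map #Closed (x ∷ xs))
  blocks-sum = cong sum (trans (List.map-cong block (allFin (length (x ∷ xs)))) (map-lookup #Closed (x ∷ xs)))
    where
    #Closed≡ : ∀ y → length y ≡ length x → #Closed y ≡ closedSets (rt (length x)) (arcs y (rt (length x)))
    #Closed≡ []        eq = contradiction x>0 (subst (λ l → ¬ 0 < l) eq λ ())
    #Closed≡ y@(_ ∷ _) eq = cong (λ l → closedSets (rt l) (arcs y (rt l))) eq
    block : ∀ i → closedSets (rt (length x)) (blockArc (encodeList (x ∷ xs)) (toℕ i)) ≡ #Closed (List.lookup (x ∷ xs) i)
    block i = trans (closedSets-cong (rt (length x)) (blockArc≡ same i))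
      (sym (#Closed≡ (List.lookup (x ∷ xs) i) (All.lookup same (List.∈-lookup i))))

loop-cartesian : ∀ {B C : Set} a (g : ℕ × B → List C) ys →
                 concatMap g (cartesianProduct (upTo a) ys) ≡ loop a (λ i → concatMap (λ y → g (i , y)) ys)
loop-cartesian a g ys = trans (concatMap-product g (upTo a) ys) (sym (loop≡concatMap a _))

matrixWord≡ : ∀ {L : Set} (A : L → L → Bool) xs → matrixWord A xs ≡ concatMap (λ x → concatMap (λ y → A x y ∷ []) xs) xs
matrixWord≡ A xs = List.concatMap-cong (λ x → sym (concatMap-[-] (A x) xs)) xs

graphWordᶜ : ∀ {L : Env n → Set} {A : ∀ ρ → L ρ → L ρ → Bool} {xs : ∀ ρ → List (L ρ)} →
             Fun (λ ρ → length (xs ρ)) → Gen (λ ρ → concatMap (λ x → concatMap (λ y → A ρ x y ∷ []) (xs ρ)) (xs ρ)) →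
             Gen (λ ρ → graphWord (A ρ) (xs ρ))
graphWordᶜ {A = A} {xs} F G = extGen (λ ρ → cong (λ w → unary (length (xs ρ)) ++ false ∷ w) (sym (matrixWord≡ (A ρ) (xs ρ))))
  (unaryᶜ F ++ᶜ (emitᶜ (boolᶜ false) ++ᶜ G))

-- The composition into Vertex Cover

chainSize : Word → ℕ
chainSize w = wordCount w * suc (side w) ∸ 1

coverWord : ℕ → ℕ → (ℕ → ℕ → ℕ → Bool) → Word
coverWord t n B = unary (t * suc n ∸ 1) ++ false ∷ graphWord (coverAdj (chainArc t n B)) (coverLabels (t * suc n ∸ 1))

coverCode : Word → Word
coverCode w = coverWord (wordCount w) (side w) (blockArc w)

positionᶜ : ∀ {i c : Env n → ℕ} → Fun i → Fun c → Fun (λ ρ → position (side (word first ρ)) (i ρ) (c ρ))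
positionᶜ I C = I ⊗ᶜ (litᶜ 1 ⊕ᶜ sideᶜ) ⊕ᶜ C

chainArcᶜ : ∀ {z z′ : Env n → ℕ} → Fun z → Fun z′ →
            BFun (λ ρ → chainArc (wordCount (word first ρ)) (side (word first ρ)) (blockArc (word first ρ)) (z ρ) (z′ ρ))
chainArcᶜ Z Z′ = anyᶜ wordCountᶜ
  (anyᶜ sideᶜ (anyᶜ sideᶜ ((wkᶜ (wkᶜ (wkᶜ Z)) ≡ᶜ positionᶜ v₂ v₁) ∧ᶜ (wkᶜ (wkᶜ (wkᶜ Z′)) ≡ᶜ positionᶜ v₂ v₀) ∧ᶜ blockArcᶜ v₂ v₁ v₀))
   ∨ᶜ anyᶜ sideᶜ ((wkᶜ (wkᶜ Z) ≡ᶜ positionᶜ v₁ sideᶜ) ∧ᶜ (wkᶜ (wkᶜ Z′) ≡ᶜ positionᶜ v₁ v₀))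
   ∨ᶜ anyᶜ sideᶜ ((wkᶜ (wkᶜ Z) ≡ᶜ positionᶜ (litᶜ 1 ⊕ᶜ v₁) v₀) ∧ᶜ (wkᶜ (wkᶜ Z′) ≡ᶜ positionᶜ v₁ sideᶜ)))

chainSizeᶜ : Fun {n} (λ ρ → chainSize (word first ρ))
chainSizeᶜ = wordCountᶜ ⊗ᶜ (litᶜ 1 ⊕ᶜ sideᶜ) ⊖ᶜ litᶜ 1

length-coverLabels : ∀ M → 2 * M ≡ length (coverLabels M)
length-coverLabels M = sym (trans (length-product (upTo 2) (upTo M)) (cong (2 *_) (List.length-upTo M)))

coverCodeᶜ : Gen {0} (coverCode ∘ proj₁)
coverCodeᶜ = unaryᶜ chainSizeᶜ ++ᶜ (emitᶜ (boolᶜ false) ++ᶜ graphWordᶜ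
    {A = λ ρ → coverAdj (chainArc (wordCount (proj₁ ρ)) (side (proj₁ ρ)) (blockArc (proj₁ ρ)))} {xs = λ ρ → coverLabels (chainSize (proj₁ ρ))}
    (ext (λ ρ → length-coverLabels (chainSize (proj₁ ρ))) (litᶜ 2 ⊗ᶜ chainSizeᶜ))
    (extGen (λ ρ → sym (unfold (chainSize (proj₁ ρ)) _)) (loopᶜ (litᶜ 2) (loopᶜ chainSizeᶜ (loopᶜ (litᶜ 2) (loopᶜ chainSizeᶜ
      (emitᶜ ((v₃ ≡ᶜ litᶜ 0) ∧ᶜ (v₁ ≡ᶜ litᶜ 1) ∧ᶜ ((v₂ ≡ᶜ v₀) ∨ᶜ chainArcᶜ v₂ v₀)
              ∨ᶜ (v₁ ≡ᶜ litᶜ 0) ∧ᶜ (v₃ ≡ᶜ litᶜ 1) ∧ᶜ ((v₀ ≡ᶜ v₂) ∨ᶜ chainArcᶜ v₀ v₂))))))))) 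
  where
  unfold₁ : ∀ M (g : ℕ × ℕ → Word) → concatMap g (coverLabels M) ≡ loop 2 (λ s → loop M λ z → g (s , z))
  unfold₁ M g = trans (loop-cartesian 2 g (upTo M)) (loop-≗ 2 λ s → sym (loop≡concatMap M (λ z → g (s , z))))
  unfold : ∀ M (A : ℕ × ℕ → ℕ × ℕ → Bool) → concatMap (λ x → concatMap (λ y → A x y ∷ []) (coverLabels M)) (coverLabels M) ≡
           loop 2 (λ s → loop M λ z → loop 2 λ s′ → loop M λ z′ → A (s , z) (s′ , z′) ∷ [])
  unfold M A = trans (unfold₁ M _) (loop-≗ 2 λ s → loop-≗ M λ z → unfold₁ M (λ y → A (s , z) y ∷ []))

readGraph,k-unary : ∀ k w G → readGraph w ≡ just G → readGraph,k (unary k ++ false ∷ w) ≡ just (G , k)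
readGraph,k-unary k w G eq = trans (cong (_>>= λ (k , w′) → readGraph w′ >>= λ G → just (G , k)) (readℕ-unary k w))
  (cong (_>>= λ G → just (G , k)) eq)

onInput-just : ∀ {A : Set} (read : Word → Maybe A) (f : A → ℕ → ℕ) w κ {a} → read w ≡ just a → onInput read f (w , κ) ≡ f a κ
onInput-just read f w κ eq = cong (maybe′ (λ a → f a κ) 0) eq

-- The two versions of Vertex Cover differ only in the test of the parameter, which the disjoint
-- edges make succeed at 0; everything else is shared.
module CoverComposition (param : Graph × ℕ → ℕ → Bool)
  (param-zero : ∀ G k a b (a-inj : Injective _≡_ _≡_ a) (b-inj : Injective _≡_ _≡_ b) (a≢b : ∀ i j → a i ≢ b j)
                (a~b : ∀ (i : Fin k) → Graph.Adj G (a i) (b i)) → param (G , k) 0 ≡ true) where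

  covers : Graph × ℕ → ℕ → ℕ
  covers (G , k) κ = if param (G , k) κ then VertexCover.coversOfSize≤ G k else 0

  problem : ParameterizedCountingProblem
  problem = onInput readGraph,k covers

  coverWord-value : ∀ t′ n B → 0 < n → problem (coverWord (suc t′) n B , 0) ≡ sum (map (λ i → closedSets n (B (toℕ i))) (allFin (suc t′)))
  coverWord-value t′ n B 0<n = value (readGraph-graphWord A (coverAdj-sym arc) (coverAdj-irrefl arc) labels)
    where
    labels : List (ℕ × ℕ)
    labels = Cover.labels t′ n 0<n B
    arc : ℕ → ℕ → Bool
    arc = chainArc (suc t′) n B
    A : ℕ × ℕ → ℕ × ℕ → Bool
    A = coverAdj arc
    M : ℕ
    M = n + t′ * suc n
    value : (∃ λ (adj : Fin (length labels) → Fin (length labels) → Bool) → ∃₂ λ s i →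
               readGraph (graphWord A labels) ≡ just (record { order = length labels ; adj = adj ; symm = s ; irrefl = i }) ×
               (∀ u v → adj u v ≡ A (List.lookup labels u) (List.lookup labels v))) →
            problem (coverWord (suc t′) n B , 0) ≡ sum (map (λ i → closedSets n (B (toℕ i))) (allFin (suc t′)))
    value (adj , s , i , eq , adj≡) = trans (onInput-just readGraph,k covers (coverWord (suc t′) n B) 0 (readGraph,k-unary M (graphWord A labels) _ eq))
      (trans (cong (λ b → if b then VertexCover.coversOfSize≤ graph M else 0) (param-zero graph M _ _
               (Cover.a-injective t′ n 0<n B adj s i adj≡) (Cover.b-injective t′ n 0<n B adj s i adj≡) (Cover.a≢b t′ n 0<n B adj s i adj≡) (Cover.a~b t′ n 0<n B adj s i adj≡)))
             (Cover.covers-count t′ n 0<n B adj s i adj≡))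
      where
      graph : Graph
      graph = record { order = length labels ; adj = adj ; symm = s ; irrefl = i }

  cover-value : ∀ x xs → All (λ y → length y ≡ length x) (x ∷ xs) → 0 < length x →
                problem (coverCode (encodeList (x ∷ xs)) , 0) ≡ sum (map #Closed (x ∷ xs))
  cover-value x xs same x>0 = trans
    (cong₂ (λ t n → problem (coverWord t n (blockArc (encodeList (x ∷ xs))) , 0)) (wordCount≡ same) (side≡ same))
    (trans (coverWord-value (length xs) (rt (length x)) (blockArc (encodeList (x ∷ xs))) (rt>0 (length x) x>0))
           (blocks-sum same x>0))

#ℓ-composition : SUMCrossComposition #Closed #ℓ-Vertex-Cover
#ℓ-composition = Composition.composition #ℓ-Vertex-Cover coverCodeᶜ (litᶜ 0)
  (λ { zero → refl ; (suc zero) → refl ; (suc (suc t)) → refl }) (λ _ _ _ → z≤n)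
  (CoverComposition.cover-value (λ (G , k) κ → does (κ ℕ.≟ ℤ.∣ 0ℤ ℤ.⊔ ceiling (fromℕ′ k ℚ.- LP-VC G) ∣))
    (λ G k a b a-inj b-inj a≢b a~b → dec-true (0 ℕ.≟ _) (sym (Disjoint.parameter-ℓ G k a b a-inj b-inj a≢b a~b))))

#m-composition : SUMCrossComposition #Closed #m-Vertex-Cover
#m-composition = Composition.composition #m-Vertex-Cover coverCodeᶜ (litᶜ 0)
  (λ { zero → refl ; (suc zero) → refl ; (suc (suc t)) → refl }) (λ _ _ _ → z≤n)
  (CoverComposition.cover-value (λ (G , k) κ → does (Enumeration.∃? bools bools-complete λ M →
      Matching.IsMaximumMatching? G M ×-dec (κ ℕ.≟ k ∸ ∣ M ∣)))
    Disjoint.parameter-m)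

covers≤ : ∀ G k → VertexCover.coversOfSize≤ G k ≤ 2 ^ Graph.order G
covers≤ G k = count≤ (λ S → VertexCover.IsVertexCover? G S ×-dec (∣ S ∣ ℕ.≤? k))

#ℓ-wellBehaved : WellBehaved #ℓ-Vertex-Cover
#ℓ-wellBehaved = k-wellBehaved λ G k κ → if≤ (does (κ ℕ.≟ ℤ.∣ 0ℤ ℤ.⊔ ceiling (fromℕ′ k ℚ.- LP-VC G) ∣)) (covers≤ G k)

#m-wellBehaved : WellBehaved #m-Vertex-Cover
#m-wellBehaved = k-wellBehaved λ G k κ → if≤ (does (Enumeration.∃? bools bools-complete λ M →
  Matching.IsMaximumMatching? G M ×-dec (κ ℕ.≟ k ∸ ∣ M ∣))) (covers≤ G k)

-- Minimum cuts
--
-- In block i every pair (u , v) of elements has a path J_i – p₁ – p₂ – J_{i+1},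
-- and joining p₁ to the hub of v and p₂ to the hub of u (if u → v is an arc) or of v
-- (otherwise) identifies these vertices as far as minimum cuts are concerned: a
-- cut needs an edge from each of the n² edge-disjoint paths through all blocks.
-- So a minimum cut takes exactly one edge of each path, all in the same block i, and the
-- elements whose hubs stay on the side of J_i form a closed set.
-- The label (i , κ , u , v) denotes J_i (κ = 0, u = v = 0), p₁ (κ = 1), p₂ (κ = 2)
-- or the hub of u (κ = 3, v = 0); other labels are isolated vertices.

Label : Set
Label = ℕ × ℕ × ℕ × ℕ

arrow : ℕ → (ℕ → ℕ → ℕ → Bool) → Label → Label → Bool
arrow t B (i , κ , u , v) (i′ , κ′ , u′ , v′) = (i <ᵇ t) ∧
  ( (κ ≡ᵇ 0) ∧ (κ′ ≡ᵇ 1) ∧ (i′ ≡ᵇ i) ∧ (u ≡ᵇ 0) ∧ (v ≡ᵇ 0)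
  ∨ (κ ≡ᵇ 1) ∧ (κ′ ≡ᵇ 2) ∧ (i′ ≡ᵇ i) ∧ (u′ ≡ᵇ u) ∧ (v′ ≡ᵇ v)
  ∨ (κ ≡ᵇ 2) ∧ (κ′ ≡ᵇ 0) ∧ (i′ ≡ᵇ suc i) ∧ (u′ ≡ᵇ 0) ∧ (v′ ≡ᵇ 0)
  ∨ (κ ≡ᵇ 1) ∧ (κ′ ≡ᵇ 3) ∧ (i′ ≡ᵇ i) ∧ (u′ ≡ᵇ v) ∧ (v′ ≡ᵇ 0)
  ∨ (κ ≡ᵇ 2) ∧ (κ′ ≡ᵇ 3) ∧ (i′ ≡ᵇ i) ∧ (v′ ≡ᵇ 0) ∧ ((u′ ≡ᵇ u) ∧ B i u v ∨ (u′ ≡ᵇ v) ∧ not (B i u v)))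

cutLabels : ℕ → ℕ → List Label
cutLabels t n = cartesianProduct (upTo (suc t)) (cartesianProduct (upTo 4) (cartesianProduct (upTo n) (upTo n)))

both : ∀ {L : Set} → (L → L → Bool) → L → L → Bool
both A x y = A x y ∨ A y x

joint : ℕ → Label
joint i = i , 0 , 0 , 0

module Arrows (t : ℕ) (B : ℕ → ℕ → ℕ → Bool) where

  -- For a pair that is not an arc, both inner vertices hang on the hub of `v`. Such a path imposes
  -- no condition but still contributes one edge to a cut, so all blocks have the same cut size
  -- whatever their arcs.
  link : ℕ → ℕ → ℕ → ℕ
  link i u v = if B i u v then u else v

  data Arrow : Label → Label → Set where
    enter : ∀ {i u v} → i < t → Arrow (joint i) (i , 1 , u , v)
    pass  : ∀ {i u v} → i < t → Arrow (i , 1 , u , v) (i , 2 , u , v)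
    leave : ∀ {i u v} → i < t → Arrow (i , 2 , u , v) (joint (suc i))
    hub₁  : ∀ {i u v} → i < t → Arrow (i , 1 , u , v) (i , 3 , v , 0)
    hub₂  : ∀ {i u v} → i < t → Arrow (i , 2 , u , v) (i , 3 , link i u v , 0)

  peel : ∀ m n {b} → T ((m ≡ᵇ n) ∧ b) → m ≡ n × T b
  peel m n h = ≡ᵇ-sound (proj₁ (∧-sound {m ≡ᵇ n} h)) , proj₂ (∧-sound {m ≡ᵇ n} h)

  arrow-sound : ∀ x y → T (arrow t B x y) → Arrow x y
  arrow-sound (i , κ , u , v) (i′ , κ′ , u′ , v′) h with ∧-sound {i <ᵇ t} h
  ... | i<ᵇt , h₀ with ℕ.<ᵇ⇒< i t i<ᵇt | ∨-sound h₀
  ... | i<t | inj₁ h₁ with peel κ 0 h₁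
  ...   | refl , g₁ with peel κ′ 1 g₁
  ...   | refl , g₂ with peel i′ i g₂
  ...   | refl , g₃ with peel u 0 g₃
  ...   | refl , g₄ with ≡ᵇ-sound {v} g₄
  ...   | refl = enter i<t
  arrow-sound (i , κ , u , v) (i′ , κ′ , u′ , v′) h | _ | i<t | inj₂ h₁ with ∨-sound h₁
  ... | inj₁ h₂ with peel κ 1 h₂
  ...   | refl , g₁ with peel κ′ 2 g₁
  ...   | refl , g₂ with peel i′ i g₂
  ...   | refl , g₃ with peel u′ u g₃
  ...   | refl , g₄ with ≡ᵇ-sound {v′} g₄
  ...   | refl = pass i<t
  arrow-sound (i , κ , u , v) (i′ , κ′ , u′ , v′) h | _ | i<t | inj₂ h₁ | inj₂ h₂ with ∨-sound h₂
  ... | inj₁ h₃ with peel κ 2 h₃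
  ...   | refl , g₁ with peel κ′ 0 g₁
  ...   | refl , g₂ with peel i′ (suc i) g₂
  ...   | refl , g₃ with peel u′ 0 g₃
  ...   | refl , g₄ with ≡ᵇ-sound {v′} g₄
  ...   | refl = leave i<t
  arrow-sound (i , κ , u , v) (i′ , κ′ , u′ , v′) h | _ | i<t | inj₂ h₁ | inj₂ h₂ | inj₂ h₃ with ∨-sound h₃
  ... | inj₁ h₄ with peel κ 1 h₄
  ...   | refl , g₁ with peel κ′ 3 g₁
  ...   | refl , g₂ with peel i′ i g₂
  ...   | refl , g₃ with peel u′ v g₃
  ...   | refl , g₄ with ≡ᵇ-sound {v′} g₄
  ...   | refl = hub₁ i<t
  arrow-sound (i , κ , u , v) (i′ , κ′ , u′ , v′) h | _ | i<t | inj₂ h₁ | inj₂ h₂ | inj₂ h₃ | inj₂ h₄ with peel κ 2 h₄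
  ... | refl , g₁ with peel κ′ 3 g₁
  ... | refl , g₂ with peel i′ i g₂
  ... | refl , g₃ with peel v′ 0 g₃
  ... | refl , g₄ = subst (λ w → Arrow (i , 2 , u , v) (i , 3 , w , 0)) (sym (linked (B i u v) g₄)) (hub₂ i<t)
    where
    linked : ∀ b → T ((u′ ≡ᵇ u) ∧ b ∨ (u′ ≡ᵇ v) ∧ not b) → u′ ≡ (if b then u else v)
    linked b g with ∨-sound {(u′ ≡ᵇ u) ∧ b} g
    linked true  g | inj₁ g′ = proj₁ (peel u′ u g′)
    linked false g | inj₁ g′ = ⊥-elim (proj₂ (peel u′ u g′))
    linked true  g | inj₂ g′ = ⊥-elim (proj₂ (peel u′ v g′))
    linked false g | inj₂ g′ = proj₁ (peel u′ v g′)

  arrow-complete : ∀ {x y} → Arrow x y → T (arrow t B x y)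
  arrow-complete (enter {i} i<t) = ∧-complete (ℕ.<⇒<ᵇ i<t) (∨-inj₁ (∧-complete (≡ᵇ-complete {i} refl) tt))
  arrow-complete (pass {i} {u} {v} i<t) = ∧-complete (ℕ.<⇒<ᵇ i<t)
    (∨-inj₁ (∧-complete (≡ᵇ-complete {i} refl) (∧-complete (≡ᵇ-complete {u} refl) (≡ᵇ-complete {v} refl))))
  arrow-complete (leave {i} i<t) = ∧-complete (ℕ.<⇒<ᵇ i<t) (∨-inj₁ (∧-complete (≡ᵇ-complete {i} refl) tt))
  arrow-complete (hub₁ {i} {u} {v} i<t) = ∧-complete (ℕ.<⇒<ᵇ i<t)
    (∨-inj₁ (∧-complete (≡ᵇ-complete {i} refl) (∧-complete (≡ᵇ-complete {v} refl) tt)))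
  arrow-complete (hub₂ {i} {u} {v} i<t) = ∧-complete (ℕ.<⇒<ᵇ i<t) (∧-complete (≡ᵇ-complete {i} refl) (linked (B i u v)))
    where
    linked : ∀ b → T (((if b then u else v) ≡ᵇ u) ∧ b ∨ ((if b then u else v) ≡ᵇ v) ∧ not b)
    linked true  = ∨-inj₁ (∧-complete (≡ᵇ-complete {u} refl) tt)
    linked false = ∨-inj₂ {(v ≡ᵇ u) ∧ false} (∧-complete (≡ᵇ-complete {v} refl) tt)

  Arrow-asym : ∀ {x y} → Arrow x y → ¬ Arrow y x
  Arrow-asym (enter _) ()
  Arrow-asym (pass _)  ()
  Arrow-asym (leave _) ()
  Arrow-asym (hub₁ _)  ()
  Arrow-asym (hub₂ _)  ()

  both-irrefl : ∀ x → both (arrow t B) x x ≡ false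
  both-irrefl x = ≡-by-T (λ h → ⊥-elim (loopless (∨-sound h))) (λ ())
    where
    loopless : T (arrow t B x x) ⊎ T (arrow t B x x) → ⊥
    loopless (inj₁ h) = Arrow-asym (arrow-sound x x h) (arrow-sound x x h)
    loopless (inj₂ h) = Arrow-asym (arrow-sound x x h) (arrow-sound x x h)

  -- The step-th edge of the path for (u , v) through block i.
  data Step : Set where
    first second third : Step

  lo hi : ℕ → ℕ → ℕ → Step → Label
  lo i u v first  = joint i
  lo i u v second = i , 1 , u , v
  lo i u v third  = i , 2 , u , v
  hi i u v first  = i , 1 , u , v
  hi i u v second = i , 2 , u , v
  hi i u v third  = joint (suc i)

  step-arrow : ∀ {i} u v s → i < t → Arrow (lo i u v s) (hi i u v s)
  step-arrow u v first  i<t = enter i<t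
  step-arrow u v second i<t = pass i<t
  step-arrow u v third  i<t = leave i<t

  -- The pair to which an edge of a path belongs. A joint carries no pair, so it is read off the
  -- other end.
  row : Label → Label → ℕ × ℕ
  row (_ , 0 , _) (_ , _ , u , v) = u , v
  row (_ , _ , u , v) _           = u , v

  row-step : ∀ i u v s → row (lo i u v s) (hi i u v s) ≡ (u , v) × row (hi i u v s) (lo i u v s) ≡ (u , v)
  row-step i u v first  = refl , refl
  row-step i u v second = refl , refl
  row-step i u v third  = refl , refl

  lo-injective : ∀ {i j u v u′ v′} s s′ → lo i u v s ≡ lo j u′ v′ s′ → hi i u v s ≡ hi j u′ v′ s′ → i ≡ j × s ≡ s′
  lo-injective first  first  refl _ = refl , refl
  lo-injective second second refl _ = refl , refl
  lo-injective third  third  refl _ = refl , refl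

  lo≢hi : ∀ {i j u v u′ v′} s s′ → lo i u v s ≡ hi j u′ v′ s′ → hi i u v s ≢ lo j u′ v′ s′
  lo≢hi first  third  refl ()
  lo≢hi second first  refl ()
  lo≢hi third  second refl ()

module Cuts (t′ n : ℕ) (0<n : 0 < n) (B : ℕ → ℕ → ℕ → Bool) where

  private
    t : ℕ
    t = suc t′

  open Arrows t B public

  labels : List Label
  labels = cutLabels t n

  Valid : Label → Set
  Valid (i , κ , u , v) = i ≤ t × κ < 4 × u < n × v < n

  valid⇒∈ : ∀ {l} → Valid l → l ∈ₗ labels
  valid⇒∈ (i< , κ< , u< , v<) = List.∈-cartesianProduct⁺ (List.∈-upTo⁺ (s≤s i<))
    (List.∈-cartesianProduct⁺ (List.∈-upTo⁺ κ<) (List.∈-cartesianProduct⁺ (List.∈-upTo⁺ u<) (List.∈-upTo⁺ v<)))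

  ∈⇒valid : ∀ {l} → l ∈ₗ labels → Valid l
  ∈⇒valid l∈ with List.∈-cartesianProduct⁻ (upTo (suc t)) _ l∈
  ... | i∈ , l∈₁ with List.∈-cartesianProduct⁻ (upTo 4) _ l∈₁
  ...   | κ∈ , l∈₂ with List.∈-cartesianProduct⁻ (upTo n) (upTo n) l∈₂
  ...     | u∈ , v∈ = ℕ.s≤s⁻¹ (List.∈-upTo⁻ i∈) , List.∈-upTo⁻ κ∈ , List.∈-upTo⁻ u∈ , List.∈-upTo⁻ v∈

  labels-unique : Unique labels
  labels-unique = Unique.cartesianProduct⁺ (Unique.upTo⁺ (suc t)) (Unique.cartesianProduct⁺ (Unique.upTo⁺ 4)
    (Unique.cartesianProduct⁺ (Unique.upTo⁺ n) (Unique.upTo⁺ n)))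

  valid-lo : ∀ {i u v} s → i < t → u < n → v < n → Valid (lo i u v s)
  valid-lo first  i<t u< v< = ℕ.<⇒≤ i<t , s≤s z≤n , 0<n , 0<n
  valid-lo second i<t u< v< = ℕ.<⇒≤ i<t , s≤s (s≤s z≤n) , u< , v<
  valid-lo third  i<t u< v< = ℕ.<⇒≤ i<t , s≤s (s≤s (s≤s z≤n)) , u< , v<

  valid-hi : ∀ {i u v} s → i < t → u < n → v < n → Valid (hi i u v s)
  valid-hi first  i<t u< v< = ℕ.<⇒≤ i<t , s≤s (s≤s z≤n) , u< , v<
  valid-hi second i<t u< v< = ℕ.<⇒≤ i<t , s≤s (s≤s (s≤s z≤n)) , u< , v<
  valid-hi third  i<t u< v< = i<t , s≤s z≤n , 0<n , 0<n

  valid-hub : ∀ {i u} → i < t → u < n → Valid (i , 3 , u , 0)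
  valid-hub i<t u< = ℕ.<⇒≤ i<t , ℕ.≤-refl , u< , 0<n

  link< : ∀ i {u v} → u < n → v < n → link i u v < n
  link< i {u} {v} u< v< with B i u v
  ... | true  = u<
  ... | false = v<

  -- The side of s of the cut given by the set S in block k.
  sideOf : ℕ → Vec Bool n → Label → Bool
  sideOf k S (i , 0 , u , v)  = i <ᵇ suc k
  sideOf k S (i , κ , u , v) with ℕ.<-cmp i k
  ... | tri< _ _ _ = true
  ... | tri> _ _ _ = false
  ... | tri≈ _ _ _ = within κ
    where
    within : ℕ → Bool
    within 1 = bitAt (Vec.toList S) v
    within 2 = bitAt (Vec.toList S) (link k u v)
    within _ = bitAt (Vec.toList S) u

  side-before : ∀ k S l → proj₁ l < k → sideOf k S l ≡ true
  side-before k S (i , zero , _)  i<k = dec-true (i ℕ.<? suc k) (ℕ.m<n⇒m<1+n i<k)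
  side-before k S (i , suc κ , _) i<k with ℕ.<-cmp i k
  ... | tri< _ _ _ = refl
  ... | tri> i≮k _ _ = contradiction i<k i≮k
  ... | tri≈ i≮k _ _ = contradiction i<k i≮k

  side-after : ∀ k S l → k < proj₁ l → sideOf k S l ≡ false
  side-after k S (i , zero , _)  k<i = dec-false (i ℕ.<? suc k) (ℕ.≤⇒≯ k<i)
  side-after k S (i , suc κ , _) k<i with ℕ.<-cmp i k
  ... | tri< _ _ i≯k = contradiction k<i i≯k
  ... | tri> _ _ _ = refl
  ... | tri≈ _ _ i≯k = contradiction k<i i≯k

  side-joint : ∀ k S → sideOf k S (joint k) ≡ true
  side-joint k S = dec-true (k ℕ.<? suc k) ℕ.≤-refl

  side₁ : ∀ k S u v → sideOf k S (k , 1 , u , v) ≡ bitAt (Vec.toList S) v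
  side₁ k S u v with ℕ.<-cmp k k
  ... | tri< k<k _ _ = contradiction k<k (ℕ.<-irrefl refl)
  ... | tri> _ _ k<k = contradiction k<k (ℕ.<-irrefl refl)
  ... | tri≈ _ _ _ = refl

  side₂ : ∀ k S u v → sideOf k S (k , 2 , u , v) ≡ bitAt (Vec.toList S) (link k u v)
  side₂ k S u v with ℕ.<-cmp k k
  ... | tri< k<k _ _ = contradiction k<k (ℕ.<-irrefl refl)
  ... | tri> _ _ k<k = contradiction k<k (ℕ.<-irrefl refl)
  ... | tri≈ _ _ _ = refl

  side₃ : ∀ k S u → sideOf k S (k , 3 , u , 0) ≡ bitAt (Vec.toList S) u
  side₃ k S u with ℕ.<-cmp k k
  ... | tri< k<k _ _ = contradiction k<k (ℕ.<-irrefl refl)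
  ... | tri> _ _ k<k = contradiction k<k (ℕ.<-irrefl refl)
  ... | tri≈ _ _ _ = refl

  -- This is where closedness acts: if the second inner vertex of a path is on the side of `s`, so
  -- is the first. Hence each path changes sides only once, at the edge given by `crossing`.
  closed-link : ∀ k S → Closed n (B k) S → ∀ {u v} → u < n → v < n →
                T (bitAt (Vec.toList S) (link k u v)) → T (bitAt (Vec.toList S) v)
  closed-link k S closed {u} {v} u< v< h with B k u v in eq
  ... | false = h
  ... | true  = subst T (sym (at v<)) (closed (fromℕ< u<) (fromℕ< v<)
      (subst₂ (λ u v → T (B k u v)) (sym (toℕ-fromℕ< u<)) (sym (toℕ-fromℕ< v<)) (≡⇒T eq)) (subst T (at u<) h))
    where
    at : ∀ {c} (c< : c < n) → bitAt (Vec.toList S) c ≡ lookup S (fromℕ< c<)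
    at c< = trans (cong (bitAt (Vec.toList S)) (sym (toℕ-fromℕ< c<))) (bitAt-toList S (fromℕ< c<))

  crossing : ℕ → Vec Bool n → ℕ → ℕ → Step
  crossing k S u v = if not (bitAt (Vec.toList S) v) then first
                     else if not (bitAt (Vec.toList S) (link k u v)) then second else third

  crossing-lo : ∀ k S u v → T (sideOf k S (lo k u v (crossing k S u v)))
  crossing-lo k S u v with bitAt (Vec.toList S) v in eq₁
  ... | false = ≡⇒T (side-joint k S)
  ... | true with bitAt (Vec.toList S) (link k u v) in eq₂
  ...   | false = ≡⇒T (trans (side₁ k S u v) eq₁)
  ...   | true  = ≡⇒T (trans (side₂ k S u v) eq₂)

  crossing-hi : ∀ k S u v → ¬ T (sideOf k S (hi k u v (crossing k S u v)))
  crossing-hi k S u v with bitAt (Vec.toList S) v in eq₁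
  ... | false = subst T (trans (side₁ k S u v) eq₁)
  ... | true with bitAt (Vec.toList S) (link k u v) in eq₂
  ...   | false = subst T (trans (side₂ k S u v) eq₂)
  ...   | true  = subst T (side-after k S (joint (suc k)) ℕ.≤-refl)

  -- Arrows of other blocks have both ends on the same side, and within block `k` an arrow to a hub
  -- joins vertices whose sides are given by the same element of `S`. Only path edges remain.
  crosses : ∀ k S → Closed n (B k) S → ∀ {x y} → Arrow x y → Valid x → Valid y → sideOf k S x ≢ sideOf k S y →
            k < t × ∃₂ λ u v → u < n × v < n × x ≡ lo k u v (crossing k S u v) × y ≡ hi k u v (crossing k S u v)
  crosses k S closed {x} {y} a vx vy ne with blockOf a
    where
    same : ∀ {i l} → proj₁ l ≡ i → (i < k → sideOf k S l ≡ true) × (k < i → sideOf k S l ≡ false)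
    same {l = l} refl = side-before k S l , side-after k S l
    blockOf : ∀ {x y} → Arrow x y → ∃ λ i → i < t × proj₁ x ≡ i × (i < k → sideOf k S y ≡ true) × (k < i → sideOf k S y ≡ false)
    blockOf (enter {i} {u} {v} i<t) = i , i<t , refl , same {l = i , 1 , u , v} refl
    blockOf (pass {i} {u} {v} i<t)  = i , i<t , refl , same {l = i , 2 , u , v} refl
    blockOf (leave {i} i<t) = i , i<t , refl , (λ i<k → dec-true (suc i ℕ.<? suc k) (s≤s i<k)) , λ k<i → side-after k S (joint (suc i)) (ℕ.m<n⇒m<1+n k<i)
    blockOf (hub₁ {i} {u} {v} i<t)  = i , i<t , refl , same {l = i , 3 , v , 0} refl
    blockOf (hub₂ {i} {u} {v} i<t)  = i , i<t , refl , same {l = i , 3 , link i u v , 0} refl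
  ... | i , i<t , refl , before , after with ℕ.<-cmp i k
  ...   | tri< i<k _ _ = contradiction (trans (side-before k S x i<k) (sym (before i<k))) ne
  ...   | tri> _ _ k<i = contradiction (trans (side-after k S x k<i) (sym (after k<i))) ne
  ...   | tri≈ _ refl _ = i<t , here′ a refl vx vy ne
    where
    here′ : ∀ {x y} → Arrow x y → proj₁ x ≡ k → Valid x → Valid y → sideOf k S x ≢ sideOf k S y →
            ∃₂ λ u v → u < n × v < n × x ≡ lo k u v (crossing k S u v) × y ≡ hi k u v (crossing k S u v)
    here′ (enter {i} {u} {v} i<t) refl vx (_ , _ , u< , v<) ne = u , v , u< , v< , atFirst
      where
      atFirst : joint k ≡ lo k u v (crossing k S u v) × (k , 1 , u , v) ≡ hi k u v (crossing k S u v)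
      atFirst with bitAt (Vec.toList S) v in eq
      ... | false = refl , refl
      ... | true  = contradiction (trans (side-joint k S) (sym (trans (side₁ k S u v) eq))) ne
    here′ (pass {i} {u} {v} i<t) refl (_ , _ , u< , v<) vy ne = u , v , u< , v< , atSecond
      where
      atSecond : (k , 1 , u , v) ≡ lo k u v (crossing k S u v) × (k , 2 , u , v) ≡ hi k u v (crossing k S u v)
      atSecond with bitAt (Vec.toList S) v in eq | bitAt (Vec.toList S) (link k u v) in eq′
      ... | true  | false = refl , refl
      ... | true  | true  = contradiction (trans (trans (side₁ k S u v) eq) (sym (trans (side₂ k S u v) eq′))) ne
      ... | false | false = contradiction (trans (trans (side₁ k S u v) eq) (sym (trans (side₂ k S u v) eq′))) ne
      ... | false | true  = ⊥-elim (subst T eq (closed-link k S closed u< v< (≡⇒T eq′)))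
    here′ (leave {i} {u} {v} i<t) refl (_ , _ , u< , v<) vy ne = u , v , u< , v< , atThird
      where
      atThird : (k , 2 , u , v) ≡ lo k u v (crossing k S u v) × joint (suc k) ≡ hi k u v (crossing k S u v)
      atThird with bitAt (Vec.toList S) v in eq | bitAt (Vec.toList S) (link k u v) in eq′
      ... | true  | true  = refl , refl
      ... | false | true  = ⊥-elim (subst T eq (closed-link k S closed u< v< (≡⇒T eq′)))
      ... | true  | false = contradiction (trans (trans (side₂ k S u v) eq′) (sym (side-after k S (joint (suc k)) ℕ.≤-refl))) ne
      ... | false | false = contradiction (trans (trans (side₂ k S u v) eq′) (sym (side-after k S (joint (suc k)) ℕ.≤-refl))) ne
    here′ (hub₁ {i} {u} {v} i<t) refl vx vy ne = contradiction (trans (side₁ k S u v) (sym (side₃ k S v))) ne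
    here′ (hub₂ {i} {u} {v} i<t) refl vx vy ne = contradiction (trans (side₂ k S u v) (sym (side₃ k S (link k u v)))) ne

abstract
  minimumCuts : Σ Graph Terminals → ℕ → ℕ
  minimumCuts (G , s , t , _) κ = count λ S → MinCut.IsMinimumCut? G s t S ×-dec (∣ S ∣ ℕ.≟ κ)

  minimumCuts≡ : ∀ G s t s≢t κ → minimumCuts (G , s , t , s≢t) κ ≡ count λ S → MinCut.IsMinimumCut? G s t S ×-dec (∣ S ∣ ℕ.≟ κ)
  minimumCuts≡ G s t s≢t κ = refl

#k-Min-st-Cut≡ : ∀ w κ {G s t s≢t} → readGraph,s,t w ≡ just (G , s , t , s≢t) → #k-Min-st-Cut (w , κ) ≡ minimumCuts (G , s , t , s≢t) κ
#k-Min-st-Cut≡ w κ {G} {s} {t} {s≢t} eq = trans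
  (onInput-just readGraph,s,t (λ (G , s , t , _) κ → count λ S → MinCut.IsMinimumCut? G s t S ×-dec (∣ S ∣ ℕ.≟ κ)) w κ eq)
  (sym (minimumCuts≡ G s t s≢t κ))

module CutGraph (t′ n : ℕ) (0<n : 0 < n) (B : ℕ → ℕ → ℕ → Bool) (labels : List Label) (labels-unique : Unique labels)
  (valid⇒∈ : ∀ {l} → Cuts.Valid t′ n 0<n B l → l ∈ₗ labels) (∈⇒valid : ∀ {l} → l ∈ₗ labels → Cuts.Valid t′ n 0<n B l) where
  open Cuts t′ n 0<n B hiding (labels; labels-unique; valid⇒∈; ∈⇒valid)

  private
    t k² : ℕ
    t = suc t′
    k² = n * n

  module _ (adj : Fin (length labels) → Fin (length labels) → Bool) (symm : ∀ u v → adj u v ≡ adj v u)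
           (irrefl : ∀ v → adj v v ≡ false)
           (adj≡ : ∀ u v → adj u v ≡ both (arrow t B) (List.lookup labels u) (List.lookup labels v)) where

    G : Graph
    G = record { order = length labels ; adj = adj ; symm = symm ; irrefl = irrefl }

    open Graph G using (Vertex; Edge; EdgeSet; Adj; Joins; Joins?; edges)
    open Edges G

    lab : Vertex → Label
    lab = List.lookup labels

    lab-injective : ∀ {u v} → lab u ≡ lab v → u ≡ v
    lab-injective = lookup-injective labels-unique

    Links : Edge → Label → Label → Set
    Links e x y = (lab (proj₁ (ends e)) ≡ x × lab (proj₂ (ends e)) ≡ y) ⊎ (lab (proj₁ (ends e)) ≡ y × lab (proj₂ (ends e)) ≡ x)

    links-unique : ∀ {e f x y} → Links e x y → Links f x y → e ≡ f
    links-unique {e} {f} l m = joins-unique (joins l) (same l m)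
      where
      joins : ∀ {x y} → Links e x y → Joins e (proj₁ (ends e)) (proj₂ (ends e))
      joins _ = inj₁ refl
      same : ∀ {x y} → Links e x y → Links f x y → Joins f (proj₁ (ends e)) (proj₂ (ends e))
      same (inj₁ (p , q)) (inj₁ (p′ , q′)) = inj₁ (cong₂ _,_ (lab-injective (trans p′ (sym p))) (lab-injective (trans q′ (sym q))))
      same (inj₂ (p , q)) (inj₂ (p′ , q′)) = inj₁ (cong₂ _,_ (lab-injective (trans p′ (sym p))) (lab-injective (trans q′ (sym q))))
      same (inj₁ (p , q)) (inj₂ (p′ , q′)) = inj₂ (cong₂ _,_ (lab-injective (trans p′ (sym q))) (lab-injective (trans q′ (sym p))))
      same (inj₂ (p , q)) (inj₁ (p′ , q′)) = inj₂ (cong₂ _,_ (lab-injective (trans p′ (sym q))) (lab-injective (trans q′ (sym p))))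

    links-labels : ∀ {e x y x′ y′} → Links e x y → Links e x′ y′ → (x ≡ x′ × y ≡ y′) ⊎ (x ≡ y′ × y ≡ x′)
    links-labels (inj₁ (refl , refl)) (inj₁ (p , q)) = inj₁ (p , q)
    links-labels (inj₁ (refl , refl)) (inj₂ (p , q)) = inj₂ (p , q)
    links-labels (inj₂ (refl , refl)) (inj₁ (p , q)) = inj₂ (q , p)
    links-labels (inj₂ (refl , refl)) (inj₂ (p , q)) = inj₁ (q , p)

    joins⇒links : ∀ {e u v} → Joins e u v → Links e (lab u) (lab v)
    joins⇒links (inj₁ eq) = inj₁ (cong (lab ∘ proj₁) eq , cong (lab ∘ proj₂) eq)
    joins⇒links (inj₂ eq) = inj₂ (cong (lab ∘ proj₁) eq , cong (lab ∘ proj₂) eq)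

    edge-arrow : ∀ e → ∃₂ λ x y → Arrow x y × Valid x × Valid y × Links e x y
    edge-arrow e = oriented (∨-sound (subst T (adj≡ u v) (proj₂ (ends-listed e))))
      where
      u v : Vertex
      u = proj₁ (ends e)
      v = proj₂ (ends e)
      oriented : T (arrow t B (lab u) (lab v)) ⊎ T (arrow t B (lab v) (lab u)) → ∃₂ λ x y → Arrow x y × Valid x × Valid y × Links e x y
      oriented (inj₁ a) = lab u , lab v , arrow-sound _ _ a , ∈⇒valid (List.∈-lookup u) , ∈⇒valid (List.∈-lookup v) , inj₁ (refl , refl)
      oriented (inj₂ a) = lab v , lab u , arrow-sound _ _ a , ∈⇒valid (List.∈-lookup v) , ∈⇒valid (List.∈-lookup u) , inj₂ (refl , refl)

    arrow-edge : ∀ {x y} → Arrow x y → Valid x → Valid y → ∃ λ e → Links e x y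
    arrow-edge {x} {y} a vx vy = found (label-index (valid⇒∈ vx)) (label-index (valid⇒∈ vy))
      where
      found : (∃ λ u → lab u ≡ x) → (∃ λ v → lab v ≡ y) → ∃ λ e → Links e x y
      found (u , refl) (v , refl) = let e , j = edge (subst T (sym (adj≡ u v)) (∨-inj₁ (arrow-complete a))) in e , joins⇒links j

    module _ (s₀ t₀ : Vertex) (s≡ : lab s₀ ≡ joint 0) (t≡ : lab t₀ ≡ joint t) where
      open MinCut G s₀ t₀

      rowOf : Fin k² → Fin n × Fin n
      rowOf = remQuot n

      rowOf-injective : ∀ {e f} → toℕ (proj₁ (rowOf e)) ≡ toℕ (proj₁ (rowOf f)) → toℕ (proj₂ (rowOf e)) ≡ toℕ (proj₂ (rowOf f)) → e ≡ f
      rowOf-injective {e} {f} p q = trans (sym (combine-remQuot {n} n e))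
        (trans (cong₂ combine (toℕ-injective p) (toℕ-injective q)) (combine-remQuot {n} n f))

      abstract
       pathEdge : ∀ {k} → k < t → (e : Fin k²) (s : Step) → ∃ λ f → Links f (lo k (toℕ (proj₁ (rowOf e))) (toℕ (proj₂ (rowOf e))) s)
                                                                           (hi k (toℕ (proj₁ (rowOf e))) (toℕ (proj₂ (rowOf e))) s)
       pathEdge k<t e s = arrow-edge (step-arrow _ _ s k<t) (valid-lo s k<t (toℕ<n _) (toℕ<n _)) (valid-hi s k<t (toℕ<n _) (toℕ<n _))

      path-row : ∀ {f i j u v u′ v′} s s′ → Links f (lo i u v s) (hi i u v s) → Links f (lo j u′ v′ s′) (hi j u′ v′ s′) →
                 i ≡ j × s ≡ s′ × (u , v) ≡ (u′ , v′)
      path-row {i = i} {j} {u} {v} {u′} {v′} s s′ l l′ = match (links-labels l l′)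
        where
        match : _ ⊎ _ → i ≡ j × s ≡ s′ × (u , v) ≡ (u′ , v′)
        match (inj₁ (p , q)) = let i≡ , s≡ = lo-injective s s′ p q in
          i≡ , s≡ , trans (sym (proj₁ (row-step i u v s))) (trans (cong₂ row p q) (proj₁ (row-step j u′ v′ s′)))
        match (inj₂ (p , q)) = contradiction q (lo≢hi s s′ p)

      differ : Bool → Bool → Bool
      differ a b = not (does (a Bool.≟ b))

      differ-sound : ∀ {a b} → T (differ a b) → a ≢ b
      differ-sound {a} {b} d a≡b = not-sound d (≡⇒T (dec-true (a Bool.≟ b) a≡b))

      differ-complete : ∀ {a b} → a ≢ b → T (differ a b)
      differ-complete {a} {b} a≢b = subst (T ∘ not) (sym (dec-false (a Bool.≟ b) a≢b)) tt

      sideᵛ : ℕ → Vec Bool n → Vertex → Bool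
      sideᵛ k S u = sideOf k S (lab u)

      crossed? : ℕ → Vec Bool n → Edge → Bool
      crossed? k S f = differ (sideᵛ k S (proj₁ (ends f))) (sideᵛ k S (proj₂ (ends f)))

      cutSet : ℕ → Vec Bool n → EdgeSet
      cutSet k S = tabulate (crossed? k S)

      cutSet⁻ : ∀ {k S f x y} → f ∈ cutSet k S → Links f x y → sideOf k S x ≢ sideOf k S y
      cutSet⁻ {k} {S} f∈ (inj₁ (refl , refl)) = differ-sound (∈-tabulate⁻ {p = crossed? k S} f∈)
      cutSet⁻ {k} {S} f∈ (inj₂ (refl , refl)) = differ-sound (∈-tabulate⁻ {p = crossed? k S} f∈) ∘ sym

      cutSet⁺ : ∀ {k S f x y} → Links f x y → sideOf k S x ≢ sideOf k S y → f ∈ cutSet k S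
      cutSet⁺ {k} {S} (inj₁ (refl , refl)) ne = ∈-tabulate⁺ {p = crossed? k S} (differ-complete ne)
      cutSet⁺ {k} {S} (inj₂ (refl , refl)) ne = ∈-tabulate⁺ {p = crossed? k S} (differ-complete (ne ∘ sym))

      module Side (C : EdgeSet) (cut : IsCut C) where
        private
          survives? : ∀ u v → Dec (Survives C u v)
          survives? u v = any? λ e → ¬? (e ∈? C) ×-dec Joins? e u v

          reach? : ∀ u → Dec (Star (Survives C) s₀ u)
          reach? = Reachability.reachable? survives? s₀

        Reached : Label → Set
        Reached x = ∃ λ u → lab u ≡ x × Star (Survives C) s₀ u

        abstract
          reached? : ∀ x → Dec (Reached x)
          reached? x = any? (λ u → labelled? (lab u) x ×-dec reach? u)
            where
            labelled? : (x y : Label) → Dec (x ≡ y)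
            labelled? (a , b , c , d) (a′ , b′ , c′ , d′) = map′ (λ { (refl , refl , refl , refl) → refl }) (λ { refl → refl , refl , refl , refl })
              ((a ℕ.≟ a′) ×-dec (b ℕ.≟ b′) ×-dec (c ℕ.≟ c′) ×-dec (d ℕ.≟ d′))

        uncut : ∀ {e x y} → Links e x y → e ∉ C → Reached x → Reached y
        uncut {e} l e∉ (u , refl , path) = across l
          where
          extend : ∀ {v w} → v ≡ u → Joins e v w → Reached (lab w)
          extend refl j = _ , refl , path ◅◅ ((e , e∉ , j) ◅ ε)
          across : ∀ {y} → Links e (lab u) y → Reached y
          across (inj₁ (p , refl)) = extend (lab-injective p) (inj₁ refl)
          across (inj₂ (refl , q)) = extend (lab-injective q) (inj₂ refl)

        flip : ∀ {e x y} → Links e x y → Links e y x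
        flip (inj₁ p) = inj₂ p
        flip (inj₂ p) = inj₁ p

        separated : ∀ {e x y} → Links e x y → Reached x → ¬ Reached y → e ∈ C
        separated {e} l rx ¬ry = decidable-stable (e ∈? C) λ e∉ → ¬ry (uncut l e∉ rx)

        start-reached : Reached (joint 0)
        start-reached = s₀ , s≡ , ε

        end-unreached : ¬ Reached (joint t)
        end-unreached (u , eq , path) = cut (subst (Star (Survives C) s₀) (lab-injective (trans eq (sym t≡))) path)

        reachedᵇ : Label → Bool
        reachedᵇ x = does (reached? x)

        sound : ∀ {x} → T (reachedᵇ x) → Reached x
        sound {x} h = from (reached? x) h
          where
          from : (d : Dec (Reached x)) → T (does d) → Reached x
          from (yes r) _ = r

        complete : ∀ {x} → Reached x → T (reachedᵇ x)
        complete {x} r = ≡⇒T (dec-true (reached? x) r)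

        abstract
          block : ∃ λ k → k < t × (∀ j → j ≤ k → Reached (joint j)) × ¬ Reached (joint (suc k))
          block = from (first-failure t (reachedᵇ ∘ joint))
            where
            unreached : ∀ k → (suc k < t → ¬ T (reachedᵇ (joint (suc k)))) → suc k < t ⊎ suc k ≡ t → ¬ Reached (joint (suc k))
            unreached k fails (inj₁ lt)   r = fails lt (complete r)
            unreached k fails (inj₂ refl) r = end-unreached r
            from : (∃ λ i → i ≤ t × (∀ j → j < i → T (reachedᵇ (joint j))) × (i < t → ¬ T (reachedᵇ (joint i)))) →
                   ∃ λ k → k < t × (∀ j → j ≤ k → Reached (joint j)) × ¬ Reached (joint (suc k))
            from (zero , _ , _ , fails) = contradiction (complete start-reached) (fails (s≤s z≤n))
            from (suc k , k<t , before , fails) = k , k<t , (λ j j≤k → sound (before j (s≤s j≤k))) ,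
              unreached k fails (ℕ.m≤n⇒m<n∨m≡n k<t)

        k : ℕ
        k = proj₁ block

        k<t : k < t
        k<t = proj₁ (proj₂ block)

        abstract
          crossed : ∀ u v → ∃ λ s → Reached (lo k u v s) × ¬ Reached (hi k u v s)
          crossed u v = from (reached? (k , 1 , u , v)) (reached? (k , 2 , u , v))
            where
            from : Dec (Reached (k , 1 , u , v)) → Dec (Reached (k , 2 , u , v)) → ∃ λ s → Reached (lo k u v s) × ¬ Reached (hi k u v s)
            from (no ¬r₁) _        = first , proj₁ (proj₂ (proj₂ block)) k ℕ.≤-refl , ¬r₁
            from (yes r₁) (no ¬r₂) = second , r₁ , ¬r₂
            from (yes r₁) (yes r₂) = third , r₂ , proj₂ (proj₂ (proj₂ block))

        step : Fin k² → Step
        step e = proj₁ (crossed (toℕ (proj₁ (rowOf e))) (toℕ (proj₂ (rowOf e))))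

        cutEdge : Fin k² → Edge
        cutEdge e = proj₁ (pathEdge k<t e (step e))

        cutEdge-links : ∀ e → Links (cutEdge e) (lo k (toℕ (proj₁ (rowOf e))) (toℕ (proj₂ (rowOf e))) (step e))
                                                (hi k (toℕ (proj₁ (rowOf e))) (toℕ (proj₂ (rowOf e))) (step e))
        cutEdge-links e = proj₂ (pathEdge k<t e (step e))

        cutEdge-links′ : ∀ {g} e → cutEdge e ≡ g → Links g (lo k (toℕ (proj₁ (rowOf e))) (toℕ (proj₂ (rowOf e))) (step e))
                                                           (hi k (toℕ (proj₁ (rowOf e))) (toℕ (proj₂ (rowOf e))) (step e))
        cutEdge-links′ e refl = cutEdge-links e

        cutEdge∈ : ∀ e → cutEdge e ∈ C
        cutEdge∈ e = separated (cutEdge-links e) (proj₁ (proj₂ c)) (proj₂ (proj₂ c))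
          where
          c : ∃ λ s → Reached (lo k (toℕ (proj₁ (rowOf e))) (toℕ (proj₂ (rowOf e))) s) × ¬ Reached (hi k (toℕ (proj₁ (rowOf e))) (toℕ (proj₂ (rowOf e))) s)
          c = crossed (toℕ (proj₁ (rowOf e))) (toℕ (proj₂ (rowOf e)))

        cutEdge-injective : Injective _≡_ _≡_ cutEdge
        cutEdge-injective {e} {f} eq = rowOf-injective (cong proj₁ uv≡) (cong proj₂ uv≡)
          where
          uv≡ : (toℕ (proj₁ (rowOf e)) , toℕ (proj₂ (rowOf e))) ≡ (toℕ (proj₁ (rowOf f)) , toℕ (proj₂ (rowOf f)))
          uv≡ = proj₂ (proj₂ (path-row (step e) (step f) (cutEdge-links e) (cutEdge-links′ f (sym eq))))

        -- Joint `k` is reached and joint `suc k` is not, so each of the edge-disjoint paths between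
        -- them contains an edge that leaves the set of reached vertices. One block is enough for
        -- the lower bound.
        k²≤∣C∣ : k² ≤ ∣ C ∣
        k²≤∣C∣ = injected⇒≤ cutEdge cutEdge-injective cutEdge∈

        module Tight (C≤ : ∣ C ∣ ≤ k²) where

          only : ∀ {f} → f ∈ C → ∃ λ e → cutEdge e ≡ f
          only = tight⇒covered cutEdge cutEdge-injective cutEdge∈ C≤

          -- The chosen path edges of block `k` already exhaust a tight cut, so every edge that is
          -- not on a path of this block survives, and its ends are reached together.
          equal : ∀ {f x y} → Links f x y → (∀ u v s → ¬ Links f (lo k u v s) (hi k u v s)) →
                  (Reached x → Reached y) × (Reached y → Reached x)
          equal {f} l other = uncut l f∉ , uncut (flip l) f∉
            where
            f∉ : f ∉ C
            f∉ f∈ = other _ _ (step (proj₁ (only f∈))) (cutEdge-links′ (proj₁ (only f∈)) (proj₂ (only f∈)))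

          across : ∀ {x y} → Arrow x y → Valid x → Valid y →
                   (∀ u v s → ¬ (x ≡ lo k u v s × y ≡ hi k u v s)) → (Reached x → Reached y) × (Reached y → Reached x)
          across a vx vy other = let f , l = arrow-edge a vx vy in
            equal l λ u v s l′ → case links-labels l l′ of λ where
              (inj₁ eqs)       → other u v s eqs
              (inj₂ (p , q)) → Arrow-asym a (subst₂ Arrow (sym q) (sym p) (step-arrow u v s k<t))

          outside : ∀ {i u v} s → i < t → i ≢ k → u < n → v < n →
                    (Reached (lo i u v s) → Reached (hi i u v s)) × (Reached (hi i u v s) → Reached (lo i u v s))
          outside {i} {u} {v} s i<t i≢k u< v< = across (step-arrow u v s i<t) (valid-lo s i<t u< v<) (valid-hi s i<t u< v<)
            λ u′ v′ s′ (p , q) → i≢k (proj₁ (lo-injective s s′ p q))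

          hub₁-equal : ∀ {i u v} → i < t → u < n → v < n →
                       (Reached (i , 1 , u , v) → Reached (i , 3 , v , 0)) × (Reached (i , 3 , v , 0) → Reached (i , 1 , u , v))
          hub₁-equal i<t u< v< = across (hub₁ i<t) (valid-hi first i<t u< v<) (valid-hub i<t v<) other
            where
            other : ∀ {i u v} u′ v′ s → ¬ ((i , 1 , u , v) ≡ lo k u′ v′ s × (i , 3 , v , 0) ≡ hi k u′ v′ s)
            other u′ v′ first  (_ , ())
            other u′ v′ second (_ , ())
            other u′ v′ third  (_ , ())

          hub₂-equal : ∀ {i u v} → i < t → u < n → v < n →
                       (Reached (i , 2 , u , v) → Reached (i , 3 , link i u v , 0)) × (Reached (i , 3 , link i u v , 0) → Reached (i , 2 , u , v))
          hub₂-equal {i} i<t u< v< = across (hub₂ i<t) (valid-hi second i<t u< v<) (valid-hub i<t (link< i u< v<)) other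
            where
            other : ∀ {i u v w} u′ v′ s → ¬ ((i , 2 , u , v) ≡ lo k u′ v′ s × (i , 3 , w , 0) ≡ hi k u′ v′ s)
            other u′ v′ first  (_ , ())
            other u′ v′ second (_ , ())
            other u′ v′ third  (_ , ())

          S : Vec Bool n
          S = tabulate λ u → reachedᵇ (k , 3 , toℕ u , 0)

          at : ∀ {c} → c < n → bitAt (Vec.toList S) c ≡ reachedᵇ (k , 3 , c , 0)
          at c< = trans (cong (bitAt (Vec.toList S)) (sym (toℕ-fromℕ< c<))) (trans (bitAt-toList S (fromℕ< c<))
            (trans (Vec.lookup∘tabulate _ (fromℕ< c<)) (cong (λ c → reachedᵇ (k , 3 , c , 0)) (toℕ-fromℕ< c<))))

          -- p₂ reached and p₁ not would put two edges of one path into C.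
          S-closed : Closed n (B k) S
          S-closed u v b su = subst T (sym (Vec.lookup∘tabulate _ v)) (complete hub-v)
            where
            e : Fin k²
            e = combine u v
            row≡ : rowOf e ≡ (u , v)
            row≡ = remQuot-combine u v
            link≡ : link k (toℕ u) (toℕ v) ≡ toℕ u
            link≡ = cong (λ b → if b then toℕ u else toℕ v) (T⇒≡ b)
            r₂ : Reached (k , 2 , toℕ u , toℕ v)
            r₂ = proj₂ (hub₂-equal k<t (toℕ<n u) (toℕ<n v)) (subst (λ c → Reached (k , 3 , c , 0)) (sym link≡)
              (sound (subst T (Vec.lookup∘tabulate (λ u → reachedᵇ (k , 3 , toℕ u , 0)) u) su)))
            r₁ : Reached (k , 1 , toℕ u , toℕ v)
            r₁ = decidable-stable (reached? (k , 1 , toℕ u , toℕ v)) λ ¬r → contradiction (steps-equal first third (proj₁ (proj₂ (proj₂ block)) k ℕ.≤-refl) ¬r r₂ (proj₂ (proj₂ (proj₂ block)))) λ ()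
              where
              steps-equal : ∀ s s′ → Reached (lo k (toℕ u) (toℕ v) s) → ¬ Reached (hi k (toℕ u) (toℕ v) s) →
                            Reached (lo k (toℕ u) (toℕ v) s′) → ¬ Reached (hi k (toℕ u) (toℕ v) s′) → s ≡ s′
              steps-equal s s′ r ¬r r′ ¬r′ = trans (is-step s r ¬r) (sym (is-step s′ r′ ¬r′))
                where
                is-step : ∀ s → Reached (lo k (toℕ u) (toℕ v) s) → ¬ Reached (hi k (toℕ u) (toℕ v) s) → s ≡ step e
                is-step s r ¬r = trans (proj₁ (proj₂ p)) (cong step (rowOf-injective
                    (trans (sym (cong proj₁ (proj₂ (proj₂ p)))) (cong (toℕ ∘ proj₁) (sym row≡)))
                    (trans (sym (cong proj₂ (proj₂ (proj₂ p)))) (cong (toℕ ∘ proj₂) (sym row≡)))))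
                  where
                  found : ∃ λ f → Links f (lo k (toℕ u) (toℕ v) s) (hi k (toℕ u) (toℕ v) s)
                  found = arrow-edge (step-arrow _ _ s k<t) (valid-lo s k<t (toℕ<n u) (toℕ<n v)) (valid-hi s k<t (toℕ<n u) (toℕ<n v))
                  l : Links (proj₁ found) (lo k (toℕ u) (toℕ v) s) (hi k (toℕ u) (toℕ v) s)
                  l = proj₂ found
                  o : ∃ λ e′ → cutEdge e′ ≡ proj₁ found
                  o = only (separated l r ¬r)
                  p : k ≡ k × s ≡ step (proj₁ o) × (toℕ u , toℕ v) ≡ (toℕ (proj₁ (rowOf (proj₁ o))) , toℕ (proj₂ (rowOf (proj₁ o))))
                  p = path-row s (step (proj₁ o)) l (cutEdge-links′ (proj₁ o) (proj₂ o))
            hub-v : Reached (k , 3 , toℕ v , 0)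
            hub-v = proj₁ (hub₁-equal k<t (toℕ<n u) (toℕ<n v)) r₁

          iff : ∀ {x b} → (Reached x → T b) → (T b → Reached x) → reachedᵇ x ≡ b
          iff f g = ≡-by-T (f ∘ sound) (complete ∘ g)

          -- The blocks behind `k` are uncut. A later reached joint could be followed back along the
          -- path for the pair (0, 0) to joint `suc k`.
          joint-after : ∀ i → k < i → i ≤ t → ¬ Reached (joint i)
          joint-after (suc i) (s≤s k≤i) i<t r = from (ℕ.m≤n⇒m<n∨m≡n k≤i)
            where
            from : k < i ⊎ k ≡ i → ⊥
            from (inj₂ k≡i) = proj₂ (proj₂ (proj₂ block)) (subst (Reached ∘ joint ∘ suc) (sym k≡i) r)
            from (inj₁ k<i) = joint-after i k<i (ℕ.<⇒≤ i<t) (back first (back second (back third r)))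
              where
              back : ∀ s → Reached (hi i 0 0 s) → Reached (lo i 0 0 s)
              back s = proj₂ (outside s i<t (λ i≡k → ℕ.<-irrefl (sym i≡k) k<i) 0<n 0<n)

          agree-joint : ∀ i → i ≤ t → reachedᵇ (joint i) ≡ sideOf k S (joint i)
          agree-joint i i≤t = iff (λ r → ℕ.<⇒<ᵇ (s≤s (ℕ.≮⇒≥ λ k<i → joint-after i k<i i≤t r)))
            (λ h → proj₁ (proj₂ (proj₂ block)) i (ℕ.s≤s⁻¹ (ℕ.<ᵇ⇒< i (suc k) h)))

          agree-p₁ : ∀ {i u v} → i < t → u < n → v < n → reachedᵇ (i , 1 , u , v) ≡ sideOf k S (i , 1 , u , v)
          agree-p₁ {i} {u} {v} i<t u< v< = from (ℕ.<-cmp i k)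
            where
            from : Tri (i < k) (i ≡ k) (k < i) → reachedᵇ (i , 1 , u , v) ≡ sideOf k S (i , 1 , u , v)
            from (tri< i<k i≢k _) = trans (T⇒≡ (complete (proj₁ (outside first i<t i≢k u< v<) (proj₁ (proj₂ (proj₂ block)) i (ℕ.<⇒≤ i<k)))))
              (sym (side-before k S (i , 1 , u , v) i<k))
            from (tri> _ i≢k k<i) = trans (iff (λ r → joint-after i k<i (ℕ.<⇒≤ i<t) (proj₂ (outside first i<t i≢k u< v<) r)) λ ())
              (sym (side-after k S (i , 1 , u , v) k<i))
            from (tri≈ _ refl _) = trans (iff (complete ∘ proj₁ (hub₁-equal i<t u< v<)) (proj₂ (hub₁-equal i<t u< v<) ∘ sound))
              (trans (sym (at v<)) (sym (side₁ k S u v)))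

          agree-p₂ : ∀ {i u v} → i < t → u < n → v < n → reachedᵇ (i , 2 , u , v) ≡ sideOf k S (i , 2 , u , v)
          agree-p₂ {i} {u} {v} i<t u< v< = from (ℕ.<-cmp i k)
            where
            from : Tri (i < k) (i ≡ k) (k < i) → reachedᵇ (i , 2 , u , v) ≡ sideOf k S (i , 2 , u , v)
            from (tri< i<k i≢k _) = trans (T⇒≡ (complete (proj₂ (outside third i<t i≢k u< v<) (proj₁ (proj₂ (proj₂ block)) (suc i) i<k))))
              (sym (side-before k S (i , 2 , u , v) i<k))
            from (tri> _ i≢k k<i) = trans (iff (λ r → joint-after (suc i) (ℕ.m<n⇒m<1+n k<i) i<t (proj₁ (outside third i<t i≢k u< v<) r)) λ ())
              (sym (side-after k S (i , 2 , u , v) k<i))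
            from (tri≈ _ refl _) = trans (iff (complete ∘ proj₁ (hub₂-equal i<t u< v<)) (proj₂ (hub₂-equal i<t u< v<) ∘ sound))
              (trans (sym (at (link< i u< v<))) (sym (side₂ k S u v)))

          agree-hub : ∀ {i u} → i < t → u < n → reachedᵇ (i , 3 , u , 0) ≡ sideOf k S (i , 3 , u , 0)
          agree-hub {i} {u} i<t u< = trans (sym (iff (complete ∘ proj₁ (hub₁-equal i<t 0<n u<)) (proj₂ (hub₁-equal i<t 0<n u<) ∘ sound)))
            (trans (agree-p₁ i<t 0<n u<) (p₁≡hub i u))
            where
            p₁≡hub : ∀ i u → sideOf k S (i , 1 , 0 , u) ≡ sideOf k S (i , 3 , u , 0)
            p₁≡hub i u with ℕ.<-cmp i k
            ... | tri< _ _ _ = refl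
            ... | tri> _ _ _ = refl
            ... | tri≈ _ _ _ = refl

          agree : ∀ {x y} → Arrow x y → Valid x → Valid y → reachedᵇ x ≡ sideOf k S x × reachedᵇ y ≡ sideOf k S y
          agree (enter {i} i<t) _ (_ , _ , u< , v<) = agree-joint i (ℕ.<⇒≤ i<t) , agree-p₁ i<t u< v<
          agree (pass i<t) (_ , _ , u< , v<) _ = agree-p₁ i<t u< v< , agree-p₂ i<t u< v<
          agree (leave {i} i<t) (_ , _ , u< , v<) _ = agree-p₂ i<t u< v< , agree-joint (suc i) i<t
          agree (hub₁ i<t) (_ , _ , u< , v<) _ = agree-p₁ i<t u< v< , agree-hub i<t v<
          agree (hub₂ {i} i<t) (_ , _ , u< , v<) _ = agree-p₂ i<t u< v< , agree-hub i<t (link< i u< v<)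

          is-cutSet : ∃₂ λ (i : Fin t) S → Closed n (B (toℕ i)) S × cutSet (toℕ i) S ≡ C
          is-cutSet = i , S , subst (λ k → Closed n (B k) S) (sym i≡) S-closed ,
              trans (cong (λ k → cutSet k S) i≡) (trans (Vec.tabulate-cong same) (Vec.tabulate∘lookup C))
            where
            i : Fin t
            i = fromℕ< k<t
            i≡ : toℕ i ≡ k
            i≡ = toℕ-fromℕ< k<t
            to : ∀ {f} → f ∈ cutSet k S → f ∈ C
            to {f} f∈ = from (edge-arrow f)
              where
              from : (∃₂ λ x y → Arrow x y × Valid x × Valid y × Links f x y) → f ∈ C
              from (x , y , a , vx , vy , l) = decidable-stable (f ∈? C) λ f∉ → cutSet⁻ {k} {S} f∈ l
                (trans (sym (proj₁ (agree a vx vy))) (trans (≡-by-T (complete ∘ uncut l f∉ ∘ sound) (complete ∘ uncut (flip l) f∉ ∘ sound)) (proj₂ (agree a vx vy))))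
            from : ∀ {f} → f ∈ C → f ∈ cutSet k S
            from {f} f∈ = cutSet⁺ {k} {S} l λ eq → proj₂ (proj₂ c) (sound (subst T (sym (proj₂ agreed))
                (subst T eq (subst T (proj₁ agreed) (complete (proj₁ (proj₂ c)))))))
              where
              e : Fin k²
              e = proj₁ (only f∈)
              u v : ℕ
              u = toℕ (proj₁ (rowOf e))
              v = toℕ (proj₂ (rowOf e))
              c : ∃ λ s → Reached (lo k u v s) × ¬ Reached (hi k u v s)
              c = crossed u v
              l : Links f (lo k u v (step e)) (hi k u v (step e))
              l = cutEdge-links′ e (proj₂ (only f∈))
              agreed : reachedᵇ (lo k u v (step e)) ≡ sideOf k S (lo k u v (step e)) × reachedᵇ (hi k u v (step e)) ≡ sideOf k S (hi k u v (step e))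
              agreed = agree (step-arrow u v (step e) k<t) (valid-lo (step e) k<t (toℕ<n _) (toℕ<n _)) (valid-hi (step e) k<t (toℕ<n _) (toℕ<n _))
            same : ∀ f → crossed? k S f ≡ lookup C f
            same f = trans (sym (Vec.lookup∘tabulate (crossed? k S) f)) (≡-by-T (∈⇒T ∘ to ∘ T⇒∈) (∈⇒T ∘ from ∘ T⇒∈))

      cutSet-cut : ∀ {k} S → k < t → IsCut (cutSet k S)
      cutSet-cut {k} S k<t path = contradiction (trans (sym (cong (sideOf k S) s≡)) (trans (constant path) (cong (sideOf k S) t≡)))
        (λ eq → case trans eq (side-after k S (joint t) k<t) of λ ())
        where
        constant : ∀ {u v} → Star (Survives (cutSet k S)) u v → sideᵛ k S u ≡ sideᵛ k S v
        constant ε = refl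
        constant ((e , e∉ , j) ◅ p) = trans (decidable-stable (_ Bool.≟ _) λ ne → e∉ (cutSet⁺ {k} {S} (joins⇒links j) ne)) (constant p)

      crossingEdge : ∀ {k} (S : Vec Bool n) → k < t → (e : Fin k²) →
                     ∃ λ f → Links f (lo k (toℕ (proj₁ (rowOf e))) (toℕ (proj₂ (rowOf e))) (crossing k S (toℕ (proj₁ (rowOf e))) (toℕ (proj₂ (rowOf e)))))
                                     (hi k (toℕ (proj₁ (rowOf e))) (toℕ (proj₂ (rowOf e))) (crossing k S (toℕ (proj₁ (rowOf e))) (toℕ (proj₂ (rowOf e)))))
      crossingEdge S k<t e = pathEdge k<t e _

      Crossing : ℕ → Vec Bool n → Label → Label → Set
      Crossing k S x y = ∃₂ λ u v → u < n × v < n × x ≡ lo k u v (crossing k S u v) × y ≡ hi k u v (crossing k S u v)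

      crossing-at : ∀ {k} S (k<t : k < t) {f x y} → Links f x y → Crossing k S x y → ∃ λ e → proj₁ (crossingEdge S k<t e) ≡ f
      crossing-at {k} S k<t {f} l (u , v , u< , v< , x≡ , y≡) = e , links-unique (proj₂ (crossingEdge S k<t e)) (subst₂ (Links f) (trans x≡ (sym lo≡)) (trans y≡ (sym hi≡)) l)
        where
        e : Fin k²
        e = combine (fromℕ< u<) (fromℕ< v<)
        u≡ : toℕ (proj₁ (rowOf e)) ≡ u
        u≡ = trans (cong (toℕ ∘ proj₁) (remQuot-combine (fromℕ< u<) (fromℕ< v<))) (toℕ-fromℕ< u<)
        v≡ : toℕ (proj₂ (rowOf e)) ≡ v
        v≡ = trans (cong (toℕ ∘ proj₂) (remQuot-combine (fromℕ< u<) (fromℕ< v<))) (toℕ-fromℕ< v<)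
        lo≡ : lo k (toℕ (proj₁ (rowOf e))) (toℕ (proj₂ (rowOf e))) (crossing k S (toℕ (proj₁ (rowOf e))) (toℕ (proj₂ (rowOf e)))) ≡ lo k u v (crossing k S u v)
        lo≡ = cong₂ (λ u v → lo k u v (crossing k S u v)) u≡ v≡
        hi≡ : hi k (toℕ (proj₁ (rowOf e))) (toℕ (proj₂ (rowOf e))) (crossing k S (toℕ (proj₁ (rowOf e))) (toℕ (proj₂ (rowOf e)))) ≡ hi k u v (crossing k S u v)
        hi≡ = cong₂ (λ u v → hi k u v (crossing k S u v)) u≡ v≡

      cutSet-size : ∀ {k} S → k < t → Closed n (B k) S → ∣ cutSet k S ∣ ≤ k²
      cutSet-size {k} S k<t closed = covered⇒≤ (λ e → proj₁ (crossingEdge S k<t e)) covered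
        where
        covered : ∀ {f} → f ∈ cutSet k S → ∃ λ e → proj₁ (crossingEdge S k<t e) ≡ f
        covered {f} f∈ = from (edge-arrow f)
          where
          from : (∃₂ λ x y → Arrow x y × Valid x × Valid y × Links f x y) → ∃ λ e → proj₁ (crossingEdge S k<t e) ≡ f
          from (x , y , a , vx , vy , l) = crossing-at S k<t l (proj₂ (crosses k S closed a vx vy (cutSet⁻ {k} {S} f∈ l)))

      Minimum : EdgeSet → Set
      Minimum C = IsMinimumCut C × ∣ C ∣ ≡ k²

      into : ∀ (i : Fin t) S → Closed n (B (toℕ i)) S → Minimum (cutSet (toℕ i) S)
      into i S closed = (cut , λ C′ cut′ → ℕ.≤-trans size≤ (Side.k²≤∣C∣ C′ cut′)) , ℕ.≤-antisym size≤ (Side.k²≤∣C∣ _ cut)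
        where
        cut : IsCut (cutSet (toℕ i) S)
        cut = cutSet-cut S (toℕ<n i)
        size≤ : ∣ cutSet (toℕ i) S ∣ ≤ k²
        size≤ = cutSet-size S (toℕ<n i) closed

      isFirst : Step → Bool
      isFirst first = true
      isFirst _     = false

      -- On a diagonal path both inner vertices hang on the hub of `c`, whether or not there is a
      -- loop at `c`. So its first edge is cut exactly if `c` is outside `S`, and the diagonal paths
      -- make `S` readable from the cut.
      crossing-bit : ∀ k S c → bitAt (Vec.toList S) c ≡ not (isFirst (crossing k S c c))
      crossing-bit k S c = by (bitAt (Vec.toList S) c) refl
        where
        link-same : link k c c ≡ c
        link-same = same (B k c c)
          where
          same : ∀ b → (if b then c else c) ≡ c
          same true  = refl
          same false = refl
        by : ∀ b → bitAt (Vec.toList S) c ≡ b → bitAt (Vec.toList S) c ≡ not (isFirst (crossing k S c c))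
        by true  eq rewrite link-same | eq = refl
        by false eq rewrite eq = refl

      cutSet-crossing : ∀ {k k′ S S′} → k < t → Closed n (B k′) S′ → cutSet k S ≡ cutSet k′ S′ → ∀ {c} → c < n →
                        k ≡ k′ × crossing k S c c ≡ crossing k′ S′ c c
      cutSet-crossing {k} {k′} {S} {S′} k<t closed′ eq {c} c< = from (proj₂ (crosses k′ S′ closed′
          (step-arrow c c s k<t) (valid-lo s k<t c< c<) (valid-hi s k<t c< c<)
          (cutSet⁻ {k′} {S′} (subst (proj₁ f ∈_) eq (cutSet⁺ {k} {S} (proj₂ f) apart)) (proj₂ f))))
        where
        s : Step
        s = crossing k S c c
        f : ∃ λ f → Links f (lo k c c s) (hi k c c s)
        f = arrow-edge (step-arrow c c s k<t) (valid-lo s k<t c< c<) (valid-hi s k<t c< c<)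
        apart : sideOf k S (lo k c c s) ≢ sideOf k S (hi k c c s)
        apart eq = crossing-hi k S c c (subst T eq (crossing-lo k S c c))
        from : Crossing k′ S′ (lo k c c s) (hi k c c s) → k ≡ k′ × s ≡ crossing k′ S′ c c
        from (u , v , _ , _ , p , q) = proj₁ (lo-injective s _ p q) , trans (proj₂ (lo-injective s _ p q)) (cong₂ (crossing k′ S′) (cong proj₁ uv≡) (cong proj₂ uv≡))
          where
          uv≡ : (u , v) ≡ (c , c)
          uv≡ = trans (sym (proj₁ (row-step k′ u v (crossing k′ S′ u v)))) (trans (cong₂ row (sym p) (sym q)) (proj₁ (row-step k c c s)))

      cutSet-injective : ∀ (i j : Fin t) S S′ → Closed n (B (toℕ i)) S → Closed n (B (toℕ j)) S′ →
                         cutSet (toℕ i) S ≡ cutSet (toℕ j) S′ → (i , S) ≡ (j , S′)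
      cutSet-injective i j S S′ _ closed′ eq = cong₂ _,_ (toℕ-injective (proj₁ (same 0<n))) (ext-vec′ λ c →
          trans (sym (bitAt-toList S c)) (trans (bits (toℕ<n c)) (bitAt-toList S′ c)))
        where
        same : ∀ {c} → c < n → toℕ i ≡ toℕ j × crossing (toℕ i) S c c ≡ crossing (toℕ j) S′ c c
        same = cutSet-crossing (toℕ<n i) closed′ eq
        bits : ∀ {c} → c < n → bitAt (Vec.toList S) c ≡ bitAt (Vec.toList S′) c
        bits {c} c< = trans (crossing-bit (toℕ i) S c) (trans (cong (not ∘ isFirst) (proj₂ (same c<))) (sym (crossing-bit (toℕ j) S′ c)))
        ext-vec′ : ∀ {v w : Vec Bool n} → (∀ i → lookup v i ≡ lookup w i) → v ≡ w
        ext-vec′ {v} {w} eq = trans (sym (Vec.tabulate∘lookup v)) (trans (Vec.tabulate-cong eq) (Vec.tabulate∘lookup w))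

      onto : ∀ C → Minimum C → ∃₂ λ (i : Fin t) S → Closed n (B (toℕ i)) S × cutSet (toℕ i) S ≡ C
      onto C ((cut , _) , size≡) = Side.Tight.is-cutSet C cut (ℕ.≤-reflexive size≡)

      cuts-count : ∀ s≢t → minimumCuts (G , s₀ , t₀ , s≢t) (n * n) ≡ sum (map (λ i → closedSets n (B (toℕ i))) (allFin t))
      cuts-count s≢t = trans (minimumCuts≡ G s₀ t₀ s≢t (n * n)) (count-Σ (λ i → closed? n (B (toℕ i))) (λ C → IsMinimumCut? C ×-dec (∣ C ∣ ℕ.≟ k²))
        (cutSet ∘ toℕ) into cutSet-injective onto)

-- Positions in lists

data At {A : Set} : List A → ℕ → A → Set where
  here  : ∀ {x xs} → At (x ∷ xs) 0 x
  there : ∀ {x y xs k} → At xs k y → At (x ∷ xs) (suc k) y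

at-++ˡ : ∀ {A : Set} {xs ys : List A} {k x} → At xs k x → At (xs ++ ys) k x
at-++ˡ here      = here
at-++ˡ (there a) = there (at-++ˡ a)

at-++ʳ : ∀ {A : Set} (xs : List A) {ys : List A} {k y} → At ys k y → At (xs ++ ys) (length xs + k) y
at-++ʳ []       a = a
at-++ʳ (x ∷ xs) a = there (at-++ʳ xs a)

at-map : ∀ {A B : Set} (f : A → B) {xs : List A} {k x} → At xs k x → At (map f xs) k (f x)
at-map f here      = here
at-map f (there a) = there (at-map f a)

at-product : ∀ {A B : Set} {xs : List A} {ys : List B} {i j x y} → At xs i x → At ys j y →
             At (cartesianProduct xs ys) (i * length ys + j) (x , y)
at-product {x = x} here b = at-++ˡ (at-map (x ,_) b)
at-product {xs = _ ∷ xs} {ys} {suc i} {j} {x′} {y} (there {x = x} a) b = subst (λ k → At (cartesianProduct (x ∷ xs) ys) k (x′ , y)) (sym (ℕ.+-assoc (length ys) (i * length ys) j))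
  (subst (λ l → At (cartesianProduct (x ∷ xs) ys) (l + (i * length ys + j)) (x′ , y)) (List.length-map (x ,_) ys) (at-++ʳ (map (x ,_) ys) (at-product a b)))

at-applyUpTo : ∀ {A : Set} (f : ℕ → A) {n i} → i < n → At (List.applyUpTo f n) i (f i)
at-applyUpTo f {suc n} {zero}  _         = here
at-applyUpTo f {suc n} {suc i} (s≤s i<n) = there (at-applyUpTo (f ∘ suc) i<n)

at-< : ∀ {A : Set} {xs : List A} {k x} → At xs k x → k < length xs
at-< here      = s≤s z≤n
at-< (there a) = s≤s (at-< a)

at-lookup : ∀ {A : Set} {xs : List A} {k x} → At xs k x → (k< : k < length xs) → List.lookup xs (fromℕ< k<) ≡ x
at-lookup here      (s≤s _)  = refl
at-lookup (there a) (s≤s k<) = at-lookup a k<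

-- The composition into minimum cuts

pairLabels : ℕ → List (ℕ × ℕ)
pairLabels n = cartesianProduct (upTo n) (upTo n)

blockLabels : ℕ → List (ℕ × ℕ × ℕ)
blockLabels n = cartesianProduct (upTo 4) (pairLabels n)

length-blockLabels : ∀ n → length (blockLabels n) ≡ 4 * (n * n)
length-blockLabels n = trans (length-product (upTo 4) (pairLabels n)) (cong (4 *_)
  (trans (length-product (upTo n) (upTo n)) (cong₂ _*_ (List.length-upTo n) (List.length-upTo n))))

length-cutLabels : ∀ t n → suc t * (4 * (n * n)) ≡ length (cutLabels t n)
length-cutLabels t n = sym (trans (length-product (upTo (suc t)) (blockLabels n))
  (cong₂ _*_ (List.length-upTo (suc t)) (length-blockLabels n)))

-- The encoding names a terminal by its index. Each block index contributes four kinds of `n * n`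
-- labels, and the joint is the first of them.
at-joint : ∀ t n → 0 < n → ∀ i → i ≤ t → At (cutLabels t n) (i * (4 * (n * n))) (joint i)
at-joint t n@(suc _) _ i i≤t = subst (λ k → At (cutLabels t n) k (joint i))
  (trans (ℕ.+-identityʳ (i * length (blockLabels n))) (cong (i *_) (length-blockLabels n)))
  (at-product {xs = upTo (suc t)} {ys = blockLabels n} (at-applyUpTo id (s≤s i≤t)) here)

cutWord : ℕ → ℕ → (ℕ → ℕ → ℕ → Bool) → Word
cutWord t n B = unary 0 ++ false ∷ unary (t * (4 * (n * n))) ++ false ∷ graphWord (both (arrow t B)) (cutLabels t n)

cutCode : Word → Word
cutCode w = cutWord (wordCount w) (side w) (blockArc w)

both-sym : ∀ {L : Set} (A : L → L → Bool) x y → both A x y ≡ both A y x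
both-sym A x y = Bool.∨-comm (A x y) (A y x)

terminals-just : ∀ G a b (a< : a < Graph.order G) (b< : b < Graph.order G) → a ≢ b →
                 ∃ λ s≢t → terminals G a b ≡ just (fromℕ< a< , fromℕ< b< , s≢t)
terminals-just G a b a< b< a≢b with a ℕ.<? Graph.order G | b ℕ.<? Graph.order G
... | no a≮  | _      = contradiction a< a≮
... | yes _  | no b≮  = contradiction b< b≮
... | yes a<′ | yes b<′ with fromℕ< a<′ Fin.≟ fromℕ< b<′
...   | yes eq = contradiction (Fin.fromℕ<-injective _ _ a<′ b<′ eq) a≢b
...   | no s≢t = s≢t , refl

readGraph,s,t-unary : ∀ a b w G → readGraph w ≡ just G → (a< : a < Graph.order G) (b< : b < Graph.order G) → a ≢ b →
  ∃ λ s≢t → readGraph,s,t (unary a ++ false ∷ unary b ++ false ∷ w) ≡ just (G , fromℕ< a< , fromℕ< b< , s≢t)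
readGraph,s,t-unary a b w G eq a< b< a≢b = found (terminals-just G a b a< b< a≢b)
  where
  found : (∃ λ s≢t → terminals G a b ≡ just (fromℕ< a< , fromℕ< b< , s≢t)) →
          ∃ λ s≢t → readGraph,s,t (unary a ++ false ∷ unary b ++ false ∷ w) ≡ just (G , fromℕ< a< , fromℕ< b< , s≢t)
  found (s≢t , eq′) = s≢t , trans
    (cong (_>>= λ (a , w₁) → readℕ w₁ >>= λ (b , w₂) → readGraph w₂ >>= λ G → terminals G a b >>= λ st → just (G , st)) (readℕ-unary a _))
    (trans (cong (_>>= λ (b , w₂) → readGraph w₂ >>= λ G → terminals G a b >>= λ st → just (G , st)) (readℕ-unary b w))
    (trans (cong (_>>= λ G → terminals G a b >>= λ st → just (G , st)) eq) (cong (_>>= λ st → just (G , st)) eq′)))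

record LFun {n} (l : Env n → Label) : Set₁ where
  constructor ⟨_,_,_,_⟩
  field
    block : Fun (proj₁ ∘ l)
    kind  : Fun (proj₁ ∘ proj₂ ∘ l)
    left  : Fun (proj₁ ∘ proj₂ ∘ proj₂ ∘ l)
    right : Fun (proj₂ ∘ proj₂ ∘ proj₂ ∘ l)

up₄ : Env (4 + n) → Env n
up₄ ρ = proj₁ (proj₁ (proj₁ (proj₁ ρ)))

label₀ : Env (4 + n) → Label
label₀ ρ = proj₂ (proj₁ (proj₁ (proj₁ ρ))) , proj₂ (proj₁ (proj₁ ρ)) , proj₂ (proj₁ ρ) , proj₂ ρ

label₀ᶜ : LFun {4 + n} label₀
label₀ᶜ = ⟨ v₃ , v₂ , v₁ , v₀ ⟩

wkˡ : ∀ {l : Env n → Label} → LFun l → LFun {1 + n} (l ∘ proj₁)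
wkˡ ⟨ i , κ , u , v ⟩ = ⟨ wkᶜ i , wkᶜ κ , wkᶜ u , wkᶜ v ⟩

wk₄ : ∀ {l : Env n → Label} → LFun l → LFun {4 + n} (l ∘ up₄)
wk₄ = wkˡ ∘ wkˡ ∘ wkˡ ∘ wkˡ

arrowᶜ : ∀ {x y : Env n → Label} → LFun x → LFun y → BFun (λ ρ → arrow (wordCount (word first ρ)) (blockArc (word first ρ)) (x ρ) (y ρ))
arrowᶜ ⟨ i , κ , u , v ⟩ ⟨ i′ , κ′ , u′ , v′ ⟩ = (i <ᶜ wordCountᶜ) ∧ᶜ
  ( (κ ≡ᶜ litᶜ 0) ∧ᶜ (κ′ ≡ᶜ litᶜ 1) ∧ᶜ (i′ ≡ᶜ i) ∧ᶜ (u ≡ᶜ litᶜ 0) ∧ᶜ (v ≡ᶜ litᶜ 0)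
  ∨ᶜ (κ ≡ᶜ litᶜ 1) ∧ᶜ (κ′ ≡ᶜ litᶜ 2) ∧ᶜ (i′ ≡ᶜ i) ∧ᶜ (u′ ≡ᶜ u) ∧ᶜ (v′ ≡ᶜ v)
  ∨ᶜ (κ ≡ᶜ litᶜ 2) ∧ᶜ (κ′ ≡ᶜ litᶜ 0) ∧ᶜ (i′ ≡ᶜ litᶜ 1 ⊕ᶜ i) ∧ᶜ (u′ ≡ᶜ litᶜ 0) ∧ᶜ (v′ ≡ᶜ litᶜ 0)
  ∨ᶜ (κ ≡ᶜ litᶜ 1) ∧ᶜ (κ′ ≡ᶜ litᶜ 3) ∧ᶜ (i′ ≡ᶜ i) ∧ᶜ (u′ ≡ᶜ v) ∧ᶜ (v′ ≡ᶜ litᶜ 0)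
  ∨ᶜ (κ ≡ᶜ litᶜ 2) ∧ᶜ (κ′ ≡ᶜ litᶜ 3) ∧ᶜ (i′ ≡ᶜ i) ∧ᶜ (v′ ≡ᶜ litᶜ 0) ∧ᶜ ((u′ ≡ᶜ u) ∧ᶜ blockArcᶜ i u v ∨ᶜ (u′ ≡ᶜ v) ∧ᶜ notᶜ (blockArcᶜ i u v)))

cutSizeᶜ : Fun {n} (λ ρ → side (word first ρ) * side (word first ρ))
cutSizeᶜ = sideᶜ ⊗ᶜ sideᶜ

loop-cutLabels : ∀ {C : Set} t n (g : Label → List C) →
                 concatMap g (cutLabels t n) ≡ loop (suc t) (λ i → loop 4 λ κ → loop n λ u → loop n λ v → g (i , κ , u , v))
loop-cutLabels t n g = trans (loop-cartesian (suc t) g (blockLabels n)) (loop-≗ (suc t) λ i →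
  trans (loop-cartesian 4 (λ l → g (i , l)) (pairLabels n)) (loop-≗ 4 λ κ →
  trans (loop-cartesian n (λ l → g (i , κ , l)) (upTo n)) (loop-≗ n λ u → sym (loop≡concatMap n λ v → g (i , κ , u , v)))))

labelsᶜ : ∀ {g : Env n → Label → Word} → Gen {4 + n} (λ ρ → g (up₄ ρ) (label₀ ρ)) →
          Gen (λ ρ → concatMap (g ρ) (cutLabels (wordCount (word first ρ)) (side (word first ρ))))
labelsᶜ {g = g} G = extGen (λ ρ → sym (loop-cutLabels (wordCount (word first ρ)) (side (word first ρ)) (g ρ)))
  (loopᶜ (litᶜ 1 ⊕ᶜ wordCountᶜ) (loopᶜ (litᶜ 4) (loopᶜ sideᶜ (loopᶜ sideᶜ G))))

labelCountᶜ : Fun {n} (λ ρ → length (cutLabels (wordCount (word first ρ)) (side (word first ρ))))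
labelCountᶜ = ext (λ ρ → length-cutLabels (wordCount (word first ρ)) (side (word first ρ))) ((litᶜ 1 ⊕ᶜ wordCountᶜ) ⊗ᶜ (litᶜ 4 ⊗ᶜ cutSizeᶜ))

cutCodeᶜ : Gen {0} (cutCode ∘ proj₁)
cutCodeᶜ = emitᶜ (boolᶜ false) ++ᶜ (unaryᶜ (wordCountᶜ ⊗ᶜ (litᶜ 4 ⊗ᶜ cutSizeᶜ)) ++ᶜ (emitᶜ (boolᶜ false) ++ᶜ graphWordᶜ
    {A = λ ρ → both (arrow (wordCount (proj₁ ρ)) (blockArc (proj₁ ρ)))} {xs = λ ρ → cutLabels (wordCount (proj₁ ρ)) (side (proj₁ ρ))}
    labelCountᶜ
    (labelsᶜ (labelsᶜ (emitᶜ (arrowᶜ (wk₄ label₀ᶜ) label₀ᶜ ∨ᶜ arrowᶜ label₀ᶜ (wk₄ label₀ᶜ)))))))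

module CutValue (t′ n : ℕ) (0<n : 0 < n) (B : ℕ → ℕ → ℕ → Bool) (labels : List Label) (labels-unique : Unique labels)
  (valid⇒∈ : ∀ {l} → Cuts.Valid t′ n 0<n B l → l ∈ₗ labels) (∈⇒valid : ∀ {l} → l ∈ₗ labels → Cuts.Valid t′ n 0<n B l)
  (b : ℕ) (0≢b : 0 ≢ b) (sAt : At labels 0 (joint 0)) (tAt : At labels b (joint (suc t′))) where
  private
    A : Label → Label → Bool
    A = both (arrow (suc t′) B)
    word′ : Word
    word′ = unary 0 ++ false ∷ unary b ++ false ∷ graphWord A labels
    total : ℕ
    total = sum (map (λ i → closedSets n (B (toℕ i))) (allFin (suc t′)))

  cuts-value : #k-Min-st-Cut (word′ , n * n) ≡ total
  cuts-value = value (readGraph-graphWord A (both-sym (arrow (suc t′) B)) (Arrows.both-irrefl (suc t′) B) labels)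
    where
    value : (∃ λ (adj : Fin (length labels) → Fin (length labels) → Bool) → ∃₂ λ s i →
               readGraph (graphWord A labels) ≡ just (record { order = length labels ; adj = adj ; symm = s ; irrefl = i }) ×
               (∀ u v → adj u v ≡ A (List.lookup labels u) (List.lookup labels v))) →
            #k-Min-st-Cut (word′ , n * n) ≡ total
    value (adj , s , i , eq , adj≡) = finish (readGraph,s,t-unary 0 b (graphWord A labels) G eq (at-< sAt) (at-< tAt) 0≢b)
      where
      G : Graph
      G = CutGraph.G t′ n 0<n B labels labels-unique valid⇒∈ ∈⇒valid adj s i adj≡
      finish : (∃ λ s≢t → readGraph,s,t word′ ≡ just (G , fromℕ< (at-< sAt) , fromℕ< (at-< tAt) , s≢t)) →
               #k-Min-st-Cut (word′ , n * n) ≡ total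
      finish (s≢t , eq′) = trans (#k-Min-st-Cut≡ word′ (n * n) eq′)
        (CutGraph.cuts-count t′ n 0<n B labels labels-unique valid⇒∈ ∈⇒valid adj s i adj≡
          (fromℕ< (at-< sAt)) (fromℕ< (at-< tAt)) (at-lookup sAt (at-< sAt)) (at-lookup tAt (at-< tAt)) s≢t)

cutWord-value : ∀ t′ n B → 0 < n → #k-Min-st-Cut (cutWord (suc t′) n B , n * n) ≡ sum (map (λ i → closedSets n (B (toℕ i))) (allFin (suc t′)))
cutWord-value t′ n B 0<n = CutValue.cuts-value t′ n 0<n B (cutLabels (suc t′) n) labels-unique valid⇒∈ ∈⇒valid
  (suc t′ * (4 * (n * n))) (ℕ.<⇒≢ (ℕ.*-mono-≤ {1} {suc t′} (s≤s z≤n) (ℕ.*-mono-≤ {1} {4} (s≤s z≤n) (ℕ.*-mono-≤ 0<n 0<n))))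
  (at-joint (suc t′) n 0<n 0 z≤n) (at-joint (suc t′) n 0<n (suc t′) ℕ.≤-refl)
  where open Cuts t′ n 0<n B

cut-small : ∀ x xs → All (λ y → length y ≡ length x) (x ∷ xs) → side (encodeList (x ∷ xs)) * side (encodeList (x ∷ xs)) ≤ length x * length x
cut-small x xs same = ℕ.≤-trans (ℕ.≤-reflexive (cong (λ n → n * n) (side≡ same))) (ℕ.≤-trans (rt²≤ (length x)) (n≤n² (length x)))

cut-value : ∀ x xs → All (λ y → length y ≡ length x) (x ∷ xs) → 0 < length x →
            #k-Min-st-Cut (cutCode (encodeList (x ∷ xs)) , side (encodeList (x ∷ xs)) * side (encodeList (x ∷ xs))) ≡ sum (map #Closed (x ∷ xs))
cut-value x xs same x>0 = trans
  (cong₂ (λ t n → #k-Min-st-Cut (cutWord t n (blockArc (encodeList (x ∷ xs))) , n * n)) (wordCount≡ same) (side≡ same))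
  (trans (cutWord-value (length xs) (rt (length x)) (blockArc (encodeList (x ∷ xs))) (rt>0 (length x) x>0))
         (blocks-sum same x>0))

cut-composition : SUMCrossComposition #Closed #k-Min-st-Cut
cut-composition = Composition.composition #k-Min-st-Cut cutCodeᶜ cutSizeᶜ
  -- The first terminal is then vertex 1, but zeros encode at most the empty graph, so reading fails
  -- for every number of empty words.
  (λ { zero → refl ; (suc zero) → refl ; (suc (suc zero)) → refl ; (suc (suc (suc t))) → refl }) cut-small cut-value

-- Odd closed walks

¬2∣-+ : ∀ m n → ¬ (2 ∣ m + n) → ¬ (2 ∣ m) ⊎ ¬ (2 ∣ n)
¬2∣-+ m n odd with 2 ∣? m | 2 ∣? n
... | no ¬m | _     = inj₁ ¬m
... | yes _ | no ¬n = inj₂ ¬n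
... | yes m∣ | yes n∣ = contradiction (∣m∣n⇒∣m+n m∣ n∣) odd

module Walks {V : Set} (_≟_ : ∀ (u v : V) → Dec (u ≡ v)) (E : V → V → Set) where

  -- The list contains all vertices but the last one.
  data Walk : V → List V → V → Set where
    []  : ∀ {v} → Walk v [] v
    _∷_ : ∀ {u w v xs} → E u w → Walk w xs v → Walk u (u ∷ xs) v

  split : ∀ {u v} xs {a ys} → Walk u (xs ++ a ∷ ys) v → Walk u xs a × Walk a (a ∷ ys) v
  split []       (e ∷ p) = [] , e ∷ p
  split (x ∷ xs) (e ∷ p) = let q , r = split xs p in e ∷ q , r

  append : ∀ {u v w xs ys} → Walk u xs v → Walk v ys w → Walk u (xs ++ ys) w
  append []      q = q
  append (e ∷ p) q = e ∷ append p q

  unique-or-repeated : ∀ xs → Unique xs ⊎ ∃ λ (a : V) → ∃₂ λ ys zs → ∃ λ ws → xs ≡ ys ++ a ∷ zs ++ a ∷ ws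
  unique-or-repeated []       = inj₁ []
  unique-or-repeated (x ∷ xs) with Any.any? (x ≟_) xs | unique-or-repeated xs
  ... | yes x∈ | _ = let zs , ws , eq = List.∈-∃++ x∈ in inj₂ (x , [] , zs , ws , cong (x ∷_) eq)
  ... | no x∉ | inj₁ u = inj₁ (All.¬Any⇒All¬ xs x∉ ∷ u)
  ... | no x∉ | inj₂ (a , ys , zs , ws , eq) = inj₂ (a , x ∷ ys , zs , ws , cong (x ∷_) eq)

  OddClosedWalk OddCircuit : Set
  OddClosedWalk = ∃₂ λ u xs → ¬ (2 ∣ length xs) × Walk u xs u
  OddCircuit = ∃₂ λ u xs → ¬ (2 ∣ length xs) × Walk u xs u × Unique xs

  -- A repeated vertex splits a closed walk into two shorter closed walks whose lengths add up, so
  -- one of them is odd again.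
  shorten : ∀ m u xs → length xs ≤ m → ¬ (2 ∣ length xs) → Walk u xs u → OddCircuit
  shorten zero    u [] _ odd p = contradiction (divides 0 refl) odd
  shorten (suc m) u xs xs≤ odd p = from (unique-or-repeated xs)
    where
    from : Unique xs ⊎ (∃ λ (a : V) → ∃₂ λ ys zs → ∃ λ ws → xs ≡ ys ++ a ∷ zs ++ a ∷ ws) → OddCircuit
    from (inj₁ unique) = u , xs , odd , p , unique
    from (inj₂ (a , ys , zs , ws , refl)) = pick (¬2∣-+ (length (a ∷ zs)) (length (ys ++ a ∷ ws)) (subst (λ k → ¬ (2 ∣ k)) lengths odd))
      where
      front : Walk u ys a × Walk a (a ∷ zs ++ a ∷ ws) u
      front = split ys p
      back : Walk a (a ∷ zs) a × Walk a (a ∷ ws) u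
      back = split (a ∷ zs) (proj₂ front)
      lengths : length (ys ++ a ∷ zs ++ a ∷ ws) ≡ length (a ∷ zs) + length (ys ++ a ∷ ws)
      lengths = trans (List.length-++ ys) (trans (cong (λ k → length ys + suc k) (List.length-++ zs))
        (trans (ring (length ys) (length zs) (length (a ∷ ws))) (cong (suc (length zs) +_) (sym (List.length-++ ys)))))
        where
        ring : ∀ a b c → a + suc (b + c) ≡ suc b + (a + c)
        ring = solve-∀
      small : length (a ∷ zs) + length (ys ++ a ∷ ws) ≤ suc m
      small = subst (_≤ suc m) lengths xs≤
      pick : ¬ (2 ∣ length (a ∷ zs)) ⊎ ¬ (2 ∣ length (ys ++ a ∷ ws)) → OddCircuit
      pick (inj₁ odd′) = shorten m a (a ∷ zs) (ℕ.s≤s⁻¹ (ℕ.<-≤-trans (ℕ.m<m+n _ (subst (0 <_) (sym (List.length-++ ys))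
        (ℕ.<-≤-trans (s≤s z≤n) (ℕ.m≤n+m (length (a ∷ ws)) (length ys))))) small)) odd′ (proj₁ back)
      pick (inj₂ odd′) = shorten m u (ys ++ a ∷ ws) (ℕ.s≤s⁻¹ (ℕ.≤-trans (s≤s (ℕ.m≤n+m _ (length zs))) small)) odd′
        (append (proj₁ front) (proj₂ back))

  circuit : OddClosedWalk → OddCircuit
  circuit (u , xs , odd , p) = shorten (length xs) u xs ℕ.≤-refl odd p

  steps : ∀ {u v xs} → Walk u (u ∷ xs) v →
          (∀ (i : Fin (length xs)) → E (List.lookup (u ∷ xs) (inject₁ i)) (List.lookup (u ∷ xs) (suc i))) ×
          E (List.lookup (u ∷ xs) (fromℕ (length xs))) v
  steps (e ∷ []) = (λ ()) , e
  steps (e ∷ p@(_ ∷ _)) = let each , last = steps p in (λ { zero → e ; (suc i) → each i }) , last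

module Odd (G : Graph) (X : Graph.VertexSet G) where
  open Graph G
  open OddCycle G

  Alive : Vertex → Vertex → Set
  Alive u v = Adj u v × u ∉ X × v ∉ X

  open Walks Fin._≟_ Alive public

  -- Lengths 0 and 2 are even and length 1 would be a loop, so the circuit is long enough to be a
  -- cycle.
  circuit⇒cycle : OddCircuit → ∃₂ λ m (c : Vec Vertex (suc m)) → IsOddCycleAvoiding X c
  circuit⇒cycle (_ , [] , odd , _) = contradiction (divides 0 refl) odd
  circuit⇒cycle (_ , x ∷ [] , odd , (e ∷ []) , _) = ⊥-elim (subst T (irrefl _) (proj₁ e))
  circuit⇒cycle (_ , x ∷ y ∷ [] , odd , _) = contradiction (divides 1 refl) odd
  circuit⇒cycle (u , xs@(x ∷ xs′@(_ ∷ _ ∷ _)) , odd , p@(_ ∷ _) , unique) = length xs′ , Vec.fromList xs , odd , isCycle (s≤s (s≤s (s≤s z≤n)))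
      (λ {i} {j} eq → lookup-injective unique (trans (sym (at i)) (trans eq (at j))))
      (λ i → subst₂ Adj (sym (at (inject₁ i))) (sym (at (suc i))) (proj₁ (proj₁ (steps p) i)))
      (subst (λ v → Adj v x) (sym (at (fromℕ (length xs′)))) (proj₁ (proj₂ (steps p)))) ,
      λ i → subst (_∉ X) (sym (at i)) (alive i)
    where
    at : ∀ i → lookup (Vec.fromList xs) i ≡ List.lookup xs i
    at = lookup-fromList (λ _ _ → true) [] xs
    alive : ∀ i → List.lookup xs i ∉ X
    alive zero    = proj₂ (proj₂ (proj₂ (steps p)))
    alive (suc i) = proj₂ (proj₂ (proj₁ (steps p) i))

  transversal⇒no-odd-walk : IsTransversal X → ¬ OddClosedWalk
  transversal⇒no-odd-walk tr w = tr (circuit⇒cycle (circuit w))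

  bipartite⇒transversal : (col : Vertex → Bool) → (∀ {u v} → Alive u v → col u ≡ not (col v)) → IsTransversal X
  bipartite⇒transversal col proper (m , c , odd , isCycle _ _ step closing , avoids) = odd (even m (alternate m c step avoids)
      (proper (closing , avoids (fromℕ m) , avoids zero)))
    where
    parity : ℕ → Bool → Bool
    parity zero    b = b
    parity (suc k) b = not (parity k b)
    alternate : ∀ m (c : Vec Vertex (suc m)) → (∀ (i : Fin m) → Adj (lookup c (inject₁ i)) (lookup c (suc i))) → (∀ i → lookup c i ∉ X) →
                col (lookup c zero) ≡ parity m (col (lookup c (fromℕ m)))
    alternate zero    c       step avoids = refl
    alternate (suc m) (x ∷ c) step avoids = trans (proper (step zero , avoids zero , avoids (suc zero)))
      (cong not (alternate m c (step ∘ suc) (avoids ∘ suc)))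
    even : ∀ m {a b} → a ≡ parity m b → b ≡ not a → 2 ∣ suc m
    even zero          {false} refl ()
    even zero          {true}  refl ()
    even (suc zero)    _ _ = divides 1 refl
    even (suc (suc m)) {a} {b} p q = ∣m∣n⇒∣m+n (divides 1 refl) (even m (trans p (Bool.not-involutive (parity m b))) q)

-- Odd cycle transversals
--
-- Every edge of G is subdivided and every original vertex is replaced by more than K
-- copies, so that a set of at most K vertices can only be useful on the subdivision vertices;
-- all copies of s are joined to all copies of t.  The odd closed walks then correspond to
-- the paths from s to t.

abstract
  transversals : Graph → ℕ → ℕ
  transversals G k = count λ S → OddCycle.IsTransversal? G S ×-dec (∣ S ∣ ℕ.≤? k)

  transversals≡ : ∀ G k → transversals G k ≡ count λ S → OddCycle.IsTransversal? G S ×-dec (∣ S ∣ ℕ.≤? k)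
  transversals≡ G k = refl

#k-Odd-Cycle-Transversal≡ : ∀ w {G k} → readGraph,k w ≡ just (G , k) → #k-Odd-Cycle-Transversal (w , k) ≡ transversals G k
#k-Odd-Cycle-Transversal≡ w {G} {k} eq = trans
  (onInput-just readGraph,k (λ (G , k) κ → if does (κ ℕ.≟ k) then (count λ S → OddCycle.IsTransversal? G S ×-dec (∣ S ∣ ℕ.≤? k)) else 0) w k eq)
  (trans (cong (λ b → if b then (count λ S → OddCycle.IsTransversal? G S ×-dec (∣ S ∣ ℕ.≤? k)) else 0) (dec-true (k ℕ.≟ k) refl))
         (sym (transversals≡ G k)))

-- The extended graph up to orientation, described without labels. A subdivision vertex is adjacent
-- to all copies of both ends of its edge, so one vertex cuts the edge in every copy of the graph.
data TLink (G : Graph) (s t : Graph.Vertex G) {V′ : Set} (copy : Graph.Vertex G → Graph.Vertex G → V′) (sub : Graph.Edge G → V′) : V′ → V′ → Set where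
  spoke : ∀ {u v y e} → Graph.Joins G e u v → TLink G s t copy sub (copy u y) (sub e)
  chord : ∀ {y y′} → TLink G s t copy sub (copy s y) (copy t y′)

-- The copies are indexed by the vertices of `G` itself, which supplies more than `K` of them
-- without a new index set.
module Transversals (G : Graph) (s t : Graph.Vertex G) (s≢t : s ≢ t) (K : ℕ) (K<order : K < Graph.order G)
  (K≤ : ∀ C → MinCut.IsCut G s t C → K ≤ ∣ C ∣) (G′ : Graph) (copy : Graph.Vertex G → Graph.Vertex G → Graph.Vertex G′)
  (sub : Graph.Edge G → Graph.Vertex G′) (origin : Graph.Vertex G′ → Bool × Graph.Vertex G) where

  open Graph G using (Vertex; Edge; EdgeSet; Joins; Joins?; order)
  open Graph G′ using () renaming (Vertex to Vertex′; Adj to Adj′)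
  open Edges G
  open MinCut G s t

  private
    Link : Vertex′ → Vertex′ → Set
    Link = TLink G s t copy sub

  module _ (copy-injective : ∀ {x x′ y y′} → copy x y ≡ copy x′ y′ → y ≡ y′) (sub-injective : ∀ {e f} → sub e ≡ sub f → e ≡ f)
    (copy-origin : ∀ x y → origin (copy x y) ≡ (false , x))
    (sub-origin : ∀ e → proj₁ (origin (sub e)) ≡ true × ∃ λ v → Joins e (proj₂ (origin (sub e))) v)
    (link : ∀ {v w} → Adj′ v w → Link v w ⊎ Link w v) (unlink : ∀ {v w} → Link v w → Adj′ v w) where

    private
      Joins-sym : ∀ {e u v} → Joins e u v → Joins e v u
      Joins-sym (inj₁ p) = inj₂ p
      Joins-sym (inj₂ p) = inj₁ p

      onto-sub : EdgeSet → Vertex′ → Bool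
      onto-sub C w = does (any? λ e → (e ∈? C) ×-dec (sub e Fin.≟ w))

    hits : EdgeSet → Graph.VertexSet G′
    hits C = tabulate (onto-sub C)

    hits⁺ : ∀ {C e} → e ∈ C → sub e ∈ hits C
    hits⁺ {C} {e} e∈ = ∈-tabulate⁺ {p = onto-sub C} (≡⇒T (dec-true (any? λ f → (f ∈? C) ×-dec (sub f Fin.≟ sub e)) (e , e∈ , refl)))

    hits⁻ : ∀ {C w} → w ∈ hits C → ∃ λ e → e ∈ C × sub e ≡ w
    hits⁻ {C} {w} w∈ = from (any? λ e → (e ∈? C) ×-dec (sub e Fin.≟ w)) (∈-tabulate⁻ {p = onto-sub C} w∈)
      where
      from : (d : Dec (∃ λ e → e ∈ C × sub e ≡ w)) → T (does d) → ∃ λ e → e ∈ C × sub e ≡ w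
      from (yes p) _ = p

    ∣hits∣≤ : ∀ C → ∣ hits C ∣ ≤ ∣ C ∣
    ∣hits∣≤ C = ℕ.≤-trans (covered⇒≤ (sub ∘ List.lookup (elements C)) covered) (ℕ.≤-reflexive (length-elements C))
      where
      covered : ∀ {w} → w ∈ hits C → ∃ λ i → sub (List.lookup (elements C) i) ≡ w
      covered w∈ = let e , e∈ , eq = hits⁻ w∈ ; i , i≡ = label-index (∈-elements⁺ e∈) in i , trans (cong sub i≡) eq

    hits-injective : ∀ {C C′} → hits C ≡ hits C′ → C ≡ C′
    hits-injective {C} {C′} eq = trans (sym (Vec.tabulate∘lookup C)) (trans (Vec.tabulate-cong same) (Vec.tabulate∘lookup C′))
      where
      ⊆′ : ∀ {C C′ e} → hits C ≡ hits C′ → e ∈ C → e ∈ C′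
      ⊆′ {C} {C′} {e} eq e∈ = from (hits⁻ (subst (sub e ∈_) eq (hits⁺ e∈)))
        where
        from : (∃ λ f → f ∈ C′ × sub f ≡ sub e) → e ∈ C′
        from (f , f∈ , f≡) = subst (_∈ C′) (sub-injective f≡) f∈
      same : ∀ e → lookup C e ≡ lookup C′ e
      same e = ≡-by-T (∈⇒T ∘ ⊆′ eq ∘ T⇒∈) (∈⇒T ∘ ⊆′ (sym eq) ∘ T⇒∈)

    module _ (C : EdgeSet) (cut : IsCut C) where

      private
        reach? : ∀ u → Dec (Star (Survives C) s u)
        reach? = Reachability.reachable? (λ u v → any? λ e → ¬? (e ∈? C) ×-dec Joins? e u v) s

        reached : Vertex → Bool
        reached u = does (reach? u)

        -- Copies are coloured by the side of the cut and subdivision vertices oppositely to an end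
        -- of their edge. For an uncut edge both ends agree, and a chord is properly coloured
        -- because the cut separates `s` from `t`.
        twist : Bool × Vertex → Bool
        twist (false , u) = reached u
        twist (true , u)  = not (reached u)

        colour : Vertex′ → Bool
        colour = twist ∘ origin

        does-cong : ∀ {P Q : Set} (p? : Dec P) (q? : Dec Q) → (P → Q) → (Q → P) → does p? ≡ does q?
        does-cong (yes p) q? to from = sym (dec-true q? (to p))
        does-cong (no ¬p) q? to from = sym (dec-false q? (¬p ∘ from))

        reached-edge : ∀ {e u v} → e ∉ C → Joins e u v → reached u ≡ reached v
        reached-edge {e} e∉ j = does-cong (reach? _) (reach? _) (λ p → p ◅◅ ((e , e∉ , j) ◅ ε)) (λ p → p ◅◅ ((e , e∉ , Joins-sym j) ◅ ε))

        reached-incident : ∀ {e u v u′ v′} → e ∉ C → Joins e u v → Joins e u′ v′ → reached u ≡ reached u′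
        reached-incident e∉ (inj₁ p) (inj₁ q) = cong (reached ∘ proj₁) (trans (sym p) q)
        reached-incident e∉ (inj₂ p) (inj₂ q) = cong (reached ∘ proj₂) (trans (sym p) q)
        reached-incident e∉ (inj₁ p) (inj₂ q) = trans (reached-edge e∉ (inj₁ p)) (cong (reached ∘ proj₂) (trans (sym p) q))
        reached-incident e∉ (inj₂ p) (inj₁ q) = trans (reached-edge e∉ (inj₂ p)) (cong (reached ∘ proj₁) (trans (sym p) q))

        twist-true : ∀ {p} → proj₁ p ≡ true → twist p ≡ not (reached (proj₂ p))
        twist-true {true , _} refl = refl

        link-colour : ∀ {v w} → Link v w → w ∉ hits C → colour v ≡ not (colour w)
        link-colour (spoke {u} {v} {y} {e} j) w∉ = trans (cong twist (copy-origin u y)) (trans (sym (Bool.not-involutive (reached u)))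
          (cong not (trans (cong not (reached-incident (w∉ ∘ hits⁺) j (proj₂ (proj₂ (sub-origin e))))) (sym (twist-true (proj₁ (sub-origin e)))))))
        link-colour (chord {y} {y′}) _ = trans (cong twist (copy-origin s y)) (trans (dec-true (reach? s) ε)
          (cong not (sym (trans (cong twist (copy-origin t y′)) (dec-false (reach? t) cut)))))

      hits-transversal : OddCycle.IsTransversal G′ (hits C)
      hits-transversal = Odd.bipartite⇒transversal G′ (hits C) colour λ (vw , v∉ , w∉) → proper (link vw) v∉ w∉
        where
        proper : ∀ {v w} → Link v w ⊎ Link w v → v ∉ hits C → w ∉ hits C → colour v ≡ not (colour w)
        proper (inj₁ l) v∉ w∉ = link-colour l w∉
        proper (inj₂ l) v∉ w∉ = trans (sym (Bool.not-involutive _)) (cong not (sym (link-colour l v∉)))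

    module _ (X : Graph.VertexSet G′) (transversal : OddCycle.IsTransversal G′ X) (X≤K : ∣ X ∣ ≤ K) where
      open Odd G′ X

      private
        untouched? : ∀ y → Dec (∀ x → copy x y ∉ X)
        untouched? y = all? λ x → ¬? (copy x y ∈? X)

        -- Different layers of copies are disjoint and there are more than `K` of them, so `X`
        -- misses a whole layer.
        untouched : ∃ λ y → ∀ x → copy x y ∉ X
        untouched = from (any? untouched?)
          where
          from : Dec (∃ λ y → ∀ x → copy x y ∉ X) → ∃ λ y → ∀ x → copy x y ∉ X
          from (yes found) = found
          from (no none) = contradiction (ℕ.≤-trans (injected⇒≤ (λ y → copy (proj₁ (hit y)) y) copy-injective (proj₂ ∘ hit)) X≤K) (ℕ.<⇒≱ K<order)
            where
            hit : ∀ y → ∃ λ x → copy x y ∈ X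
            hit y = pick (any? λ x → copy x y ∈? X)
              where
              pick : Dec (∃ λ x → copy x y ∈ X) → ∃ λ x → copy x y ∈ X
              pick (yes p) = p
              pick (no ¬p) = contradiction (y , λ x x∈ → ¬p (x , x∈)) none

        y : Vertex
        y = proj₁ untouched

        C : EdgeSet
        C = tabulate λ e → does (sub e ∈? X)

        C⁺ : ∀ {e} → sub e ∈ X → e ∈ C
        C⁺ {e} x∈ = ∈-tabulate⁺ {p = λ e → does (sub e ∈? X)} (≡⇒T (dec-true (sub e ∈? X) x∈))

        C⁻ : ∀ {e} → e ∈ C → sub e ∈ X
        C⁻ {e} e∈ = from (sub e ∈? X) (∈-tabulate⁻ {p = λ e → does (sub e ∈? X)} e∈)
          where
          from : (d : Dec (sub e ∈ X)) → T (does d) → sub e ∈ X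
          from (yes p) _ = p

        -- In the untouched layer every surviving edge becomes two steps. From `s` to `t` this is an
        -- even walk, and the chord closes it to an odd one.
        lift : ∀ {u v} → Star (Survives C) u v → ∃ λ xs → 2 ∣ length xs × Walk (copy u y) xs (copy v y)
        lift ε = [] , divides 0 refl , []
        lift {u} ((e , e∉ , j) ◅ p) = let xs , even , q = lift p in copy u y ∷ sub e ∷ xs , ∣m∣n⇒∣m+n (divides 1 refl) even ,
          (unlink (spoke j) , proj₂ untouched u , e∉ ∘ C⁺) ∷
          (Edges.Adj-sym G′ (unlink (spoke (Joins-sym j))) , e∉ ∘ C⁺ , proj₂ untouched _) ∷ q

        cut : IsCut C
        cut path = transversal⇒no-odd-walk transversal (close (lift path))
          where
          close : (∃ λ xs → 2 ∣ length xs × Walk (copy s y) xs (copy t y)) → OddClosedWalk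
          close (xs , even , p) = copy t y , copy t y ∷ xs , (λ odd → even-suc even odd) ,
            ((Edges.Adj-sym G′ (unlink chord) , proj₂ untouched t , proj₂ untouched s) ∷ p)
            where
            even-suc : ∀ {k} → 2 ∣ k → ¬ (2 ∣ suc k)
            even-suc {k} 2∣k 2∣1+k = contradiction (∣m+n∣m⇒∣n (subst (2 ∣_) (ℕ.+-comm 1 k) 2∣1+k) 2∣k) λ { (divides zero ()) ; (divides (suc _) ()) }

        image : Fin (length (elements C)) → Vertex′
        image = sub ∘ List.lookup (elements C)

        image-injective : Injective _≡_ _≡_ image
        image-injective = lookup-injective (elements-unique C) ∘ sub-injective

        image∈ : ∀ i → image i ∈ X
        image∈ i = C⁻ (∈-elements⁻ (List.∈-lookup i))

        ∣X∣≤ : ∣ X ∣ ≤ length (elements C)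
        ∣X∣≤ = ℕ.≤-trans X≤K (ℕ.≤-trans (K≤ C cut) (ℕ.≤-reflexive (sym (length-elements C))))

        ∣C∣≤K : ∣ C ∣ ≤ K
        ∣C∣≤K = ℕ.≤-trans (ℕ.≤-reflexive (sym (length-elements C))) (ℕ.≤-trans (injected⇒≤ image image-injective image∈) X≤K)

        -- The subdivision vertices of `C` lie in `X`, and every cut has at least `K` edges, so they
        -- already fill `X`; in particular `X` contains no copies.
        hits≡ : hits C ≡ X
        hits≡ = trans (Vec.tabulate-cong same) (Vec.tabulate∘lookup X)
          where
          to : ∀ {w} → w ∈ hits C → w ∈ X
          to w∈ = let e , e∈ , eq = hits⁻ w∈ in subst (_∈ X) eq (C⁻ e∈)
          from : ∀ {w} → w ∈ X → w ∈ hits C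
          from w∈ = let i , eq = tight⇒covered image image-injective image∈ ∣X∣≤ w∈ in
            subst (_∈ hits C) eq (hits⁺ (∈-elements⁻ (List.∈-lookup i)))
          same : ∀ w → onto-sub C w ≡ lookup X w
          same w = trans (sym (Vec.lookup∘tabulate (onto-sub C) w)) (≡-by-T (∈⇒T ∘ to ∘ T⇒∈) (∈⇒T ∘ from ∘ T⇒∈))

      transversal-hits : ∃ λ C → (IsMinimumCut C × ∣ C ∣ ≡ K) × hits C ≡ X
      transversal-hits = C , ((cut , λ C′ cut′ → ℕ.≤-trans ∣C∣≤K (K≤ C′ cut′)) , ℕ.≤-antisym ∣C∣≤K (K≤ C cut)) , hits≡

    transversals-count : transversals G′ K ≡ minimumCuts (G , s , t , s≢t) K
    transversals-count = trans (transversals≡ G′ K) (trans (sym (count-≡ (λ C → IsMinimumCut? C ×-dec (∣ C ∣ ℕ.≟ K)) _ hits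
      (λ C ((cut , _) , size) → hits-transversal C cut , ℕ.≤-trans (∣hits∣≤ C) (ℕ.≤-reflexive size))
      (λ _ _ _ _ → hits-injective)
      (λ X (transversal , X≤K) → transversal-hits X transversal X≤K)))
      (sym (minimumCuts≡ G s t s≢t K)))

-- The label (0 , x , y) denotes copy y of the vertex x, and (1 , x , y) the subdivision
-- vertex of the arrow from x to y.
module _ {L : Set} (_≡ˡ_ : L → L → Bool) where

  transversalArrow : (L → L → Bool) → L → L → ℕ × L × L → ℕ × L × L → Bool
  transversalArrow A s t (κ , x , y) (κ′ , x′ , y′) = (κ ≡ᵇ 0) ∧
    ((κ′ ≡ᵇ 1) ∧ A x′ y′ ∧ ((x ≡ˡ x′) ∨ (x ≡ˡ y′)) ∨ (κ′ ≡ᵇ 0) ∧ (x ≡ˡ s) ∧ (x′ ≡ˡ t))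

transversalLabels : ∀ {L : Set} → List L → List (ℕ × L × L)
transversalLabels labels = cartesianProduct (upTo 2) (cartesianProduct labels labels)

module TransversalArrows {L : Set} (_≡ˡ_ : L → L → Bool) (≡ˡ-sound : ∀ x y → T (x ≡ˡ y) → x ≡ y) (≡ˡ-complete : ∀ x → T (x ≡ˡ x))
  (A : L → L → Bool) (s t : L) where

  data TArrow : ℕ × L × L → ℕ × L × L → Set where
    source : ∀ {x y x′} → T (A x x′) → TArrow (0 , x , y) (1 , x , x′)
    target : ∀ {x y x′} → T (A x′ x) → TArrow (0 , x , y) (1 , x′ , x)
    chord  : ∀ {y y′} → TArrow (0 , s , y) (0 , t , y′)

  tArrow-sound : ∀ p q → T (transversalArrow _≡ˡ_ A s t p q) → TArrow p q
  tArrow-sound (κ , x , y) (κ′ , x′ , y′) h = at₀ (≡ᵇ-sound (proj₁ (∧-sound {κ ≡ᵇ 0} h))) (∨-sound (proj₂ (∧-sound {κ ≡ᵇ 0} h)))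
    where
    at₁ : κ ≡ 0 → κ′ ≡ 1 → T (A x′ y′) → T (x ≡ˡ x′) ⊎ T (x ≡ˡ y′) → TArrow (κ , x , y) (κ′ , x′ , y′)
    at₁ refl refl a (inj₁ eq) = subst (λ z → TArrow (0 , z , y) (1 , x′ , y′)) (sym (≡ˡ-sound _ _ eq)) (source a)
    at₁ refl refl a (inj₂ eq) = subst (λ z → TArrow (0 , z , y) (1 , x′ , y′)) (sym (≡ˡ-sound _ _ eq)) (target a)
    at₂ : κ ≡ 0 → κ′ ≡ 0 → T (x ≡ˡ s) → T (x′ ≡ˡ t) → TArrow (κ , x , y) (κ′ , x′ , y′)
    at₂ refl refl p q = subst₂ (λ z z′ → TArrow (0 , z , y) (0 , z′ , y′)) (sym (≡ˡ-sound _ _ p)) (sym (≡ˡ-sound _ _ q)) chord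
    at₀ : κ ≡ 0 → T ((κ′ ≡ᵇ 1) ∧ A x′ y′ ∧ ((x ≡ˡ x′) ∨ (x ≡ˡ y′))) ⊎ T ((κ′ ≡ᵇ 0) ∧ (x ≡ˡ s) ∧ (x′ ≡ˡ t)) → TArrow (κ , x , y) (κ′ , x′ , y′)
    at₀ κ≡ (inj₁ g) = let g₁ , g₂ = ∧-sound {κ′ ≡ᵇ 1} g ; g₃ , g₄ = ∧-sound {A x′ y′} g₂ in at₁ κ≡ (≡ᵇ-sound g₁) g₃ (∨-sound g₄)
    at₀ κ≡ (inj₂ g) = let g₁ , g₂ = ∧-sound {κ′ ≡ᵇ 0} g ; g₃ , g₄ = ∧-sound {x ≡ˡ s} g₂ in at₂ κ≡ (≡ᵇ-sound g₁) g₃ g₄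

  tArrow-complete : ∀ {p q} → TArrow p q → T (transversalArrow _≡ˡ_ A s t p q)
  tArrow-complete (source {x} {y} {x′} a) = ∨-inj₁ (∧-complete {A x x′} a (∨-inj₁ (≡ˡ-complete x)))
  tArrow-complete (target {x} {y} {x′} a) = ∨-inj₁ (∧-complete {A x′ x} a (∨-inj₂ {x ≡ˡ x′} (≡ˡ-complete x)))
  tArrow-complete chord = ∧-complete (≡ˡ-complete s) (≡ˡ-complete t)

  tArrow-irrefl : s ≢ t → ∀ p → both (transversalArrow _≡ˡ_ A s t) p p ≡ false
  tArrow-irrefl s≢t p = ≡-by-T (λ h → ⊥-elim (loop′ (∨-sound h))) (λ ())
    where
    loopless : ∀ {p q} → TArrow p q → p ≢ q
    loopless (source _) ()
    loopless (target _) ()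
    loopless chord eq = s≢t (cong (proj₁ ∘ proj₂) eq)
    loop′ : T (transversalArrow _≡ˡ_ A s t p p) ⊎ T (transversalArrow _≡ˡ_ A s t p p) → ⊥
    loop′ (inj₁ h) = loopless (tArrow-sound p p h) refl
    loop′ (inj₂ h) = loopless (tArrow-sound p p h) refl

module TransversalGraph {L : Set} (_≡ˡ_ : L → L → Bool) (≡ˡ-sound : ∀ x y → T (x ≡ˡ y) → x ≡ y) (≡ˡ-complete : ∀ x → T (x ≡ˡ x))
  (A : L → L → Bool) (A-asym : ∀ x y → T (A x y) → ¬ T (A y x))
  (labels : List L) (labels-unique : Unique labels)
  (places : List (ℕ × L × L)) (places-unique : Unique places)
  (place⁺ : ∀ {κ x y} → κ < 2 → x ∈ₗ labels → y ∈ₗ labels → (κ , x , y) ∈ₗ places)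
  (place⁻ : ∀ {κ x y} → (κ , x , y) ∈ₗ places → x ∈ₗ labels × y ∈ₗ labels) where

  module _ (adj : Fin (length labels) → Fin (length labels) → Bool) (symm : ∀ u v → adj u v ≡ adj v u) (irrefl : ∀ v → adj v v ≡ false)
    (adj≡ : ∀ u v → adj u v ≡ both A (List.lookup labels u) (List.lookup labels v))
    (s t : Fin (length labels)) (s≢t : s ≢ t)
    (adj′ : Fin (length places) → Fin (length places) → Bool) (symm′ : ∀ u v → adj′ u v ≡ adj′ v u) (irrefl′ : ∀ v → adj′ v v ≡ false)
    (adj′≡ : ∀ v w → adj′ v w ≡ both (transversalArrow _≡ˡ_ A (List.lookup labels s) (List.lookup labels t)) (List.lookup places v) (List.lookup places w))
    where

    G G′ : Graph
    G  = record { order = length labels ; adj = adj ; symm = symm ; irrefl = irrefl }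
    G′ = record { order = length places ; adj = adj′ ; symm = symm′ ; irrefl = irrefl′ }

    open Graph G using (Vertex; Edge; Joins)
    open Graph G′ using () renaming (Vertex to Vertex′; Adj to Adj′)
    open Edges G

    private
      lab : Vertex → L
      lab = List.lookup labels

      place : Vertex′ → ℕ × L × L
      place = List.lookup places

      lab-injective : ∀ {u v} → lab u ≡ lab v → u ≡ v
      lab-injective = lookup-injective labels-unique

      place-injective : ∀ {v w} → place v ≡ place w → v ≡ w
      place-injective = lookup-injective places-unique

    open TransversalArrows _≡ˡ_ ≡ˡ-sound ≡ˡ-complete A (lab s) (lab t)

    abstract
      -- An edge knows its ends in the order of the vertex list, whereas its subdivision vertex is
      -- named by the arrow. The orientation by the arrow fixes that name.
      orient : ∀ e → ∃₂ λ u v → T (A (lab u) (lab v)) × Joins e u v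
      orient e = from (∨-sound (subst T (adj≡ _ _) (proj₂ (ends-listed e))))
        where
        from : T (A (lab (proj₁ (ends e))) (lab (proj₂ (ends e)))) ⊎ T (A (lab (proj₂ (ends e))) (lab (proj₁ (ends e)))) →
               ∃₂ λ u v → T (A (lab u) (lab v)) × Joins e u v
        from (inj₁ a) = proj₁ (ends e) , proj₂ (ends e) , a , inj₁ refl
        from (inj₂ a) = proj₂ (ends e) , proj₁ (ends e) , a , inj₂ refl

      vertex : ∀ {κ} → κ < 2 → ∀ x y → ∃ λ v → place v ≡ (κ , lab x , lab y)
      vertex κ< x y = label-index (place⁺ κ< (List.∈-lookup x) (List.∈-lookup y))

      components : ∀ v → (∃ λ x → lab x ≡ proj₁ (proj₂ (place v))) × (∃ λ y → lab y ≡ proj₂ (proj₂ (place v)))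
      components v = let x∈ , y∈ = place⁻ (List.∈-lookup {xs = places} v) in label-index x∈ , label-index y∈

      src tgt : Edge → Vertex
      src e = proj₁ (orient e)
      tgt e = proj₁ (proj₂ (orient e))

      src-tgt : ∀ e → Joins e (src e) (tgt e)
      src-tgt e = proj₂ (proj₂ (proj₂ (orient e)))

      arrow-src-tgt : ∀ e → T (A (lab (src e)) (lab (tgt e)))
      arrow-src-tgt e = proj₁ (proj₂ (proj₂ (orient e)))

      twin : Vertex → Vertex → Vertex′
      twin x y = proj₁ (vertex (s≤s z≤n) x y)

      place-twin : ∀ x y → place (twin x y) ≡ (0 , lab x , lab y)
      place-twin x y = proj₂ (vertex (s≤s z≤n) x y)

      sub : Edge → Vertex′
      sub e = proj₁ (vertex ℕ.≤-refl (src e) (tgt e))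

      place-sub : ∀ e → place (sub e) ≡ (1 , lab (src e) , lab (tgt e))
      place-sub e = proj₂ (vertex ℕ.≤-refl (src e) (tgt e))

    origin : Vertex′ → Bool × Vertex
    origin v = (proj₁ (place v) ≡ᵇ 1) , proj₁ (proj₁ (components v))

    origin≡ : ∀ {v κ x l} → place v ≡ (κ , lab x , l) → origin v ≡ ((κ ≡ᵇ 1) , x)
    origin≡ {v} eq = cong₂ _,_ (cong (λ p → proj₁ p ≡ᵇ 1) eq) (lab-injective (trans (proj₂ (proj₁ (components v))) (cong (proj₁ ∘ proj₂) eq)))

    twin-injective : ∀ {x x′ y y′} → twin x y ≡ twin x′ y′ → y ≡ y′
    twin-injective eq = lab-injective (cong (proj₂ ∘ proj₂) (trans (sym (place-twin _ _)) (trans (cong place eq) (place-twin _ _))))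

    sub-injective : ∀ {e f} → sub e ≡ sub f → e ≡ f
    sub-injective {e} {f} eq = joins-unique (subst₂ (Joins e) (lab-injective (cong (proj₁ ∘ proj₂) places≡)) (lab-injective (cong (proj₂ ∘ proj₂) places≡)) (src-tgt e)) (src-tgt f)
      where
      places≡ : (1 , lab (src e) , lab (tgt e)) ≡ (1 , lab (src f) , lab (tgt f))
      places≡ = trans (sym (place-sub e)) (trans (cong place eq) (place-sub f))

    sub-origin : ∀ e → proj₁ (origin (sub e)) ≡ true × ∃ λ v → Joins e (proj₂ (origin (sub e))) v
    sub-origin e = cong proj₁ (origin≡ (place-sub e)) , tgt e , subst (λ u → Joins e u (tgt e)) (sym (cong proj₂ (origin≡ (place-sub e)))) (src-tgt e)

    module Generic (K : ℕ) (K<order : K < length labels) (K≤ : ∀ C → MinCut.IsCut G s t C → K ≤ ∣ C ∣) where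
      private
        Link : Vertex′ → Vertex′ → Set
        Link = TLink G s t twin sub

        is-twin : ∀ {v x l} → place v ≡ (0 , lab x , l) → ∃ λ y → v ≡ twin x y
        is-twin {v} {x} eq = proj₁ (proj₂ (components v)) , place-injective (trans eq (trans (cong (λ l → 0 , lab x , l)
          (sym (trans (proj₂ (proj₂ (components v))) (cong (proj₂ ∘ proj₂) eq)))) (sym (place-twin _ _))))

        -- Asymmetry of the arrows excludes that the edge is named by the reverse pair, so each edge
        -- has one subdivision vertex.
        is-sub : ∀ {w x y} → place w ≡ (1 , lab x , lab y) → T (A (lab x) (lab y)) → ∃ λ e → Joins e x y × w ≡ sub e
        is-sub {w} {x} {y} eq a = from (edge (subst T (sym (adj≡ x y)) (∨-inj₁ a)))
          where
          ordered : ∀ {e} → Joins e x y → Joins e (src e) (tgt e) → T (A (lab (src e)) (lab (tgt e))) → src e ≡ x × tgt e ≡ y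
          ordered (inj₁ p) (inj₁ q) _ = cong proj₁ (trans (sym q) p) , cong proj₂ (trans (sym q) p)
          ordered (inj₂ p) (inj₂ q) _ = cong proj₂ (trans (sym q) p) , cong proj₁ (trans (sym q) p)
          ordered (inj₁ p) (inj₂ q) b = contradiction (subst₂ (λ u v → T (A (lab u) (lab v))) (cong proj₂ (trans (sym q) p)) (cong proj₁ (trans (sym q) p)) b) (A-asym _ _ a)
          ordered (inj₂ p) (inj₁ q) b = contradiction (subst₂ (λ u v → T (A (lab u) (lab v))) (cong proj₁ (trans (sym q) p)) (cong proj₂ (trans (sym q) p)) b) (A-asym _ _ a)
          from : (∃ λ e → Joins e x y) → ∃ λ e → Joins e x y × w ≡ sub e
          from (e , j) = let p , q = ordered j (src-tgt e) (arrow-src-tgt e) in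
            e , j , place-injective (trans eq (sym (trans (place-sub e) (cong₂ (λ u v → 1 , lab u , lab v) p q))))

        link-spoke : ∀ {v w u u′ e} → (∃ λ y → v ≡ twin u y) → w ≡ sub e → Joins e u u′ → Link v w
        link-spoke (y , refl) refl j = spoke j

        link-chord : ∀ {v w} → (∃ λ y → v ≡ twin s y) → (∃ λ y → w ≡ twin t y) → Link v w
        link-chord (y , refl) (y′ , refl) = chord

        tArrow-link : ∀ {v w p q} → TArrow p q → place v ≡ p → place w ≡ q → Link v w
        tArrow-link {v} {w} (source {x} {y} {x′} a) v≡ w≡ = from (components w)
          where
          from : (∃ λ u → lab u ≡ proj₁ (proj₂ (place w))) × (∃ λ u′ → lab u′ ≡ proj₂ (proj₂ (place w))) → Link v w
          from ((u , u≡) , (u′ , u′≡)) = found (is-sub {w} {u} {u′} (trans w≡ (sym (cong₂ (λ x x′ → 1 , x , x′) x≡ x′≡))) (subst₂ (λ x x′ → T (A x x′)) (sym x≡) (sym x′≡) a))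
            where
            x≡ : lab u ≡ x
            x≡ = trans u≡ (cong (proj₁ ∘ proj₂) w≡)
            x′≡ : lab u′ ≡ x′
            x′≡ = trans u′≡ (cong (proj₂ ∘ proj₂) w≡)
            found : (∃ λ e → Joins e u u′ × w ≡ sub e) → Link v w
            found (e , j , eq) = link-spoke (is-twin {x = u} (trans v≡ (cong (λ x → 0 , x , y) (sym x≡)))) eq j
        tArrow-link {v} {w} (target {x} {y} {x′} a) v≡ w≡ = from (components w)
          where
          from : (∃ λ u → lab u ≡ proj₁ (proj₂ (place w))) × (∃ λ u′ → lab u′ ≡ proj₂ (proj₂ (place w))) → Link v w
          from ((u , u≡) , (u′ , u′≡)) = found (is-sub {w} {u} {u′} (trans w≡ (sym (cong₂ (λ x x′ → 1 , x , x′) x′≡ x≡))) (subst₂ (λ x x′ → T (A x x′)) (sym x′≡) (sym x≡) a))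
            where
            x′≡ : lab u ≡ x′
            x′≡ = trans u≡ (cong (proj₁ ∘ proj₂) w≡)
            x≡ : lab u′ ≡ x
            x≡ = trans u′≡ (cong (proj₂ ∘ proj₂) w≡)
            found : (∃ λ e → Joins e u u′ × w ≡ sub e) → Link v w
            found (e , j , eq) = link-spoke (is-twin {x = u′} (trans v≡ (cong (λ x → 0 , x , y) (sym x≡)))) eq (swap j)
              where
              swap : ∀ {e u v} → Joins e u v → Joins e v u
              swap (inj₁ p) = inj₂ p
              swap (inj₂ p) = inj₁ p
        tArrow-link chord v≡ w≡ = link-chord (is-twin v≡) (is-twin w≡)

        link : ∀ {v w} → Adj′ v w → Link v w ⊎ Link w v
        link {v} {w} vw = from (∨-sound (subst T (adj′≡ v w) vw))
          where
          from : T (transversalArrow _≡ˡ_ A (lab s) (lab t) (place v) (place w)) ⊎ T (transversalArrow _≡ˡ_ A (lab s) (lab t) (place w) (place v)) →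
                 Link v w ⊎ Link w v
          from (inj₁ h) = inj₁ (tArrow-link (tArrow-sound _ _ h) refl refl)
          from (inj₂ h) = inj₂ (tArrow-link (tArrow-sound _ _ h) refl refl)

        adjacent : ∀ {v w p q} → place v ≡ p → place w ≡ q → TArrow p q → Adj′ v w
        adjacent {v} {w} v≡ w≡ a = subst T (sym (adj′≡ v w)) (∨-inj₁ (tArrow-complete (subst₂ TArrow (sym v≡) (sym w≡) a)))

        unlink : ∀ {v w} → Link v w → Adj′ v w
        unlink (spoke {u} {v} {y} {e} j) = from (end j (src-tgt e))
          where
          end : ∀ {u v u′ v′} → Joins e u v → Joins e u′ v′ → u ≡ u′ ⊎ u ≡ v′
          end (inj₁ p) (inj₁ q) = inj₁ (cong proj₁ (trans (sym p) q))
          end (inj₂ p) (inj₂ q) = inj₁ (cong proj₂ (trans (sym p) q))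
          end (inj₁ p) (inj₂ q) = inj₂ (cong proj₁ (trans (sym p) q))
          end (inj₂ p) (inj₁ q) = inj₂ (cong proj₂ (trans (sym p) q))
          from : u ≡ src e ⊎ u ≡ tgt e → Adj′ (twin u y) (sub e)
          from (inj₁ refl) = adjacent (place-twin _ _) (place-sub e) (source (arrow-src-tgt e))
          from (inj₂ refl) = adjacent (place-twin _ _) (place-sub e) (target (arrow-src-tgt e))
        unlink chord = adjacent (place-twin _ _) (place-twin _ _) chord

      count-transversals : transversals G′ K ≡ minimumCuts (G , s , t , s≢t) K
      count-transversals = Transversals.transversals-count G s t s≢t K K<order K≤ G′ twin sub origin twin-injective sub-injective (λ x y → origin≡ (place-twin x y)) sub-origin link unlink

-- The composition into odd cycle transversals

sameLabel : Label → Label → Bool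
sameLabel (i , κ , u , v) (i′ , κ′ , u′ , v′) = (i ≡ᵇ i′) ∧ (κ ≡ᵇ κ′) ∧ (u ≡ᵇ u′) ∧ (v ≡ᵇ v′)

sameLabel-sound : ∀ x y → T (sameLabel x y) → x ≡ y
sameLabel-sound (i , κ , u , v) (i′ , κ′ , u′ , v′) h =
  let h₁ , g₁ = ∧-sound {i ≡ᵇ i′} h ; h₂ , g₂ = ∧-sound {κ ≡ᵇ κ′} g₁ ; h₃ , h₄ = ∧-sound {u ≡ᵇ u′} g₂ in
  cong₂ _,_ (≡ᵇ-sound h₁) (cong₂ _,_ (≡ᵇ-sound h₂) (cong₂ _,_ (≡ᵇ-sound h₃) (≡ᵇ-sound h₄)))

sameLabel-complete : ∀ x → T (sameLabel x x)
sameLabel-complete (i , κ , u , v) = ∧-complete (≡ᵇ-complete {i} refl) (∧-complete (≡ᵇ-complete {κ} refl)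
  (∧-complete (≡ᵇ-complete {u} refl) (≡ᵇ-complete {v} refl)))

transversalAdj : ℕ → (ℕ → ℕ → ℕ → Bool) → ℕ × Label × Label → ℕ × Label × Label → Bool
transversalAdj t B = both (transversalArrow sameLabel (arrow t B) (joint 0) (joint t))

transversalWord : ℕ → ℕ → (ℕ → ℕ → ℕ → Bool) → Word
transversalWord t n B = unary (n * n) ++ false ∷ graphWord (transversalAdj t B) (transversalLabels (cutLabels t n))

transversalCode : Word → Word
transversalCode w = transversalWord (wordCount w) (side w) (blockArc w)

sameLabelᶜ : ∀ {x y : Env n → Label} → LFun x → LFun y → BFun (λ ρ → sameLabel (x ρ) (y ρ))
sameLabelᶜ ⟨ i , κ , u , v ⟩ ⟨ i′ , κ′ , u′ , v′ ⟩ = (i ≡ᶜ i′) ∧ᶜ (κ ≡ᶜ κ′) ∧ᶜ (u ≡ᶜ u′) ∧ᶜ (v ≡ᶜ v′)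

transversalArrowᶜ : ∀ {κ κ′ : Env n → ℕ} {x y x′ y′ : Env n → Label} → Fun κ → LFun x → LFun y → Fun κ′ → LFun x′ → LFun y′ →
  BFun (λ ρ → transversalArrow sameLabel (arrow (wordCount (word first ρ)) (blockArc (word first ρ))) (joint 0) (joint (wordCount (word first ρ)))
                (κ ρ , x ρ , y ρ) (κ′ ρ , x′ ρ , y′ ρ))
transversalArrowᶜ κ x y κ′ x′ y′ = (κ ≡ᶜ litᶜ 0) ∧ᶜ
  ((κ′ ≡ᶜ litᶜ 1) ∧ᶜ arrowᶜ x′ y′ ∧ᶜ (sameLabelᶜ x x′ ∨ᶜ sameLabelᶜ x y′)
   ∨ᶜ (κ′ ≡ᶜ litᶜ 0) ∧ᶜ sameLabelᶜ x ⟨ litᶜ 0 , litᶜ 0 , litᶜ 0 , litᶜ 0 ⟩ ∧ᶜ sameLabelᶜ x′ ⟨ wordCountᶜ , litᶜ 0 , litᶜ 0 , litᶜ 0 ⟩)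

up₉ : Env (9 + n) → Env n
up₉ {n} ρ = proj₁ (up₄ {1 + n} (up₄ {5 + n} ρ))

place₀ : Env (9 + n) → ℕ × Label × Label
place₀ {n} ρ = proj₂ (up₄ {1 + n} (up₄ {5 + n} ρ)) , label₀ {1 + n} (up₄ {5 + n} ρ) , label₀ {5 + n} ρ

placesᶜ : ∀ {n} {g : Env n → ℕ × Label × Label → Word} → Gen {9 + n} (λ ρ → g (up₉ {n} ρ) (place₀ {n} ρ)) →
          Gen (λ ρ → concatMap (g ρ) (transversalLabels (cutLabels (wordCount (word first ρ)) (side (word first ρ)))))
placesᶜ {n} {g} G = extGen (λ ρ → sym (unfold (cutLabels (wordCount (word first ρ)) (side (word first ρ))) (g ρ)))
  (loopᶜ (litᶜ 2) (labelsᶜ {1 + n} {λ ρ x → concatMap (λ y → g (proj₁ ρ) (proj₂ ρ , x , y)) (labels ρ)}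
    (labelsᶜ {5 + n} {λ ρ y → g (proj₁ (up₄ {1 + n} ρ)) (proj₂ (up₄ {1 + n} ρ) , label₀ {1 + n} ρ , y)} G)))
  where
  labels : Env (1 + n) → List Label
  labels ρ = cutLabels (wordCount (word {1 + n} first ρ)) (side (word {1 + n} first ρ))
  unfold : ∀ (labels : List Label) (g : ℕ × Label × Label → Word) → concatMap g (transversalLabels labels) ≡
           loop 2 (λ κ → concatMap (λ x → concatMap (λ y → g (κ , x , y)) labels) labels)
  unfold labels g = trans (loop-cartesian 2 g (cartesianProduct labels labels)) (loop-≗ 2 λ κ → concatMap-product (λ l → g (κ , l)) labels labels)

length-transversalLabels : ∀ {L : Set} (labels : List L) → 2 * (length labels * length labels) ≡ length (transversalLabels labels)
length-transversalLabels labels = sym (trans (length-product (upTo 2) (cartesianProduct labels labels)) (cong (2 *_) (length-product labels labels)))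

transversalCodeᶜ : Gen {0} (transversalCode ∘ proj₁)
transversalCodeᶜ = unaryᶜ cutSizeᶜ ++ᶜ (emitᶜ (boolᶜ false) ++ᶜ graphWordᶜ
    {A = λ ρ → transversalAdj (wordCount (proj₁ ρ)) (blockArc (proj₁ ρ))}
    {xs = λ ρ → transversalLabels (cutLabels (wordCount (proj₁ ρ)) (side (proj₁ ρ)))}
    (ext (λ ρ → length-transversalLabels (cutLabels (wordCount (proj₁ ρ)) (side (proj₁ ρ)))) (litᶜ 2 ⊗ᶜ (labelCountᶜ ⊗ᶜ labelCountᶜ)))
    (placesᶜ {g = λ ρ p → concatMap (λ q → transversalAdj (wordCount (proj₁ ρ)) (blockArc (proj₁ ρ)) p q ∷ []) (places ρ)}
      (placesᶜ {g = λ ρ q → transversalAdj (wordCount (proj₁ (up₉ {0} ρ))) (blockArc (proj₁ (up₉ {0} ρ))) (place₀ {0} ρ) q ∷ []}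
      (emitᶜ (transversalArrowᶜ κ x y κ′ x′ y′ ∨ᶜ transversalArrowᶜ κ′ x′ y′ κ x y)))))
  where
  places : Env 0 → List (ℕ × Label × Label)
  places ρ = transversalLabels (cutLabels (wordCount (proj₁ ρ)) (side (proj₁ ρ)))
  y′ : LFun {18} (label₀ {14})
  y′ = label₀ᶜ
  x′ : LFun {18} (label₀ {10} ∘ up₄ {14})
  x′ = wk₄ label₀ᶜ
  κ′ : Fun {18} (λ ρ → proj₂ (up₄ {10} (up₄ {14} ρ)))
  κ′ = v₈
  y : LFun {18} (λ ρ → label₀ {5} (up₉ {9} ρ))
  y = wk₄ (wk₄ (wkˡ (label₀ᶜ {5})))
  x : LFun {18} (λ ρ → label₀ {1} (up₄ {5} (up₉ {9} ρ)))
  x = wk₄ (wk₄ (wkˡ (wk₄ (label₀ᶜ {1}))))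
  κ : Fun {18} (λ ρ → proj₂ (up₄ {1} (up₄ {5} (up₉ {9} ρ))))
  κ = wkᶜ (wkᶜ (wkᶜ (wkᶜ (wkᶜ (wkᶜ (wkᶜ (wkᶜ (wkᶜ v₈))))))))

arrow-asym : ∀ t B x y → T (arrow t B x y) → ¬ T (arrow t B y x)
arrow-asym t B x y a b = Arrow-asym (arrow-sound x y a) (arrow-sound y x b)
  where open Arrows t B

module TransversalValue (t′ n : ℕ) (0<n : 0 < n) (B : ℕ → ℕ → ℕ → Bool) (labels : List Label) (labels-unique : Unique labels)
  (valid⇒∈ : ∀ {l} → Cuts.Valid t′ n 0<n B l → l ∈ₗ labels) (∈⇒valid : ∀ {l} → l ∈ₗ labels → Cuts.Valid t′ n 0<n B l)
  (n²<labels : n * n < length labels)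
  (places : List (ℕ × Label × Label)) (places-unique : Unique places)
  (place⁺ : ∀ {κ x y} → κ < 2 → x ∈ₗ labels → y ∈ₗ labels → (κ , x , y) ∈ₗ places)
  (place⁻ : ∀ {κ x y} → (κ , x , y) ∈ₗ places → x ∈ₗ labels × y ∈ₗ labels) where

  private
    t : ℕ
    t = suc t′
    A : Label → Label → Bool
    A = both (arrow t B)
    word′ : Word
    word′ = unary (n * n) ++ false ∷ graphWord (transversalAdj t B) places
    total : ℕ
    total = sum (map (λ i → closedSets n (B (toℕ i))) (allFin t))

    Read : ∀ {L : Set} → (L → L → Bool) → List L → Set
    Read A xs = ∃ λ (adj : Fin (length xs) → Fin (length xs) → Bool) → ∃₂ λ s i →
      readGraph (graphWord A xs) ≡ just (record { order = length xs ; adj = adj ; symm = s ; irrefl = i }) ×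
      (∀ u v → adj u v ≡ A (List.lookup xs u) (List.lookup xs v))

    -- The network itself is not part of the output. Reading its code back serves to obtain a
    -- `Graph` to which the count of minimum cuts applies.
    base : Read A labels
    base = readGraph-graphWord A (both-sym (arrow t B)) (Arrows.both-irrefl t B) labels

    extended : Read (transversalAdj t B) places
    extended = readGraph-graphWord (transversalAdj t B) (both-sym (transversalArrow sameLabel (arrow t B) (joint 0) (joint t)))
      (TransversalArrows.tArrow-irrefl sameLabel sameLabel-sound sameLabel-complete (arrow t B) (joint 0) (joint t) λ ()) places

    terminal : ∀ i → i ≤ t → ∃ λ u → List.lookup labels u ≡ joint i
    terminal i i≤t = label-index (valid⇒∈ (i≤t , s≤s z≤n , 0<n , 0<n))

    value : Read A labels → (∃ λ u → List.lookup labels u ≡ joint 0) → (∃ λ u → List.lookup labels u ≡ joint t) →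
            Read (transversalAdj t B) places → #k-Odd-Cycle-Transversal (word′ , n * n) ≡ total
    value (adj , symm , irrefl , _ , adj≡) (s₀ , s≡) (t₀ , t≡) (adj′ , symm′ , irrefl′ , eq , adj′≡) =
      trans (#k-Odd-Cycle-Transversal≡ word′ (readGraph,k-unary (n * n) (graphWord (transversalAdj t B) places) G′ eq))
      (trans (TransversalGraph.Generic.count-transversals sameLabel sameLabel-sound sameLabel-complete (arrow t B) (arrow-asym t B) labels labels-unique places places-unique place⁺ place⁻
               adj symm irrefl adj≡ s₀ t₀ s≢t adj′ symm′ irrefl′ adj′≡₀ (n * n) n²<labels
               λ C cut → CutGraph.Side.k²≤∣C∣ t′ n 0<n B labels labels-unique valid⇒∈ ∈⇒valid adj symm irrefl adj≡ s₀ t₀ s≡ t≡ C cut)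
      (trans (cong (λ I → minimumCuts I (n * n)) same) (CutGraph.cuts-count t′ n 0<n B labels labels-unique valid⇒∈ ∈⇒valid adj symm irrefl adj≡ s₀ t₀ s≡ t≡ s≢t)))
      where
      s≢t : s₀ ≢ t₀
      s≢t eq = case trans (sym s≡) (trans (cong (List.lookup labels) eq) t≡) of λ ()
      adj′≡₀ : ∀ v w → adj′ v w ≡ both (transversalArrow sameLabel (arrow t B) (List.lookup labels s₀) (List.lookup labels t₀)) (List.lookup places v) (List.lookup places w)
      adj′≡₀ v w = trans (adj′≡ v w) (cong₂ (λ s t → both (transversalArrow sameLabel (arrow (suc t′) B) s t) (List.lookup places v) (List.lookup places w)) (sym s≡) (sym t≡))
      G′ : Graph
      G′ = TransversalGraph.G′ sameLabel sameLabel-sound sameLabel-complete (arrow t B) (arrow-asym t B) labels labels-unique places places-unique place⁺ place⁻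
        adj symm irrefl adj≡ s₀ t₀ s≢t adj′ symm′ irrefl′ adj′≡₀
      same : _≡_ {A = Σ Graph Terminals} (TransversalGraph.G sameLabel sameLabel-sound sameLabel-complete (arrow t B) (arrow-asym t B) labels labels-unique places places-unique place⁺ place⁻
        adj symm irrefl adj≡ s₀ t₀ s≢t adj′ symm′ irrefl′ adj′≡₀ , s₀ , t₀ , s≢t) (CutGraph.G t′ n 0<n B labels labels-unique valid⇒∈ ∈⇒valid adj symm irrefl adj≡ , s₀ , t₀ , s≢t)
      same = refl

  transversals-value : #k-Odd-Cycle-Transversal (word′ , n * n) ≡ total
  transversals-value = value base (terminal 0 z≤n) (terminal t ℕ.≤-refl) extended

transversalWord-value : ∀ t′ n B → 0 < n → #k-Odd-Cycle-Transversal (transversalWord (suc t′) n B , n * n) ≡ sum (map (λ i → closedSets n (B (toℕ i))) (allFin (suc t′)))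
transversalWord-value t′ n B 0<n = TransversalValue.transversals-value t′ n 0<n B (cutLabels (suc t′) n) labels-unique valid⇒∈ ∈⇒valid
  -- The labels of a single block, four times `n * n`, already outnumber the budget.
  (subst (n * n <_) (length-cutLabels (suc t′) n) (ℕ.<-≤-trans (ℕ.m<m+n (n * n) {n * n + (n * n + (n * n + 0))} (ℕ.≤-trans (ℕ.*-mono-≤ 0<n 0<n) (ℕ.m≤m+n (n * n) _)))
    (ℕ.m≤m+n (4 * (n * n)) _)))
  (transversalLabels (cutLabels (suc t′) n))
  (Unique.cartesianProduct⁺ (Unique.upTo⁺ 2) (Unique.cartesianProduct⁺ labels-unique labels-unique))
  (λ κ< x∈ y∈ → List.∈-cartesianProduct⁺ (List.∈-upTo⁺ κ<) (List.∈-cartesianProduct⁺ x∈ y∈))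
  (λ p → List.∈-cartesianProduct⁻ (cutLabels (suc t′) n) (cutLabels (suc t′) n) (proj₂ (List.∈-cartesianProduct⁻ (upTo 2) _ p)))
  where open Cuts t′ n 0<n B

transversal-value : ∀ x xs → All (λ y → length y ≡ length x) (x ∷ xs) → 0 < length x →
                    #k-Odd-Cycle-Transversal (transversalCode (encodeList (x ∷ xs)) , side (encodeList (x ∷ xs)) * side (encodeList (x ∷ xs))) ≡ sum (map #Closed (x ∷ xs))
transversal-value x xs same x>0 = trans
  (cong₂ (λ t n → #k-Odd-Cycle-Transversal (transversalWord t n (blockArc (encodeList (x ∷ xs))) , n * n)) (wordCount≡ same) (side≡ same))
  (trans (transversalWord-value (length xs) (rt (length x)) (blockArc (encodeList (x ∷ xs))) (rt>0 (length x) x>0))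
         (blocks-sum same x>0))

transversal-composition : SUMCrossComposition #Closed #k-Odd-Cycle-Transversal
transversal-composition = Composition.composition #k-Odd-Cycle-Transversal transversalCodeᶜ cutSizeᶜ
  (λ { zero → refl ; (suc zero) → refl ; (suc (suc t)) → refl }) cut-small transversal-value

transversal-wellBehaved : WellBehaved #k-Odd-Cycle-Transversal
transversal-wellBehaved = k-wellBehaved λ G k κ → if≤ (does (κ ℕ.≟ k)) (count≤ (λ S → OddCycle.IsTransversal? G S ×-dec (∣ S ∣ ℕ.≤? k)))

theorem1p5 : SUMConjecture →
             ¬ PolynomialCompression #k-Min-st-Cut ×
             ¬ PolynomialCompression #k-Odd-Cycle-Transversal ×
             ¬ PolynomialCompression #ℓ-Vertex-Cover ×
             ¬ PolynomialCompression #m-Vertex-Cover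
theorem1p5 conjecture =
  conjecture #Closed #k-Min-st-Cut #Closed-hard cut-composition st-wellBehaved ,
  conjecture #Closed #k-Odd-Cycle-Transversal #Closed-hard transversal-composition transversal-wellBehaved ,
  conjecture #Closed #ℓ-Vertex-Cover #Closed-hard #ℓ-composition #ℓ-wellBehaved ,
  conjecture #Closed #m-Vertex-Cover #Closed-hard #m-composition #m-wellBehaved
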